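{- Let $n>228000$ be an integer and let $d$ be a positive integer with $d>8\sqrt{2}$. If $x,y$ are positive integers with $\gcd(x,y)=1$ and $$(x-d)^2+x^2+(x+d)^2=y^n,$$ then $y^n<2^{3/2}d^3$. -}

module Defs where

{-# OPTIONS --safe #-}
module Submission where

import Tactic.RingSolver as Ring
open import Data.Nat using (ℕ; zero; suc)
open import Data.Product using (Σ; _,_; _×_; proj₁; proj₂; ∃; ∃₂)
open import Data.Sum using (_⊎_; inj₁; inj₂)
open import Data.Empty using (⊥; ⊥-elim)
open import Relation.Nullary
open import Relation.Nullary.Decidable using (toWitness)
open import Relation.Binary.PropositionalEquality

-- The equation reads 3x² + 2d² = yⁿ. Suppose that yⁿ is at least 2^(3/2) d³; a contradiction is
-- wanted.
--
-- Arithmetic. Put ξ = x√3 + d√-2 and ξ̄ = x√3 - d√-2, so that ξξ̄ = yⁿ. Congruences modulo 2, 3 and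
-- 9 show that y is odd, y ≡ 2 (mod 3), n is odd, and y is prime to x and d. Thue's lemma (`rep`)
-- yields α = a√3 - b√-2 with 3a² + 2b² = y and xb ≡ da (mod y); thus xα ≡ aξ̄ (mod y). `M↑n`
-- sharpens this to α^(2n) = ξ̄², with no recourse to ideals. Hence β = α²/y is an element of Q(√-6)
-- on the unit circle with denominator y. It is not a root of unity (`M-not-root`), and |βⁿ - 1|² =
-- 8d²/yⁿ, so the assumption gives |βⁿ - 1| ≤ 2w with w = y^(-⌊n/6⌋) (`near-root`).
--
-- Diophantine approximation. It remains to see that βⁿ cannot be so close to 1 (`no-near-root`).
-- This is a lower bound for a linear form in log β and 2πi, proved here with rational numbers only.
-- The number exp(2πi/n) is replaced by a point g of the unit circle in Q(√-6) with gⁿ ≈ 1, n|g - 1|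
-- ≤ 7 and β ≈ g^k for some k (`arc`). It is found by walking around the circle with the powers of
-- one tiny rotation; inequalities between coordinates do the work of angles.
--
-- The auxiliary function is F(m) = Σ c(k,l) binom(m,k) g^(lm), with k < K and |l| ≤ H. In its
-- Newton series Σ a_j binom(m,j) the coefficients decay geometrically for j > K, because g^l is
-- near 1. The box principle (`siegel`) chooses c(k,l) in Z[√-6], not all zero, that make the first
-- coefficients tiny; the others are tiny anyway. So F is tiny at every natural m below a multiple
-- Un of n (`auxiliary`). When m ≡ kr (mod n), g^m is close to β^r and F(m) is close to an element
-- of Q(√-6) whose denominator is a known power of y. Being smaller than the inverse of that
-- denominator, this element is 0 (`vanishing`). That gives more zeros than an exponential
-- polynomial can have (`zero-estimate`): a determinant built from it is a polynomial with too many
-- roots, while its top coefficient is, up to nonzero factors, a Vandermonde determinant in powers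
-- of β, which are distinct as β is not a root of unity.
--
-- Numerical part. H is about log₄ n, 2^u is about y², and U = uH; all sizes are powers of 2 with
-- exponents proportional to U. Two inequalities decide: `count`, that there are more coefficient
-- vectors than boxes, and `y^e≥`, that y^⌊n/6⌋ exceeds every other factor. The second needs n to
-- exceed a constant times (log n)², and for H = 9 it is met by n > 228000 (`find-H`).

-- Choice of the parameters; the count of unknowns against boxes

module ParameterChoice where
  open import Data.Nat
  open import Data.Nat.Properties
  open import Data.Nat.DivMod using (m/n*n≤m; m≡m%n+[m/n]*n; m%n<n; _/_; _%_; /-mono-≤)
  open import Data.Nat.Tactic.RingSolver using (solve-∀)
  open import Relation.Unary using (Decidable)

  least : ∀ {P : ℕ → Set} → Decidable P → ∀ n → P n → ∃ λ i → i ≤ n × P i × (∀ j → j < i → ¬ P j)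
  least P? zero p = 0 , z≤n , p , λ _ ()
  least {P} P? (suc n) p with P? 0
  ... | yes q = 0 , z≤n , q , λ _ ()
  ... | no ¬q with least (λ i → P? (suc i)) n p
  ...   | i , i≤n , pi , min = suc i , s≤s i≤n , pi , λ { zero _ → ¬q ; (suc j) (s≤s l) → min j l }

  prod : ℕ → (ℕ → ℕ) → ℕ
  prod zero f = 1
  prod (suc n) f = f n * prod n f

  sumℕ : ℕ → (ℕ → ℕ) → ℕ
  sumℕ zero f = 0
  sumℕ (suc n) f = sumℕ n f + f n

  sumℕ-mono : ∀ n {f g} → (∀ i → i < n → f i ≤ g i) → sumℕ n f ≤ sumℕ n g
  sumℕ-mono zero h = z≤n
  sumℕ-mono (suc n) h = +-mono-≤ (sumℕ-mono n (λ i l → h i (m≤n⇒m≤1+n l))) (h n ≤-refl)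

  sumℕ-split : ∀ m n f → sumℕ (m + n) f ≡ sumℕ m f + sumℕ n (λ i → f (m + i))
  sumℕ-split m zero f = trans (cong (λ t → sumℕ t f) (+-identityʳ m)) (sym (+-identityʳ _))
  sumℕ-split m (suc n) f = trans (cong (λ t → sumℕ t f) (+-suc m n)) (trans (cong (_+ f (m + n)) (sumℕ-split m n f)) (+-assoc (sumℕ m f) _ _))

  sumℕ-const : ∀ n c → sumℕ n (λ _ → c) ≡ n * c
  sumℕ-const zero c = refl
  sumℕ-const (suc n) c = trans (cong (_+ c) (sumℕ-const n c)) (+-comm (n * c) c)

  prod-2^ : ∀ n {f} e → (∀ i → i < n → f i ≤ 2 ^ e i) → prod n f ≤ 2 ^ sumℕ n e
  prod-2^ zero e h = ≤-refl
  prod-2^ (suc n) e h = ≤-trans (*-mono-≤ (h n ≤-refl) (prod-2^ n e (λ i l → h i (m≤n⇒m≤1+n l)))) (≤-reflexive (trans (sym (^-distribˡ-+-* 2 (e n) (sumℕ n e))) (cong (2 ^_) (+-comm (e n) (sumℕ n e)))))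

  prod-≡2^ : ∀ n {f} e → (∀ i → f i ≡ 2 ^ e i) → prod n f ≡ 2 ^ sumℕ n e
  prod-≡2^ zero e h = refl
  prod-≡2^ (suc n) e h = trans (cong₂ _*_ (h n) (prod-≡2^ n e h)) (trans (sym (^-distribˡ-+-* 2 (e n) (sumℕ n e))) (cong (2 ^_) (+-comm (e n) (sumℕ n e))))

  triangle : ∀ n c d → 2 * sumℕ n (λ i → c + d * (n ∸ i)) ≡ 2 * (n * c) + d * (n * (n + 1))
  triangle n c d = trans (cong (2 *_) (lin n n)) (trans (l (n * c) d (tri n)) (cong (λ t → 2 * (n * c) + d * t) (trans (tri≡ n) (cong (n *_) (+-comm 1 n)))))
    where
    tri : ℕ → ℕ
    tri n = sumℕ n (λ i → n ∸ i)
    lin : ∀ m n → sumℕ m (λ i → c + d * (n ∸ i)) ≡ m * c + d * sumℕ m (λ i → n ∸ i)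
    lin zero n = sym (*-zeroʳ d)
    lin (suc m) n = trans (cong (_+ (c + d * (n ∸ m))) (lin m n)) (e (m * c) d (sumℕ m (λ i → n ∸ i)) c (n ∸ m))
      where e : ∀ x d s c t → x + d * s + (c + d * t) ≡ c + x + d * (s + t)
            e = solve-∀
    l : ∀ x d t → 2 * (x + d * t) ≡ 2 * x + d * (2 * t)
    l = solve-∀
    shift : ∀ m n → m ≤ n → sumℕ m (λ i → suc n ∸ i) ≡ m + sumℕ m (λ i → n ∸ i)
    shift zero n _ = refl
    shift (suc m) n m<n = trans (cong₂ _+_ (shift m n (<⇒≤ m<n)) (+-∸-assoc 1 (<⇒≤ m<n))) (e m _ _)
      where e : ∀ m s t → m + s + suc t ≡ suc (m + (s + t))
            e = solve-∀
    tri≡ : ∀ n → 2 * tri n ≡ n * suc n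
    tri≡ zero = refl
    tri≡ (suc n) = trans (cong (2 *_) (cong₂ _+_ (shift n n ≤-refl) (m+n∸n≡m 1 n))) (trans (e n (tri n)) (trans (cong (λ t → 2 * n + t + 2) (tri≡ n)) (e₂ n)))
      where e : ∀ n t → 2 * (n + t + 1) ≡ 2 * n + 2 * t + 2
            e = solve-∀
            e₂ : ∀ n → 2 * n + n * suc n + 2 ≡ suc n * suc (suc n)
            e₂ = solve-∀

  -- 2 Σ_{k<K} (b − μk) ≥ 2bK − μK²
  slope : ∀ K b μ → 2 * (b * K) ≤ 2 * sumℕ K (λ k → b ∸ μ * k) + μ * (K * K)
  slope zero b μ = ≤-trans (≤-reflexive (cong (2 *_) (*-zeroʳ b))) z≤n
  slope (suc K) b μ = ≤-trans (≤-reflexive (e₁ b K)) (≤-trans (+-mono-≤ (slope K b μ) (*-monoʳ-≤ 2 (≤-trans (m≤n+m∸n b (μ * K)) (≤-reflexive (+-comm (μ * K) (b ∸ μ * K))))))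
     (≤-trans (m≤m+n _ μ) (≤-reflexive (e₂ (sumℕ K (λ k → b ∸ μ * k)) μ K (b ∸ μ * K)))))
    where e₁ : ∀ b K → 2 * (b * suc K) ≡ 2 * (b * K) + 2 * b
          e₁ = solve-∀
          e₂ : ∀ s μ K t → 2 * s + μ * (K * K) + 2 * (t + μ * K) + μ ≡ 2 * (s + t) + μ * (suc K * suc K)
          e₂ = solve-∀

  -- From 45 on, raising the argument by one multiplies its fourth power by less than 2.
  quartic-growth : ∀ C → 45 * 45 * (45 * 45) * C ≤ 2 ^ 45 → ∀ v → (v + 45) * (v + 45) * ((v + 45) * (v + 45)) * C ≤ 2 ^ (v + 45)
  quartic-growth C base zero = base
  quartic-growth C base (suc v) = subst (λ t → t * t * (t * t) * C ≤ 2 ^ suc (v + 45)) (+-suc v 45) (≤-trans (*-monoˡ-≤ C (≤-trans (m≤m+n (w * w * (w * w)) _) (≤-reflexive (e v)))) (≤-trans (≤-reflexive (l (q * q * (q * q)) C)) (*-monoʳ-≤ 2 (quartic-growth C base v))))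
    where w = v + 46
          q = v + 45
          e : ∀ v → (v + 46) * (v + 46) * ((v + 46) * (v + 46)) + (v * 339656 + v * v * 11604 + v * v * v * 176 + v * v * v * v + 3723794) ≡ ((v + 45) * (v + 45) * ((v + 45) * (v + 45))) * 2
          e = solve-∀
          l : ∀ b a → b * 2 * a ≡ 2 * (b * a)
          l = solve-∀

  -- The constant is 61·193·204, the product of the numerical factors met in `bound₂`; one factor
  -- `2 ^ U` absorbs them together with four factors of size `U`.
  U⁴ : ∀ U → 45 ≤ U → U * U * (U * U) * 2401692 ≤ 2 ^ U
  U⁴ U h = subst (λ t → t * t * (t * t) * 2401692 ≤ 2 ^ t) (m∸n+n≡m h) (quartic-growth 2401692 (toWitness {a? = 45 * 45 * (45 * 45) * 2401692 ≤? 2 ^ 45} _) (U ∸ 45))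

  +1≡suc : ∀ v → v + 1 ≡ suc v
  +1≡suc v = +-comm v 1

  -- H = h + 9 is the least integer from 9 on with n ≤ 4^H, so it is about log₄ n. The last clause
  -- is what lets y^⌊n/6⌋ dominate the denominators of the extrapolation. For h > 0 minimality gives
  -- n > 4^(H-1), which outgrows the quadratic polynomials in h.
  find-H : ∀ n → 228000 < n → ∃ λ h → n ≤ 4 ^ (h + 9) × (h + 9) * 25088 ≤ n × (h * 188 + 1601) * (h + 9) * 7 ≤ (n / 6) * 3
  find-H n n> = go (least (λ h → n ≤? 4 ^ (h + 9)) n (≤-trans (n≤4^n n) (^-monoʳ-≤ 4 (m≤m+n n 9))))
    where
    n≤4^n : ∀ n → n ≤ 4 ^ n
    n≤4^n zero = z≤n
    n≤4^n (suc n) = ≤-trans (+-mono-≤ (>-nonZero⁻¹ (4 ^ n) {{m^n≢0 4 n}}) (n≤4^n n)) (≤-trans (m≤m+n _ (4 ^ n + 4 ^ n)) (≤-reflexive (e (4 ^ n))))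
      where e : ∀ a → a + a + (a + a) ≡ 4 * a
            e = solve-∀
    six : ∀ n → n ≤ (n / 6) * 6 + 5
    six n = ≤-trans (≤-reflexive (m≡m%n+[m/n]*n n 6)) (≤-trans (+-monoˡ-≤ _ (≤-pred (m%n<n n 6))) (≤-reflexive (+-comm 5 _)))
    growth : ∀ v → v * v * 2632 + v * 51366 + 262144 ≤ 4 ^ (v + 9)
    growth zero = toWitness {a? = 262144 ≤? 4 ^ 9} _
    growth (suc v) = subst (λ t → t * t * 2632 + t * 51366 + 262144 ≤ 4 * 4 ^ (v + 9)) (+1≡suc v) (≤-trans (≤-trans (m≤m+n _ (v * v * 7896 + v * 148834 + 732434)) (≤-reflexive (e v))) (*-monoʳ-≤ 4 (growth v)))
      where e : ∀ v → (v + 1) * (v + 1) * 2632 + (v + 1) * 51366 + 262144 + (v * v * 7896 + v * 148834 + 732434) ≡ 4 * (v * v * 2632 + v * 51366 + 262144)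
            e = solve-∀
    Goal = ∃ λ h → n ≤ 4 ^ (h + 9) × (h + 9) * 25088 ≤ n × (h * 188 + 1601) * (h + 9) * 7 ≤ (n / 6) * 3
    go : (∃ λ h → h ≤ n × n ≤ 4 ^ (h + 9) × (∀ j → j < h → ¬ n ≤ 4 ^ (j + 9))) → Goal
    -- For H = 9 the two requirements are 225792 ≤ n and 100863 ≤ 3⌊n/6⌋; this is where the size of
    -- n matters.
    go (zero , _ , le , _) = 0 , le , ≤-trans (toWitness {a? = 9 * 25088 ≤? 228000} _) (<⇒≤ n>) , ≤-trans (toWitness {a? = 1601 * 9 * 7 ≤? (228000 / 6) * 3} _) (*-monoˡ-≤ 3 (/-mono-≤ (<⇒≤ n>) (≤-refl {6})))
    go (suc v , _ , le , min) = suc v , le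
        , subst (λ t → (t + 9) * 25088 ≤ n) (+1≡suc v) (≤-trans (≤-trans (m≤m+n ((v + 1 + 9) * 25088) (v * v * 2632 + v * 26278 + 11264)) (≤-reflexive (e₂ v))) grow)
        , *-cancelʳ-≤ _ _ 2 (+-cancelʳ-≤ 5 _ _ (≤-trans (subst (λ t → (t * 188 + 1601) * (t + 9) * 7 * 2 + 5 ≤ n) (+1≡suc v) (≤-trans (≤-trans (m≤m+n (((v + 1) * 188 + 1601) * ((v + 1) + 9) * 7 * 2 + 5) 11679) (≤-reflexive (e v))) grow)) (≤-trans (six n) (≤-reflexive (cong (_+ 5) (sym (*-assoc (n / 6) 3 2)))))))
      where e : ∀ v → ((v + 1) * 188 + 1601) * ((v + 1) + 9) * 7 * 2 + 5 + 11679 ≡ v * v * 2632 + v * 51366 + 262144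
            e = solve-∀
            e₂ : ∀ v → (v + 1 + 9) * 25088 + (v * v * 2632 + v * 26278 + 11264) ≡ v * v * 2632 + v * 51366 + 262144
            e₂ = solve-∀
            grow : v * v * 2632 + v * 51366 + 262144 ≤ n
            grow = ≤-trans (growth v) (<⇒≤ (≰⇒> (min v ≤-refl)))

  -- 2^u is y² rounded up to a power of two. For u ≥ 7 the rounding is harmless: y² > 2^(u-1) gives
  -- y¹⁴ > 2^(7(u-1)) ≥ 2^(6u). The cases u = 5 and u = 6 are settled by y ≥ 5 and y ≥ 6.
  find-u : ∀ y → 5 ≤ y → ∃ λ u → 5 ≤ u × y * y ≤ 2 ^ u × 2 ^ (u * 6) ≤ y ^ 14
  find-u y 5≤y = go (least (λ u → y * y ≤? 2 ^ (u + 5)) (y * y) (≤-trans (n≤2^n (y * y)) (^-monoʳ-≤ 2 (m≤m+n (y * y) 5))))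
    where
    n≤2^n : ∀ n → n ≤ 2 ^ n
    n≤2^n zero = z≤n
    n≤2^n (suc n) = ≤-trans (+-mono-≤ (>-nonZero⁻¹ (2 ^ n) {{m^n≢0 2 n}}) (n≤2^n n)) (≤-reflexive (e (2 ^ n)))
      where e : ∀ a → a + a ≡ 2 * a
            e = solve-∀
    y¹⁴ : (y * y) ^ 7 ≡ y ^ 14
    y¹⁴ = trans (cong (λ t → (y * t) ^ 7) (sym (*-identityʳ y))) (^-*-assoc y 2 7)
    Goal = ∃ λ u → 5 ≤ u × y * y ≤ 2 ^ u × 2 ^ (u * 6) ≤ y ^ 14
    go : (∃ λ u → u ≤ y * y × y * y ≤ 2 ^ (u + 5) × (∀ j → j < u → ¬ y * y ≤ 2 ^ (j + 5))) → Goal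
    go (zero , _ , le , _) = 5 , ≤-refl , le , ≤-trans (toWitness {a? = 2 ^ 30 ≤? 5 ^ 14} _) (^-monoˡ-≤ 14 5≤y)
    go (1 , _ , le , min) = 6 , n≤1+n 5 , le , ≤-trans (toWitness {a? = 2 ^ 36 ≤? 6 ^ 14} _) (^-monoˡ-≤ 14 6≤y)
      where 6≤y : 6 ≤ y
            6≤y with 6 ≤? y
            ... | yes p = p
            ... | no ¬p = ⊥-elim (min 0 (s≤s z≤n) (≤-trans (*-mono-≤ (≤-pred (≰⇒> ¬p)) (≤-pred (≰⇒> ¬p))) (toWitness {a? = 25 ≤? 32} _)))
    go (suc (suc u) , _ , le , min) = suc (suc u) + 5 , m≤n+m 5 (suc (suc u)) , le , ≤-trans (≤-trans (^-monoʳ-≤ 2 (≤-trans (m≤m+n _ u) (≤-reflexive (e u)))) (≤-reflexive (sym (^-*-assoc 2 (suc u + 5) 7)))) (≤-trans (^-monoˡ-≤ 7 (<⇒≤ (≰⇒> (min (suc u) ≤-refl)))) (≤-reflexive y¹⁴))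
      where e : ∀ u → (suc (suc u) + 5) * 6 + u ≡ (suc u + 5) * 7
            e = solve-∀

  private
    L≡ : ∀ h → suc ((h + 9) + (h + 9)) ≡ h * 2 + 19
    L≡ = solve-∀

    lhs : ∀ h U → (U * 61 * ((h * 49 + 411) * U * 3 + (h + 9) * U * 84 + 2)) * 2 + (((h + 9) * U * 42 * ((h * 49 + 411) * U * 3 + 2)) * 2 + ((h + 9) * U * 42 * ((h + 9) * U * 42 + 1)) * 2 + (((h * 49 + 411) * U * 2) * 2 + ((h * 49 + 411) * U * ((h * 49 + 411) * U + 1)) * 3)) + (h * 2 + 19) * ((h * 2 + 13) * (U * 61 * (U * 61)))
          ≡ U * U * (h * h * 37963 + h * 665368 + 2886424) + U * (h * 595 + 5389)
    lhs = solve-∀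

    rhs : ∀ h U → U * U * (h * h * 37963 + h * 665368 + 2886424) + U * (U * (h * h * 101 + h * 508 + 4122)) ≡ (h * 2 + 19) * ((h * 156 + 1247) * U * (U * 61) * 2)
    rhs = solve-∀

    two : ∀ a b c d e l → 2 * a + (2 * b + 2 * c + (2 * d + 3 * e)) + l ≡ a * 2 + (b * 2 + c * 2 + (d * 2 + e * 3)) + l
    two = solve-∀

    small : ∀ h U → 45 ≤ U → 1 + U * (h * 595 + 5389) ≤ U * (U * (h * h * 101 + h * 508 + 4122))
    small h U 45≤U = ≤-trans (+-monoˡ-≤ (U * (h * 595 + 5389)) (≤-trans (s≤s z≤n) 45≤U)) (≤-trans (≤-reflexive (d₁ U (h * 595 + 5389))) (*-monoʳ-≤ U (≤-trans (≤-trans (m≤m+n (h * 595 + 5389 + 1) (h * h * 4545 + h * 22265 + 180100)) (≤-reflexive (d h))) (*-monoˡ-≤ (h * h * 101 + h * 508 + 4122) 45≤U))))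
      where d : ∀ h → h * 595 + 5389 + 1 + (h * h * 4545 + h * 22265 + 180100) ≡ 45 * (h * h * 101 + h * 508 + 4122)
            d = solve-∀
            d₁ : ∀ U y → U + U * y ≡ U * (y + 1)
            d₁ = solve-∀

    <-from-parts : ∀ {a b c d e} → a ≡ b + c → 1 + c ≤ e → b + e ≡ d → a < d
    <-from-parts {b = b} refl h refl = +-monoʳ-< b h

    -- The left side is twice the number of bits spent on boxes, plus the loss term of `slope`; the
    -- right side is twice the bits gained from the coefficients. Both share a main term in U², the
    -- right side has a surplus U²(101h² + 508h + 4122), and U ≥ 45 makes it exceed what is linear
    -- in U.
    room : ∀ h U {K W V A b μ L} → 45 ≤ U → K ≡ U * 61 → W ≡ (h * 49 + 411) * U → V ≡ (h + 9) * U → A ≡ (h + 9) * U * 42 → b ≡ (h * 156 + 1247) * U → μ ≡ h * 2 + 13 → L ≡ h * 2 + 19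
      → 2 * (K * (W * 3 + V * 84 + 2)) + (2 * (A * (W * 3 + 2)) + 2 * (A * (A + 1)) + (2 * (W * 2) + 3 * (W * (W + 1)))) + L * (μ * (K * K)) < L * (2 * (b * K))
    room h U {K} {W} {V} {A} {b} {μ} {L} 45≤U k w v a b′ m l = <-from-parts {b = U * U * (h * h * 37963 + h * 665368 + 2886424)} {c = U * (h * 595 + 5389)} {e = U * (U * (h * h * 101 + h * 508 + 4122))}
      (trans (two (K * (W * 3 + V * 84 + 2)) (A * (W * 3 + 2)) (A * (A + 1)) (W * 2) (W * (W + 1)) (L * (μ * (K * K)))) left) (small h U 45≤U) (trans (rhs h U) (sym right))
      where
      left : K * (W * 3 + V * 84 + 2) * 2 + (A * (W * 3 + 2) * 2 + A * (A + 1) * 2 + (W * 2 * 2 + W * (W + 1) * 3)) + L * (μ * (K * K)) ≡ U * U * (h * h * 37963 + h * 665368 + 2886424) + U * (h * 595 + 5389)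
      left rewrite k | w | v | a | m | l = lhs h U
      right : L * (2 * (b * K)) ≡ (h * 2 + 19) * ((h * 156 + 1247) * U * (U * 61) * 2)
      right rewrite k | b′ | l = cong ((h * 2 + 19) *_) (*-comm 2 ((h * 156 + 1247) * U * (U * 61)))

  -- The parameters of the construction, as functions of h and u.
  module Parameters (h u : ℕ) (5≤u : 5 ≤ u) where
    -- There are `L` exponentials, with exponents from -`H` to `H`, and `K` binomials. The
    -- coefficients at the k-th binomial get `b` - `μ`k bits, and the forms are made small to `δ`
    -- bits. `p₂` and `p₃` bound the bit size of (1 + 2^(-μ) + ρθ)^M for ρ = 4 and ρ = 8. `V` and
    -- `W` measure the two sloping segments in the bound for the Newton coefficients.
    H U L K W V b μ δ p₂ p₃ : ℕ
    H = h + 9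
    U = u * H
    L = suc (H + H)
    K = U * 61
    V = H * U
    W = (h * 49 + 411) * U
    b = (h * 156 + 1247) * U
    μ = h * 2 + 13
    δ = (L * 16 + 2) * U
    p₂ = U * 48 + V * 43
    p₃ = U * 48 + V * 85

    5H≤U : 5 * H ≤ U
    5H≤U = *-monoˡ-≤ H 5≤u

    45≤U : 45 ≤ U
    45≤U = ≤-trans (*-monoʳ-≤ 5 (m≤n+m 9 h)) 5H≤U

    1≤U : 1 ≤ U
    1≤U = ≤-trans (s≤s z≤n) 45≤U

    H≤U : H ≤ U
    H≤U = ≤-trans (m≤n*m H 5) 5H≤U

    L≤U : L ≤ U
    L≤U = ≤-trans (≤-trans (m≤m+n L (h * 3 + 26)) (≤-reflexive (e h))) 5H≤U
      where e : ∀ h → suc ((h + 9) + (h + 9)) + (h * 3 + 26) ≡ 5 * (h + 9)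
            e = solve-∀

    2^U : U * U * (U * U) * 2401692 ≤ 2 ^ U
    2^U = U⁴ U 45≤U

    1≤U² : 1 ≤ U * U
    1≤U² = *-mono-≤ 1≤U 1≤U

    pad : 3 * (K * L) ≤ 2 ^ U
    pad = ≤-trans (*-monoʳ-≤ 3 (*-monoʳ-≤ K L≤U)) (≤-trans (≤-reflexive (e U)) (≤-trans (*-mono-≤ (m≤m*n (U * U) (U * U) {{>-nonZero 1≤U²}}) (toWitness {a? = 183 ≤? 2401692} _)) 2^U))
      where e : ∀ U → 3 * (U * 61 * U) ≡ U * U * 183
            e = solve-∀

    -- With `a₃≡` this gives the heights of the two bounding lines at j = `K`. The line of slope -2
    -- starts at 3W + 84V and that of slope -3 at 3W + 126V, so they meet after 42V steps, at height
    -- 3W.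
    a₂≡ : δ + (U + (b + p₂)) ≡ W * 3 + V * 84
    a₂≡ = e h U
      where e : ∀ h U → (suc ((h + 9) + (h + 9)) * 16 + 2) * U + (U + ((h * 156 + 1247) * U + (U * 48 + ((h + 9) * U) * 43))) ≡ ((h * 49 + 411) * U) * 3 + ((h + 9) * U) * 84
            e = solve-∀

    a₃≡ : δ + (U + (b + p₃)) ≡ W * 3 + V * 126
    a₃≡ = e h U
      where e : ∀ h U → (suc ((h + 9) + (h + 9)) * 16 + 2) * U + (U + ((h * 156 + 1247) * U + (U * 48 + ((h + 9) * U) * 85))) ≡ ((h * 49 + 411) * U) * 3 + ((h + 9) * U) * 126
            e = solve-∀

    μk≤b : ∀ k → k < K → μ * k ≤ b
    μk≤b k k< = ≤-trans (*-monoʳ-≤ μ (<⇒≤ k<)) (≤-trans (m≤m+n (μ * K) ((h * 34 + 454) * U)) (≤-reflexive (e h U)))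
      where e : ∀ h U → (h * 2 + 13) * (U * 61) + (h * 34 + 454) * U ≡ (h * 156 + 1247) * U
            e = solve-∀

    -- The index at which the line of slope -3 comes down to 0.
    Jmax : ℕ
    Jmax = K + (V * 42 + W)

    tail : δ + (U + (b + p₃)) ≤ 3 * (Jmax ∸ K)
    tail = subst (λ t → δ + (U + (b + p₃)) ≤ 3 * t) (sym (m+n∸m≡n K (V * 42 + W))) (≤-reflexive (trans a₃≡ (e W V)))
      where e : ∀ W V → W * 3 + V * 126 ≡ 3 * (V * 42 + W)
            e = solve-∀

    module _ (bits : ℕ → ℕ) (bits₂ : ∀ j → bits j ≤ δ + (U + (b + p₂)) ∸ 2 * (j ∸ K)) (bits₃ : ∀ j → bits j ≤ δ + (U + (b + p₃)) ∸ 3 * (j ∸ K)) where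

      private
        A : ℕ
        A = V * 42

        e₁ : ∀ j → suc (2 ^ bits j + 2 ^ bits j) ≤ 2 ^ (bits j + 2)
        e₁ j = ≤-trans (+-monoˡ-≤ _ (>-nonZero⁻¹ (2 ^ bits j) {{m^n≢0 2 (bits j)}})) (≤-trans (m≤m+n _ (2 ^ bits j)) (≤-reflexive (trans (e (2 ^ bits j)) (sym (^-distribˡ-+-* 2 (bits j) 2)))))
          where e : ∀ a → a + (a + a) + a ≡ a * 4
                e = solve-∀

        seg₁ : sumℕ K (λ j → bits j + 2) ≤ K * (W * 3 + V * 84 + 2)
        seg₁ = ≤-trans (sumℕ-mono K (λ j _ → +-monoˡ-≤ 2 (≤-trans (bits₂ j) (≤-trans (m∸n≤m _ (2 * (j ∸ K))) (≤-reflexive a₂≡))))) (≤-reflexive (sumℕ-const K _))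

        seg₂ : sumℕ A (λ i → bits (K + i) + 2) ≤ sumℕ A (λ i → (W * 3 + 2) + 2 * (A ∸ i))
        seg₂ = sumℕ-mono A λ i i< → ≤-trans (+-monoˡ-≤ 2 (≤-trans (bits₂ (K + i)) (≤-reflexive (trans (cong₂ (λ s t → s ∸ 2 * t) (trans a₂≡ (d W V)) (m+n∸m≡n K i)) (trans (+-∸-assoc (W * 3) (*-monoʳ-≤ 2 (<⇒≤ i<))) (cong (W * 3 +_) (sym (*-distribˡ-∸ 2 A i)))))))) (≤-reflexive (d₂ (W * 3) _))
          where d : ∀ W V → W * 3 + V * 84 ≡ W * 3 + 2 * (V * 42)
                d = solve-∀
                d₂ : ∀ w t → w + t + 2 ≡ w + 2 + t
                d₂ = solve-∀

        seg₃ : sumℕ W (λ i → bits (K + (A + i)) + 2) ≤ sumℕ W (λ i → 2 + 3 * (W ∸ i))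
        seg₃ = sumℕ-mono W λ i _ → ≤-trans (+-monoˡ-≤ 2 (≤-trans (bits₃ (K + (A + i))) (≤-reflexive (trans (cong₂ (λ s t → s ∸ 3 * t) (trans a₃≡ (d W V)) (m+n∸m≡n K (A + i))) (trans (sym (*-distribˡ-∸ 3 (A + W) (A + i))) (cong (3 *_) ([m+n]∸[m+o]≡n∸o A W i))))))) (≤-reflexive (+-comm _ 2))
          where d : ∀ W V → W * 3 + V * 126 ≡ 3 * (V * 42 + W)
                d = solve-∀

        total : 2 * sumℕ Jmax (λ j → bits j + 2) ≤ 2 * (K * (W * 3 + V * 84 + 2)) + (2 * (A * (W * 3 + 2)) + 2 * (A * (A + 1)) + (2 * (W * 2) + 3 * (W * (W + 1))))
        total = ≤-trans (≤-reflexive (trans (cong (2 *_) (trans (sumℕ-split K (A + W) f) (cong (sumℕ K f +_) (sumℕ-split A W (λ i → f (K + i)))))) (d (sumℕ K f) (sumℕ A (λ i → f (K + i))) (sumℕ W (λ i → f (K + (A + i)))))))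
            (+-mono-≤ (*-monoʳ-≤ 2 seg₁) (+-mono-≤ (≤-trans (*-monoʳ-≤ 2 seg₂) (≤-reflexive (triangle A (W * 3 + 2) 2))) (≤-trans (*-monoʳ-≤ 2 seg₃) (≤-reflexive (triangle W 2 3)))))
          where f : ℕ → ℕ
                f j = bits j + 2
                d : ∀ a b c → 2 * (a + (b + c)) ≡ 2 * a + (2 * b + 2 * c)
                d = solve-∀

        enough : 2 * (K * (W * 3 + V * 84 + 2)) + (2 * (A * (W * 3 + 2)) + 2 * (A * (A + 1)) + (2 * (W * 2) + 3 * (W * (W + 1)))) + L * (μ * (K * K)) < L * (2 * (b * K))
        enough = room h U 45≤U refl refl refl refl refl refl (L≡ h)

      -- This is the inequality that the box principle needs. Both products become powers of 2; the
      -- exponents are doubled to keep the triangular sums integral. The boxes are summed over the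
      -- plateau j < `K` and the two slopes, with 2 extra bits per form, and `slope` bounds the
      -- unknowns from below.
      count : prod Jmax (λ j → suc (2 ^ bits j + 2 ^ bits j)) < prod K (λ k → prod L (λ _ → 2 ^ (b ∸ μ * k)))
      count = ≤-<-trans (prod-2^ Jmax (λ j → bits j + 2) (λ j _ → e₁ j)) (<-≤-trans (^-monoʳ-< 2 (s≤s (s≤s z≤n)) exps) (≤-reflexive (sym (prod-≡2^ K (λ k → L * (b ∸ μ * k)) (λ k → trans (prod-≡2^ L (λ _ → b ∸ μ * k) (λ _ → refl)) (cong (2 ^_) (sumℕ-const L _)))))))
        where
        pull : ∀ n f → sumℕ n (λ k → L * f k) ≡ L * sumℕ n f
        pull zero f = sym (*-zeroʳ L)
        pull (suc n) f = trans (cong (_+ L * f n) (pull n f)) (sym (*-distribˡ-+ L _ (f n)))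
        exps : sumℕ Jmax (λ j → bits j + 2) < sumℕ K (λ k → L * (b ∸ μ * k))
        exps = *-cancelˡ-< 2 _ _ (+-cancelʳ-< (L * (μ * (K * K))) _ _ (≤-<-trans (+-monoˡ-≤ _ total) (<-≤-trans enough (≤-trans (*-monoʳ-≤ L (slope K b μ))
           (≤-reflexive (trans (d L (sumℕ K (λ k → b ∸ μ * k)) (μ * (K * K))) (cong (λ t → 2 * t + L * (μ * (K * K))) (sym (pull K _)))))))))
          where d : ∀ l s m → l * (2 * s + m) ≡ 2 * (l * s) + l * m
                d = solve-∀

-- Error terms compared with y^⌊n/6⌋

module ParameterEstimates where
  open ParameterChoice
  open import Data.Nat
  open import Data.Nat.Properties
  open import Data.Nat.DivMod using (m≡m%n+[m/n]*n; m%n<n; _/_; _%_; m/n*n≤m)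
  open import Data.Nat.Tactic.RingSolver using (solve-∀)

  ^-cancelˡ-≤ : ∀ {a b} n .{{_ : NonZero n}} → a ^ n ≤ b ^ n → a ≤ b
  ^-cancelˡ-≤ {a} {b} n h = go (a ≤? b)
    where go : Dec (a ≤ b) → a ≤ b
          go (yes p) = p
          go (no ¬p) = ⊥-elim (<⇒≱ (^-monoˡ-< n (≰⇒> ¬p)) h)

  ^-mono : ∀ a {m n} → 1 ≤ a → m ≤ n → a ^ m ≤ a ^ n
  ^-mono a 1≤a m≤n = ^-monoʳ-≤ a {{>-nonZero 1≤a}} m≤n

  module Estimates (n y h u e : ℕ) (5≤u : 5 ≤ u) (1≤n : 1 ≤ n) (1≤y : 1 ≤ y) (n≤ : n ≤ 4 ^ (h + 9)) (e≥ : (h * 188 + 1601) * (h + 9) * 7 ≤ e * 3)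
    (y²≤ : y * y ≤ 2 ^ u) (y¹⁴≥ : 2 ^ (u * 6) ≤ y ^ 14) where
    open Parameters h u 5≤u

    -- The sample points come from `R₂` powers of β and `S` translates by n; `R′` centres the
    -- exponents of β; `T₀` bounds how many errors ε accumulate when a power of g is replaced by a
    -- power of β.
    R₂ R′ T₀ S : ℕ
    R₂ = L * 63
    R′ = L * 32
    T₀ = n * U * 193
    S = U ∸ 1

    S+1≡U : suc S ≡ U
    S+1≡U = m+[n∸m]≡n 1≤U

    n≤2^U : n ≤ 2 ^ U
    n≤2^U = ≤-trans n≤ (≤-trans (≤-reflexive (^-*-assoc 2 2 H)) (^-monoʳ-≤ 2 (≤-trans (*-monoˡ-≤ H (toWitness {a? = 2 ≤? 5} _)) 5H≤U)))

    y^-≤ : y ^ (R′ * H) ≤ 2 ^ (L * U * 16)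
    y^-≤ = ≤-trans (≤-reflexive (trans (cong (y ^_) (d₀ L H)) (trans (sym (^-*-assoc y 2 (L * H * 16))) (cong (_^ (L * H * 16)) (cong (y *_) (*-identityʳ y)))))) (≤-trans (^-monoˡ-≤ (L * H * 16) y²≤) (≤-reflexive (trans (^-*-assoc 2 u (L * H * 16)) (cong (2 ^_) (d₁ u L H)))))
      where d₀ : ∀ l h → l * 32 * h ≡ 2 * (l * h * 16)
            d₀ = solve-∀
            d₁ : ∀ u l h → u * (l * h * 16) ≡ l * (u * h) * 16
            d₁ = solve-∀

    private
      ^-+₃ : ∀ a b c → 2 ^ a * (2 ^ b * 2 ^ c) ≡ 2 ^ (a + (b + c))
      ^-+₃ a b c = trans (cong (2 ^ a *_) (sym (^-distribˡ-+-* 2 b c))) (sym (^-distribˡ-+-* 2 a (b + c)))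

    -- The factor 12 is 4·3: each of the Un Newton terms is at most 3·2^(-δ), and the total times
    -- the denominator is to be at most 1/4.
    bound₁ : y ^ (R′ * H) * (U * n * 12) ≤ 2 ^ δ
    bound₁ = ≤-trans (*-mono-≤ y^-≤ (≤-trans (≤-reflexive (d U n)) (*-mono-≤ (≤-trans (*-mono-≤ (≤-trans (m≤m*n U (U * (U * U)) {{>-nonZero (*-mono-≤ 1≤U 1≤U²)}}) (≤-reflexive (d₂ U))) (toWitness {a? = 12 ≤? 2401692} _)) 2^U) n≤2^U))) (≤-reflexive (trans (^-+₃ (L * U * 16) U U) (cong (2 ^_) (d₃ L U))))
      where d : ∀ u n → u * n * 12 ≡ u * 12 * n
            d = solve-∀
            d₂ : ∀ u → u * (u * (u * u)) ≡ u * u * (u * u)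
            d₂ = solve-∀
            d₃ : ∀ l u → l * u * 16 + (u + u) ≡ (l * 16 + 2) * u
            d₃ = solve-∀

    -- Compared through 14th powers, because y¹⁴ is known to be at least 2^(6u); what remains is the
    -- last clause of `find-H` multiplied by 2u.
    y^e≥ : 2 ^ ((h * 188 + 1601) * U) ≤ y ^ e
    y^e≥ = ^-cancelˡ-≤ {2 ^ ((h * 188 + 1601) * U)} {y ^ e} 14 (≤-trans (≤-reflexive (^-*-assoc 2 ((h * 188 + 1601) * U) 14)) (≤-trans (^-monoʳ-≤ 2 (≤-trans (≤-reflexive (d (h * 188 + 1601) u H)) (≤-trans (*-monoʳ-≤ (u * 2) e≥) (≤-reflexive (d₂ u e))))) (≤-trans (≤-reflexive (sym (^-*-assoc 2 (u * 6) e))) (≤-trans (^-monoˡ-≤ e y¹⁴≥) (≤-reflexive (trans (^-*-assoc y 14 e) (trans (cong (y ^_) (*-comm 14 e)) (sym (^-*-assoc y e 14)))))))))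
      where d : ∀ c u h → c * (u * h) * 14 ≡ u * 2 * (c * h * 7)
            d = solve-∀
            d₂ : ∀ u e → u * 2 * (e * 3) ≡ u * 6 * e
            d₂ = solve-∀

    -- The factor 204 is 4·3·17: 4 for the target 1/4, 3 from the coefficient bound, 17 from ε =
    -- 17w. The exponents of 2 add up to exactly (188h + 1601)U.
    bound₂ : y ^ (R′ * H) * (K * L * (2 ^ b * 2 ^ (U * 48) * (H * T₀))) * 204 ≤ y ^ e
    bound₂ = ≤-trans (≤-reflexive (d (y ^ (R′ * H)) L (2 ^ b) (2 ^ (U * 48)) H n U)) (≤-trans (*-mono-≤ y^-≤ (*-monoˡ-≤ (2 ^ b * 2 ^ (U * 48)) (*-mono-≤ (≤-trans (*-monoˡ-≤ 2401692 (*-mono-≤ {x = U * L} {u = U * H} (*-monoʳ-≤ U L≤U) (*-monoʳ-≤ U H≤U))) 2^U) n≤2^U)))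
       (≤-trans (≤-reflexive (trans (cong (2 ^ (L * U * 16) *_) (trans (cong₂ _*_ (sym (^-distribˡ-+-* 2 U U)) (sym (^-distribˡ-+-* 2 b (U * 48)))) refl)) (trans (^-+₃ (L * U * 16) (U + U) (b + U * 48)) (cong (2 ^_) (d₂ h U))))) y^e≥))
      where d : ∀ y l b p h n u → y * (u * 61 * l * (b * p * (h * (n * u * 193)))) * 204 ≡ y * (u * l * (u * h) * 2401692 * n * (b * p))
            d = solve-∀
            d₂ : ∀ h u → suc ((h + 9) + (h + 9)) * u * 16 + ((u + u) + ((h * 156 + 1247) * u + u * 48)) ≡ (h * 188 + 1601) * u
            d₂ = solve-∀

    bound₃ : y ^ R₂ * T₀ * 68 ≤ y ^ e
    bound₃ = ≤-trans (*-mono-≤ {y ^ R₂ * T₀} {y ^ (R′ * H) * (K * L * (2 ^ b * 2 ^ (U * 48) * (H * T₀)))} {68} {204} (*-mono-≤ (^-mono y 1≤y R₂≤) T₀≤) (toWitness {a? = 68 ≤? 204} _)) bound₂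
      where
      R₂≤ : R₂ ≤ R′ * H
      R₂≤ = ≤-trans (*-monoʳ-≤ L (≤-trans (toWitness {a? = 63 ≤? 32 * 9} _) (*-monoʳ-≤ 32 (m≤n+m 9 h)))) (≤-reflexive (sym (*-assoc L 32 H)))
      1≤H : 1 ≤ H
      1≤H = ≤-trans (s≤s z≤n) (m≤n+m 9 h)
      1≤2^ : ∀ a → 1 ≤ 2 ^ a
      1≤2^ a = >-nonZero⁻¹ (2 ^ a) {{m^n≢0 2 a}}
      grow : ∀ {a b} → 1 ≤ a → b ≤ a * b
      grow {a} {b} 1≤a = m≤n*m b a {{>-nonZero 1≤a}}
      T₀≤ : T₀ ≤ K * L * (2 ^ b * 2 ^ (U * 48) * (H * T₀))
      T₀≤ = ≤-trans (grow 1≤H) (≤-trans (grow (*-mono-≤ (1≤2^ b) (1≤2^ (U * 48)))) (grow {K * L} (*-mono-≤ {1} {K} {1} {L} (*-mono-≤ {1} {U} {1} {61} 1≤U (s≤s z≤n)) (s≤s z≤n))))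

    T₀≥ : 2 * (L + R₂) + S + 2 * (n * R′) ≤ T₀
    T₀≥ = ≤-trans (≤-reflexive (d L S n)) (≤-trans (+-mono-≤ (+-mono-≤ (*-monoˡ-≤ 128 L≤U) (m∸n≤m U 1)) (*-monoˡ-≤ 64 (*-monoʳ-≤ n L≤U))) (≤-trans (+-monoˡ-≤ _ (≤-trans (≤-reflexive (d₂ U)) (*-monoˡ-≤ 129 (m≤n*m U n {{>-nonZero 1≤n}})))) (≤-reflexive (d₃ (n * U)))))
      where d : ∀ l s n → 2 * (l + l * 63) + s + 2 * (n * (l * 32)) ≡ l * 128 + s + n * l * 64
            d = solve-∀
            d₂ : ∀ u → u * 128 + u ≡ u * 129
            d₂ = solve-∀
            d₃ : ∀ u → u * 129 + u * 64 ≡ u * 193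
            d₃ = solve-∀

    R′≥ : L + R₂ ≤ R′ + R′
    R′≥ = ≤-reflexive (d L)
      where d : ∀ l → l + l * 63 ≡ l * 32 + l * 32
            d = solve-∀

    -- After division by `L` this is 61U < 63(U - 1).
    points : L * K < R₂ * S
    points = +-cancelʳ-< (L * 63) _ _ (<-≤-trans (≤-<-trans (≤-reflexive (d L U)) (*-monoʳ-< L (≤-trans (s≤s (+-monoʳ-≤ (U * 61) (toWitness {a? = 63 ≤? 45 * 2 ∸ 1} _))) (≤-trans (≤-reflexive (sym (+-suc (U * 61) 89))) (≤-trans (+-monoʳ-≤ (U * 61) (*-monoˡ-≤ 2 45≤U)) (≤-reflexive (d₂ U))))))) (≤-reflexive (trans (cong (λ t → L * (t * 63)) (sym S+1≡U)) (d₃ L S))))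
      where d : ∀ l u → l * (u * 61) + l * 63 ≡ l * (u * 61 + 63)
            d = solve-∀
            d₂ : ∀ u → u * 61 + u * 2 ≡ u * 63
            d₂ = solve-∀
            d₃ : ∀ l s → l * (suc s * 63) ≡ l * 63 * s + l * 63
            d₃ = solve-∀

-- Congruences for 3x² + 2d² = yⁿ, and Thue's lemma

module ThueLemma where
  open import Data.Nat
  open import Data.Nat.Properties
  open import Data.Nat.DivMod
  open import Data.Nat.Divisibility
  open import Data.Nat.Coprimality as Cop using (Coprime; coprime-divisor)
  open import Data.Nat.Tactic.RingSolver using (solve-∀)
  open import Data.Integer as ℤ using (ℤ) renaming (+_ to pos; ∣_∣ to abs)
  import Data.Integer.Properties as ℤ
  import Data.Integer.Divisibility.Signed as S
  import Data.Integer.Tactic.RingSolver as ℤR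
  open import Data.Fin as Fin using (Fin; toℕ; fromℕ<; remQuot; combine)
  open import Data.Fin.Properties as Fin using (pigeonhole; fromℕ<-injective; toℕ-injective; combine-remQuot)

  <3-cases : ∀ r → r < 3 → r ≡ 0 ⊎ r ≡ 1 ⊎ r ≡ 2
  <3-cases 0 _ = inj₁ refl
  <3-cases 1 _ = inj₂ (inj₁ refl)
  <3-cases 2 _ = inj₂ (inj₂ refl)
  <3-cases (suc (suc (suc _))) (s≤s (s≤s (s≤s ())))

  *-mod : ∀ m n {p q} d .{{_ : NonZero d}} → m % d ≡ p → n % d ≡ q → (m * n) % d ≡ (p * q) % d
  *-mod m n d e f = trans (%-distribˡ-* m n d) (cong₂ (λ s t → (s * t) % d) e f)

  sq3 : ∀ b → (b * b) % 3 ≡ 0 × b % 3 ≡ 0 ⊎ (b * b) % 3 ≡ 1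
  sq3 b with <3-cases (b % 3) (m%n<n b 3)
  ... | inj₁ e = inj₁ (*-mod b b 3 e e , e)
  ... | inj₂ (inj₁ e) = inj₂ (*-mod b b 3 e e)
  ... | inj₂ (inj₂ e) = inj₂ (*-mod b b 3 e e)

  form3 : ∀ A B → (3 * A + 2 * B) % 3 ≡ (2 * (B % 3)) % 3
  form3 A B = trans (%-remove-+ˡ (2 * B) (m∣m*n A)) (*-mod 2 B 3 refl refl)

  -- Modulo 3 only 2b² counts, and b² is 0 or 1; hence a value of the form is never 1 modulo 3. The
  -- exclusions below rest on this.
  form-sq3 : ∀ A b → (3 * A + 2 * (b * b)) % 3 ≡ 0 × b % 3 ≡ 0 ⊎ (3 * A + 2 * (b * b)) % 3 ≡ 2
  form-sq3 A b with sq3 b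
  ... | inj₁ (e , f) = inj₁ (trans (form3 A (b * b)) (cong (λ t → (2 * t) % 3) e) , f)
  ... | inj₂ e = inj₂ (trans (form3 A (b * b)) (cong (λ t → (2 * t) % 3) e))

  2≢0 : ¬ 2 ≡ 0
  2≢0 ()

  3≢1 : ¬ 3 ≡ 1
  3≢1 ()

  m*m≡0⇒m≡0 : ∀ m → m * m ≡ 0 → m ≡ 0
  m*m≡0⇒m≡0 zero _ = refl

  2≢1 : ¬ 2 ≡ 1
  2≢1 ()

  pow-mod1 : ∀ y n → y % 3 ≡ 1 → (y ^ n) % 3 ≡ 1
  pow-mod1 y zero e = refl
  pow-mod1 y (suc n) e = *-mod y (y ^ n) 3 e (pow-mod1 y n e)

  halves : ∀ n → ∃ λ h → n ≡ h + h ⊎ n ≡ suc (h + h)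
  halves zero = 0 , inj₁ refl
  halves (suc n) with halves n
  ... | h , inj₁ e = h , inj₂ (cong suc e)
  ... | h , inj₂ e = suc h , inj₁ (cong suc (trans e (sym (+-suc h h))))

  pow-mod2 : ∀ y h → y % 3 ≡ 2 → (y ^ (h + h)) % 3 ≡ 1
  pow-mod2 y h e = trans (cong (_% 3) (trans (^-distribˡ-+-* y h h) (sym (lem y h)))) (pow-mod1 (y * y) h (*-mod y y 3 e e))
    where lem : ∀ y h → (y * y) ^ h ≡ y ^ h * y ^ h
          lem y zero = refl
          lem y (suc h) = trans (cong ((y * y) *_) (lem y h)) (r y (y ^ h))
            where r : ∀ a b → (a * a) * (b * b) ≡ (a * b) * (a * b)
                  r = solve-∀

  odd-sq : ∀ x → x % 2 ≡ 1 → (3 * (x * x)) % 2 ≡ 1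
  odd-sq x e = *-mod 3 (x * x) 2 refl (*-mod x x 2 e e)

  <2-cases : ∀ r → r < 2 → r ≡ 0 ⊎ r ≡ 1
  <2-cases 0 _ = inj₁ refl
  <2-cases 1 _ = inj₂ refl
  <2-cases (suc (suc _)) (s≤s (s≤s ()))

  even-of-form : ∀ A B → (3 * (A * A) + 2 * B) % 2 ≡ 0 → 2 ∣ A
  even-of-form A B e with <2-cases (A % 2) (m%n<n A 2)
  ... | inj₁ z = m%n≡0⇒n∣m A 2 z
  ... | inj₂ o with () ← trans (sym e) (trans (%-remove-+ʳ (3 * (A * A)) (m∣m*n B)) (odd-sq A o))

  coprime-pow : ∀ {a b} n → Coprime a b → Coprime (a ^ n) b
  coprime-pow zero c (d , _) = ∣1⇒≡1 d
  coprime-pow {a} (suc n) c {k} (d , d′) = coprime-pow n c (coprime-divisor (λ (e , f) → c (f , ∣-trans e d′)) d , d′)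

  isqrt : ∀ y → ∃ λ s → s * s ≤ y × y < suc s * suc s
  isqrt zero = 0 , z≤n , s≤s z≤n
  isqrt (suc y) with isqrt y
  ... | s , l , u with suc s * suc s ≤? suc y
  ...   | yes p = suc s , p , ≤-trans (s≤s u) (≤-trans (s≤s (m≤m+n _ (2 * s + 2))) (≤-reflexive (cong suc (r s))))
    where r : ∀ s → (suc s * suc s) + (2 * s + 2) ≡ suc s + suc s * suc (suc s)
          r = solve-∀
  ...   | no ¬p = s , m≤n⇒m≤1+n l , ≰⇒> ¬p

  ∣sq∣ : ∀ a → a ℤ.* a ≡ pos ((abs a) * (abs a))
  ∣sq∣ (pos n) = sym (ℤ.pos-* n n)
  ∣sq∣ (ℤ.-[1+ n ]) = refl

  pos-form : ∀ p q → pos (3 * p + 2 * q) ≡ pos 3 ℤ.* pos p ℤ.+ pos 2 ℤ.* pos q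
  pos-form p q = trans (ℤ.pos-+ (3 * p) (2 * q)) (cong₂ ℤ._+_ (ℤ.pos-* 3 p) (ℤ.pos-* 2 q))

  mod-diff : ∀ u v y .{{_ : NonZero y}} → u % y ≡ v % y → ∃ λ c → pos u ℤ.- pos v ≡ c ℤ.* pos y
  mod-diff u v y e = pos (u / y) ℤ.- pos (v / y) , trans (cong₂ ℤ._-_ (dec u) (trans (dec v) (cong (λ t → pos t ℤ.+ pos (v / y) ℤ.* pos y) (sym e)))) (r (pos (u % y)) (pos (u / y)) (pos (v / y)) (pos y))
    where dec : ∀ u → pos u ≡ pos (u % y) ℤ.+ pos (u / y) ℤ.* pos y
          dec u = trans (cong pos (m≡m%n+[m/n]*n u y)) (trans (ℤ.pos-+ (u % y) _) (cong (λ t → pos (u % y) ℤ.+ t) (ℤ.pos-* (u / y) y)))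
          r : ∀ r p q y → (r ℤ.+ p ℤ.* y) ℤ.- (r ℤ.+ q ℤ.* y) ≡ (p ℤ.- q) ℤ.* y
          r = ℤR.solve-∀

  ∣pos-pos∣≤ : ∀ {a b s} → a ≤ s → b ≤ s → (abs (pos a ℤ.- pos b)) ≤ s
  ∣pos-pos∣≤ {a} {b} p q = ≤-trans (≤-reflexive (cong abs (ℤ.m-n≡m⊖n a b))) (≤-trans (ℤ.∣m⊝n∣≤m⊔n a b) (⊔-lub p q))

  module Form {n d x y : ℕ} (2≤n : 2 ≤ n) (y>0 : 0 < y) (cop : Coprime x y) (E : 3 * (x * x) + 2 * (d * d) ≡ y ^ n) where

    private instance
      nz : NonZero y
      nz = >-nonZero y>0

    abstract
      y∣yⁿ : y ∣ y ^ n
      y∣yⁿ = subst (λ k → y ∣ y ^ k) (m+[n∸m]≡n 2≤n) (m∣m*n _)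

    private
      -- If 3 divides d and y, then 9 divides 2d² and, since n ≥ 2, also yⁿ; so 9 divides 3x².
      3∣x-of : ∀ q → d ≡ q * 3 → 3 ∣ y → 3 ∣ x
      3∣x-of q d≡ 3∣y = go (sq3 x)
        where
        9∣yⁿ : 3 * 3 ∣ y ^ n
        9∣yⁿ = subst (λ k → 3 * 3 ∣ y ^ k) (m+[n∸m]≡n 2≤n) (subst (3 * 3 ∣_) (*-assoc y y (y ^ (n ∸ 2))) (∣-trans (*-pres-∣ 3∣y 3∣y) (m∣m*n (y ^ (n ∸ 2)))))
        9∣2dd : 3 * 3 ∣ 2 * (d * d)
        9∣2dd = divides (2 * (q * q)) (trans (cong (λ t → 2 * (t * t)) d≡) (r q))
          where r : ∀ q → 2 * (q * 3 * (q * 3)) ≡ 2 * (q * q) * 9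
                r = solve-∀
        9∣form : 3 * 3 ∣ 3 * (x * x)
        9∣form = ∣m+n∣m⇒∣n {3 * 3} {2 * (d * d)} {3 * (x * x)} (subst (3 * 3 ∣_) (trans (sym E) (+-comm (3 * (x * x)) (2 * (d * d)))) 9∣yⁿ) 9∣2dd
        go : (x * x) % 3 ≡ 0 × x % 3 ≡ 0 ⊎ (x * x) % 3 ≡ 1 → 3 ∣ x
        go (inj₁ (_ , e)) = m%n≡0⇒n∣m x 3 e
        go (inj₂ e) = ⊥-elim (0≢1 (trans (sym (n∣m⇒m%n≡0 (x * x) 3 (*-cancelˡ-∣ 3 9∣form))) e))
          where 0≢1 : ¬ 0 ≡ 1
                0≢1 ()

      form-% : (3 * (x * x) + 2 * (d * d)) % 3 ≡ (y ^ n) % 3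
      form-% = cong (_% 3) E

      y%3≢1 : ¬ y % 3 ≡ 1
      y%3≢1 e = go (form-sq3 (x * x) d)
        where go : (3 * (x * x) + 2 * (d * d)) % 3 ≡ 0 × d % 3 ≡ 0 ⊎ (3 * (x * x) + 2 * (d * d)) % 3 ≡ 2 → ⊥
              go (inj₁ (f , _)) with () ← trans (sym f) (trans form-% (pow-mod1 y n e))
              go (inj₂ f) with () ← trans (sym f) (trans form-% (pow-mod1 y n e))

      y%3≢0 : ¬ y % 3 ≡ 0
      y%3≢0 e = go (form-sq3 (x * x) d)
        where
        3∣y : 3 ∣ y
        3∣y = m%n≡0⇒n∣m y 3 e
        go : (3 * (x * x) + 2 * (d * d)) % 3 ≡ 0 × d % 3 ≡ 0 ⊎ (3 * (x * x) + 2 * (d * d)) % 3 ≡ 2 → ⊥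
        go (inj₁ (_ , g)) with m%n≡0⇒n∣m d 3 g
        ... | divides q d≡ = 3≢1 (cop {3} (3∣x-of q d≡ 3∣y , 3∣y))
        go (inj₂ f) with () ← trans (sym f) (trans form-% (n∣m⇒m%n≡0 (y ^ n) 3 (∣-trans 3∣y y∣yⁿ)))

    y%3 : y % 3 ≡ 2
    y%3 = go (<3-cases (y % 3) (m%n<n y 3))
      where go : y % 3 ≡ 0 ⊎ y % 3 ≡ 1 ⊎ y % 3 ≡ 2 → y % 3 ≡ 2
            go (inj₁ e) = ⊥-elim (y%3≢0 e)
            go (inj₂ (inj₁ e)) = ⊥-elim (y%3≢1 e)
            go (inj₂ (inj₂ e)) = e

    -- As y ≡ 2 (mod 3), an even power of y would be 1 modulo 3, a residue that the form misses.
    n-odd : ∃ λ h → n ≡ suc (h + h)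
    n-odd with halves n
    ... | h , inj₂ e = h , e
    ... | h , inj₁ e with form-sq3 (x * x) d
    ...   | inj₁ (f , _) with () ← trans (sym f) (trans (cong (_% 3) (trans E (cong (y ^_) e))) (pow-mod2 y h y%3))
    ...   | inj₂ f with () ← trans (sym f) (trans (cong (_% 3) (trans E (cong (y ^_) e))) (pow-mod2 y h y%3))

    coprime-y2 : Coprime y 2
    coprime-y2 {k} (k∣y , k∣2) = go k (∣⇒≤ k∣2) k∣y k∣2
      where
      go : ∀ k → k ≤ 2 → k ∣ y → k ∣ 2 → k ≡ 1
      go 0 _ _ 0∣2 = ⊥-elim (2≢0 (0∣⇒≡0 0∣2))
      go 1 _ _ _ = refl
      go 2 _ 2∣y _ = cop (even-of-form x (d * d) (trans (cong (_% 2) E) (n∣m⇒m%n≡0 (y ^ n) 2 (∣-trans 2∣y y∣yⁿ))) , 2∣y)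
      go (suc (suc (suc _))) (s≤s (s≤s ()))

    coprime-yx : Coprime y x
    coprime-yx = Cop.sym cop

    -- A common divisor divides 3x², hence divides 3, being prime to x; and 3 does not divide y.
    coprime-yd : Coprime y d
    coprime-yd {k} (k∣y , k∣d) = go k (∣⇒≤ k∣3) k∣y k∣3
      where
      k∣3 : k ∣ 3
      k∣3 = coprime-divisor (λ (e , f) → cop (f , ∣-trans e k∣y)) (coprime-divisor (λ (e , f) → cop (f , ∣-trans e k∣y))
        (subst (k ∣_) (r x) (∣m+n∣m⇒∣n {k} {2 * (d * d)} {3 * (x * x)} (subst (k ∣_) (trans (sym E) (+-comm (3 * (x * x)) (2 * (d * d)))) (∣-trans k∣y y∣yⁿ)) (∣n⇒∣m*n 2 (∣m⇒∣m*n d k∣d)))))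
        where r : ∀ x → 3 * (x * x) ≡ x * (x * 3)
              r = solve-∀
      3≢0 : ¬ 3 ≡ 0
      3≢0 ()
      go : ∀ k → k ≤ 3 → k ∣ y → k ∣ 3 → k ≡ 1
      go 0 _ _ 0∣3 = ⊥-elim (3≢0 (0∣⇒≡0 0∣3))
      go 1 _ _ _ = refl
      go 2 _ _ (divides 0 ())
      go 2 _ _ (divides 1 ())
      go 2 _ _ (divides (suc (suc _)) ())
      go 3 _ 3∣y _ = ⊥-elim (2≢0 (trans (sym y%3) (n∣m⇒m%n≡0 y 3 3∣y)))
      go (suc (suc (suc (suc _)))) (s≤s (s≤s (s≤s ())))

    5≤y : 5 ≤ y
    5≤y with 5 ≤? y
    ... | yes p = p
    ... | no ¬p = ⊥-elim (small y (≰⇒> ¬p) y%3 coprime-y2)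
      where small : ∀ y → y < 5 → y % 3 ≡ 2 → Coprime y 2 → ⊥
            small 0 _ ()
            small 1 _ ()
            small 2 _ _ c = 2≢1 (c (∣-refl , ∣-refl))
            small 3 _ ()
            small 4 _ ()
            small (suc (suc (suc (suc (suc _))))) (s≤s (s≤s (s≤s (s≤s (s≤s ())))))

    -- With α = a√3 - b√-2 and ξ̄ = x√3 - d√-2, the norm of α is y and xα = aξ̄ + yc√-2. This is how
    -- α is tied to the factor ξ̄ of yⁿ.
    Rep : Set
    Rep = ∃₂ λ a b → ∃ λ c → pos x ℤ.* b ≡ pos d ℤ.* a ℤ.- pos y ℤ.* c × 3 * ((abs a) * (abs a)) + 2 * ((abs b) * (abs b)) ≡ y

    -- The bounds a², b² ≤ y leave 3a² + 2b² = ky with k ≤ 5. For k = 2 and k = 5 the right side is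
    -- 1 modulo 3, which is excluded; k = 3 forces 3 | b and then a² ≡ y ≡ 2 (mod 3); k = 4 forces a
    -- and b to be even, and halving them brings k down to 1.
    multiple⇒rep : ∀ a b c s → s * s ≤ y → (abs a) ≤ s → (abs b) ≤ s → ¬ ((abs a) ≡ 0 × (abs b) ≡ 0)
      → pos x ℤ.* b ≡ pos d ℤ.* a ℤ.- pos y ℤ.* c → ∀ k → 3 * ((abs a) * (abs a)) + 2 * ((abs b) * (abs b)) ≡ k * y → Rep
    multiple⇒rep a b c s s²≤y a≤ b≤ nz lin 0 e = ⊥-elim (nz
      ( m*m≡0⇒m≡0 (abs a) (m+n≡0⇒m≡0 (abs a * abs a) (m+n≡0⇒m≡0 (3 * (abs a * abs a)) e))
      , m*m≡0⇒m≡0 (abs b) (m+n≡0⇒m≡0 (abs b * abs b) (m+n≡0⇒n≡0 (3 * (abs a * abs a)) e))))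
    multiple⇒rep a b c s s²≤y a≤ b≤ nz lin 1 e = a , b , c , lin , trans e (*-identityˡ y)
    multiple⇒rep a b c s s²≤y a≤ b≤ nz lin 2 e with form-sq3 ((abs a) * (abs a)) (abs b)
    ... | inj₁ (f , _) with () ← trans (sym f) (trans (cong (_% 3) e) (*-mod 2 y 3 refl y%3))
    ... | inj₂ f with () ← trans (sym f) (trans (cong (_% 3) e) (*-mod 2 y 3 refl y%3))
    multiple⇒rep a b c s s²≤y a≤ b≤ nz lin 3 e with form-sq3 ((abs a) * (abs a)) (abs b)
    ... | inj₂ f with () ← trans (sym f) (trans (cong (_% 3) e) (*-mod 3 y 3 refl y%3))
    ... | inj₁ (_ , g) with m%n≡0⇒n∣m (abs b) 3 g
    ...   | divides q h = ⊥-elim (absurd (sq3 (abs a)))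
      where
      y≡ : (abs a) * (abs a) + 2 * (q * q) * 3 ≡ y
      y≡ = *-cancelˡ-≡ _ _ 3 (trans (trans (r ((abs a) * (abs a)) q) (cong (λ t → 3 * ((abs a) * (abs a)) + 2 * (t * t)) (sym h))) e)
        where r : ∀ A q → 3 * (A + 2 * (q * q) * 3) ≡ 3 * A + 2 * ((q * 3) * (q * 3))
              r = solve-∀
      a²≡2 : ((abs a) * (abs a)) % 3 ≡ 2
      a²≡2 = trans (sym ([m+kn]%n≡m%n ((abs a) * (abs a)) (2 * (q * q)) 3)) (trans (cong (_% 3) y≡) y%3)
      absurd : ((abs a) * (abs a)) % 3 ≡ 0 × (abs a) % 3 ≡ 0 ⊎ ((abs a) * (abs a)) % 3 ≡ 1 → ⊥
      absurd (inj₁ (f , _)) = 2≢0 (trans (sym a²≡2) f)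
      absurd (inj₂ f) = 2≢1 (trans (sym a²≡2) f)
    multiple⇒rep a b c s s²≤y a≤ b≤ nz lin 4 e
      with even-of-form (abs a) ((abs b) * (abs b)) (trans (cong (_% 2) e) (trans (cong (_% 2) (*-assoc 2 2 y)) (n∣m⇒m%n≡0 (2 * (2 * y)) 2 (m∣m*n (2 * y)))))
    ... | 2∣a with S.∣ᵤ⇒∣ {pos 2} {a} 2∣a
    ... | S.divides a′ refl = step 2∣b
      where
      A′ = (abs a′)
      ∣a∣≡ : (abs (a′ ℤ.* pos 2)) ≡ A′ * 2
      ∣a∣≡ = ℤ.abs-* a′ (pos 2)
      B²≡ : 3 * (A′ * A′) * 2 + (abs b) * (abs b) ≡ 2 * y
      B²≡ = *-cancelˡ-≡ _ _ 2 (trans (trans (r A′ ((abs b) * (abs b))) (cong (λ t → 3 * (t * t) + 2 * ((abs b) * (abs b))) (sym ∣a∣≡))) (trans e (*-assoc 2 2 y)))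
        where r : ∀ A B → 2 * (3 * (A * A) * 2 + B) ≡ 3 * ((A * 2) * (A * 2)) + 2 * B
              r = solve-∀
      2∣b : 2 ∣ (abs b)
      2∣b = even-of-form (abs b) 0 (trans (%-remove-+ʳ (3 * ((abs b) * (abs b))) (m∣m*n 0)) (n∣m⇒m%n≡0 (3 * ((abs b) * (abs b))) 2 (∣n⇒∣m*n 3 2∣b²)))
        where 2∣b² : 2 ∣ (abs b) * (abs b)
              2∣b² = ∣m+n∣m⇒∣n (subst (2 ∣_) (sym B²≡) (m∣m*n y)) (n∣m*n (3 * (A′ * A′)))
      step : 2 ∣ (abs b) → Rep
      step 2∣b with S.∣ᵤ⇒∣ {pos 2} {b} 2∣b
      -- Halving a and b turns the congruence into y | 2m, and y is odd.
      ... | S.divides b′ refl = fin (S.∣ᵤ⇒∣ {pos y} {m} (coprime-divisor coprime-y2 y∣2m))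
        where
        m = pos d ℤ.* a′ ℤ.- pos x ℤ.* b′
        2m≡ : pos 2 ℤ.* m ≡ c ℤ.* pos y
        2m≡ = trans (r₁ (pos d) a′ (pos x) b′) (trans (cong (λ t → pos d ℤ.* (a′ ℤ.* pos 2) ℤ.- t) lin) (r₂ (pos d ℤ.* (a′ ℤ.* pos 2)) (pos y) c))
          where r₁ : ∀ d a x b → pos 2 ℤ.* (d ℤ.* a ℤ.- x ℤ.* b) ≡ d ℤ.* (a ℤ.* pos 2) ℤ.- x ℤ.* (b ℤ.* pos 2)
                r₁ = ℤR.solve-∀
                r₂ : ∀ t y c → t ℤ.- (t ℤ.- y ℤ.* c) ≡ c ℤ.* y
                r₂ = ℤR.solve-∀
        y∣2m : y ∣ 2 * (abs m)
        y∣2m = divides (abs c) (trans (sym (ℤ.abs-* (pos 2) m)) (trans (cong abs 2m≡) (ℤ.abs-* c (pos y))))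
        fin : S._∣_ (pos y) m → Rep
        fin (S.divides c′ eq) = a′ , b′ , c′ , trans (r (pos x ℤ.* b′) (pos d ℤ.* a′)) (cong (λ t → pos d ℤ.* a′ ℤ.- t) (trans eq (ℤ.*-comm c′ (pos y)))) ,
            *-cancelˡ-≡ _ _ 4 (trans (trans (r₄ (abs a′) (abs b′)) (cong₂ (λ s t → 3 * (s * s) + 2 * (t * t)) (sym ∣a∣≡) (sym (ℤ.abs-* b′ (pos 2))))) e)
          where r : ∀ p q → p ≡ q ℤ.- (q ℤ.- p)
                r = ℤR.solve-∀
                r₄ : ∀ A B → 4 * (3 * (A * A) + 2 * (B * B)) ≡ 3 * ((A * 2) * (A * 2)) + 2 * ((B * 2) * (B * 2))
                r₄ = solve-∀
    multiple⇒rep a b c s s²≤y a≤ b≤ nz lin 5 e with form-sq3 ((abs a) * (abs a)) (abs b)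
    ... | inj₁ (f , _) with () ← trans (sym f) (trans (cong (_% 3) e) (*-mod 5 y 3 refl y%3))
    ... | inj₂ f with () ← trans (sym f) (trans (cong (_% 3) e) (*-mod 5 y 3 refl y%3))
    multiple⇒rep a b c s s²≤y a≤ b≤ nz lin (suc (suc (suc (suc (suc (suc k)))))) e = ⊥-elim (<⇒≱ (m<m+n (5 * y) y>0) (begin
        5 * y + y ≡⟨ +-comm (5 * y) y ⟩
        6 * y ≤⟨ *-monoˡ-≤ y (m≤m+n 6 k) ⟩
        (6 + k) * y ≡⟨ sym e ⟩
        3 * ((abs a) * (abs a)) + 2 * ((abs b) * (abs b)) ≤⟨ +-mono-≤ (*-monoʳ-≤ 3 (≤-trans (*-mono-≤ a≤ a≤) s²≤y)) (*-monoʳ-≤ 2 (≤-trans (*-mono-≤ b≤ b≤) s²≤y)) ⟩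
        3 * y + 2 * y ≡⟨ sym (*-distribʳ-+ y 3 2) ⟩
        5 * y ∎))
      where open ≤-Reasoning

    -- Thue's lemma, applied to x b ≡ d a (mod y)
    rep : Rep
    rep with isqrt y
    -- More than y pairs (i₁, i₂) are sent to x i₂ + d(s - i₁) modulo y; s - i₁ takes the place of
    -- -i₁ so that the values are natural numbers.
    ... | s , s²≤y , y<s² with pigeonhole y<s² (λ i → fromℕ< (m%n<n (x * toℕ (proj₂ (remQuot {suc s} (suc s) i)) + d * (s ∸ toℕ (proj₁ (remQuot {suc s} (suc s) i)))) y))
    ... | i , j , i<j , eq with mod-diff _ _ y (fromℕ<-injective _ _ _ _ eq)
    ... | c , ce = multiple⇒rep a b (ℤ.- c) s s²≤y (∣pos-pos∣≤ (bnd i₁) (bnd j₁)) (∣pos-pos∣≤ (bnd i₂) (bnd j₂)) nonzero lin (quotient y∣T) (_∣_.equality y∣T)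
      where
      i₁ = proj₁ (remQuot {suc s} (suc s) i)
      i₂ = proj₂ (remQuot {suc s} (suc s) i)
      j₁ = proj₁ (remQuot {suc s} (suc s) j)
      j₂ = proj₂ (remQuot {suc s} (suc s) j)
      a = pos (toℕ i₁) ℤ.- pos (toℕ j₁)
      b = pos (toℕ i₂) ℤ.- pos (toℕ j₂)
      bnd : ∀ (k : Fin (suc s)) → toℕ k ≤ s
      bnd k = ≤-pred (Fin.toℕ<n k)
      coerce : ∀ (k l : Fin (suc s)) → pos (x * toℕ l + d * (s ∸ toℕ k)) ≡ pos x ℤ.* pos (toℕ l) ℤ.+ pos d ℤ.* (pos s ℤ.- pos (toℕ k))
      coerce k l = trans (ℤ.pos-+ (x * toℕ l) (d * (s ∸ toℕ k))) (cong₂ ℤ._+_ (ℤ.pos-* x (toℕ l)) (trans (ℤ.pos-* d (s ∸ toℕ k)) (cong (pos d ℤ.*_) (trans (sym (ℤ.⊖-≥ (bnd k))) (sym (ℤ.m-n≡m⊖n s (toℕ k)))))))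
      lin : pos x ℤ.* b ≡ pos d ℤ.* a ℤ.- pos y ℤ.* (ℤ.- c)
      lin = trans (r (pos x) (pos d) (pos s) (pos (toℕ i₁)) (pos (toℕ i₂)) (pos (toℕ j₁)) (pos (toℕ j₂)))
         (trans (cong (λ t → pos d ℤ.* a ℤ.+ t) (trans (sym (cong₂ ℤ._-_ (coerce i₁ i₂) (coerce j₁ j₂))) ce)) (r₂ (pos d ℤ.* a) c (pos y)))
        where r : ∀ x d s i₁ i₂ j₁ j₂ → x ℤ.* (i₂ ℤ.- j₂) ≡ d ℤ.* (i₁ ℤ.- j₁) ℤ.+ ((x ℤ.* i₂ ℤ.+ d ℤ.* (s ℤ.- i₁)) ℤ.- (x ℤ.* j₂ ℤ.+ d ℤ.* (s ℤ.- j₁)))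
              r = ℤR.solve-∀
              r₂ : ∀ t c y → t ℤ.+ c ℤ.* y ≡ t ℤ.- y ℤ.* (ℤ.- c)
              r₂ = ℤR.solve-∀
      nonzero : ¬ ((abs a) ≡ 0 × (abs b) ≡ 0)
      nonzero (p , q) = Fin.<⇒≢ i<j (trans (sym (combine-remQuot {suc s} (suc s) i)) (trans (cong₂ combine (same i₁ j₁ p) (same i₂ j₂ q)) (combine-remQuot {suc s} (suc s) j)))
        where same : ∀ (k l : Fin (suc s)) → (abs (pos (toℕ k) ℤ.- pos (toℕ l))) ≡ 0 → k ≡ l
              same k l e = toℕ-injective (ℤ.+-injective (ℤ.i-j≡0⇒i≡j _ _ (ℤ.∣i∣≡0⇒i≡0 e)))
      T = 3 * ((abs a) * (abs a)) + 2 * ((abs b) * (abs b))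
      Tℤ : pos T ≡ pos 3 ℤ.* (a ℤ.* a) ℤ.+ pos 2 ℤ.* (b ℤ.* b)
      Tℤ = trans (pos-form (abs a * abs a) (abs b * abs b)) (cong₂ ℤ._+_ (cong (pos 3 ℤ.*_) (sym (∣sq∣ a))) (cong (pos 2 ℤ.*_) (sym (∣sq∣ b))))
      Eℤ : pos 3 ℤ.* (pos x ℤ.* pos x) ℤ.+ pos 2 ℤ.* (pos d ℤ.* pos d) ≡ pos (quotient y∣yⁿ) ℤ.* pos y
      Eℤ = trans (sym (trans (pos-form (x * x) (d * d)) (cong₂ ℤ._+_ (cong (pos 3 ℤ.*_) (ℤ.pos-* x x)) (cong (pos 2 ℤ.*_) (ℤ.pos-* d d)))))
           (trans (cong pos (trans E (_∣_.equality y∣yⁿ))) (ℤ.pos-* (quotient y∣yⁿ) y))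
      c″ = ℤ.- (ℤ.- c)
      W = (a ℤ.* a ℤ.* pos (quotient y∣yⁿ) ℤ.- pos 4 ℤ.* (pos d ℤ.* a ℤ.* (ℤ.- c)) ℤ.+ pos 2 ℤ.* (pos y ℤ.* (c″ ℤ.* c″)))
      -- Substituting xb = da - yc turns x²(3a² + 2b²) into a²(3x² + 2d²) plus multiples of y, and x
      -- is prime to y.
      x²T : pos x ℤ.* (pos x ℤ.* pos T) ≡ W ℤ.* pos y
      x²T = trans (cong (λ t → pos x ℤ.* (pos x ℤ.* t)) Tℤ) (trans (r (pos x) a b) (trans (cong (λ t → pos 3 ℤ.* (a ℤ.* a ℤ.* (pos x ℤ.* pos x)) ℤ.+ pos 2 ℤ.* (t ℤ.* t)) lin)
          (trans (r₂ (pos x) a (pos d) (pos y) (ℤ.- c)) (trans (cong (λ t → a ℤ.* a ℤ.* t ℤ.- pos 4 ℤ.* (pos d ℤ.* a ℤ.* (ℤ.- c)) ℤ.* pos y ℤ.+ pos 2 ℤ.* (pos y ℤ.* (c″ ℤ.* c″)) ℤ.* pos y) Eℤ) (r₃ (a ℤ.* a) (pos (quotient y∣yⁿ)) (pos y) (pos 4 ℤ.* (pos d ℤ.* a ℤ.* (ℤ.- c))) (pos 2 ℤ.* (pos y ℤ.* (c″ ℤ.* c″))))))))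
        where r : ∀ x a b → x ℤ.* (x ℤ.* (pos 3 ℤ.* (a ℤ.* a) ℤ.+ pos 2 ℤ.* (b ℤ.* b))) ≡ pos 3 ℤ.* (a ℤ.* a ℤ.* (x ℤ.* x)) ℤ.+ pos 2 ℤ.* ((x ℤ.* b) ℤ.* (x ℤ.* b))
              r = ℤR.solve-∀
              r₂ : ∀ x a d y c → pos 3 ℤ.* (a ℤ.* a ℤ.* (x ℤ.* x)) ℤ.+ pos 2 ℤ.* ((d ℤ.* a ℤ.- y ℤ.* c) ℤ.* (d ℤ.* a ℤ.- y ℤ.* c)) ≡ a ℤ.* a ℤ.* (pos 3 ℤ.* (x ℤ.* x) ℤ.+ pos 2 ℤ.* (d ℤ.* d)) ℤ.- pos 4 ℤ.* (d ℤ.* a ℤ.* c) ℤ.* y ℤ.+ pos 2 ℤ.* (y ℤ.* ((ℤ.- c) ℤ.* (ℤ.- c))) ℤ.* y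
              r₂ = ℤR.solve-∀
              r₃ : ∀ A q y u v → A ℤ.* (q ℤ.* y) ℤ.- u ℤ.* y ℤ.+ v ℤ.* y ≡ (A ℤ.* q ℤ.- u ℤ.+ v) ℤ.* y
              r₃ = ℤR.solve-∀
      y∣T : y ∣ T
      y∣T = coprime-divisor coprime-yx (coprime-divisor coprime-yx (divides (abs W) (trans (sym (trans (ℤ.abs-* (pos x) (pos x ℤ.* pos T)) (cong (x *_) (ℤ.abs-* (pos x) (pos T))))) (trans (cong abs x²T) (ℤ.abs-* W (pos y))))))

-- Rational arithmetic: embedded integers, order, powers, floor

module Rationals where
  open import Data.Rational
  open import Data.Rational.Properties
  import Data.Rational.Unnormalised as U
  import Data.Rational.Unnormalised.Properties as U
  import Data.Integer as ℤ
  import Data.Integer.Properties as ℤ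
  import Data.Integer.DivMod as ℤ
  open import Data.Integer using (ℤ; +_; -[1+_])
  import Data.Nat as ℕ
  import Data.Nat.Properties as ℕ
  open import Data.Nat.Coprimality as Cop using (1-coprimeTo)
  open import Data.Maybe.Base using (just; nothing; Maybe)
  open import Level using (0ℓ)
  import Tactic.RingSolver.Core.AlmostCommutativeRing as ACR

  zero?Q : (p : ℚ) → Maybe (0ℚ ≡ p)
  zero?Q p with 0ℚ ≟ p
  ... | yes e = just e
  ... | no _ = nothing

  ringQ : ACR.AlmostCommutativeRing 0ℓ 0ℓ
  ringQ = ACR.fromCommutativeRing +-*-commutativeRing zero?Q

  ≤-≡ : ∀ {p q} → p ≡ q → p ≤ q
  ≤-≡ refl = ≤-refl

  infixr 4 _≤≡_ _≡≤_
  _≤≡_ : ∀ {p q r} → p ≤ q → q ≡ r → p ≤ r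
  h ≤≡ refl = h
  _≡≤_ : ∀ {p q r} → p ≡ q → q ≤ r → p ≤ r
  refl ≡≤ h = h

  -- A transparent literal: closed comparisons and the ring solver compute with it, whereas `ι`,
  -- built on the abstract `ζ`, stays folded. `ι-lit` passes from one to the other.
  lit : ℕ → ℚ
  lit n = mkℚ (+ n) 0 (Cop.sym (1-coprimeTo _))

  abstract
    ζ : ℤ → ℚ
    ζ z = mkℚ z 0 (Cop.sym (1-coprimeTo _))

    ζ-+ : ∀ a b → ζ (a ℤ.+ b) ≡ ζ a + ζ b
    ζ-+ a b = toℚᵘ-injective (U.≃-trans
      (U.*≡* (cong₂ ℤ._*_ (cong₂ ℤ._+_ (sym (ℤ.*-identityʳ a)) (sym (ℤ.*-identityʳ b))) refl))
      (U.≃-sym (toℚᵘ-homo-+ (ζ a) (ζ b))))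

    ζ-* : ∀ a b → ζ (a ℤ.* b) ≡ ζ a * ζ b
    ζ-* a b = toℚᵘ-injective (U.≃-trans (U.*≡* refl) (U.≃-sym (toℚᵘ-homo-* (ζ a) (ζ b))))

    ζ-neg : ∀ a → ζ (ℤ.- a) ≡ - ζ a
    ζ-neg a = toℚᵘ-injective (U.≃-trans (U.*≡* refl) (U.≃-sym (toℚᵘ-homo‿- (ζ a))))

    ζ-mono : ∀ {a b} → a ℤ.≤ b → ζ a ≤ ζ b
    ζ-mono {a} {b} h = *≤* (subst₂ ℤ._≤_ (sym (ℤ.*-identityʳ a)) (sym (ℤ.*-identityʳ b)) h)

    ζ-mono-< : ∀ {a b} → a ℤ.< b → ζ a < ζ b
    ζ-mono-< {a} {b} h = *<* (subst₂ ℤ._<_ (sym (ℤ.*-identityʳ a)) (sym (ℤ.*-identityʳ b)) h)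

    ζ-cancel-< : ∀ {a b} → ζ a < ζ b → a ℤ.< b
    ζ-cancel-< {a} {b} (*<* h) = subst₂ ℤ._<_ (ℤ.*-identityʳ a) (ℤ.*-identityʳ b) h

    ζ-cancel-≤ : ∀ {a b} → ζ a ≤ ζ b → a ℤ.≤ b
    ζ-cancel-≤ {a} {b} (*≤* h) = subst₂ ℤ._≤_ (ℤ.*-identityʳ a) (ℤ.*-identityʳ b) h

    ζ-lit : ∀ n → ζ (+ n) ≡ lit n
    ζ-lit n = refl

    ζ-inj : ∀ {a b} → ζ a ≡ ζ b → a ≡ b
    ζ-inj refl = refl

  ι : ℕ → ℚ
  ι n = ζ (+ n)

  ι-lit : ∀ n → ι n ≡ lit n
  ι-lit n = ζ-lit n

  ι-+ : ∀ a b → ι (a ℕ.+ b) ≡ ι a + ι b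
  ι-+ a b = ζ-+ (+ a) (+ b)

  ι-* : ∀ a b → ι (a ℕ.* b) ≡ ι a * ι b
  ι-* a b = trans (cong ζ (ℤ.pos-* a b)) (ζ-* (+ a) (+ b))

  ι-suc : ∀ a → ι (suc a) ≡ 1ℚ + ι a
  ι-suc a = trans (ι-+ 1 a) (cong (_+ ι a) (ι-lit 1))

  ι-mono : ∀ {a b} → a ℕ.≤ b → ι a ≤ ι b
  ι-mono h = ζ-mono (ℤ.+≤+ h)

  ι-mono-< : ∀ {a b} → a ℕ.< b → ι a < ι b
  ι-mono-< h = ζ-mono-< (ℤ.+<+ h)

  ι-cancel-≤ : ∀ {a b} → ι a ≤ ι b → a ℕ.≤ b
  ι-cancel-≤ h = ℤ.drop‿+≤+ (ζ-cancel-≤ h)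

  0≤ι : ∀ n → 0ℚ ≤ ι n
  0≤ι n = sym (ι-lit 0) ≡≤ ι-mono ℕ.z≤n

  0≤1 : 0ℚ ≤ 1ℚ
  0≤1 = 0≤ι 1 ≤≡ ι-lit 1

  0<ι : ∀ n → 0ℚ < ι (suc n)
  0<ι n = subst (_< ι (suc n)) (ι-lit 0) (ι-mono-< (ℕ.s≤s ℕ.z≤n))

  0≤lit : ∀ n → 0ℚ ≤ lit n
  0≤lit n = 0≤ι n ≤≡ ι-lit n

  abstract
    -- The inverse of n + 1, so that no proof of nonvanishing has to be carried along.
    1/ι : ℕ → ℚ
    1/ι n = mkℚ (+ 1) n (1-coprimeTo (suc n))

    1/ι-inverse : ∀ n → ι (suc n) * 1/ι n ≡ 1ℚ
    1/ι-inverse n = trans (cong (_* 1/ι n) (ι-lit (suc n))) (toℚᵘ-injective (U.≃-trans (toℚᵘ-homo-* (lit (suc n)) (1/ι n))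
      (U.*≡* (cong (λ t → + t) (trans (ℕ.*-identityʳ _) (trans (ℕ.*-identityʳ _) (sym (trans (ℕ.+-identityʳ _) (ℕ.+-identityʳ _)))))))))

    0≤1/ι : ∀ n → 0ℚ ≤ 1/ι n
    0≤1/ι n = *≤* (ℤ.+≤+ ℕ.z≤n)

    0<1/ι : ∀ n → 0ℚ < 1/ι n
    0<1/ι n = *<* (ℤ.+<+ (ℕ.s≤s ℕ.z≤n))

  diff⇒≤ : ∀ {p q} → 0ℚ ≤ q - p → p ≤ q
  diff⇒≤ {p} {q} h = subst₂ _≤_ (e₁ p) (e₂ p q) (+-monoˡ-≤ p h)
    where e₁ : ∀ p → 0ℚ + p ≡ p
          e₁ = Ring.solve-∀ ringQ
          e₂ : ∀ p q → q - p + p ≡ q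
          e₂ = Ring.solve-∀ ringQ

  ≤⇒diff : ∀ {p q} → p ≤ q → 0ℚ ≤ q - p
  ≤⇒diff {p} {q} h = subst (_≤ q - p) (+-inverseʳ p) (+-monoˡ-≤ (- p) h)

  diff⇒< : ∀ {p q} → 0ℚ < q - p → p < q
  diff⇒< {p} {q} h = subst₂ _<_ (e₁ p) (e₂ p q) (+-monoˡ-< p h)
    where e₁ : ∀ p → 0ℚ + p ≡ p
          e₁ = Ring.solve-∀ ringQ
          e₂ : ∀ p q → q - p + p ≡ q
          e₂ = Ring.solve-∀ ringQ

  <⇒diff : ∀ {p q} → p < q → 0ℚ < q - p
  <⇒diff {p} {q} h = subst (_< q - p) (+-inverseʳ p) (+-monoˡ-< (- p) h)

  infixr 4 _<≡_
  _<≡_ : ∀ {p q r} → p < q → q ≡ r → p < r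
  h <≡ refl = h

  0≤+ : ∀ {p q} → 0ℚ ≤ p → 0ℚ ≤ q → 0ℚ ≤ p + q
  0≤+ = +-mono-≤

  *-monoʳ : ∀ {r p q} → 0ℚ ≤ r → p ≤ q → r * p ≤ r * q
  *-monoʳ {r} 0≤r = *-monoˡ-≤-nonNeg r {{nonNegative 0≤r}}

  *-monoˡ : ∀ {r p q} → 0ℚ ≤ r → p ≤ q → p * r ≤ q * r
  *-monoˡ {r} 0≤r = *-monoʳ-≤-nonNeg r {{nonNegative 0≤r}}

  0≤* : ∀ {p q} → 0ℚ ≤ p → 0ℚ ≤ q → 0ℚ ≤ p * q
  0≤* {p} {q} 0≤p 0≤q = sym (*-zeroʳ p) ≡≤ *-monoʳ 0≤p 0≤q

  0<* : ∀ {p q} → 0ℚ < p → 0ℚ < q → 0ℚ < p * q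
  0<* {p} {q} 0<p 0<q = subst (_< p * q) (*-zeroʳ p) (*-monoʳ-<-pos p {{positive 0<p}} 0<q)

  *-mono : ∀ {p q r s} → 0ℚ ≤ p → p ≤ q → 0ℚ ≤ r → r ≤ s → p * r ≤ q * s
  *-mono 0≤p p≤q 0≤r r≤s = ≤-trans (*-monoˡ 0≤r p≤q) (*-monoʳ (≤-trans 0≤p p≤q) r≤s)

  0≤sq : ∀ p → 0ℚ ≤ p * p
  0≤sq p with ≤-total 0ℚ p
  ... | inj₁ h = 0≤* h h
  ... | inj₂ h = 0≤* (≤⇒diff h) (≤⇒diff h) ≤≡ e p
    where e : ∀ p → (0ℚ - p) * (0ℚ - p) ≡ p * p
          e = Ring.solve-∀ ringQ

  cancelʳ : ∀ {r p q} → 0ℚ < r → p * r ≤ q * r → p ≤ q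
  cancelʳ {r} 0<r = *-cancelʳ-≤-pos r {{positive 0<r}}

  <⇒≱ : ∀ {p q} → p < q → ¬ q ≤ p
  <⇒≱ l h = <-irrefl refl (<-≤-trans l h)

  sq-cancel : ∀ {s t} → 0ℚ ≤ t → s * s ≤ t * t → s ≤ t
  sq-cancel {s} {t} 0≤t h with s ≤? t
  ... | yes p = p
  ... | no ¬p = ⊥-elim (<-irrefl refl (<-≤-trans lt h))
    where t<s = ≰⇒> ¬p
          0<s = ≤-<-trans 0≤t t<s
          lt : t * t < s * s
          lt = ≤-<-trans (*-monoˡ 0≤t (<⇒≤ t<s)) (*-monoʳ-<-pos s {{positive 0<s}} t<s)

  infixr 8 _^_
  _^_ : ℚ → ℕ → ℚ
  p ^ zero = 1ℚ
  p ^ suc n = p * p ^ n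

  0≤^ : ∀ {p} n → 0ℚ ≤ p → 0ℚ ≤ p ^ n
  0≤^ zero h = 0≤1
  0≤^ (suc n) h = 0≤* h (0≤^ n h)

  ^-mono : ∀ {p q} n → 0ℚ ≤ p → p ≤ q → p ^ n ≤ q ^ n
  ^-mono zero h l = ≤-refl
  ^-mono (suc n) h l = *-mono h l (0≤^ n h) (^-mono n h l)

  1≤^ : ∀ {p} n → 1ℚ ≤ p → 1ℚ ≤ p ^ n
  1≤^ zero h = ≤-refl
  1≤^ (suc n) h = *-mono 0≤1 h 0≤1 (1≤^ n h)

  ^-+ : ∀ p m n → p ^ (m ℕ.+ n) ≡ p ^ m * p ^ n
  ^-+ p zero n = sym (*-identityˡ _)
  ^-+ p (suc m) n = trans (cong (p *_) (^-+ p m n)) (sym (*-assoc p _ _))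

  ^-*-base : ∀ p q n → (p * q) ^ n ≡ p ^ n * q ^ n
  ^-*-base p q zero = refl
  ^-*-base p q (suc n) = trans (cong ((p * q) *_) (^-*-base p q n)) (e p q _ _)
    where e : ∀ p q r s → (p * q) * (r * s) ≡ (p * r) * (q * s)
          e = Ring.solve-∀ ringQ

  1^ : ∀ n → 1ℚ ^ n ≡ 1ℚ
  1^ zero = refl
  1^ (suc n) = trans (*-identityˡ _) (1^ n)

  ^-* : ∀ p m n → p ^ (m ℕ.* n) ≡ (p ^ m) ^ n
  ^-* p zero n = sym (1^ n)
  ^-* p (suc m) n = trans (^-+ p n (m ℕ.* n)) (trans (cong (p ^ n *_) (^-* p m n)) (sym (^-*-base p (p ^ m) n)))

  ^-mono-exp : ∀ {p m n} → 1ℚ ≤ p → m ℕ.≤ n → p ^ m ≤ p ^ n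
  ^-mono-exp {p} {m} {n} 1≤p m≤n = sym (*-identityʳ _) ≡≤ *-monoʳ (0≤^ m (≤-trans 0≤1 1≤p)) (1≤^ (n ℕ.∸ m) 1≤p)
     ≤≡ trans (sym (^-+ p m (n ℕ.∸ m))) (cong (p ^_) (ℕ.m+[n∸m]≡n m≤n))

  ι-^ : ∀ a n → ι (a ℕ.^ n) ≡ ι a ^ n
  ι-^ a zero = ι-lit 1
  ι-^ a (suc n) = trans (ι-* a (a ℕ.^ n)) (cong (ι a *_) (ι-^ a n))

  inv-^ : ∀ {p q} n → p * q ≡ 1ℚ → p ^ n * q ^ n ≡ 1ℚ
  inv-^ {p} {q} n e = trans (sym (^-*-base p q n)) (trans (cong (_^ n) e) (1^ n))

  abstract
    floor-exists : ∀ p → ∃ λ z → (ζ z ≤ p) × (p < ζ (z ℤ.+ + 1))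
    floor-exists p@(mkℚ a d-1 c) = z , *≤* l , *<* u
      where
      d : ℕ
      d = suc d-1
      z : ℤ
      z = a ℤ./ℕ d
      r : ℕ
      r = a ℤ.%ℕ d
      eq : a ≡ + r ℤ.+ z ℤ.* + d
      eq = ℤ.a≡a%ℕn+[a/ℕn]*n a d
      l : z ℤ.* + d ℤ.≤ a ℤ.* + 1
      l = subst (z ℤ.* + d ℤ.≤_) (trans (sym eq) (sym (ℤ.*-identityʳ a))) (ℤ.i≤j+i _ (+ r))
      u : a ℤ.* + 1 ℤ.< (z ℤ.+ + 1) ℤ.* + d
      u = subst₂ ℤ._<_ (trans (sym eq) (sym (ℤ.*-identityʳ a))) (trans (ℤ.+-comm (+ d) (z ℤ.* + d)) (trans (cong (λ t → z ℤ.* + d ℤ.+ t) (sym (ℤ.*-identityˡ (+ d)))) (sym (ℤ.*-distribʳ-+ (+ d) z (+ 1)))))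
          (ℤ.+-monoˡ-< (z ℤ.* + d) (ℤ.+<+ (ℤ.n%ℕd<d a d)))

-- The field Q(√-6), its norm and absolute values

module QuadraticField where
  open Rationals
  open import Data.Rational
  open import Data.Rational.Properties
  import Data.Integer as ℤ
  import Data.Integer.Properties as ℤ
  open import Data.Integer using (ℤ; +_; -[1+_])
  import Data.Nat as ℕ
  import Data.Nat.Properties as ℕ
  open import Data.Maybe.Base using (just; nothing; Maybe)
  open import Level using (0ℓ)
  open import Algebra.Bundles using (CommutativeRing)
  import Tactic.RingSolver.Core.AlmostCommutativeRing as ACR

  infix 5 _⸴_
  -- `a ⸴ b` is the number a + b√-6.
  data K : Set where
    _⸴_ : ℚ → ℚ → K

  re im : K → ℚ
  re (a ⸴ b) = a
  im (a ⸴ b) = b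

  infixl 6 _⊕_ _⊝_
  infixl 7 _⊗_
  infix 8 ⊖_
  _⊕_ _⊗_ _⊝_ : K → K → K
  (a ⸴ b) ⊕ (c ⸴ d) = (a + c) ⸴ (b + d)
  (a ⸴ b) ⊗ (c ⸴ d) = (a * c - lit 6 * (b * d)) ⸴ (a * d + b * c)
  ⊖_ : K → K
  ⊖ (a ⸴ b) = (- a) ⸴ (- b)
  z ⊝ w = z ⊕ ⊖ w

  0K 1K : K
  0K = 0ℚ ⸴ 0ℚ
  1K = 1ℚ ⸴ 0ℚ

  ⊕-assoc : ∀ x y z → (x ⊕ y) ⊕ z ≡ x ⊕ (y ⊕ z)
  ⊕-assoc (a ⸴ b) (c ⸴ d) (e ⸴ f) = cong₂ _⸴_ (+-assoc a c e) (+-assoc b d f)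
  ⊕-comm : ∀ x y → x ⊕ y ≡ y ⊕ x
  ⊕-comm (a ⸴ b) (c ⸴ d) = cong₂ _⸴_ (+-comm a c) (+-comm b d)
  ⊕-idˡ : ∀ x → 0K ⊕ x ≡ x
  ⊕-idˡ (a ⸴ b) = cong₂ _⸴_ (+-identityˡ a) (+-identityˡ b)
  ⊕-invˡ : ∀ x → ⊖ x ⊕ x ≡ 0K
  ⊕-invˡ (a ⸴ b) = cong₂ _⸴_ (+-inverseˡ a) (+-inverseˡ b)
  ⊗-assoc : ∀ x y z → (x ⊗ y) ⊗ z ≡ x ⊗ (y ⊗ z)
  ⊗-assoc (a ⸴ b) (c ⸴ d) (e ⸴ f) = cong₂ _⸴_ (p a b c d e f) (q a b c d e f)
    where p : ∀ a b c d e f → (a * c - lit 6 * (b * d)) * e - lit 6 * ((a * d + b * c) * f) ≡ a * (c * e - lit 6 * (d * f)) - lit 6 * (b * (c * f + d * e))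
          p = Ring.solve-∀ ringQ
          q : ∀ a b c d e f → (a * c - lit 6 * (b * d)) * f + (a * d + b * c) * e ≡ a * (c * f + d * e) + b * (c * e - lit 6 * (d * f))
          q = Ring.solve-∀ ringQ
  ⊗-comm : ∀ x y → x ⊗ y ≡ y ⊗ x
  ⊗-comm (a ⸴ b) (c ⸴ d) = cong₂ _⸴_ (p a b c d) (q a b c d)
    where p : ∀ a b c d → a * c - lit 6 * (b * d) ≡ c * a - lit 6 * (d * b)
          p = Ring.solve-∀ ringQ
          q : ∀ a b c d → a * d + b * c ≡ c * b + d * a
          q = Ring.solve-∀ ringQ
  ⊗-idˡ : ∀ x → 1K ⊗ x ≡ x
  ⊗-idˡ (a ⸴ b) = cong₂ _⸴_ (p a b) (q a b)
    where p : ∀ a b → 1ℚ * a - lit 6 * (0ℚ * b) ≡ a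
          p = Ring.solve-∀ ringQ
          q : ∀ a b → 1ℚ * b + 0ℚ * a ≡ b
          q = Ring.solve-∀ ringQ
  ⊗-distˡ : ∀ x y z → x ⊗ (y ⊕ z) ≡ x ⊗ y ⊕ x ⊗ z
  ⊗-distˡ (a ⸴ b) (c ⸴ d) (e ⸴ f) = cong₂ _⸴_ (p a b c d e f) (q a b c d e f)
    where p : ∀ a b c d e f → a * (c + e) - lit 6 * (b * (d + f)) ≡ (a * c - lit 6 * (b * d)) + (a * e - lit 6 * (b * f))
          p = Ring.solve-∀ ringQ
          q : ∀ a b c d e f → a * (d + f) + b * (c + e) ≡ (a * d + b * c) + (a * f + b * e)
          q = Ring.solve-∀ ringQ
  ⊗-distʳ : ∀ x y z → (y ⊕ z) ⊗ x ≡ y ⊗ x ⊕ z ⊗ x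
  ⊗-distʳ x y z = trans (⊗-comm (y ⊕ z) x) (trans (⊗-distˡ x y z) (cong₂ _⊕_ (⊗-comm x y) (⊗-comm x z)))

  ringK-bundle : CommutativeRing 0ℓ 0ℓ
  ringK-bundle = record { Carrier = K ; _≈_ = _≡_ ; _+_ = _⊕_ ; _*_ = _⊗_ ; -_ = ⊖_ ; 0# = 0K ; 1# = 1K
    ; isCommutativeRing = record { isRing = record
      { +-isAbelianGroup = record { isGroup = record { isMonoid = record { isSemigroup = record
          { isMagma = record { isEquivalence = isEquivalence ; ∙-cong = cong₂ _⊕_ } ; assoc = ⊕-assoc }
          ; identity = ⊕-idˡ , λ x → trans (⊕-comm x 0K) (⊕-idˡ x) }
          ; inverse = ⊕-invˡ , λ x → trans (⊕-comm x (⊖ x)) (⊕-invˡ x) ; ⁻¹-cong = cong ⊖_ } ; comm = ⊕-comm }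
      ; *-cong = cong₂ _⊗_ ; *-assoc = ⊗-assoc ; *-identity = ⊗-idˡ , (λ x → trans (⊗-comm x 1K) (⊗-idˡ x))
      ; distrib = ⊗-distˡ , ⊗-distʳ } ; *-comm = ⊗-comm } }

  _≟K_ : (x y : K) → Dec (x ≡ y)
  (a ⸴ b) ≟K (c ⸴ d) with a ≟ c | b ≟ d
  ... | yes refl | yes refl = yes refl
  ... | no n | _ = no λ { refl → n refl }
  ... | _ | no n = no λ { refl → n refl }

  ringK : ACR.AlmostCommutativeRing 0ℓ 0ℓ
  ringK = ACR.fromCommutativeRing ringK-bundle zero?K
    where zero?K : (p : K) → Maybe (0K ≡ p)
          zero?K p with 0K ≟K p
          ... | yes e = just e
          ... | no _ = nothing

  conj : K → K
  conj (a ⸴ b) = a ⸴ - b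

  N : K → ℚ
  N (a ⸴ b) = a * a + lit 6 * (b * b)

  ⌜_⌝ : ℚ → K
  ⌜ q ⌝ = q ⸴ 0ℚ

  κ : ℕ → K
  κ n = ⌜ ι n ⌝

  ⌜⌝-* : ∀ p q → ⌜ p * q ⌝ ≡ ⌜ p ⌝ ⊗ ⌜ q ⌝
  ⌜⌝-* p q = cong₂ _⸴_ (e p q) (f p q)
    where e : ∀ p q → p * q ≡ p * q - lit 6 * (0ℚ * 0ℚ)
          e = Ring.solve-∀ ringQ
          f : ∀ p q → 0ℚ ≡ p * 0ℚ + 0ℚ * q
          f = Ring.solve-∀ ringQ

  scale : ∀ q a b → ⌜ q ⌝ ⊗ (a ⸴ b) ≡ q * a ⸴ q * b
  scale q a b = cong₂ _⸴_ (e q a b) (f q a b)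
    where e : ∀ q a b → q * a - lit 6 * (0ℚ * b) ≡ q * a
          e = Ring.solve-∀ ringQ
          f : ∀ q a b → q * b + 0ℚ * a ≡ q * b
          f = Ring.solve-∀ ringQ

  κ-+ : ∀ a b → κ (a ℕ.+ b) ≡ κ a ⊕ κ b
  κ-+ a b = cong ⌜_⌝ (ι-+ a b)

  κ-* : ∀ a b → κ (a ℕ.* b) ≡ κ a ⊗ κ b
  κ-* a b = trans (cong ⌜_⌝ (ι-* a b)) (⌜⌝-* (ι a) (ι b))

  κ-inj : ∀ {a b} → κ a ≡ κ b → a ≡ b
  κ-inj e = ℤ.+-injective (ζ-inj (cong re e))

  κ-1 : κ 1 ≡ 1K
  κ-1 = cong ⌜_⌝ (ι-lit 1)

  κ-0 : κ 0 ≡ 0K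
  κ-0 = cong ⌜_⌝ (ι-lit 0)

  N-⊗ : ∀ z w → N (z ⊗ w) ≡ N z * N w
  N-⊗ (a ⸴ b) (c ⸴ d) = e a b c d
    where e : ∀ a b c d → (a * c - lit 6 * (b * d)) * (a * c - lit 6 * (b * d)) + lit 6 * ((a * d + b * c) * (a * d + b * c)) ≡ (a * a + lit 6 * (b * b)) * (c * c + lit 6 * (d * d))
          e = Ring.solve-∀ ringQ

  N-conj : ∀ z → N (conj z) ≡ N z
  N-conj (a ⸴ b) = e a b
    where e : ∀ a b → a * a + lit 6 * ((- b) * (- b)) ≡ a * a + lit 6 * (b * b)
          e = Ring.solve-∀ ringQ

  N-⌜⌝ : ∀ q → N ⌜ q ⌝ ≡ q * q
  N-⌜⌝ q = e q
    where e : ∀ q → q * q + lit 6 * (0ℚ * 0ℚ) ≡ q * q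
          e = Ring.solve-∀ ringQ

  N-⊖ : ∀ z → N (⊖ z) ≡ N z
  N-⊖ (a ⸴ b) = e a b
    where e : ∀ a b → (- a) * (- a) + lit 6 * ((- b) * (- b)) ≡ a * a + lit 6 * (b * b)
          e = Ring.solve-∀ ringQ

  ⊗-conj : ∀ z → z ⊗ conj z ≡ ⌜ N z ⌝
  ⊗-conj (a ⸴ b) = cong₂ _⸴_ (e a b) (f a b)
    where e : ∀ a b → a * a - lit 6 * (b * (- b)) ≡ a * a + lit 6 * (b * b)
          e = Ring.solve-∀ ringQ
          f : ∀ a b → a * (- b) + b * a ≡ 0ℚ
          f = Ring.solve-∀ ringQ

  conj-⊗ : ∀ z w → conj (z ⊗ w) ≡ conj z ⊗ conj w
  conj-⊗ (a ⸴ b) (c ⸴ d) = cong₂ _⸴_ (e a b c d) (f a b c d)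
    where e : ∀ a b c d → a * c - lit 6 * (b * d) ≡ a * c - lit 6 * ((- b) * (- d))
          e = Ring.solve-∀ ringQ
          f : ∀ a b c d → - (a * d + b * c) ≡ a * (- d) + (- b) * c
          f = Ring.solve-∀ ringQ

  conj-⊝ : ∀ z w → conj (z ⊝ w) ≡ conj z ⊝ conj w
  conj-⊝ (a ⸴ b) (c ⸴ d) = cong (a - c ⸴_) (neg-distrib-+ b (- d))

  0≤N : ∀ z → 0ℚ ≤ N z
  0≤N (a ⸴ b) = 0≤+ (0≤sq a) (0≤* (0≤lit 6) (0≤sq b))

  re²≤N : ∀ z → re z * re z ≤ N z
  re²≤N (a ⸴ b) = sym (+-identityʳ _) ≡≤ +-monoʳ-≤ (a * a) (0≤* (0≤lit 6) (0≤sq b))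

  im²≤N : ∀ z → lit 6 * (im z * im z) ≤ N z
  im²≤N (a ⸴ b) = sym (+-identityˡ _) ≡≤ +-monoˡ-≤ (lit 6 * (b * b)) (0≤sq a)

  sq≡0 : ∀ {a} → a * a ≤ 0ℚ → a ≡ 0ℚ
  sq≡0 {a} h = ≤-antisym (sq-cancel ≤-refl (≤-trans h (≤-≡ (sym (*-zeroˡ 0ℚ)))))
    (neg⁻ (sq-cancel { - a} ≤-refl (≤-trans (≤-≡ (e a)) (≤-trans h (≤-≡ (sym (*-zeroˡ 0ℚ)))))))
    where e : ∀ a → (- a) * (- a) ≡ a * a
          e = Ring.solve-∀ ringQ
          neg⁻ : - a ≤ 0ℚ → 0ℚ ≤ a
          neg⁻ h = diff⇒≤ (≤⇒diff h ≤≡ f a)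
            where f : ∀ a → 0ℚ - (- a) ≡ a - 0ℚ
                  f = Ring.solve-∀ ringQ

  N≡0 : ∀ z → N z ≡ 0ℚ → z ≡ 0K
  N≡0 (a ⸴ b) h = cong₂ _⸴_ (sq≡0 (≤-trans (re²≤N (a ⸴ b)) (≤-≡ h)))
    (sq≡0 (≤-trans (≤-trans (sym (*-identityˡ _) ≡≤ *-monoˡ {b * b} {1ℚ} {lit 6} (0≤sq b) (*≤* (ℤ.+≤+ (ℕ.s≤s ℕ.z≤n)))) (im²≤N (a ⸴ b))) (≤-≡ h)))

  ⊗-zeroˡ : ∀ z → 0K ⊗ z ≡ 0K
  ⊗-zeroˡ = Ring.solve-∀ ringK
  ⊗-zeroʳ : ∀ z → z ⊗ 0K ≡ 0K
  ⊗-zeroʳ = Ring.solve-∀ ringK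

  noZeroDiv : ∀ z w → z ⊗ w ≡ 0K → ¬ z ≡ 0K → w ≡ 0K
  noZeroDiv z w e z≢0 = N≡0 w (*-cancelˡ-0 (trans (sym (N-⊗ z w)) (trans (cong N e) refl)))
    where *-cancelˡ-0 : N z * N w ≡ 0ℚ → N w ≡ 0ℚ
          *-cancelˡ-0 h with N z ≟ 0ℚ
          ... | yes p = ⊥-elim (z≢0 (N≡0 z p))
          ... | no p = *-cancelˡ-/0 (N z) (N w) p h
            where *-cancelˡ-/0 : ∀ r s → ¬ r ≡ 0ℚ → r * s ≡ 0ℚ → s ≡ 0ℚ
                  *-cancelˡ-/0 r s r≢0 e = trans (sym (*-identityˡ s)) (trans (cong (_* s) (sym (*-inverseˡ r {{≢-nonZero r≢0}})))
                    (trans (*-assoc (1/_ r {{≢-nonZero r≢0}}) r s) (trans (cong ((1/_ r {{≢-nonZero r≢0}}) *_) e) (*-zeroʳ (1/_ r {{≢-nonZero r≢0}})))))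

  infix 4 _≼_
  -- This is |z| ≤ q, stated through squares so that no square root of a norm is needed.
  record _≼_ (z : K) (q : ℚ) : Set where
    constructor bound
    field
      nonneg : 0ℚ ≤ q
      norm : N z ≤ q * q
  open _≼_ public

  ≼-mono : ∀ {z p q} → z ≼ p → p ≤ q → z ≼ q
  ≼-mono (bound h n) l = bound (≤-trans h l) (≤-trans n (*-mono h l h l))

  ≼-≡ : ∀ {z w p} → z ≼ p → z ≡ w → w ≼ p
  ≼-≡ h refl = h

  -- The triangle inequality. Its cross term is bounded by Cauchy-Schwarz, which is Lagrange's
  -- identity N z · N w - t² = 6(ad - bc)².
  ≼-⊕ : ∀ {z w p q} → z ≼ p → w ≼ q → z ⊕ w ≼ p + q
  ≼-⊕ {z@(a ⸴ b)} {w@(c ⸴ d)} {p} {q} (bound 0≤p hz) (bound 0≤q hw) = bound (0≤+ 0≤p 0≤q) (diff⇒≤ (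
      0≤+ (0≤+ (≤⇒diff hz) (≤⇒diff hw)) (0≤* (0≤lit 2) (≤⇒diff cs)) ≤≡ e a b c d p q))
    where
    t = a * c + lit 6 * (b * d)
    cs : t ≤ p * q
    cs = sq-cancel (0≤* 0≤p 0≤q) (≤-trans (diff⇒≤ (0≤* (0≤lit 6) (0≤sq (a * d - b * c)) ≤≡ f a b c d))
          (≤-trans (*-mono (0≤N z) hz (0≤N w) hw) (≤-≡ (g p q))))
      where f : ∀ a b c d → lit 6 * ((a * d - b * c) * (a * d - b * c)) ≡ (a * a + lit 6 * (b * b)) * (c * c + lit 6 * (d * d)) - (a * c + lit 6 * (b * d)) * (a * c + lit 6 * (b * d))
            f = Ring.solve-∀ ringQ
            g : ∀ p q → (p * p) * (q * q) ≡ (p * q) * (p * q)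
            g = Ring.solve-∀ ringQ
    e : ∀ a b c d p q → ((p * p - (a * a + lit 6 * (b * b))) + (q * q - (c * c + lit 6 * (d * d)))) + lit 2 * (p * q - (a * c + lit 6 * (b * d)))
        ≡ (p + q) * (p + q) - ((a + c) * (a + c) + lit 6 * ((b + d) * (b + d)))
    e = Ring.solve-∀ ringQ

  ≼-⊗ : ∀ {z w p q} → z ≼ p → w ≼ q → z ⊗ w ≼ p * q
  ≼-⊗ {z} {w} {p} {q} (bound 0≤p hz) (bound 0≤q hw) = bound (0≤* 0≤p 0≤q)
    (≤-trans (≤-≡ (N-⊗ z w)) (≤-trans (*-mono (0≤N z) hz (0≤N w) hw) (≤-≡ (g p q))))
    where g : ∀ p q → (p * p) * (q * q) ≡ (p * q) * (p * q)
          g = Ring.solve-∀ ringQ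

  ≼-⊖ : ∀ {z p} → z ≼ p → ⊖ z ≼ p
  ≼-⊖ {z} (bound h n) = bound h (N-⊖ z ≡≤ n)

  ≼-⊝ : ∀ {z w p q} → z ≼ p → w ≼ q → z ⊝ w ≼ p + q
  ≼-⊝ h k = ≼-⊕ h (≼-⊖ k)

  ≼-conj : ∀ {z p} → z ≼ p → conj z ≼ p
  ≼-conj {z} (bound h n) = bound h (N-conj z ≡≤ n)

  ≼-0 : 0K ≼ 0ℚ
  ≼-0 = bound ≤-refl (≤-≡ refl)

  ≼-⌜⌝ : ∀ {q} → 0ℚ ≤ q → ⌜ q ⌝ ≼ q
  ≼-⌜⌝ {q} h = bound h (≤-≡ (N-⌜⌝ q))

  ≼-κ : ∀ n → κ n ≼ ι n
  ≼-κ n = ≼-⌜⌝ (0≤ι n)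

  ≼-swap : ∀ {z w p} → z ⊝ w ≼ p → w ⊝ z ≼ p
  ≼-swap {z} {w} h = ≼-≡ (≼-⊖ h) (e z w)
    where e : ∀ z w → ⊖ (z ⊝ w) ≡ w ⊝ z
          e = Ring.solve-∀ ringK

  ≼-trans : ∀ {x y z p q} → x ⊝ y ≼ p → y ⊝ z ≼ q → x ⊝ z ≼ p + q
  ≼-trans {x} {y} {z} h k = ≼-≡ (≼-⊕ h k) (e x y z)
    where e : ∀ x y z → (x ⊝ y) ⊕ (y ⊝ z) ≡ x ⊝ z
          e = Ring.solve-∀ ringK

  -- A point of the unit circle, which need not be a unit of Z[√-6].
  Unit : K → Set
  Unit z = N z ≡ 1ℚ

  unit≼ : ∀ {z} → Unit z → z ≼ 1ℚ
  unit≼ e = bound 0≤1 (≤-≡ e)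

  unit-⊗ : ∀ {z w} → Unit z → Unit w → Unit (z ⊗ w)
  unit-⊗ {z} {w} e f = trans (N-⊗ z w) (trans (cong₂ _*_ e f) refl)

  unit-conj : ∀ {z} → Unit z → Unit (conj z)
  unit-conj {z} e = trans (N-conj z) e

  unit-inv : ∀ {z} → Unit z → z ⊗ conj z ≡ 1K
  unit-inv {z} e = trans (⊗-conj z) (cong ⌜_⌝ e)

  unit≢0 : ∀ {z} → Unit z → ¬ z ≡ 0K
  unit≢0 e refl with () ← e

  infixr 8 _↑_
  _↑_ : K → ℕ → K
  z ↑ zero = 1K
  z ↑ suc n = z ⊗ z ↑ n

  ↑-+ : ∀ z m n → z ↑ (m ℕ.+ n) ≡ z ↑ m ⊗ z ↑ n
  ↑-+ z zero n = sym (⊗-idˡ _)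
  ↑-+ z (suc m) n = trans (cong (z ⊗_) (↑-+ z m n)) (sym (⊗-assoc z _ _))

  1↑ : ∀ n → 1K ↑ n ≡ 1K
  1↑ zero = refl
  1↑ (suc n) = trans (⊗-idˡ _) (1↑ n)

  ↑-⊗ : ∀ z w n → (z ⊗ w) ↑ n ≡ z ↑ n ⊗ w ↑ n
  ↑-⊗ z w zero = sym (⊗-idˡ _)
  ↑-⊗ z w (suc n) = trans (cong ((z ⊗ w) ⊗_) (↑-⊗ z w n)) (e z w _ _)
    where e : ∀ z w p q → (z ⊗ w) ⊗ (p ⊗ q) ≡ (z ⊗ p) ⊗ (w ⊗ q)
          e = Ring.solve-∀ ringK

  ↑-* : ∀ z m n → z ↑ (m ℕ.* n) ≡ (z ↑ m) ↑ n
  ↑-* z zero n = sym (1↑ n)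
  ↑-* z (suc m) n = trans (↑-+ z n (m ℕ.* n)) (trans (cong (z ↑ n ⊗_) (↑-* z m n)) (sym (↑-⊗ z (z ↑ m) n)))

  ↑-swap : ∀ z m n → (z ↑ m) ↑ n ≡ (z ↑ n) ↑ m
  ↑-swap z m n = trans (sym (↑-* z m n)) (trans (cong (z ↑_) (ℕ.*-comm m n)) (↑-* z n m))

  unit-↑ : ∀ {z} n → Unit z → Unit (z ↑ n)
  unit-↑ zero e = refl
  unit-↑ {z} (suc n) e = unit-⊗ {z} e (unit-↑ n e)

  conj-↑ : ∀ z n → conj (z ↑ n) ≡ conj z ↑ n
  conj-↑ z zero = refl
  conj-↑ z (suc n) = trans (conj-⊗ z _) (cong (conj z ⊗_) (conj-↑ z n))

  ↑-≼ : ∀ {z q} n → z ≼ q → z ↑ n ≼ q ^ n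
  ↑-≼ zero h = unit≼ {1K} refl
  ↑-≼ (suc n) h = ≼-⊗ h (↑-≼ n h)

  ⌜⌝-↑ : ∀ q n → ⌜ q ^ n ⌝ ≡ ⌜ q ⌝ ↑ n
  ⌜⌝-↑ q zero = refl
  ⌜⌝-↑ q (suc n) = trans (⌜⌝-* q (q ^ n)) (cong (⌜ q ⌝ ⊗_) (⌜⌝-↑ q n))

  -- |aⁿ − bⁿ| ≤ n |a − b| on the unit circle
  unit-↑-close : ∀ {a b p} n → Unit a → Unit b → a ⊝ b ≼ p → a ↑ n ⊝ b ↑ n ≼ ι n * p
  unit-↑-close {p = p} zero ua ub h = ≼-mono ≼-0 (≤-≡ (sym (trans (cong (_* p) (ι-lit 0)) (*-zeroˡ p))))
  unit-↑-close {a} {b} {p} (suc n) ua ub h =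
    ≼-mono (≼-≡ (≼-⊕ (≼-⊗ h (unit≼ {a ↑ n} (unit-↑ {a} n ua))) (≼-⊗ (unit≼ {b} ub) (unit-↑-close {a} {b} n ua ub h))) (e a b _ _))
     (≤-≡ (trans (f p (ι n)) (cong (_* p) (sym (ι-suc n)))))
    where e : ∀ a b x y → (a ⊝ b) ⊗ x ⊕ b ⊗ (x ⊝ y) ≡ a ⊗ x ⊝ b ⊗ y
          e = Ring.solve-∀ ringK
          f : ∀ p n → p * 1ℚ + 1ℚ * (n * p) ≡ (1ℚ + n) * p
          f = Ring.solve-∀ ringQ

  ⊗-close : ∀ {a b c d p q} → Unit a → Unit d → a ⊝ b ≼ p → c ⊝ d ≼ q → a ⊗ c ⊝ b ⊗ d ≼ p + q
  ⊗-close {a} {b} {c} {d} {p} {q} ua ud h k = ≼-mono (≼-≡ (≼-⊕ (≼-⊗ (unit≼ {a} ua) k) (≼-⊗ h (unit≼ {d} ud))) (e a b c d)) (≤-≡ (f p q))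
    where e : ∀ a b c d → a ⊗ (c ⊝ d) ⊕ (a ⊝ b) ⊗ d ≡ a ⊗ c ⊝ b ⊗ d
          e = Ring.solve-∀ ringK
          f : ∀ p q → 1ℚ * q + p * 1ℚ ≡ p + q
          f = Ring.solve-∀ ringQ

  Integral : K → Set
  Integral z = ∃₂ λ a b → z ≡ ζ a ⸴ ζ b

  integral-⊕ : ∀ {z w} → Integral z → Integral w → Integral (z ⊕ w)
  integral-⊕ (a , b , refl) (c , d , refl) = a ℤ.+ c , b ℤ.+ d , cong₂ _⸴_ (sym (ζ-+ a c)) (sym (ζ-+ b d))

  integral-⊗ : ∀ {z w} → Integral z → Integral w → Integral (z ⊗ w)
  integral-⊗ (a , b , refl) (c , d , refl) = a ℤ.* c ℤ.- + 6 ℤ.* (b ℤ.* d) , a ℤ.* d ℤ.+ b ℤ.* c ,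
    cong₂ _⸴_ (sym (trans (ζ-+ (a ℤ.* c) _) (cong₂ _+_ (ζ-* a c) (trans (ζ-neg (+ 6 ℤ.* (b ℤ.* d))) (cong -_ (trans (ζ-* (+ 6) (b ℤ.* d)) (cong₂ _*_ (ζ-lit 6) (ζ-* b d))))))))
              (sym (trans (ζ-+ (a ℤ.* d) _) (cong₂ _+_ (ζ-* a d) (ζ-* b c))))

  integral-κ : ∀ n → Integral (κ n)
  integral-κ n = + n , + 0 , cong (ι n ⸴_) (sym (ζ-lit 0))

  integral-↑ : ∀ {z} n → Integral z → Integral (z ↑ n)
  integral-↑ zero h = subst Integral κ-1 (integral-κ 1)
  integral-↑ (suc n) h = integral-⊗ h (integral-↑ n h)

  integral-⊖ : ∀ {z} → Integral z → Integral (⊖ z)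
  integral-⊖ (a , b , refl) = ℤ.- a , ℤ.- b , cong₂ _⸴_ (sym (ζ-neg a)) (sym (ζ-neg b))

  integral-conj : ∀ {z} → Integral z → Integral (conj z)
  integral-conj (a , b , refl) = a , ℤ.- b , cong (ζ a ⸴_) (sym (ζ-neg b))

  -- The norm is a nonnegative integer. This is the Liouville inequality behind both vanishing
  -- arguments of the extrapolation.
  integral-small : ∀ {z} → Integral z → N z < 1ℚ → z ≡ 0K
  integral-small {z} (a , b , refl) h = N≡0 z (trans (sym nz) (trans (cong ζ (sym (ge0 n≥0 n<1))) (ζ-lit 0)))
    where
    n = a ℤ.* a ℤ.+ + 6 ℤ.* (b ℤ.* b)
    nz : ζ n ≡ N z
    nz = trans (ζ-+ (a ℤ.* a) _) (cong₂ _+_ (ζ-* a a) (trans (ζ-* (+ 6) (b ℤ.* b)) (cong₂ _*_ (ζ-lit 6) (ζ-* b b))))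
    n≥0 : + 0 ℤ.≤ n
    n≥0 = ζ-cancel-≤ (ζ-lit 0 ≡≤ 0≤N z ≤≡ sym nz)
    n<1 : n ℤ.< + 1
    n<1 = ζ-cancel-< (subst₂ _<_ (sym nz) (sym (ζ-lit 1)) h)
    ge0 : ∀ {m} → + 0 ℤ.≤ m → m ℤ.< + 1 → + 0 ≡ m
    ge0 {+ zero} _ _ = refl
    ge0 {+ suc m} _ (ℤ.+<+ (ℕ.s≤s ()))
    ge0 { -[1+ m ]} () _

-- Determinants, polynomials in Horner form, Vandermonde

module Determinants where
  open Rationals using (ι)
  open QuadraticField
  open import Data.Nat using (ℕ; zero; suc; _+_; _≤_; _<_; z≤n; s≤s)
  open import Data.Nat.Properties
  open import Data.List using (List; []; _∷_; _++_; map; length)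
  open import Data.List.Properties using (++-assoc; map-++; length-map)
  open import Data.List.Relation.Unary.All as All using (All; []; _∷_)
  open import Data.List.Relation.Unary.AllPairs as AllPairs using (AllPairs; []; _∷_)
  open import Data.List.Relation.Unary.Any using (here; there)
  open import Data.List.Membership.Propositional using (_∈_)
  open import Data.List.Membership.Propositional.Properties using (∈-∃++; ∈-map⁺)
  open import Function using (id; _∘_)

  module _ {A : Set} where
    -- The alternating sum of a Laplace expansion: `f` receives one column and the list of the
    -- remaining ones, in their order.
    alt : (A → List A → K) → List A → K
    alt f [] = 0K
    alt f (c ∷ cs) = f c cs ⊝ alt (λ d ds → f d (c ∷ ds)) cs

    alt-ext : ∀ {f g} → (∀ d ds → f d ds ≡ g d ds) → ∀ cs → alt f cs ≡ alt g cs
    alt-ext h [] = refl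
    alt-ext h (c ∷ cs) = cong₂ _⊝_ (h c cs) (alt-ext (λ d ds → h d (c ∷ ds)) cs)

    alt-lin0 : ∀ {f g h} a → (∀ d ds → f d ds ≡ a ⊗ g d ds ⊕ h d ds) → ∀ cs → alt f cs ≡ a ⊗ alt g cs ⊕ alt h cs
    alt-lin0 a e [] = lem a
      where lem : ∀ a → 0K ≡ a ⊗ 0K ⊕ 0K
            lem = Ring.solve-∀ ringK
    alt-lin0 a e (c ∷ cs) = trans (cong₂ _⊝_ (e c cs) (alt-lin0 a (λ d ds → e d (c ∷ ds)) cs)) (lem a _ _ _ _)
      where lem : ∀ a x y z w → (a ⊗ x ⊕ y) ⊝ (a ⊗ z ⊕ w) ≡ a ⊗ (x ⊝ z) ⊕ (y ⊝ w)
            lem = Ring.solve-∀ ringK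

    alt-zero : ∀ {f} → (∀ d ds → f d ds ≡ 0K) → ∀ cs → alt f cs ≡ 0K
    alt-zero h [] = refl
    alt-zero h (c ∷ cs) = trans (cong₂ _⊝_ (h c cs) (alt-zero (λ d ds → h d (c ∷ ds)) cs)) refl

    alt-scale : ∀ {f} a → ∀ cs → alt (λ d ds → a ⊗ f d ds) cs ≡ a ⊗ alt f cs
    alt-scale {f} a cs = trans (alt-lin0 {h = λ _ _ → 0K} a (λ d ds → lem (a ⊗ f d ds)) cs) (trans (cong (a ⊗ alt f cs ⊕_) (alt-zero (λ _ _ → refl) cs)) (sym (lem _)))
      where lem : ∀ x → x ≡ x ⊕ 0K
            lem = Ring.solve-∀ ringK

    alt-adj : ∀ f → (∀ d P c Q → f d (P ++ c ∷ c ∷ Q) ≡ 0K) → ∀ P c Q → alt f (P ++ c ∷ c ∷ Q) ≡ 0K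
    alt-adj f h [] c Q = trans (cong (λ t → f c (c ∷ Q) ⊝ (f c (c ∷ Q) ⊝ t)) (alt-zero (λ d ds → h d [] c ds) Q)) (lem _)
      where lem : ∀ x → x ⊝ (x ⊝ 0K) ≡ 0K
            lem = Ring.solve-∀ ringK
    alt-adj f h (x ∷ P) c Q = trans (cong₂ _⊝_ (h x P c Q) (alt-adj (λ d ds → f d (x ∷ ds)) (λ d P → h d (x ∷ P)) P c Q)) refl

    alt-lin : ∀ f {e c d : A} a → (∀ rest → f e rest ≡ a ⊗ f c rest ⊕ f d rest)
      → (∀ x P Q → f x (P ++ e ∷ Q) ≡ a ⊗ f x (P ++ c ∷ Q) ⊕ f x (P ++ d ∷ Q))
      → ∀ P Q → alt f (P ++ e ∷ Q) ≡ a ⊗ alt f (P ++ c ∷ Q) ⊕ alt f (P ++ d ∷ Q)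
    alt-lin f a h₁ h₂ [] Q = trans (cong₂ _⊝_ (h₁ Q) (alt-lin0 a (λ x xs → h₂ x [] xs) Q)) (lem a _ _ _ _)
      where lem : ∀ a x y z w → (a ⊗ x ⊕ y) ⊝ (a ⊗ z ⊕ w) ≡ a ⊗ (x ⊝ z) ⊕ (y ⊝ w)
            lem = Ring.solve-∀ ringK
    alt-lin f a h₁ h₂ (x ∷ P) Q = trans (cong₂ _⊝_ (h₂ x P Q) (alt-lin (λ d ds → f d (x ∷ ds)) a (λ rest → h₁ (x ∷ rest)) (λ x′ P → h₂ x′ (x ∷ P)) P Q)) (lem a _ _ _ _)
      where lem : ∀ a x y z w → (a ⊗ x ⊕ y) ⊝ (a ⊗ z ⊕ w) ≡ a ⊗ (x ⊝ z) ⊕ (y ⊝ w)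
            lem = Ring.solve-∀ ringK

  alt-map : ∀ {A B : Set} (φ : A → B) f as → alt f (map φ as) ≡ alt (λ d ds → f (φ d) (map φ ds)) as
  alt-map φ f [] = refl
  alt-map φ f (a ∷ as) = cong (f (φ a) (map φ as) ⊝_) (alt-map φ (λ d ds → f d (φ a ∷ ds)) as)

  -- D t i cs is the determinant of the t × t matrix with columns cs, restricted to rows i, …, i + t − 1.
  D : ℕ → ℕ → List (ℕ → K) → K
  D zero i [] = 1K
  D zero i (_ ∷ _) = 0K
  D (suc t) i cs = alt (λ c rest → c i ⊗ D t (suc i) rest) cs

  D-adj : ∀ t i P c Q → D t i (P ++ c ∷ c ∷ Q) ≡ 0K
  D-adj zero i [] c Q = refl
  D-adj zero i (_ ∷ _) c Q = refl
  D-adj (suc t) i P c Q = alt-adj _ (λ d P c Q → trans (cong (d i ⊗_) (D-adj t (suc i) P c Q)) (⊗-zeroʳ (d i))) P c Q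

  -- The column relation is asked only on rows that the minor meets, because the kernel relations
  -- used later are available for those rows alone.
  D-lin : ∀ {B e c d} a → (∀ r → r < B → e r ≡ a ⊗ c r ⊕ d r) → ∀ t i → i + t ≤ B → ∀ P Q
    → D t i (P ++ e ∷ Q) ≡ a ⊗ D t i (P ++ c ∷ Q) ⊕ D t i (P ++ d ∷ Q)
  D-lin a h zero i le [] Q = lem a
    where lem : ∀ a → 0K ≡ a ⊗ 0K ⊕ 0K
          lem = Ring.solve-∀ ringK
  D-lin a h zero i le (_ ∷ _) Q = lem a
    where lem : ∀ a → 0K ≡ a ⊗ 0K ⊕ 0K
          lem = Ring.solve-∀ ringK
  D-lin {B} {e} {c} {d} a h (suc t) i le P Q = alt-lin _ a
      (λ rest → trans (cong (_⊗ D t (suc i) rest) (h i (≤-trans (s≤s (m≤m+n i t)) le′))) (lem₁ a _ _ _))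
      (λ x P Q → trans (cong (x i ⊗_) (D-lin a h t (suc i) le′ P Q)) (lem₂ a _ _ _)) P Q
    where le′ : suc (i + t) ≤ B
          le′ = subst (_≤ B) (+-suc i t) le
          lem₁ : ∀ a x y z → (a ⊗ x ⊕ y) ⊗ z ≡ a ⊗ (x ⊗ z) ⊕ y ⊗ z
          lem₁ = Ring.solve-∀ ringK
          lem₂ : ∀ a x y z → x ⊗ (a ⊗ y ⊕ z) ≡ a ⊗ (x ⊗ y) ⊕ x ⊗ z
          lem₂ = Ring.solve-∀ ringK

  -- Polarisation: the determinant with a + b in both places is 0 by `D-adj`, and so are two of the
  -- four terms into which it expands.
  D-swap : ∀ t i P a b Q → D t i (P ++ a ∷ b ∷ Q) ⊕ D t i (P ++ b ∷ a ∷ Q) ≡ 0K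
  D-swap t i P a b Q = trans (sym (trans (lin P (s ∷ Q)) (trans (cong₂ _⊕_ (snd a) (snd b)) (trans (cong₂ (λ x y → (x ⊕ D t i (P ++ a ∷ b ∷ Q)) ⊕ (D t i (P ++ b ∷ a ∷ Q) ⊕ y)) (D-adj t i P a Q) (D-adj t i P b Q)) (lem₀ _ _))))) (D-adj t i P s Q)
    where
    s = λ r → a r ⊕ b r
    lem₁ : ∀ x y → x ⊕ y ≡ 1K ⊗ x ⊕ y
    lem₁ = Ring.solve-∀ ringK
    lem₀ : ∀ x y → (0K ⊕ x) ⊕ (y ⊕ 0K) ≡ x ⊕ y
    lem₀ = Ring.solve-∀ ringK
    lin : ∀ P Q → D t i (P ++ s ∷ Q) ≡ D t i (P ++ a ∷ Q) ⊕ D t i (P ++ b ∷ Q)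
    lin P Q = trans (D-lin {i + t} 1K (λ r _ → lem₁ (a r) (b r)) t i ≤-refl P Q) (sym (lem₁ _ _))
    mv : ∀ c d → D t i ((P ++ c ∷ []) ++ d ∷ Q) ≡ D t i (P ++ c ∷ d ∷ Q)
    mv c d = cong (D t i) (++-assoc P (c ∷ []) (d ∷ Q))
    snd : ∀ c → D t i (P ++ c ∷ s ∷ Q) ≡ D t i (P ++ c ∷ a ∷ Q) ⊕ D t i (P ++ c ∷ b ∷ Q)
    snd c = trans (sym (mv c s)) (trans (lin (P ++ c ∷ []) Q) (cong₂ _⊕_ (mv c a) (mv c b)))

  -- The first copy is moved to the right by transpositions until the two copies are adjacent.
  D-dup : ∀ t i mid P c Q → D t i (P ++ c ∷ (mid ++ c ∷ Q)) ≡ 0K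
  D-dup t i [] P c Q = D-adj t i P c Q
  D-dup t i (x ∷ m) P c Q = trans (sym (lem _)) (trans (cong (D t i (P ++ c ∷ x ∷ (m ++ c ∷ Q)) ⊕_)
      (sym (trans (sym (cong (D t i) (++-assoc P (x ∷ []) _))) (D-dup t i m (P ++ x ∷ []) c Q)))) (D-swap t i P c x (m ++ c ∷ Q)))
    where lem : ∀ x → x ⊕ 0K ≡ x
          lem = Ring.solve-∀ ringK

  module _ {A : Set} (col : A → ℕ → K) (v : A → K) where
    comb : List A → ℕ → K
    comb [] r = 0K
    comb (a ∷ as) r = v a ⊗ col a r ⊕ comb as r

  D-comb : ∀ {A : Set} (col : A → ℕ → K) w t i pre post → D t i (comb col w post ∷ map col (pre ++ post)) ≡ 0K
  D-comb col w t i pre [] = trans (D-lin {i + t} {c = λ _ → 0K} (⊖ 1K) (λ r _ → refl) t i ≤-refl [] (map col (pre ++ []))) (lem _)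
    where lem : ∀ x → ⊖ 1K ⊗ x ⊕ x ≡ 0K
          lem = Ring.solve-∀ ringK
  D-comb col w t i pre (a ∷ post) = trans (D-lin {i + t} (w a) (λ r _ → refl) t i ≤-refl [] (map col (pre ++ a ∷ post)))
    (trans (cong₂ (λ x y → w a ⊗ x ⊕ y)
      (trans (cong (λ l → D t i (col a ∷ l)) (map-++ col pre (a ∷ post))) (D-dup t i (map col pre) [] (col a) (map col post)))
      (trans (cong (λ l → D t i (comb col w post ∷ map col l)) (sym (++-assoc pre (a ∷ []) post))) (D-comb col w t i (pre ++ a ∷ []) post))) (lem (w a)))
    where lem : ∀ x → x ⊗ 0K ⊕ 0K ≡ 0K
          lem = Ring.solve-∀ ringK

  -- The relation is solved for the column of `a`, whose coefficient has the inverse `u`; that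
  -- column is then a combination of the others.
  D-singular : ∀ {A : Set} (col : A → ℕ → K) v u a as t → u ⊗ v a ≡ 1K
    → (∀ r → r < t → comb col v (a ∷ as) r ≡ 0K) → D t 0 (map col (a ∷ as)) ≡ 0K
  D-singular col v u a as t inv h = trans (D-lin {t} {c = comb col w as} {d = λ _ → 0K} 1K (λ r r<t → trans (sol r r<t) (lem₁ _)) t 0 ≤-refl [] (map col as))
    (trans (cong₂ (λ x y → 1K ⊗ x ⊕ y) (D-comb col w t 0 [] as) zcol) refl)
    where
    w = λ b → ⊖ u ⊗ v b
    lem₁ : ∀ x → x ≡ 1K ⊗ x ⊕ 0K
    lem₁ = Ring.solve-∀ ringK
    combw : ∀ bs r → comb col w bs r ≡ ⊖ u ⊗ comb col v bs r
    combw [] r = lem u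
      where lem : ∀ u → 0K ≡ ⊖ u ⊗ 0K
            lem = Ring.solve-∀ ringK
    combw (b ∷ bs) r = trans (cong ((⊖ u ⊗ v b) ⊗ col b r ⊕_) (combw bs r)) (lem u _ _ _)
      where lem : ∀ u x y z → (⊖ u ⊗ x) ⊗ y ⊕ ⊖ u ⊗ z ≡ ⊖ u ⊗ (x ⊗ y ⊕ z)
            lem = Ring.solve-∀ ringK
    sol : ∀ r → r < t → col a r ≡ comb col w as r
    sol r r<t = trans (e₁ (col a r)) (trans (cong (_⊗ col a r) (sym inv)) (trans (e₂ u (v a) (col a r) (comb col v as r))
       (trans (cong (λ x → u ⊗ x ⊕ ⊖ u ⊗ comb col v as r) (h r r<t)) (trans (e₃ u _) (sym (combw as r))))))
      where e₁ : ∀ x → x ≡ 1K ⊗ x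
            e₁ = Ring.solve-∀ ringK
            e₂ : ∀ u v c s → (u ⊗ v) ⊗ c ≡ u ⊗ (v ⊗ c ⊕ s) ⊕ ⊖ u ⊗ s
            e₂ = Ring.solve-∀ ringK
            e₃ : ∀ u s → u ⊗ 0K ⊕ ⊖ u ⊗ s ≡ ⊖ u ⊗ s
            e₃ = Ring.solve-∀ ringK
    zcol : D t 0 ((λ _ → 0K) ∷ map col as) ≡ 0K
    zcol = D-comb col w t 0 as [] ≡-cong
      where _≡-cong : D t 0 ((λ _ → 0K) ∷ map col (as ++ [])) ≡ 0K → D t 0 ((λ _ → 0K) ∷ map col as) ≡ 0K
            e ≡-cong = trans (cong (λ l → D t 0 ((λ _ → 0K) ∷ map col l)) (sym (++-[] as))) e
              where ++-[] : ∀ (l : List _) → l ++ [] ≡ l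
                    ++-[] [] = refl
                    ++-[] (x ∷ l) = cong (x ∷_) (++-[] l)

  module _ {X : Set} (p : X → K) where
    -- Horner form of a polynomial in `p x` of formal degree d, the index c being the coefficient at
    -- degree d. As c may be 0, d is only an upper bound for the degree.
    data Poly : ℕ → K → (X → K) → Set where
      con : ∀ {c f} → (∀ x → f x ≡ c) → Poly 0 c f
      hor : ∀ {d c f h} a → Poly d c h → (∀ x → f x ≡ a ⊕ p x ⊗ h x) → Poly (suc d) c f

  module _ {X : Set} {p : X → K} where
    poly-ext : ∀ {d c f g} → Poly p d c f → (∀ x → g x ≡ f x) → Poly p d c g
    poly-ext (con e) h = con (λ x → trans (h x) (e x))
    poly-ext (hor a q e) h = hor a q (λ x → trans (h x) (e x))

    poly-weaken : ∀ {d c f} → Poly p d c f → Poly p (suc d) 0K f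
    poly-weaken {c = c} (con e) = hor c (con (λ x → refl)) (λ x → trans (e x) (lem c (p x)))
      where lem : ∀ c x → c ≡ c ⊕ x ⊗ 0K
            lem = Ring.solve-∀ ringK
    poly-weaken (hor a q e) = hor a (poly-weaken q) e

    poly-raise : ∀ {d c f} k → Poly p d c f → Poly p (suc k + d) 0K f
    poly-raise zero q = poly-weaken q
    poly-raise (suc k) q = poly-weaken (poly-raise k q)

    poly-zero : ∀ d → Poly p d 0K (λ _ → 0K)
    poly-zero zero = con (λ _ → refl)
    poly-zero (suc d) = poly-weaken (poly-zero d)

    poly-⊕ : ∀ {d c c′ f g} → Poly p d c f → Poly p d c′ g → Poly p d (c ⊕ c′) (λ x → f x ⊕ g x)
    poly-⊕ (con e) (con e′) = con (λ x → cong₂ _⊕_ (e x) (e′ x))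
    poly-⊕ (hor {h = h} a q e) (hor {h = h′} b r e′) = hor (a ⊕ b) (poly-⊕ q r) (λ x → trans (cong₂ _⊕_ (e x) (e′ x)) (lem a b (p x) (h x) (h′ x)))
      where lem : ∀ a b x y z → (a ⊕ x ⊗ y) ⊕ (b ⊕ x ⊗ z) ≡ (a ⊕ b) ⊕ x ⊗ (y ⊕ z)
            lem = Ring.solve-∀ ringK

    poly-scale : ∀ {d c f} s → Poly p d c f → Poly p d (s ⊗ c) (λ x → s ⊗ f x)
    poly-scale s (con e) = con (λ x → cong (s ⊗_) (e x))
    poly-scale s (hor {h = h} a q e) = hor (s ⊗ a) (poly-scale s q) (λ x → trans (cong (s ⊗_) (e x)) (lem s a (p x) (h x)))
      where lem : ∀ s a x y → s ⊗ (a ⊕ x ⊗ y) ≡ s ⊗ a ⊕ x ⊗ (s ⊗ y)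
            lem = Ring.solve-∀ ringK

    poly-deg : ∀ {d d′ c f} → d ≡ d′ → Poly p d c f → Poly p d′ c f
    poly-deg refl q = q

    poly-lead : ∀ {d c c′ f} → c ≡ c′ → Poly p d c f → Poly p d c′ f
    poly-lead refl q = q

    poly-⊝ : ∀ {d c c′ f g} → Poly p d c f → Poly p d c′ g → Poly p d (c ⊝ c′) (λ x → f x ⊝ g x)
    poly-⊝ {c = c} {c′} {f} {g} q r = poly-lead (lem c c′) (poly-ext (poly-⊕ q (poly-scale (⊖ 1K) r)) (λ x → sym (lem (f x) (g x))))
      where lem : ∀ x y → x ⊕ ⊖ 1K ⊗ y ≡ x ⊝ y
            lem = Ring.solve-∀ ringK

    poly-⊗ : ∀ {d e c c′ f g} → Poly p d c f → Poly p e c′ g → Poly p (d + e) (c ⊗ c′) (λ x → f x ⊗ g x)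
    poly-⊗ {c = c} {g = g} (con e) r = poly-ext (poly-scale c r) (λ x → cong (_⊗ g x) (e x))
    poly-⊗ {suc d} {e} {c} {c′} {f} {g} (hor {h = h} a q e₁) r = poly-lead (lem₀ (c ⊗ c′)) (poly-ext
        (poly-⊕ (poly-raise d (poly-scale a r)) (hor 0K (poly-⊗ q r) (λ x → refl)))
        (λ x → trans (cong (_⊗ g x) (e₁ x)) (lem a (p x) (h x) (g x))))
      where lem : ∀ a x y z → (a ⊕ x ⊗ y) ⊗ z ≡ a ⊗ z ⊕ (0K ⊕ x ⊗ (y ⊗ z))
            lem = Ring.solve-∀ ringK
            lem₀ : ∀ x → 0K ⊕ x ≡ x
            lem₀ = Ring.solve-∀ ringK

    -- Synthetic division: the quotient by p x - p a keeps the top coefficient.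
    poly-divide : ∀ {d c f} → Poly p (suc d) c f → ∀ a → Σ (X → K) λ h → Poly p d c h × (∀ x → f x ≡ f a ⊕ (p x ⊝ p a) ⊗ h x)
    poly-divide (hor {h = h} b q@(con {c} e) e′) a = h , q , λ x → trans (e′ x) (trans (cong (λ t → b ⊕ p x ⊗ t) (e x))
        (trans (lem b (p x) c (p a)) (cong₂ (λ s t → s ⊕ (p x ⊝ p a) ⊗ t) (sym (trans (e′ a) (cong (λ t → b ⊕ p a ⊗ t) (e a)))) (sym (e x)))))
      where lem : ∀ b x c y → b ⊕ x ⊗ c ≡ (b ⊕ y ⊗ c) ⊕ (x ⊝ y) ⊗ c
            lem = Ring.solve-∀ ringK
    poly-divide (hor {h = h} b q@(hor _ _ _) e′) a with poly-divide q a
    ... | h″ , r , e″ = (λ x → h a ⊕ p x ⊗ h″ x) , hor (h a) r (λ _ → refl) , λ x → trans (e′ x) (trans (cong (λ t → b ⊕ p x ⊗ t) (e″ x))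
        (trans (lem b (p x) (h a) (p a) (h″ x)) (cong (_⊕ (p x ⊝ p a) ⊗ (h a ⊕ p x ⊗ h″ x)) (sym (e′ a)))))
      where lem : ∀ b x k y l → b ⊕ x ⊗ (k ⊕ (x ⊝ y) ⊗ l) ≡ (b ⊕ y ⊗ k) ⊕ (x ⊝ y) ⊗ (k ⊕ x ⊗ l)
            lem = Ring.solve-∀ ringK

    -- Dividing out one of the d + 1 roots lowers the degree and leaves the top coefficient and the
    -- other roots; in degree 0 the function is its top coefficient.
    poly-roots : ∀ {d c f} → Poly p d c f → (pts : ℕ → X) → (∀ i j → i ≤ d → j ≤ d → p (pts i) ≡ p (pts j) → i ≡ j)
      → (∀ i → i ≤ d → f (pts i) ≡ 0K) → c ≡ 0K
    poly-roots (con e) pts inj z = trans (sym (e (pts 0))) (z 0 z≤n)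
    poly-roots {suc d} {c} {f} q pts inj z with poly-divide q (pts (suc d))
    ... | h , r , e = poly-roots r pts (λ i j i≤ j≤ → inj i j (m≤n⇒m≤1+n i≤) (m≤n⇒m≤1+n j≤)) λ i i≤ →
        noZeroDiv (p (pts i) ⊝ p (pts (suc d))) (h (pts i))
          (trans (sym (lem₀ _)) (trans (cong (_⊕ _) (sym (z (suc d) ≤-refl))) (trans (sym (e (pts i))) (z i (m≤n⇒m≤1+n i≤)))))
          (λ eq → <⇒≢ (s≤s i≤) (inj i (suc d) (m≤n⇒m≤1+n i≤) ≤-refl (trans (lem₁ _ _) (trans (cong (_⊕ p (pts (suc d))) eq) (lem₀ _)))))
      where lem₀ : ∀ x → 0K ⊕ x ≡ x
            lem₀ = Ring.solve-∀ ringK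
            lem₁ : ∀ x y → x ≡ (x ⊝ y) ⊕ y
            lem₁ = Ring.solve-∀ ringK

    alt-poly : ∀ {A : Set} {n} {g : A → List A → K} {f : A → List A → X → K} cs
      → (∀ d ds → suc (length ds) ≡ length cs → Poly p n (g d ds) (f d ds)) → Poly p n (alt g cs) (λ x → alt (λ d ds → f d ds x) cs)
    alt-poly {n = n} [] h = poly-zero n
    alt-poly (c ∷ cs) h = poly-⊝ (h c cs refl) (alt-poly cs (λ d ds e → h d (c ∷ ds) (cong suc e)))

    module _ {A : Set} (deg : A → ℕ) where
      sumdeg : List A → ℕ
      sumdeg [] = 0
      sumdeg (a ∷ as) = deg a + sumdeg as

      -- `e` collects the degrees of the columns already passed over, so that all terms of the
      -- expansion have one common degree.
      alt-poly-deg : ∀ {e} {g : A → List A → K} {f : A → List A → X → K}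
        → (∀ d ds → Poly p (e + (deg d + sumdeg ds)) (g d ds) (f d ds)) → ∀ cs → Poly p (e + sumdeg cs) (alt g cs) (λ x → alt (λ d ds → f d ds x) cs)
      alt-poly-deg {e} h [] = poly-zero (e + 0)
      alt-poly-deg {e} h (c ∷ cs) = poly-⊝ (h c cs) (poly-deg (+-assoc e (deg c) (sumdeg cs))
        (alt-poly-deg {e + deg c} (λ d ds → poly-deg (eq d ds) (h d (c ∷ ds))) cs))
        where eq : ∀ d ds → e + (deg d + (deg c + sumdeg ds)) ≡ e + deg c + (deg d + sumdeg ds)
              eq d ds = trans (cong (e +_) (trans (sym (+-assoc (deg d) (deg c) _)) (trans (cong (_+ sumdeg ds) (+-comm (deg d) (deg c))) (+-assoc (deg c) (deg d) _)))) (sym (+-assoc e (deg c) _))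

      -- Degrees depend on the column and not on the row, so every term of the expansion has the sum
      -- of the column degrees, and taking top coefficients commutes with the determinant.
      D-poly : (col : A → ℕ → X → K) (lead : A → ℕ → K) → (∀ a r → Poly p (deg a) (lead a r) (col a r))
        → ∀ t i as → Poly p (sumdeg as) (D t i (map lead as)) (λ x → D t i (map (λ a r → col a r x) as))
      D-poly col lead h zero i [] = con (λ _ → refl)
      D-poly col lead h zero i (a ∷ as) = poly-zero _
      D-poly col lead h (suc t) i as = poly-lead (sym (alt-map lead _ as)) (poly-ext
        (alt-poly-deg {0} (λ d ds → poly-⊗ (h d i) (D-poly col lead h t (suc i) ds)) as)
        (λ x → alt-map (λ a r → col a r x) _ as))

  pw : K → ℕ → K
  pw b r = b ↑ r

  sgn : ℕ → K
  sgn zero = 1K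
  sgn (suc t) = ⊖ sgn t

  pow-poly : ∀ i → Poly id i 1K (_↑ i)
  pow-poly zero = con (λ _ → refl)
  pow-poly (suc i) = hor 0K (pow-poly i) (λ x → lem (x ⊗ x ↑ i))
    where lem : ∀ x → x ≡ 0K ⊕ x
          lem = Ring.solve-∀ ringK

  -- Only the last row, with exponent i + t, reaches the top degree. Its cofactor is the minor of
  -- the other columns on the first t rows, with sign (-1)^t.
  vandermonde-poly : ∀ t i cs → length cs ≡ t → Poly id (i + t) (sgn t ⊗ D t i cs) (λ x → D (suc t) i (pw x ∷ cs))
  vandermonde-poly zero i [] refl = poly-deg (sym (+-identityʳ i))
    (poly-ext (poly-lead (lem₁ 1K) (pow-poly i)) (λ x → lem (x ↑ i)))
    where lem : ∀ x → x ⊗ 1K ⊝ 0K ≡ x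
          lem = Ring.solve-∀ ringK
          lem₁ : ∀ x → x ≡ x ⊗ 1K
          lem₁ = Ring.solve-∀ ringK
  vandermonde-poly (suc t) i cs eq = poly-lead
     (trans (cong (λ s → 0K ⊝ s) (trans (alt-ext (λ d ds → lem₂ (d i) (sgn t) _) cs) (alt-scale (sgn t) cs))) (lem (sgn t) _))
    (poly-⊝ (poly-deg (trans (+-comm (suc t) i) refl) (poly-raise t (poly-ext (poly-scale (D (suc t) (suc i) cs) (pow-poly i)) (λ x → lem₃ _ _))))
      (alt-poly cs λ d ds e → poly-scale (d i) (poly-deg (sym (+-suc i t)) (vandermonde-poly t (suc i) ds (suc-injective (trans e eq))))))
    where lem : ∀ s x → 0K ⊝ s ⊗ x ≡ ⊖ s ⊗ x
          lem = Ring.solve-∀ ringK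
          lem₂ : ∀ x s y → x ⊗ (s ⊗ y) ≡ s ⊗ (x ⊗ y)
          lem₂ = Ring.solve-∀ ringK
          lem₃ : ∀ x y → x ⊗ y ≡ y ⊗ x
          lem₃ = Ring.solve-∀ ringK

  nth : ∀ {A : Set} → A → List A → ℕ → A
  nth d [] i = d
  nth d (a ∷ as) zero = a
  nth d (a ∷ as) (suc i) = nth d as i

  nth-∈ : ∀ {A : Set} {d : A} as i → i < length as → nth d as i ∈ as
  nth-∈ (a ∷ as) zero l = here refl
  nth-∈ (a ∷ as) (suc i) (s≤s l) = there (nth-∈ as i l)

  nth-inj : ∀ {A : Set} {d : A} {as} → AllPairs _≢_ as → ∀ i j → i < length as → j < length as → nth d as i ≡ nth d as j → i ≡ j
  nth-inj (_ ∷ _) zero zero _ _ _ = refl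
  nth-inj {as = a ∷ as} (n ∷ u) zero (suc j) _ (s≤s l) e = ⊥-elim (All.lookup n (nth-∈ as j l) e)
  nth-inj {as = a ∷ as} (n ∷ u) (suc i) zero (s≤s l) _ e = ⊥-elim (All.lookup n (nth-∈ as i l) (sym e))
  nth-inj (_ ∷ u) (suc i) (suc j) (s≤s l) (s≤s l′) e = cong suc (nth-inj u i j l l′ e)

  sgn≢0 : ∀ t → ¬ sgn t ≡ 0K
  sgn≢0 zero ()
  sgn≢0 (suc t) e = sgn≢0 t (trans (lem (sgn t)) (cong ⊖_ e))
    where lem : ∀ x → x ≡ ⊖ (⊖ x)
          lem = Ring.solve-∀ ringK

  -- As a function of its first entry the determinant vanishes at b by assumption and at each member
  -- of `bs` by a repeated column. These are t + 1 roots in degree t, so the smaller Vandermonde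
  -- determinant would vanish too.
  vandermonde : ∀ bs → AllPairs _≢_ bs → ¬ D (length bs) 0 (map pw bs) ≡ 0K
  vandermonde [] u ()
  vandermonde (b ∷ bs) (n ∷ u) e = vandermonde bs u (noZeroDiv (sgn t) _ lead≡0 (sgn≢0 t))
    where
    t = length bs
    lead≡0 : sgn t ⊗ D t 0 (map pw bs) ≡ 0K
    lead≡0 = poly-roots (vandermonde-poly t 0 (map pw bs) (length-map pw bs)) (nth b (b ∷ bs))
      (λ i j i≤ j≤ → nth-inj (n ∷ u) i j (s≤s i≤) (s≤s j≤)) z
      where
      z : ∀ i → i ≤ t → D (suc t) 0 (pw (nth b (b ∷ bs) i) ∷ map pw bs) ≡ 0K
      z zero _ = e
      z (suc i) l with ∈-∃++ (∈-map⁺ pw (nth-∈ {d = b} bs i l))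
      ... | P , Q , eq = trans (cong (λ cs → D (suc t) 0 (pw (nth b bs i) ∷ cs)) eq) (D-dup (suc t) 0 P [] (pw (nth b bs i)) Q)

-- Extraction of an n-th root in Q(√-6)

module RootExtraction where
  open Rationals
  open QuadraticField
  open ThueLemma using (coprime-pow; ∣sq∣; pos-form)
  open import Data.Rational hiding (pos)
  open import Data.Rational.Properties
  import Data.Nat as ℕ
  import Data.Nat.Properties as ℕ
  open import Data.Nat.Divisibility as ℕ using (divides)
  open import Data.Nat.Coprimality as Cop using (Coprime; coprime-divisor)
  open import Data.Integer as ℤ using (ℤ) renaming (+_ to pos; ∣_∣ to abs)
  import Data.Integer.Properties as ℤ
  import Data.Integer.Divisibility.Signed as S
  import Data.Integer.Tactic.RingSolver as ℤR

  κ-↑ : ∀ a n → κ (a ℕ.^ n) ≡ κ a ↑ n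
  κ-↑ a n = trans (cong ⌜_⌝ (ι-^ a n)) (⌜⌝-↑ (ι a) n)

  cancelK : ∀ {z u v} → ¬ z ≡ 0K → z ⊗ u ≡ z ⊗ v → u ≡ v
  cancelK {z} {u} {v} z≢0 e = trans (lem₁ u v) (trans (cong (_⊕ v) (noZeroDiv z (u ⊝ v) (trans (lem₂ z u v) (trans (cong (_⊝ z ⊗ v) e) (lem₃ (z ⊗ v)))) z≢0)) (lem₄ v))
    where lem₁ : ∀ u v → u ≡ (u ⊝ v) ⊕ v
          lem₁ = Ring.solve-∀ ringK
          lem₂ : ∀ z u v → z ⊗ (u ⊝ v) ≡ z ⊗ u ⊝ z ⊗ v
          lem₂ = Ring.solve-∀ ringK
          lem₃ : ∀ v → v ⊝ v ≡ 0K
          lem₃ = Ring.solve-∀ ringK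
          lem₄ : ∀ v → 0K ⊕ v ≡ v
          lem₄ = Ring.solve-∀ ringK

  κ≢0 : ∀ {n} → ¬ n ≡ 0 → ¬ κ n ≡ 0K
  κ≢0 n≢0 e = n≢0 (κ-inj (trans e (sym κ-0)))

  integral-ζ : ∀ z → Integral ⌜ ζ z ⌝
  integral-ζ z = z , pos 0 , cong (ζ z ⸴_) (sym (ζ-lit 0))

  integral-⊝ : ∀ {z w} → Integral z → Integral w → Integral (z ⊝ w)
  integral-⊝ h k = integral-⊕ h (integral-⊖ k)

  -- divisibility of an integral element by a natural number coprime to a known factor
  ∣-from-ζ : ∀ {m k} p p′ → Coprime m k → ι k * ζ p ≡ ι m * ζ p′ → ∃ λ r → p ≡ r ℤ.* pos m
  ∣-from-ζ {m} {k} p p′ c e = go (S.∣ᵤ⇒∣ {pos m} {p} (coprime-divisor c (divides (abs p′) (trans (sym (ℤ.abs-* (pos k) p)) (trans (cong abs eℤ) (trans (ℤ.abs-* (pos m) p′) (ℕ.*-comm m (abs p′))))))))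
    where
    eℤ : pos k ℤ.* p ≡ pos m ℤ.* p′
    eℤ = ζ-inj (trans (ζ-* (pos k) p) (trans e (sym (ζ-* (pos m) p′))))
    go : pos m S.∣ p → ∃ λ r → p ≡ r ℤ.* pos m
    go (S.divides r eq) = r , eq

  -- divisibility of an integral element by a natural number coprime to a known factor
  κ-divides : ∀ {m k z w} → Coprime m k → Integral z → Integral w → κ k ⊗ z ≡ κ m ⊗ w → ∃ λ v → Integral v × z ≡ κ m ⊗ v
  κ-divides {m} {k} {z} {w} c (p , q , z≡) (p′ , q′ , w≡) e = go (∣-from-ζ p p′ c (cong re e′)) (∣-from-ζ q q′ c (cong im e′))
    where
    e′ : ι k * ζ p ⸴ ι k * ζ q ≡ ι m * ζ p′ ⸴ ι m * ζ q′
    e′ = trans (sym (scale (ι k) (ζ p) (ζ q))) (trans (cong (κ k ⊗_) (sym z≡)) (trans e (trans (cong (κ m ⊗_) w≡) (scale (ι m) (ζ p′) (ζ q′)))))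
    multiple : ∀ {p r} → p ≡ r ℤ.* pos m → ζ p ≡ ι m * ζ r
    multiple {p} {r} e = trans (cong ζ (trans e (ℤ.*-comm r (pos m)))) (ζ-* (pos m) r)
    go : (∃ λ r → p ≡ r ℤ.* pos m) → (∃ λ r → q ≡ r ℤ.* pos m) → ∃ λ v → Integral v × z ≡ κ m ⊗ v
    go (r , er) (s , es) = (ζ r ⸴ ζ s) , (r , s , refl) , trans z≡ (trans (cong₂ _⸴_ (multiple er) (multiple es)) (sym (scale (ι m) (ζ r) (ζ s))))

  -- From r² + 6s² = 1 follows s = 0: the integral elements of norm 1 are ±1, and squaring removes
  -- the sign.
  norm1⇒sq≡1 : ∀ {v} → Integral v → N v ≡ 1ℚ → v ⊗ v ≡ 1K
  norm1⇒sq≡1 (r , s , refl) e = cong₂ _⸴_ re≡ im≡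
    where
    eℤ : r ℤ.* r ℤ.+ pos 6 ℤ.* (s ℤ.* s) ≡ pos 1
    eℤ = ζ-inj (trans (trans (ζ-+ (r ℤ.* r) _) (cong₂ _+_ (ζ-* r r) (trans (ζ-* (pos 6) (s ℤ.* s)) (cong₂ _*_ (ζ-lit 6) (ζ-* s s))))) (trans e (sym (ζ-lit 1))))
    eℕ : abs r ℕ.* abs r ℕ.+ 6 ℕ.* (abs s ℕ.* abs s) ≡ 1
    eℕ = ℤ.+-injective (trans (trans (ℤ.pos-+ (abs r ℕ.* abs r) _) (cong₂ ℤ._+_ (sym (∣sq∣ r)) (trans (ℤ.pos-* 6 (abs s ℕ.* abs s)) (cong (pos 6 ℤ.*_) (sym (∣sq∣ s)))))) eℤ)
    s≡0 : s ≡ pos 0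
    s≡0 = ℤ.∣i∣≡0⇒i≡0 (go (abs s) (abs r ℕ.* abs r) eℕ)
      where go : ∀ m t → t ℕ.+ 6 ℕ.* (m ℕ.* m) ≡ 1 → m ≡ 0
            go zero t e = refl
            go (suc m) t e with () ← ℕ.<⇒≱ {1} {6} (ℕ.s≤s (ℕ.s≤s ℕ.z≤n)) (ℕ.≤-trans (ℕ.≤-trans (ℕ.*-monoʳ-≤ 6 (ℕ.s≤s (ℕ.z≤n {m ℕ.+ m ℕ.* suc m}))) (ℕ.m≤n+m _ t)) (ℕ.≤-reflexive e))
    im0 : ζ s ≡ 0ℚ
    im0 = trans (cong ζ s≡0) (ζ-lit 0)
    rr : ζ r * ζ r ≡ 1ℚ
    rr = trans (trans (lem (ζ r)) (cong (λ t → ζ r * ζ r + lit 6 * (t * t)) (sym im0))) e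
      where lem : ∀ a → a * a ≡ a * a + lit 6 * (0ℚ * 0ℚ)
            lem = Ring.solve-∀ ringQ
    re≡ : ζ r * ζ r - lit 6 * (ζ s * ζ s) ≡ 1ℚ
    re≡ = trans (cong (λ t → ζ r * ζ r - lit 6 * (t * t)) im0) (trans (lem (ζ r)) rr)
      where lem : ∀ a → a * a - lit 6 * (0ℚ * 0ℚ) ≡ a * a
            lem = Ring.solve-∀ ringQ
    im≡ : ζ r * ζ s + ζ s * ζ r ≡ 0ℚ
    im≡ = trans (cong (λ t → ζ r * t + t * ζ r) im0) (lem (ζ r))
      where lem : ∀ a → a * 0ℚ + 0ℚ * a ≡ 0ℚ
            lem = Ring.solve-∀ ringQ

  module RootOf {x d y h : ℕ} {a b c : ℤ} (y≢0 : ¬ y ≡ 0) (cop : Coprime y x)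
    (E : 3 ℕ.* (x ℕ.* x) ℕ.+ 2 ℕ.* (d ℕ.* d) ≡ y ℕ.^ suc (h ℕ.+ h))
    (lin : pos x ℤ.* b ≡ pos d ℤ.* a ℤ.- pos y ℤ.* c)
    (rep : 3 ℕ.* (abs a ℕ.* abs a) ℕ.+ 2 ℕ.* (abs b ℕ.* abs b) ≡ y) where

    private
      n = suc (h ℕ.+ h)
      X = ι x
      Δ = ι d
      Y = ι y
      A = ζ a
      B = ζ b
      C = ζ c
      F = ι (y ℕ.^ n)

      linQ : X * B ≡ Δ * A - Y * C
      linQ = trans (sym (ζ-* (pos x) b)) (trans (cong ζ lin) (trans (ζ-+ (pos d ℤ.* a) _) (cong₂ _+_ (ζ-* (pos d) a) (trans (ζ-neg (pos y ℤ.* c)) (cong -_ (ζ-* (pos y) c))))))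

      formQ : ∀ p q → lit 3 * (ι p * ι p) + lit 2 * (ι q * ι q) ≡ ι (3 ℕ.* (p ℕ.* p) ℕ.+ 2 ℕ.* (q ℕ.* q))
      formQ p q = sym (trans (ι-+ (3 ℕ.* (p ℕ.* p)) _) (cong₂ _+_ (trans (ι-* 3 (p ℕ.* p)) (cong₂ _*_ (ι-lit 3) (ι-* p p))) (trans (ι-* 2 (q ℕ.* q)) (cong₂ _*_ (ι-lit 2) (ι-* q q)))))

      EQ : lit 3 * (X * X) + lit 2 * (Δ * Δ) ≡ F
      EQ = trans (formQ x d) (cong ι E)

      sqabs : ∀ z → ζ z * ζ z ≡ ι (abs z) * ι (abs z)
      sqabs z = trans (sym (ζ-* z z)) (trans (cong ζ (∣sq∣ z)) (ι-* (abs z) (abs z)))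

      repQ : lit 3 * (A * A) + lit 2 * (B * B) ≡ Y
      repQ = trans (cong₂ (λ s t → lit 3 * s + lit 2 * t) (sqabs a) (sqabs b)) (trans (formQ (abs a) (abs b)) (cong ι rep))

      two = ⌜ lit 2 ⌝

      ext : ∀ {a b c d} → a ≡ c → b ≡ d → _≡_ {A = K} (a ⸴ b) (c ⸴ d)
      ext refl refl = refl

    -- With α = a√3 - b√-2, ξ = x√3 + d√-2 and ξ̄ = x√3 - d√-2: `M` = α², `Ξ` = ξ², `Ξ̄` = ξ̄², `η`
    -- = ξα, `Eₙ` = √-2 ξ, `E₁` = √-2 ξ̄. All of them lie in Z[√-6], although α and ξ do not.
    M Ξ Ξ̄ η Eₙ E₁ s : K
    M = (lit 3 * (A * A) - lit 2 * (B * B)) ⸴ - (lit 2 * (A * B))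
    Ξ = (lit 3 * (X * X) - lit 2 * (Δ * Δ)) ⸴ (lit 2 * (X * Δ))
    Ξ̄ = (lit 3 * (X * X) - lit 2 * (Δ * Δ)) ⸴ - (lit 2 * (X * Δ))
    η = (lit 3 * (X * A) + lit 2 * (Δ * B)) ⸴ (Δ * A - X * B)
    Eₙ = - (lit 2 * Δ) ⸴ X
    E₁ = (lit 2 * Δ) ⸴ X
    s = ⌜ Y * C ⌝

    private
      iX = integral-ζ (pos x)
      iΔ = integral-ζ (pos d)
      iA = integral-ζ a
      iB = integral-ζ b
      i2 : Integral two
      i2 = subst Integral (cong ⌜_⌝ (ζ-lit 2)) (integral-ζ (pos 2))

      integral-pair : ∀ {p q} → (∃ λ z → p ≡ ζ z) → (∃ λ z → q ≡ ζ z) → Integral (p ⸴ q)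
      integral-pair (z , refl) (w , refl) = z , w , refl
      iz-* : ∀ {p q} → (∃ λ z → p ≡ ζ z) → (∃ λ z → q ≡ ζ z) → (∃ λ z → p * q ≡ ζ z)
      iz-* (z , refl) (w , refl) = z ℤ.* w , sym (ζ-* z w)
      iz-+ : ∀ {p q} → (∃ λ z → p ≡ ζ z) → (∃ λ z → q ≡ ζ z) → (∃ λ z → p + q ≡ ζ z)
      iz-+ (z , refl) (w , refl) = z ℤ.+ w , sym (ζ-+ z w)
      iz-neg : ∀ {p} → (∃ λ z → p ≡ ζ z) → (∃ λ z → - p ≡ ζ z)
      iz-neg (z , refl) = ℤ.- z , sym (ζ-neg z)
      iz : ∀ z → ∃ λ w → ζ z ≡ ζ w
      iz z = z , refl
      izl : ∀ n → ∃ λ w → lit n ≡ ζ w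
      izl n = pos n , sym (ζ-lit n)

    integral-M : Integral M
    integral-M = integral-pair (iz-+ (iz-* (izl 3) (iz-* (iz a) (iz a))) (iz-neg (iz-* (izl 2) (iz-* (iz b) (iz b))))) (iz-neg (iz-* (izl 2) (iz-* (iz a) (iz b))))

    private
      integral-Ξ̄ : Integral Ξ̄
      integral-Ξ̄ = integral-pair (iz-+ (iz-* (izl 3) (iz-* (iz (pos x)) (iz (pos x)))) (iz-neg (iz-* (izl 2) (iz-* (iz (pos d)) (iz (pos d)))))) (iz-neg (iz-* (izl 2) (iz-* (iz (pos x)) (iz (pos d)))))
      integral-η : Integral η
      integral-η = integral-pair (iz-+ (iz-* (izl 3) (iz-* (iz (pos x)) (iz a))) (iz-* (izl 2) (iz-* (iz (pos d)) (iz b)))) (iz-+ (iz-* (iz (pos d)) (iz a)) (iz-neg (iz-* (iz (pos x)) (iz b))))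
      integral-Eₙ : Integral Eₙ
      integral-Eₙ = integral-pair (iz-neg (iz-* (izl 2) (iz (pos d)))) (iz (pos x))
      integral-E₁ : Integral E₁
      integral-E₁ = integral-pair (iz-* (izl 2) (iz (pos d))) (iz (pos x))
      integral-C : Integral ⌜ C ⌝
      integral-C = integral-ζ c

      s≡ : s ≡ κ y ⊗ ⌜ C ⌝
      s≡ = ⌜⌝-* Y C

      -- `linQ` says that xα = aξ̄ + s√-2; here this is multiplied by ξ, with ξξ̄ = F.
      base : ⌜ X ⌝ ⊗ η ≡ ⌜ A * F ⌝ ⊕ s ⊗ Eₙ
      base = trans (scale X _ _) (trans (ext re′ im′) (cong (⌜ A * F ⌝ ⊕_) (sym (scale (Y * C) _ _))))
        where
        re′ : X * (lit 3 * (X * A) + lit 2 * (Δ * B)) ≡ A * F + Y * C * - (lit 2 * Δ)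
        re′ = trans (l₁ X A Δ B) (trans (cong (λ t → lit 3 * (X * X) * A + lit 2 * (Δ * t)) linQ) (trans (l₂ X A Δ (Y * C)) (cong (λ t → A * t + Y * C * - (lit 2 * Δ)) EQ)))
          where l₁ : ∀ X A Δ B → X * (lit 3 * (X * A) + lit 2 * (Δ * B)) ≡ lit 3 * (X * X) * A + lit 2 * (Δ * (X * B))
                l₁ = Ring.solve-∀ ringQ
                l₂ : ∀ X A Δ S → lit 3 * (X * X) * A + lit 2 * (Δ * (Δ * A - S)) ≡ A * (lit 3 * (X * X) + lit 2 * (Δ * Δ)) + S * - (lit 2 * Δ)
                l₂ = Ring.solve-∀ ringQ
        im′ : X * (Δ * A - X * B) ≡ 0ℚ + Y * C * X
        im′ = trans (cong (λ t → X * (Δ * A - t)) linQ) (l X (Δ * A) (Y * C))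
          where l : ∀ X T S → X * (T - (T - S)) ≡ 0ℚ + S * X
                l = Ring.solve-∀ ringQ

      G = ⌜ X ⌝ ⊗ (⌜ X ⌝ ⊗ M)

      -- The square of xα = aξ̄ + s√-2.
      G≡ : G ≡ (⌜ A * A ⌝ ⊗ Ξ̄ ⊕ ⌜ lit 2 * A ⌝ ⊗ (s ⊗ E₁)) ⊝ two ⊗ (s ⊗ s)
      G≡ = trans (cong (⌜ X ⌝ ⊗_) (scale X _ _)) (trans (scale X _ _) (trans (ext re′ im′) (sym (cong₂ _⊝_ (cong₂ _⊕_ (scale (A * A) _ _) (trans (cong (⌜ lit 2 * A ⌝ ⊗_) (scale (Y * C) _ _)) (scale (lit 2 * A) _ _)))
              (trans (cong (two ⊗_) (scale (Y * C) _ _)) (scale (lit 2) (Y * C * (Y * C)) (Y * C * 0ℚ)))))))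
        where
        re′ : X * (X * (lit 3 * (A * A) - lit 2 * (B * B))) ≡ A * A * (lit 3 * (X * X) - lit 2 * (Δ * Δ)) + lit 2 * A * (Y * C * (lit 2 * Δ)) - lit 2 * (Y * C * (Y * C))
        re′ = trans (l₁ X A B) (trans (cong (λ t → lit 3 * (X * X) * (A * A) - lit 2 * (t * t)) linQ) (l₂ X A Δ (Y * C)))
          where l₁ : ∀ X A B → X * (X * (lit 3 * (A * A) - lit 2 * (B * B))) ≡ lit 3 * (X * X) * (A * A) - lit 2 * ((X * B) * (X * B))
                l₁ = Ring.solve-∀ ringQ
                l₂ : ∀ X A Δ S → lit 3 * (X * X) * (A * A) - lit 2 * ((Δ * A - S) * (Δ * A - S)) ≡ A * A * (lit 3 * (X * X) - lit 2 * (Δ * Δ)) + lit 2 * A * (S * (lit 2 * Δ)) - lit 2 * (S * S)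
                l₂ = Ring.solve-∀ ringQ
        im′ : X * (X * - (lit 2 * (A * B))) ≡ A * A * - (lit 2 * (X * Δ)) + lit 2 * A * (Y * C * X) - lit 2 * (Y * C * 0ℚ)
        im′ = trans (l₁ X A B) (trans (cong (λ t → - (lit 2 * (A * X * t))) linQ) (l₂ X A Δ (Y * C)))
          where l₁ : ∀ X A B → X * (X * - (lit 2 * (A * B))) ≡ - (lit 2 * (A * X * (X * B)))
                l₁ = Ring.solve-∀ ringQ
                l₂ : ∀ X A Δ S → - (lit 2 * (A * X * (Δ * A - S))) ≡ A * A * - (lit 2 * (X * Δ)) + lit 2 * A * (S * X) - lit 2 * (S * 0ℚ)
                l₂ = Ring.solve-∀ ringQ

      EΞ̄ : Eₙ ⊗ Ξ̄ ≡ ⌜ F ⌝ ⊗ E₁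
      EΞ̄ = trans (ext (l₁ X Δ) (l₂ X Δ)) (trans (cong (λ t → t * (lit 2 * Δ) ⸴ t * X) EQ) (sym (scale F _ _)))
        where l₁ : ∀ X Δ → - (lit 2 * Δ) * (lit 3 * (X * X) - lit 2 * (Δ * Δ)) - lit 6 * (X * - (lit 2 * (X * Δ))) ≡ (lit 3 * (X * X) + lit 2 * (Δ * Δ)) * (lit 2 * Δ)
              l₁ = Ring.solve-∀ ringQ
              l₂ : ∀ X Δ → - (lit 2 * Δ) * - (lit 2 * (X * Δ)) + X * (lit 3 * (X * X) - lit 2 * (Δ * Δ)) ≡ (lit 3 * (X * X) + lit 2 * (Δ * Δ)) * X
              l₂ = Ring.solve-∀ ringQ

      EE₁ : Eₙ ⊗ E₁ ≡ ⊖ (two ⊗ ⌜ F ⌝)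
      EE₁ = trans (ext (l₁ X Δ) (l₂ X Δ)) (trans (cong (λ t → (- (lit 2 * t)) ⸴ (- (lit 2 * 0ℚ))) EQ) (cong ⊖_ (sym (scale (lit 2) F 0ℚ))))
        where l₁ : ∀ X Δ → - (lit 2 * Δ) * (lit 2 * Δ) - lit 6 * (X * X) ≡ - (lit 2 * (lit 3 * (X * X) + lit 2 * (Δ * Δ)))
              l₁ = Ring.solve-∀ ringQ
              l₂ : ∀ X Δ → - (lit 2 * Δ) * X + X * (lit 2 * Δ) ≡ - (lit 2 * 0ℚ)
              l₂ = Ring.solve-∀ ringQ

      two-suc : ∀ k → suc (suc k ℕ.+ suc k) ≡ suc (suc (suc (k ℕ.+ k)))
      two-suc k = cong suc (cong suc (ℕ.+-suc k k))

      -- The left side is ξ(aξ̄ + s√-2)^(2k+1). Modulo F = ξξ̄ only the last binomial term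
      -- s^(2k+1)(-2)^k √-2 ξ survives, and s = yc supplies the powers of y.
      descent : ∀ k → ∃₂ λ T W → Integral W × (∃ λ V → Integral V × T ≡ κ y ↑ suc (k ℕ.+ k) ⊗ V)
        × ⌜ X ⌝ ↑ suc (k ℕ.+ k) ⊗ (η ⊗ M ↑ k) ≡ T ⊗ Eₙ ⊕ ⌜ F ⌝ ⊗ W
      descent zero = s , ⌜ A ⌝ , iA , (⌜ C ⌝ , integral-C , trans s≡ (l₁ (κ y) ⌜ C ⌝)) ,
         trans (l₂ ⌜ X ⌝ η) (trans base (trans (cong (_⊕ s ⊗ Eₙ) (⌜⌝-* A F)) (l₃ ⌜ A ⌝ ⌜ F ⌝ (s ⊗ Eₙ))))
        where l₁ : ∀ y c → y ⊗ c ≡ (y ⊗ 1K) ⊗ c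
              l₁ = Ring.solve-∀ ringK
              l₂ : ∀ x e → (x ⊗ 1K) ⊗ (e ⊗ 1K) ≡ x ⊗ e
              l₂ = Ring.solve-∀ ringK
              l₃ : ∀ a f e → a ⊗ f ⊕ e ≡ e ⊕ f ⊗ a
              l₃ = Ring.solve-∀ ringK
      descent (suc k) with descent k
      ... | T , W , iW , (V , iV , eT) , eq = T ⊗ ⊖ (two ⊗ (s ⊗ s)) , T ⊗ (⌜ A * A ⌝ ⊗ E₁ ⊝ ⌜ lit 2 * A ⌝ ⊗ (s ⊗ two)) ⊕ W ⊗ G ,
          integral-⊕ (integral-⊗ iT (integral-⊝ (integral-⊗ iA² integral-E₁) (integral-⊗ i2A (integral-⊗ is i2)))) (integral-⊗ iW (integral-⊗ iX (integral-⊗ iX integral-M))) ,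
          (V ⊗ ⊖ (two ⊗ (⌜ C ⌝ ⊗ ⌜ C ⌝)) , integral-⊗ iV (integral-⊖ (integral-⊗ i2 (integral-⊗ integral-C integral-C))) ,
            trans (cong₂ (λ t u → t ⊗ ⊖ (two ⊗ (u ⊗ u))) eT s≡) (trans (l₁ (κ y ↑ suc (k ℕ.+ k)) V two (κ y) ⌜ C ⌝) (cong (λ m → κ y ↑ m ⊗ (V ⊗ ⊖ (two ⊗ (⌜ C ⌝ ⊗ ⌜ C ⌝)))) (sym (two-suc k))))) ,
          trans (cong (λ m → ⌜ X ⌝ ↑ m ⊗ (η ⊗ (M ⊗ M ↑ k))) (two-suc k))
            (trans (l₂ ⌜ X ⌝ (⌜ X ⌝ ↑ suc (k ℕ.+ k)) η M (M ↑ k)) (trans (cong (G ⊗_) eq) (trans (l₃ G T Eₙ ⌜ F ⌝ W)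
            (trans (cong (λ g → T ⊗ (Eₙ ⊗ g) ⊕ ⌜ F ⌝ ⊗ (W ⊗ G)) G≡) (trans (cong (λ t → T ⊗ t ⊕ ⌜ F ⌝ ⊗ (W ⊗ G))
              (trans (l₄ Eₙ ⌜ A * A ⌝ Ξ̄ ⌜ lit 2 * A ⌝ s E₁ two) (cong₂ (λ u v → ⌜ A * A ⌝ ⊗ u ⊕ ⌜ lit 2 * A ⌝ ⊗ (s ⊗ v) ⊕ ⊖ (two ⊗ (s ⊗ s)) ⊗ Eₙ) EΞ̄ EE₁)))
              (l₅ T ⌜ A * A ⌝ ⌜ F ⌝ E₁ ⌜ lit 2 * A ⌝ s two Eₙ (W ⊗ G)))))))
        where
        iT : Integral T
        iT = subst Integral (sym eT) (integral-⊗ (integral-↑ (suc (k ℕ.+ k)) (integral-κ y)) iV)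
        iA² = subst Integral (sym (⌜⌝-* A A)) (integral-⊗ iA iA)
        i2A = subst Integral (sym (⌜⌝-* (lit 2) A)) (integral-⊗ i2 iA)
        is = subst Integral (sym s≡) (integral-⊗ (integral-κ y) integral-C)
        l₁ : ∀ p v t y c → (p ⊗ v) ⊗ ⊖ (t ⊗ ((y ⊗ c) ⊗ (y ⊗ c))) ≡ (y ⊗ (y ⊗ p)) ⊗ (v ⊗ ⊖ (t ⊗ (c ⊗ c)))
        l₁ = Ring.solve-∀ ringK
        l₂ : ∀ x p e m q → (x ⊗ (x ⊗ p)) ⊗ (e ⊗ (m ⊗ q)) ≡ (x ⊗ (x ⊗ m)) ⊗ (p ⊗ (e ⊗ q))
        l₂ = Ring.solve-∀ ringK
        l₃ : ∀ g t e f w → g ⊗ (t ⊗ e ⊕ f ⊗ w) ≡ t ⊗ (e ⊗ g) ⊕ f ⊗ (w ⊗ g)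
        l₃ = Ring.solve-∀ ringK
        l₄ : ∀ e a x b s f t → e ⊗ ((a ⊗ x ⊕ b ⊗ (s ⊗ f)) ⊝ t ⊗ (s ⊗ s)) ≡ a ⊗ (e ⊗ x) ⊕ b ⊗ (s ⊗ (e ⊗ f)) ⊕ ⊖ (t ⊗ (s ⊗ s)) ⊗ e
        l₄ = Ring.solve-∀ ringK
        l₅ : ∀ T a f e b s t E w → T ⊗ (a ⊗ (f ⊗ e) ⊕ b ⊗ (s ⊗ ⊖ (t ⊗ f)) ⊕ ⊖ (t ⊗ (s ⊗ s)) ⊗ E) ⊕ f ⊗ w ≡ (T ⊗ ⊖ (t ⊗ (s ⊗ s))) ⊗ E ⊕ f ⊗ (T ⊗ (a ⊗ e ⊝ b ⊗ (s ⊗ t)) ⊕ w)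
        l₅ = Ring.solve-∀ ringK

      F↑ : ⌜ F ⌝ ≡ κ y ↑ n
      F↑ = κ-↑ y n

      F≢0 : ¬ ⌜ F ⌝ ≡ 0K
      F≢0 = κ≢0 (λ e → y≢0 (ℕ.m^n≡0⇒m≡0 y n e))

      A′ = η ⊗ M ↑ h

      -- At k = h the factor y^(2h+1) of T is F itself, so F divides xⁿA′; and x is prime to y.
      quotient-A′ : ∃ λ V → Integral V × A′ ≡ ⌜ F ⌝ ⊗ V
      quotient-A′ with descent h
      ... | T , W , iW , (V , iV , eT) , eq = κ-divides {y ℕ.^ n} {x ℕ.^ n} (coprime-pow n (Cop.sym (coprime-pow n (Cop.sym cop))))
          (integral-⊗ integral-η (integral-↑ h integral-M)) (integral-⊕ (integral-⊗ iV integral-Eₙ) iW)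
          (trans (cong (_⊗ A′) (κ-↑ x n)) (trans eq (trans (cong (λ t → t ⊗ Eₙ ⊕ ⌜ F ⌝ ⊗ W) (trans eT (cong (_⊗ V) (sym F↑)))) (l ⌜ F ⌝ V Eₙ W))))
        where l : ∀ f v e w → (f ⊗ v) ⊗ e ⊕ f ⊗ w ≡ f ⊗ (v ⊗ e ⊕ w)
              l = Ring.solve-∀ ringK

    N-M : N M ≡ Y * Y
    N-M = trans (l A B) (cong₂ _*_ repQ repQ)
      where l : ∀ A B → (lit 3 * (A * A) - lit 2 * (B * B)) * (lit 3 * (A * A) - lit 2 * (B * B)) + lit 6 * (- (lit 2 * (A * B)) * - (lit 2 * (A * B))) ≡ (lit 3 * (A * A) + lit 2 * (B * B)) * (lit 3 * (A * A) + lit 2 * (B * B))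
            l = Ring.solve-∀ ringQ

    private
      N-η : N η ≡ F * Y
      N-η = trans (l X Δ A B) (cong₂ _*_ EQ repQ)
        where l : ∀ X Δ A B → (lit 3 * (X * A) + lit 2 * (Δ * B)) * (lit 3 * (X * A) + lit 2 * (Δ * B)) + lit 6 * ((Δ * A - X * B) * (Δ * A - X * B)) ≡ (lit 3 * (X * X) + lit 2 * (Δ * Δ)) * (lit 3 * (A * A) + lit 2 * (B * B))
              l = Ring.solve-∀ ringQ

      N-↑ : ∀ z k → N (z ↑ k) ≡ N z ^ k
      N-↑ z zero = refl
      N-↑ z (suc k) = trans (N-⊗ z (z ↑ k)) (cong (N z *_) (N-↑ z k))

      N-A′ : N A′ ≡ F * F
      N-A′ = trans (N-⊗ η (M ↑ h)) (trans (cong₂ _*_ N-η (trans (N-↑ M h) (trans (cong (_^ h) N-M) (^-*-base Y Y h)))) (trans (l F Y (Y ^ h)) (cong (F *_) (trans (cong (Y *_) (sym (^-+ Y h h))) (sym (ι-^ y n))))))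
        where l : ∀ f y p → f * y * (p * p) ≡ f * (y * (p * p))
              l = Ring.solve-∀ ringQ

      ηη : η ⊗ η ≡ Ξ ⊗ M
      ηη = ext (l₁ X Δ A B) (l₂ X Δ A B)
        where l₁ : ∀ X Δ A B → (lit 3 * (X * A) + lit 2 * (Δ * B)) * (lit 3 * (X * A) + lit 2 * (Δ * B)) - lit 6 * ((Δ * A - X * B) * (Δ * A - X * B))
                   ≡ (lit 3 * (X * X) - lit 2 * (Δ * Δ)) * (lit 3 * (A * A) - lit 2 * (B * B)) - lit 6 * ((lit 2 * (X * Δ)) * - (lit 2 * (A * B)))
              l₁ = Ring.solve-∀ ringQ
              l₂ : ∀ X Δ A B → (lit 3 * (X * A) + lit 2 * (Δ * B)) * (Δ * A - X * B) + (Δ * A - X * B) * (lit 3 * (X * A) + lit 2 * (Δ * B))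
                   ≡ (lit 3 * (X * X) - lit 2 * (Δ * Δ)) * - (lit 2 * (A * B)) + (lit 2 * (X * Δ)) * (lit 3 * (A * A) - lit 2 * (B * B))
              l₂ = Ring.solve-∀ ringQ

      ΞΞ̄ : Ξ̄ ⊗ Ξ ≡ ⌜ F ⌝ ⊗ ⌜ F ⌝
      ΞΞ̄ = trans (ext (l₁ X Δ) (l₂ X Δ)) (trans (cong (λ t → t * t ⸴ 0ℚ) EQ) (⌜⌝-* F F))
        where l₁ : ∀ X Δ → (lit 3 * (X * X) - lit 2 * (Δ * Δ)) * (lit 3 * (X * X) - lit 2 * (Δ * Δ)) - lit 6 * (- (lit 2 * (X * Δ)) * (lit 2 * (X * Δ))) ≡ (lit 3 * (X * X) + lit 2 * (Δ * Δ)) * (lit 3 * (X * X) + lit 2 * (Δ * Δ))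
              l₁ = Ring.solve-∀ ringQ
              l₂ : ∀ X Δ → (lit 3 * (X * X) - lit 2 * (Δ * Δ)) * (lit 2 * (X * Δ)) + - (lit 2 * (X * Δ)) * (lit 3 * (X * X) - lit 2 * (Δ * Δ)) ≡ 0ℚ
              l₂ = Ring.solve-∀ ringQ

    -- Ξ Mⁿ = (η M^h)² = (FV)². The norms of A′ and F agree, so V has norm 1 and V² = 1; hence Ξ Mⁿ
    -- = F² = Ξ Ξ̄.
    M↑n : M ↑ n ≡ Ξ̄
    M↑n = go quotient-A′
      where
      l₁ : ∀ z x m p → (z ⊗ x) ⊗ (m ⊗ (p ⊗ p)) ≡ z ⊗ ((x ⊗ m) ⊗ (p ⊗ p))
      l₁ = Ring.solve-∀ ringK
      l₂ : ∀ z e p → z ⊗ ((e ⊗ e) ⊗ (p ⊗ p)) ≡ z ⊗ ((e ⊗ p) ⊗ (e ⊗ p))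
      l₂ = Ring.solve-∀ ringK
      l₃ : ∀ z f v → z ⊗ ((f ⊗ v) ⊗ (f ⊗ v)) ≡ (f ⊗ f) ⊗ (z ⊗ (v ⊗ v))
      l₃ = Ring.solve-∀ ringK
      l₄ : ∀ f z → f ⊗ (z ⊗ 1K) ≡ f ⊗ z
      l₄ = Ring.solve-∀ ringK
      go : (∃ λ V → Integral V × A′ ≡ ⌜ F ⌝ ⊗ V) → M ↑ n ≡ Ξ̄
      go (V , iV , eA) = cancelK {⌜ F ⌝ ⊗ ⌜ F ⌝} (λ e → F≢0 (noZeroDiv ⌜ F ⌝ ⌜ F ⌝ e F≢0))
        (trans (cong (_⊗ M ↑ n) (sym ΞΞ̄)) (trans (cong (λ t → (Ξ̄ ⊗ Ξ) ⊗ (M ⊗ t)) (↑-+ M h h)) (trans (l₁ Ξ̄ Ξ M (M ↑ h)) (trans (cong (λ t → Ξ̄ ⊗ (t ⊗ (M ↑ h ⊗ M ↑ h))) (sym ηη))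
          (trans (l₂ Ξ̄ η (M ↑ h)) (trans (cong (λ t → Ξ̄ ⊗ (t ⊗ t)) eA) (trans (l₃ Ξ̄ ⌜ F ⌝ V) (trans (cong (λ t → (⌜ F ⌝ ⊗ ⌜ F ⌝) ⊗ (Ξ̄ ⊗ t)) VV) (l₄ (⌜ F ⌝ ⊗ ⌜ F ⌝) Ξ̄)))))))))
        where
        VV : V ⊗ V ≡ 1K
        VV = norm1⇒sq≡1 iV (cong re (cancelK {⌜ F * F ⌝} {⌜ N V ⌝} {1K} (λ e → F≢0 (noZeroDiv ⌜ F ⌝ ⌜ F ⌝ (trans (sym (⌜⌝-* F F)) e) F≢0))
          (trans (sym (⌜⌝-* (F * F) (N V))) (trans (cong ⌜_⌝ (trans (cong (_* N V) (sym (N-⌜⌝ F))) (trans (sym (N-⊗ ⌜ F ⌝ V)) (trans (cong N (sym eA)) N-A′)))) (l₅ ⌜ F * F ⌝)))))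
          where l₅ : ∀ z → z ≡ z ⊗ 1K
                l₅ = Ring.solve-∀ ringK

    -- If M ↑ r = y ^ r, then Ξ̄ satisfies the same kind of relation; but Ξ̄ ↑ r ≡ (2 re Ξ̄) ^ (r − 1) Ξ̄ (mod y).
    M-not-root : ¬ y ≡ 1 → Coprime y 2 → Coprime y d → ∀ r → ¬ M ↑ suc r ≡ κ y ↑ suc r
    -- Reading real parts modulo y, y divides (2p)^r p; being prime to 2 and to p, the real part of
    -- Ξ̄, it would be 1.
    M-not-root y≢1 cop2 copd r e = y≢1 (cop-p^ (ℕ.∣-refl , ℕ.∣-trans y∣ (ℕ.∣-reflexive (ℕ.*-identityʳ (q ℕ.* 1)))))
      where
      p : ℤ
      p = pos 3 ℤ.* (pos x ℤ.* pos x) ℤ.- pos 2 ℤ.* (pos d ℤ.* pos d)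
      p≡ : lit 3 * (X * X) - lit 2 * (Δ * Δ) ≡ ζ p
      p≡ = sym (trans (ζ-+ (pos 3 ℤ.* (pos x ℤ.* pos x)) _) (cong₂ _+_ (trans (ζ-* (pos 3) (pos x ℤ.* pos x)) (cong₂ _*_ (ζ-lit 3) (ζ-* (pos x) (pos x))))
         (trans (ζ-neg _) (cong -_ (trans (ζ-* (pos 2) (pos d ℤ.* pos d)) (cong₂ _*_ (ζ-lit 2) (ζ-* (pos d) (pos d))))))))
      y∣yⁿ : y ℕ.∣ y ℕ.^ n
      y∣yⁿ = ℕ.m∣m*n _
      -- yⁿ - p = 4d², and y is prime to 2 and to d.
      cop-p : Coprime y (abs p)
      cop-p {k} (k∣y , k∣p) = cop-4 (k∣y , subst (k ℕ.∣_) (cong abs 4d²) (S.∣⇒∣ᵤ (S.∣m∣n⇒∣m-n (S.∣ᵤ⇒∣ {pos k} {pos (y ℕ.^ n)} (ℕ.∣-trans k∣y y∣yⁿ)) (S.∣ᵤ⇒∣ {pos k} {p} k∣p))))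
        where
        4d² : pos (y ℕ.^ n) ℤ.- p ≡ pos (2 ℕ.* (2 ℕ.* (d ℕ.* d)))
        4d² = trans (cong (ℤ._- p) (trans (cong pos (sym E)) (trans (pos-form (x ℕ.* x) (d ℕ.* d)) (cong₂ (λ s t → pos 3 ℤ.* s ℤ.+ pos 2 ℤ.* t) (ℤ.pos-* x x) (ℤ.pos-* d d)))))
           (trans (l (pos x ℤ.* pos x) (pos d ℤ.* pos d)) (sym (trans (ℤ.pos-* 2 (2 ℕ.* (d ℕ.* d))) (cong (pos 2 ℤ.*_) (trans (ℤ.pos-* 2 (d ℕ.* d)) (cong (pos 2 ℤ.*_) (ℤ.pos-* d d)))))))
          where l : ∀ s t → (pos 3 ℤ.* s ℤ.+ pos 2 ℤ.* t) ℤ.- (pos 3 ℤ.* s ℤ.- pos 2 ℤ.* t) ≡ pos 2 ℤ.* (pos 2 ℤ.* t)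
                l = ℤR.solve-∀
        cop-* : ∀ {u v} → Coprime y u → Coprime y v → Coprime y (u ℕ.* v)
        cop-* cu cv (e , f) = cv (e , coprime-divisor (λ (i , j) → cu (ℕ.∣-trans i e , j)) f)
        cop-4 : Coprime y (2 ℕ.* (2 ℕ.* (d ℕ.* d)))
        cop-4 = cop-* cop2 (cop-* cop2 (cop-* copd copd))
      cop-*′ : ∀ {u v} → Coprime y u → Coprime y v → Coprime y (u ℕ.* v)
      cop-*′ cu cv (e , f) = cv (e , coprime-divisor (λ (i , j) → cu (ℕ.∣-trans i e , j)) f)
      P = ⌜ lit 2 * ζ p ⌝
      ΞΞ : Ξ̄ ⊗ Ξ̄ ≡ P ⊗ Ξ̄ ⊝ ⌜ F ⌝ ⊗ ⌜ F ⌝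
      ΞΞ = trans (l Ξ̄ Ξ) (cong₂ _⊝_ (cong (_⊗ Ξ̄) (ext (trans (l₁ (lit 3 * (X * X) - lit 2 * (Δ * Δ))) (cong (lit 2 *_) p≡)) (l₂ (lit 2 * (X * Δ))))) ΞΞ̄)
        where l : ∀ z w → z ⊗ z ≡ (z ⊕ w) ⊗ z ⊝ z ⊗ w
              l = Ring.solve-∀ ringK
              l₁ : ∀ t → t + t ≡ lit 2 * t
              l₁ = Ring.solve-∀ ringQ
              l₂ : ∀ t → - t + t ≡ 0ℚ
              l₂ = Ring.solve-∀ ringQ
      Fy : ∃ λ W → Integral W × ⌜ F ⌝ ≡ κ y ⊗ W
      Fy = κ (y ℕ.^ (h ℕ.+ h)) , integral-κ (y ℕ.^ (h ℕ.+ h)) , κ-* y (y ℕ.^ (h ℕ.+ h))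
      -- Induction on r with Ξ̄² = PΞ̄ - F², where P is the trace of Ξ̄ and y divides F.
      expand : ∀ r → ∃ λ W → Integral W × Ξ̄ ↑ suc r ≡ P ↑ r ⊗ Ξ̄ ⊕ κ y ⊗ W
      expand zero = 0K , subst Integral κ-0 (integral-κ 0) , l Ξ̄ (κ y)
        where l : ∀ z y → z ⊗ 1K ≡ 1K ⊗ z ⊕ y ⊗ 0K
              l = Ring.solve-∀ ringK
      expand (suc r) = go (expand r) Fy
        where
        iP : Integral P
        iP = subst Integral (sym (⌜⌝-* (lit 2) (ζ p))) (integral-⊗ i2 (integral-ζ p))
        l₁ : ∀ z q y w → z ⊗ (q ⊗ z ⊕ y ⊗ w) ≡ q ⊗ (z ⊗ z) ⊕ y ⊗ (z ⊗ w)
        l₁ = Ring.solve-∀ ringK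
        l₂ : ∀ q P z y w f v → q ⊗ (P ⊗ z ⊝ (y ⊗ w) ⊗ f) ⊕ y ⊗ (z ⊗ v) ≡ (P ⊗ q) ⊗ z ⊕ y ⊗ (⊖ (q ⊗ (w ⊗ f)) ⊕ z ⊗ v)
        l₂ = Ring.solve-∀ ringK
        go : (∃ λ W → Integral W × Ξ̄ ↑ suc r ≡ P ↑ r ⊗ Ξ̄ ⊕ κ y ⊗ W) → (∃ λ W → Integral W × ⌜ F ⌝ ≡ κ y ⊗ W) → ∃ λ W → Integral W × Ξ̄ ↑ suc (suc r) ≡ P ↑ suc r ⊗ Ξ̄ ⊕ κ y ⊗ W
        go (W , iW , eW) (W′ , iW′ , eF) = ⊖ (P ↑ r ⊗ (W′ ⊗ ⌜ F ⌝)) ⊕ Ξ̄ ⊗ W ,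
          integral-⊕ (integral-⊖ (integral-⊗ (integral-↑ r iP) (integral-⊗ iW′ (integral-κ (y ℕ.^ n))))) (integral-⊗ integral-Ξ̄ iW) ,
          trans (cong (Ξ̄ ⊗_) eW) (trans (l₁ Ξ̄ (P ↑ r) (κ y) W) (trans (cong (λ t → P ↑ r ⊗ t ⊕ κ y ⊗ (Ξ̄ ⊗ W)) (trans ΞΞ (cong (λ t → P ⊗ Ξ̄ ⊝ t ⊗ ⌜ F ⌝) eF))) (l₂ (P ↑ r) P Ξ̄ (κ y) W′ ⌜ F ⌝ W)))
      Ξ̄↑ : Ξ̄ ↑ suc r ≡ κ y ⊗ κ (y ℕ.^ (h ℕ.+ h ℕ.+ r ℕ.* n))
      Ξ̄↑ = trans (cong (_↑ suc r) (sym M↑n)) (trans (↑-swap M n (suc r)) (trans (cong (_↑ n) e) (trans (↑-swap (κ y) (suc r) n) (trans (sym (↑-* (κ y) n (suc r)))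
         (trans (cong (κ y ↑_) (ℕ.*-comm n (suc r))) (trans (sym (κ-↑ y (suc r ℕ.* n))) (κ-* y (y ℕ.^ (h ℕ.+ h ℕ.+ r ℕ.* n)))))))))
      2pr : ℤ
      2pr = (pos 2 ℤ.* p) ℤ.^ r ℤ.* p
      ζ^ : ∀ z k → ζ (z ℤ.^ k) ≡ ζ z ^ k
      ζ^ z zero = ζ-lit 1
      ζ^ z (suc k) = trans (ζ-* z (z ℤ.^ k)) (cong (ζ z *_) (ζ^ z k))
      abs-^ : ∀ z k → abs (z ℤ.^ k) ≡ abs z ℕ.^ k
      abs-^ z zero = refl
      abs-^ z (suc k) = trans (ℤ.abs-* z _) (cong (abs z ℕ.*_) (abs-^ z k))
      q = abs (pos 2 ℤ.* p) ℕ.^ r ℕ.* abs p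
      cop-p^ : Coprime y (q ℕ.* 1)
      cop-p^ = subst (λ t → Coprime y t) (sym (ℕ.*-identityʳ q)) (cop-*′ (Cop.sym (coprime-pow r (Cop.sym (subst (λ t → Coprime y t) (sym (ℤ.abs-* (pos 2) p)) (cop-*′ cop2 cop-p))))) cop-p)
      y∣ : y ℕ.∣ q ℕ.* 1 ℕ.* 1
      y∣ = go (expand r)
        where
        Qr = y ℕ.^ (h ℕ.+ h ℕ.+ r ℕ.* n)
        lhs : ζ 2pr ≡ (lit 2 * ζ p) ^ r * ζ p
        lhs = trans (ζ-* ((pos 2 ℤ.* p) ℤ.^ r) p) (cong (_* ζ p) (trans (ζ^ (pos 2 ℤ.* p) r) (cong (_^ r) (trans (ζ-* (pos 2) p) (cong (_* ζ p) (ζ-lit 2))))))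
        l₃ : ∀ q w y → (q + - w) * y ≡ y * q - y * w
        l₃ = Ring.solve-∀ ringQ
        l₄ : ∀ t u → (t + u) - u ≡ t
        l₄ = Ring.solve-∀ ringQ
        go : (∃ λ W → Integral W × Ξ̄ ↑ suc r ≡ P ↑ r ⊗ Ξ̄ ⊕ κ y ⊗ W) → y ℕ.∣ q ℕ.* 1 ℕ.* 1
        go (W , (w , w′ , W≡) , eW) = subst (y ℕ.∣_) (trans (trans (ℤ.abs-* ((pos 2 ℤ.* p) ℤ.^ r) p) (cong (ℕ._* abs p) (abs-^ (pos 2 ℤ.* p) r))) (sym (trans (ℕ.*-identityʳ (q ℕ.* 1)) (ℕ.*-identityʳ q))))
            (S.∣⇒∣ᵤ (S.divides {pos y} {2pr} (pos Qr ℤ.- w) (ζ-inj (trans lhs (sym rhs)))))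
          where
          reEq : (lit 2 * ζ p) ^ r * ζ p + Y * ζ w ≡ Y * ι Qr
          reEq = trans (cong₂ _+_ (cong ((lit 2 * ζ p) ^ r *_) (sym p≡)) refl) (sym (cong re
             (trans (trans (sym (scale Y (ι Qr) 0ℚ)) (trans (sym Ξ̄↑) (trans eW (cong (λ t → P ↑ r ⊗ Ξ̄ ⊕ κ y ⊗ t) W≡)))) (cong₂ _⊕_ (trans (cong (_⊗ Ξ̄) (sym (⌜⌝-↑ (lit 2 * ζ p) r))) (scale ((lit 2 * ζ p) ^ r) (lit 3 * (X * X) - lit 2 * (Δ * Δ)) (- (lit 2 * (X * Δ))))) (scale Y (ζ w) (ζ w′))))))
          rhs : ζ ((pos Qr ℤ.- w) ℤ.* pos y) ≡ (lit 2 * ζ p) ^ r * ζ p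
          rhs = trans (ζ-* (pos Qr ℤ.- w) (pos y)) (trans (cong (_* Y) (trans (ζ-+ (pos Qr) (ℤ.- w)) (cong (λ t → ι Qr + t) (ζ-neg w)))) (trans (l₃ (ι Qr) (ζ w) Y) (trans (cong (_- Y * ζ w) (sym reEq)) (l₄ ((lit 2 * ζ p) ^ r * ζ p) (Y * ζ w)))))

-- Turning around the circle by small steps: sectors and half-turns

module CircleWalk where
  open Rationals
  open ParameterChoice using (least)
  open QuadraticField
  open import Data.Rational
  open import Data.Rational.Properties
  import Data.Nat as ℕ
  import Data.Nat.Properties as ℕ
  import Data.Nat.DivMod as ℕ
  open import Data.Nat.Tactic.RingSolver using (solve-∀)
  import Data.Integer as ℤ
  open import Data.Integer using (+_)

  neg≤ : ∀ {p} → ¬ 0ℚ ≤ p → 0ℚ ≤ - p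
  neg≤ {p} h = ≤⇒diff (<⇒≤ (≰⇒> h)) ≤≡ +-identityˡ (- p)

  <0⇒ : ∀ {p} → p < 0ℚ → 0ℚ ≤ - p
  <0⇒ {p} h = neg≤ (<⇒≱ h)

  -- ω = v² / 343 with v = 17 + 3√−6 of norm 343; its argument, 46.76…°, exceeds a quarter of a half-turn.
  W v : K
  W = lit 235 ⸴ lit 102
  v = lit 17 ⸴ lit 3

  abstract
    r₃₄₃ : ℚ
    r₃₄₃ = 1/ι 342

    343r : lit 343 * r₃₄₃ ≡ 1ℚ
    343r = trans (cong (_* r₃₄₃) (sym (ι-lit 343))) (1/ι-inverse 342)

    0<r₃₄₃ : 0ℚ < r₃₄₃
    0<r₃₄₃ = 0<1/ι 342

  ω : K
  ω = ⌜ r₃₄₃ ⌝ ⊗ W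

  unit-ω : Unit ω
  unit-ω = trans (N-⊗ ⌜ r₃₄₃ ⌝ W) (trans (cong (_* N W) (N-⌜⌝ r₃₄₃)) (trans (e r₃₄₃) (cong₂ _*_ 343r 343r)))
    where e : ∀ r → r * r * (lit 235 * lit 235 + lit 6 * (lit 102 * lit 102)) ≡ (lit 343 * r) * (lit 343 * r)
          e = Ring.solve-∀ ringQ

  im-conjω : ∀ a b → im ((a ⸴ b) ⊗ conj ω) ≡ r₃₄₃ * (a * - lit 102 + b * lit 235)
  im-conjω a b = trans (cong (λ t → im ((a ⸴ b) ⊗ conj t)) (scale r₃₄₃ (lit 235) (lit 102))) (e r₃₄₃ a b)
    where e : ∀ r a b → a * - (r * lit 102) + b * (r * lit 235) ≡ r * (a * - lit 102 + b * lit 235)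
          e = Ring.solve-∀ ringQ

  im-ω³ : ∀ a b → im ((a ⸴ b) ⊗ (ω ⊗ (ω ⊗ ω))) ≡ r₃₄₃ * (r₃₄₃ * r₃₄₃) * (a * lit 10531602 + b * - lit 31031045)
  im-ω³ a b = trans (cong (λ t → im ((a ⸴ b) ⊗ (t ⊗ (t ⊗ t)))) (scale r₃₄₃ (lit 235) (lit 102))) (e r₃₄₃ a b)
    where e : ∀ r a b → a * (r * lit 235 * (r * lit 235 * (r * lit 102) + r * lit 102 * (r * lit 235)) + r * lit 102 * (r * lit 235 * (r * lit 235) - lit 6 * (r * lit 102 * (r * lit 102))))
              + b * (r * lit 235 * (r * lit 235 * (r * lit 235) - lit 6 * (r * lit 102 * (r * lit 102))) - lit 6 * (r * lit 102 * (r * lit 235 * (r * lit 102) + r * lit 102 * (r * lit 235))))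
              ≡ r * (r * r) * (a * lit 10531602 + b * - lit 31031045)
          e = Ring.solve-∀ ringQ

  sq-le : ∀ {x y} → 0ℚ ≤ x → x ≤ y → x * x ≤ y * y
  sq-le 0≤x x≤y = *-mono 0≤x x≤y 0≤x x≤y

  -- P + Q√-6 is the moving point multiplied by the conjugate of v. The sector from 1 to ω becomes
  -- the symmetric one from the conjugate of v to v, with slopes ∓3/17; on the circle of norm 343 it
  -- satisfies -3 ≤ Q ≤ 3 and P ≥ 17.
  module Sector {P Q : ℚ} (norm343 : P * P + lit 6 * (Q * Q) ≡ lit 343) where
    lower⇒-3≤ : 0ℚ ≤ lit 3 * P + lit 17 * Q → 0ℚ ≤ P → - lit 3 ≤ Q
    lower⇒-3≤ low 0≤P with 0ℚ ≤? Q
    ... | yes 0≤Q = ≤-trans (toWitness {a? = - lit 3 ≤? 0ℚ} _) 0≤Q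
    ... | no Q<0 = diff⇒≤ (≤⇒diff R≤3 ≤≡ e Q)
      where
      e : ∀ Q → lit 3 - (- Q) ≡ Q - (- lit 3)
      e = Ring.solve-∀ ringQ
      R = - Q
      0≤R = neg≤ Q<0
      17R≤3P : lit 17 * R ≤ lit 3 * P
      17R≤3P = diff⇒≤ (low ≤≡ f P Q)
        where f : ∀ P Q → lit 3 * P + lit 17 * Q ≡ lit 3 * P - lit 17 * (- Q)
              f = Ring.solve-∀ ringQ
      R≤3 : R ≤ lit 3
      R≤3 = sq-cancel (0≤lit 3) (cancelʳ {lit 343} (toWitness {a? = 0ℚ <? lit 343} _)
         (diff⇒≤ (≤⇒diff (sq-le (0≤* (0≤lit 17) 0≤R) 17R≤3P) ≤≡ trans (f P Q) (trans (cong (λ t → lit 9 * t - lit 343 * (Q * Q)) norm343) (g Q)))))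
        where f : ∀ P Q → lit 3 * P * (lit 3 * P) - lit 17 * (- Q) * (lit 17 * (- Q)) ≡ lit 9 * (P * P + lit 6 * (Q * Q)) - lit 343 * (Q * Q)
              f = Ring.solve-∀ ringQ
              g : ∀ Q → lit 9 * lit 343 - lit 343 * (Q * Q) ≡ lit 3 * lit 3 * lit 343 - (- Q) * (- Q) * lit 343
              g = Ring.solve-∀ ringQ

    inside⇒17≤ : 0ℚ ≤ P → lit 17 * Q ≤ lit 3 * P → - lit 3 ≤ Q → lit 17 ≤ P
    inside⇒17≤ 0≤P up lo with 0ℚ ≤? Q
    ... | yes 0≤Q = sq-cancel 0≤P (cancelʳ {lit 343} (toWitness {a? = 0ℚ <? lit 343} _)
         (diff⇒≤ (≤⇒diff (*-monoʳ (0≤lit 6) (sq-le (0≤* (0≤lit 17) 0≤Q) up)) ≤≡ trans (f P Q) (trans (cong (λ t → lit 343 * (P * P) - lit 289 * t) norm343) (g P)))))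
        where f : ∀ P Q → lit 6 * (lit 3 * P * (lit 3 * P)) - lit 6 * (lit 17 * Q * (lit 17 * Q)) ≡ lit 343 * (P * P) - lit 289 * (P * P + lit 6 * (Q * Q))
              f = Ring.solve-∀ ringQ
              g : ∀ P → lit 343 * (P * P) - lit 289 * lit 343 ≡ P * P * lit 343 - lit 17 * lit 17 * lit 343
              g = Ring.solve-∀ ringQ
    ... | no Q<0 = sq-cancel 0≤P (diff⇒≤ (≤⇒diff (*-monoʳ (0≤lit 6) (sq-le { - Q} {lit 3} (neg≤ Q<0) (diff⇒≤ (≤⇒diff lo ≤≡ e Q)))) ≤≡ trans (f P Q) (trans (cong (λ t → P * P + (lit 54 - t)) norm343) (g P))))
        where e : ∀ Q → Q - (- lit 3) ≡ lit 3 - (- Q)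
              e = Ring.solve-∀ ringQ
              f : ∀ P Q → lit 6 * (lit 3 * lit 3) - lit 6 * ((- Q) * (- Q)) ≡ P * P + (lit 54 - (P * P + lit 6 * (Q * Q)))
              f = Ring.solve-∀ ringQ
              g : ∀ P → P * P + (lit 54 - lit 343) ≡ P * P - lit 17 * lit 17
              g = Ring.solve-∀ ringQ

    upper⇒≤3 : 0ℚ ≤ P → lit 17 * Q ≤ lit 3 * P → Q ≤ lit 3
    upper⇒≤3 0≤P up with 0ℚ ≤? Q
    ... | no Q<0 = ≤-trans (<⇒≤ (≰⇒> Q<0)) (0≤lit 3)
    ... | yes 0≤Q = sq-cancel (0≤lit 3) (cancelʳ {lit 343} (toWitness {a? = 0ℚ <? lit 343} _)
         (diff⇒≤ (≤⇒diff (sq-le (0≤* (0≤lit 17) 0≤Q) up) ≤≡ trans (f P Q) (trans (cong (λ t → lit 9 * t - lit 343 * (Q * Q)) norm343) (g Q)))))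
        where f : ∀ P Q → lit 3 * P * (lit 3 * P) - lit 17 * Q * (lit 17 * Q) ≡ lit 9 * (P * P + lit 6 * (Q * Q)) - lit 343 * (Q * Q)
              f = Ring.solve-∀ ringQ
              g : ∀ Q → lit 9 * lit 343 - lit 343 * (Q * Q) ≡ lit 3 * lit 3 * lit 343 - Q * Q * lit 343
              g = Ring.solve-∀ ringQ

  -- On the unit circle |z - 1|² = 2 - 2 re z, so distances to 1 are compared through real parts.
  N-1 : ∀ z → Unit z → N (z ⊝ 1K) ≡ lit 2 - lit 2 * re z
  N-1 (a ⸴ b) u = trans (f a b) (trans (cong (λ t → t + (1ℚ - lit 2 * a)) u) (g a))
    where f : ∀ a b → (a + - 1ℚ) * (a + - 1ℚ) + lit 6 * ((b + - 0ℚ) * (b + - 0ℚ)) ≡ (a * a + lit 6 * (b * b)) + (1ℚ - lit 2 * a)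
          f = Ring.solve-∀ ringQ
          g : ∀ a → 1ℚ + (1ℚ - lit 2 * a) ≡ lit 2 - lit 2 * a
          g = Ring.solve-∀ ringQ

  N-expand : ∀ z → N z ≡ re z * re z + lit 6 * (im z * im z)
  N-expand (a ⸴ b) = refl

  re≤1 : ∀ z → Unit z → re z ≤ 1ℚ
  re≤1 z u = sq-cancel 0≤1 (≤-trans (re²≤N z) (≤-≡ u))

  im≤1 : ∀ z → Unit z → im z ≤ 1ℚ
  im≤1 z u = sq-cancel 0≤1 (≤-trans (diff⇒≤ (0≤* (0≤lit 5) (0≤sq (im z)) ≤≡ e (im z))) (≤-trans (im²≤N z) (≤-≡ u)))
    where e : ∀ b → lit 5 * (b * b) ≡ lit 6 * (b * b) - b * b
          e = Ring.solve-∀ ringQ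

  im-conj : ∀ z → im (conj z) ≡ - im z
  im-conj (a ⸴ b) = refl
  re-conj : ∀ z → re (conj z) ≡ re z
  re-conj (a ⸴ b) = refl
  im-⊖ : ∀ z → im (⊖ z) ≡ - im z
  im-⊖ (a ⸴ b) = refl

  -- A rotation by a small positive angle. `δs` is the least rise of Q per step inside a sector, so
  -- that `B` steps climb more than its height 6; `η` bounds the length of a step, and 8`B` steps,
  -- enough for two half-turns, have total length at most 7.
  record SmallStep : Set where
    field
      p q δs η : ℚ
      B : ℕ
      unit-h : Unit (p ⸴ q)
      0<q : 0ℚ < q
      9≤10p : lit 9 ≤ lit 10 * p
      q≤ : lit 10 * q ≤ 1ℚ
      0≤δs : 0ℚ ≤ δs
      step≥ : δs ≤ lit 17 * q - lit 3 * (1ℚ - p)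
      B-large : lit 6 < ι B * δs
      1-p≤ : lit 6 * (1ℚ - p) ≤ q
      h-1≼ : (p ⸴ q) ⊝ 1K ≼ η
      η≤q : lit 2 * η ≤ lit 5 * q
      lap≤7 : ι (8 ℕ.* B) * η ≤ lit 7

  module Walk (S : SmallStep) where
    open SmallStep S

    h : K
    h = p ⸴ q

    0<p : 0ℚ < p
    0<p = *-cancelˡ-<-nonNeg (lit 10) {{nonNegative (0≤lit 10)}} (<-≤-trans (toWitness {a? = lit 10 * 0ℚ <? lit 9} _) 9≤10p)

    0≤p : 0ℚ ≤ p
    0≤p = <⇒≤ 0<p
    0≤q : 0ℚ ≤ q
    0≤q = <⇒≤ 0<q

    p≤1 : p ≤ 1ℚ
    p≤1 = re≤1 h unit-h

    private
      -- the radial part stays positive on leaving the sector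
      out-pos : ∀ {P Q} → lit 17 ≤ P → Q ≤ lit 3 → 0ℚ ≤ P * p - lit 6 * (Q * q)
      out-pos {P} {Q} P≥ Q≤ = 0≤+ (0≤+ (0≤* (≤⇒diff P≥) 0≤p) (0≤* (≤⇒diff Q≤) (0≤* (0≤lit 6) 0≤q))) c ≤≡ e P Q p q
        where c : 0ℚ ≤ lit 17 * p - lit 18 * q
              c = cancelʳ {lit 10} (toWitness {a? = 0ℚ <? lit 10} _) (0≤+ (0≤+ (0≤* (0≤lit 17) (≤⇒diff 9≤10p)) (0≤* (0≤lit 18) (≤⇒diff q≤))) (toWitness {a? = 0ℚ ≤? lit 135} _) ≤≡ f p q)
                    where f : ∀ p q → lit 17 * (lit 10 * p - lit 9) + lit 18 * (1ℚ - lit 10 * q) + lit 135 ≡ (lit 17 * p - lit 18 * q) * lit 10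
                          f = Ring.solve-∀ ringQ
              e : ∀ P Q p q → (P - lit 17) * p + (lit 3 - Q) * (lit 6 * q) + (lit 17 * p - lit 18 * q) ≡ P * p - lit 6 * (Q * q)
              e = Ring.solve-∀ ringQ

      -- The increment Pq - Q(1 - p) is at least 17q - 3(1 - p).
      rise : ∀ {P Q} → lit 17 ≤ P → Q ≤ lit 3 → Q + δs ≤ P * q + Q * p
      rise {P} {Q} P≥ Q≤ = diff⇒≤ (0≤+ (0≤+ (0≤* (≤⇒diff P≥) 0≤q) (0≤* (≤⇒diff Q≤) (≤⇒diff p≤1))) (≤⇒diff step≥) ≤≡ e P Q p q δs)
        where e : ∀ P Q p q d → (P - lit 17) * q + (lit 3 - Q) * (1ℚ - p) + ((lit 17 * q - lit 3 * (1ℚ - p)) - d) ≡ (P * q + Q * p) - (Q + d)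
              e = Ring.solve-∀ ringQ

    ⊗↑1 : ∀ Z → Z ⊗ h ≡ Z ⊗ h ↑ 1
    ⊗↑1 Z = l Z h
      where l : ∀ z h → z ⊗ h ≡ z ⊗ (h ⊗ 1K)
            l = Ring.solve-∀ ringK

    Exit : ℕ → K → Set
    Exit k Z = ∃ λ i → i ℕ.≤ k × 0ℚ ≤ re (Z ⊗ h ↑ i) × lit 3 * re (Z ⊗ h ↑ i) ≤ lit 17 * im (Z ⊗ h ↑ i)

    -- k counts the steps left. After B - k steps the height is at least -3 + (B - k)δs; with k = 0
    -- it would exceed 3, which is outside the sector.
    sector : ∀ k Z → N Z ≡ lit 343 → 0ℚ ≤ re Z → lit 17 * im Z ≤ lit 3 * re Z → - lit 3 + (ι B - ι k) * δs ≤ im Z → k ℕ.≤ B → Exit k Z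
    sector zero Z@(P ⸴ Q) nz 0≤P up lo _ = ⊥-elim (<⇒≱ (<-≤-trans (diff⇒< (<⇒diff B-large <≡ e (ι B) δs)) (≤-trans (≤-≡ (cong (λ t → - lit 3 + (ι B - t) * δs) (sym (ι-lit 0)))) lo)) (Sector.upper⇒≤3 nz 0≤P up))
      where e : ∀ b d → b * d - lit 6 ≡ (- lit 3 + (b - 0ℚ) * d) - lit 3
            e = Ring.solve-∀ ringQ
    sector (suc k) Z@(P ⸴ Q) nz 0≤P up lo k≤B = go (lit 17 * (P * q + Q * p) ≤? lit 3 * (P * p - lit 6 * (Q * q)))
      where
      -3≤Q : - lit 3 ≤ Q
      -3≤Q = ≤-trans (diff⇒≤ (0≤* (≤⇒diff (ι-mono k≤B)) 0≤δs ≤≡ e ((ι B - ι (suc k)) * δs))) lo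
        where e : ∀ x → x ≡ (- lit 3 + x) - (- lit 3)
              e = Ring.solve-∀ ringQ
      P≥ : lit 17 ≤ P
      P≥ = Sector.inside⇒17≤ nz 0≤P up -3≤Q
      Q≤ : Q ≤ lit 3
      Q≤ = Sector.upper⇒≤3 nz 0≤P up
      lo′ : - lit 3 + (ι B - ι k) * δs ≤ P * q + Q * p
      lo′ = ≤-trans (diff⇒≤ (≤⇒diff lo ≤≡ trans (cong (λ s → Q - (- lit 3 + (ι B - s) * δs)) (ι-suc k)) (e (ι B) (ι k) δs Q))) (rise P≥ Q≤)
        where e : ∀ b k d Q → Q - (- lit 3 + (b - (1ℚ + k)) * d) ≡ (Q + d) - (- lit 3 + (b - k) * d)
              e = Ring.solve-∀ ringQ
      nz′ : N (Z ⊗ h) ≡ lit 343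
      nz′ = trans (N-⊗ Z h) (trans (cong₂ _*_ nz unit-h) refl)
      go : Dec (lit 17 * (P * q + Q * p) ≤ lit 3 * (P * p - lit 6 * (Q * q))) → Exit (suc k) Z
      go (no ¬up) = 1 , ℕ.s≤s ℕ.z≤n , subst (λ z → 0ℚ ≤ re z) (⊗↑1 Z) (out-pos P≥ Q≤) , subst (λ z → lit 3 * re z ≤ lit 17 * im z) (⊗↑1 Z) (<⇒≤ (≰⇒> ¬up))
      go (yes up′) = advance (sector k (Z ⊗ h) nz′ (out-pos P≥ Q≤) up′ lo′ (ℕ.<⇒≤ k≤B))
        where
        advance : Exit k (Z ⊗ h) → Exit (suc k) Z
        advance (i , i≤ , r , s) = suc i , ℕ.s≤s i≤ , subst (λ z → 0ℚ ≤ re z) (⊗-assoc Z h (h ↑ i)) r , subst (λ z → lit 3 * re z ≤ lit 17 * im z) (⊗-assoc Z h (h ↑ i)) s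

    -- One sector: from argument in [0, π] the point Y moves on until its argument exceeds that of ω.
    step : ∀ Y → Unit Y → 0ℚ ≤ im Y → ∃ λ i → i ℕ.≤ B × 0ℚ ≤ im (Y ⊗ h ↑ i) × 0ℚ ≤ im ((Y ⊗ h ↑ i) ⊗ conj ω)
    step Y u 0≤b = go (lit 17 * im L ≤? lit 3 * re L)
      where
      L = Y ⊗ conj v
      -- Multiplying Z · conj v by v gives 343 Z, and multiplying it by conj v gives 343 Z · conj ω;
      -- `low` and `high` read off imaginary parts.
      low : ∀ Z → ι 343 * im Z ≡ lit 3 * re (Z ⊗ conj v) + lit 17 * im (Z ⊗ conj v)
      low (a ⸴ b) = trans (cong (_* b) (ι-lit 343)) (e a b)
        where e : ∀ a b → lit 343 * b ≡ lit 3 * (a * lit 17 - lit 6 * (b * - lit 3)) + lit 17 * (a * - lit 3 + b * lit 17)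
              e = Ring.solve-∀ ringQ
      high : ∀ Z → ι 343 * im (Z ⊗ conj ω) ≡ lit 17 * im (Z ⊗ conj v) - lit 3 * re (Z ⊗ conj v)
      high (a ⸴ b) = trans (cong₂ _*_ (ι-lit 343) (im-conjω a b)) (trans (sym (*-assoc (lit 343) r₃₄₃ _)) (trans (cong (_* (a * - lit 102 + b * lit 235)) 343r) (e a b)))
        where e : ∀ a b → 1ℚ * (a * - lit 102 + b * lit 235) ≡ lit 17 * (a * - lit 3 + b * lit 17) - lit 3 * (a * lit 17 - lit 6 * (b * - lit 3))
              e = Ring.solve-∀ ringQ
      un343 : ∀ {x} → 0ℚ ≤ ι 343 * x → 0ℚ ≤ x
      un343 {x} l = cancelʳ {ι 343} (0<ι 342) (≤-trans (≤-≡ (*-zeroˡ (ι 343))) (l ≤≡ *-comm (ι 343) x))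
      lowL : 0ℚ ≤ lit 3 * re L + lit 17 * im L
      lowL = 0≤* (0≤ι 343) 0≤b ≤≡ low Y
      nL : N L ≡ lit 343
      nL = trans (N-⊗ Y (conj v)) (trans (cong (_* N (conj v)) u) refl)
      Goal = ∃ λ i → i ℕ.≤ B × 0ℚ ≤ im (Y ⊗ h ↑ i) × 0ℚ ≤ im ((Y ⊗ h ↑ i) ⊗ conj ω)
      go : Dec (lit 17 * im L ≤ lit 3 * re L) → Goal
      go (no ¬up) = 0 , ℕ.z≤n , subst (λ z → 0ℚ ≤ im z) (sym (Y1 Y)) 0≤b , subst (λ z → 0ℚ ≤ im (z ⊗ conj ω)) (sym (Y1 Y)) (un343 (≤⇒diff (<⇒≤ (≰⇒> ¬up)) ≤≡ sym (high Y)))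
        where Y1 : ∀ Y → Y ⊗ 1K ≡ Y
              Y1 = Ring.solve-∀ ringK
      go (yes up) = fin (sector B L nL 0≤re up start ℕ.≤-refl)
        where
        0≤re : 0ℚ ≤ re L
        0≤re = cancelʳ {lit 6} (toWitness {a? = 0ℚ <? lit 6} _) (≤-trans (≤-≡ (*-zeroˡ (lit 6))) (0≤+ lowL (≤⇒diff up) ≤≡ e (re L) (im L)))
          where e : ∀ P Q → (lit 3 * P + lit 17 * Q) + (lit 3 * P - lit 17 * Q) ≡ P * lit 6
                e = Ring.solve-∀ ringQ
        start : - lit 3 + (ι B - ι B) * δs ≤ im L
        start = ≤-trans (≤-≡ (e (ι B) δs)) (Sector.lower⇒-3≤ {re L} {im L} (trans (sym (N-expand L)) nL) lowL 0≤re)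
          where e : ∀ b d → - lit 3 + (b - b) * d ≡ - lit 3
                e = Ring.solve-∀ ringQ
        fin : Exit B L → Goal
        fin (i , i≤B , 0≤re′ , up′) = i , i≤B , un343 (0≤+ (0≤* (0≤lit 3) 0≤re″) 0≤17im ≤≡ sym (low Z)) , un343 (≤⇒diff up″ ≤≡ sym (high Z))
          where
          Z = Y ⊗ h ↑ i
          mv : L ⊗ h ↑ i ≡ Z ⊗ conj v
          mv = l Y (conj v) (h ↑ i)
            where l : ∀ y v h → (y ⊗ v) ⊗ h ≡ (y ⊗ h) ⊗ v
                  l = Ring.solve-∀ ringK
          0≤re″ = subst (λ z → 0ℚ ≤ re z) mv 0≤re′
          up″ = subst (λ z → lit 3 * re z ≤ lit 17 * im z) mv up′
          0≤17im = ≤-trans (0≤* (0≤lit 3) 0≤re″) up″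

    -- Angles are never measured: that the walk has passed s sectors is recorded by a remaining
    -- factor `Y` in the closed upper half-plane.
    Turned : ℕ → K → Set
    Turned s Z = ∃ λ i → i ℕ.≤ s ℕ.* B × ∃ λ Y → Unit Y × 0ℚ ≤ im Y × Y ⊗ ω ↑ s ≡ Z ⊗ h ↑ i

    turned : ∀ s Z → Unit Z → 0ℚ ≤ im Z → Turned s Z
    turned zero Z u 0≤im = 0 , ℕ.z≤n , Z , u , 0≤im , refl
    turned (suc s) Z u 0≤im = one (turned s Z u 0≤im)
      where
      one : Turned s Z → Turned (suc s) Z
      one (i , i≤ , Y , uY , imY , eq) = two (step Y uY imY)
        where
        two : (∃ λ j → j ℕ.≤ B × 0ℚ ≤ im (Y ⊗ h ↑ j) × 0ℚ ≤ im ((Y ⊗ h ↑ j) ⊗ conj ω)) → Turned (suc s) Z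
        two (j , j≤ , _ , c) = j ℕ.+ i , ℕ.+-mono-≤ j≤ i≤ , (Y ⊗ h ↑ j) ⊗ conj ω , unit-⊗ {Y ⊗ h ↑ j} (unit-⊗ {Y} uY (unit-↑ {h} j unit-h)) (unit-conj {ω} unit-ω) , c ,
          trans (l Y (h ↑ j) (conj ω) ω (ω ↑ s)) (trans (cong₂ (λ s t → s ⊗ (t ⊗ h ↑ j)) eq (unit-inv {ω} unit-ω)) (trans (l₂ Z (h ↑ i) (h ↑ j)) (cong (Z ⊗_) (sym (↑-+ h j i)))))
          where l : ∀ y g w′ w p → ((y ⊗ g) ⊗ w′) ⊗ (w ⊗ p) ≡ (y ⊗ p) ⊗ ((w ⊗ w′) ⊗ g)
                l = Ring.solve-∀ ringK
                l₂ : ∀ z a b → (z ⊗ a) ⊗ (1K ⊗ b) ≡ z ⊗ (b ⊗ a)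
                l₂ = Ring.solve-∀ ringK

    -- Four sectors make more than a half-turn.
    half-turn : ∀ Z → Unit Z → 0ℚ ≤ im Z → ∃ λ i → i ℕ.≤ 4 ℕ.* B × im (Z ⊗ h ↑ i) < 0ℚ
    half-turn Z u 0≤im = one (turned 3 Z u 0≤im)
      where
      -- Y has its argument between that of ω and π; since four times 46.76° exceeds 180°, Yω³ lies
      -- strictly below the axis.
      final : ∀ Y → Unit Y → 0ℚ ≤ im Y → 0ℚ ≤ im (Y ⊗ conj ω) → im (Y ⊗ (ω ⊗ (ω ⊗ ω))) < 0ℚ
      final (a ⸴ b) u 0≤b c = ≰⇒> λ 0≤ → no-unit (b≡0 (low₂ 0≤)) (a≡0 (low₂ 0≤))
        where
        unscale : ∀ {r x y} → 0ℚ < r → x ≡ r * y → 0ℚ ≤ x → 0ℚ ≤ y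
        unscale {r} {x} {y} 0<r e 0≤x = cancelʳ 0<r (≤-trans (≤-≡ (*-zeroˡ r)) (0≤x ≤≡ trans e (*-comm r y)))
        low₁ : 0ℚ ≤ a * - lit 102 + b * lit 235
        low₁ = unscale 0<r₃₄₃ (im-conjω a b) c
        low₂ : 0ℚ ≤ im ((a ⸴ b) ⊗ (ω ⊗ (ω ⊗ ω))) → 0ℚ ≤ a * lit 10531602 + b * - lit 31031045
        low₂ = unscale (0<* 0<r₃₄₃ (0<* 0<r₃₄₃ 0<r₃₄₃)) (im-ω³ a b)
        b≡0 : 0ℚ ≤ a * lit 10531602 + b * - lit 31031045 → b ≡ 0ℚ
        -- 690240120 = 102·31031045 - 235·10531602 comes from eliminating a between the two linear
        -- inequalities.
        b≡0 0≤ = ≤-antisym (cancelʳ {lit 690240120} (toWitness {a? = 0ℚ <? lit 690240120} _) (diff⇒≤ (0≤+ (0≤* (0≤lit 102) 0≤) (0≤* (0≤lit 10531602) low₁) ≤≡ e a b))) 0≤b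
          where e : ∀ a b → lit 102 * (a * lit 10531602 + b * - lit 31031045) + lit 10531602 * (a * - lit 102 + b * lit 235) ≡ 0ℚ * lit 690240120 - b * lit 690240120
                e = Ring.solve-∀ ringQ
        a≡0 : 0ℚ ≤ a * lit 10531602 + b * - lit 31031045 → a ≡ 0ℚ
        a≡0 0≤ = ≤-antisym (cancelʳ {lit 102} (toWitness {a? = 0ℚ <? lit 102} _) (diff⇒≤ (low₁ ≤≡ trans (cong (λ t → a * - lit 102 + t * lit 235) (b≡0 0≤)) (e a))))
           (cancelʳ {lit 10531602} (toWitness {a? = 0ℚ <? lit 10531602} _) (diff⇒≤ (0≤ ≤≡ trans (cong (λ t → a * lit 10531602 + t * - lit 31031045) (b≡0 0≤)) (f a))))
          where e : ∀ a → a * - lit 102 + 0ℚ * lit 235 ≡ 0ℚ * lit 102 - a * lit 102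
                e = Ring.solve-∀ ringQ
                f : ∀ a → a * lit 10531602 + 0ℚ * - lit 31031045 ≡ a * lit 10531602 - 0ℚ * lit 10531602
                f = Ring.solve-∀ ringQ
        no-unit : b ≡ 0ℚ → a ≡ 0ℚ → ⊥
        no-unit e f = unit≢0 u (cong₂ _⸴_ f e)
      one : Turned 3 Z → ∃ λ i → i ℕ.≤ 4 ℕ.* B × im (Z ⊗ h ↑ i) < 0ℚ
      one (i , i≤ , Y , uY , imY , eq) = two (step Y uY imY)
        where
        two : (∃ λ j → j ℕ.≤ B × 0ℚ ≤ im (Y ⊗ h ↑ j) × 0ℚ ≤ im ((Y ⊗ h ↑ j) ⊗ conj ω)) → _
        two (j , j≤ , b , c) = j ℕ.+ i , ℕ.+-mono-≤ j≤ i≤ , subst (λ z → im z < 0ℚ)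
            (trans (l Y (h ↑ j) ω) (trans (cong (_⊗ h ↑ j) eq) (trans (l₂ Z (h ↑ i) (h ↑ j)) (cong (Z ⊗_) (sym (↑-+ h j i))))))
            (final (Y ⊗ h ↑ j) (unit-⊗ {Y} uY (unit-↑ {h} j unit-h)) b c)
          where l : ∀ y g w → (y ⊗ g) ⊗ (w ⊗ (w ⊗ w)) ≡ (y ⊗ (w ⊗ (w ⊗ (w ⊗ 1K)))) ⊗ g
                l = Ring.solve-∀ ringK
                l₂ : ∀ z a b → (z ⊗ a) ⊗ b ≡ z ⊗ (b ⊗ a)
                l₂ = Ring.solve-∀ ringK

-- Full laps, and an n-th part of a lap

module LapCount where
  open Rationals
  open ParameterChoice using (least)
  open QuadraticField
  open CircleWalk
  open import Data.Rational
  open import Data.Rational.Properties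
  import Data.Nat as ℕ
  import Data.Nat.Properties as ℕ
  import Data.Nat.DivMod as ℕ
  open import Data.Nat.Tactic.RingSolver using (solve-∀)

  im-mul : ∀ Z W → im (Z ⊗ W) ≡ re Z * im W + im Z * re W
  im-mul (a ⸴ b) (c ⸴ d) = refl

  re-mul : ∀ Z W → re (Z ⊗ W) ≡ re Z * re W - lit 6 * (im Z * im W)
  re-mul (a ⸴ b) (c ⸴ d) = refl

  im≤bound : ∀ {z t} → z ≼ t → im z ≤ t
  im≤bound {z} (bound 0≤t n) = sq-cancel 0≤t (≤-trans (diff⇒≤ (0≤* (0≤lit 5) (0≤sq (im z)) ≤≡ e (im z))) (≤-trans (im²≤N z) n))
    where e : ∀ b → lit 5 * (b * b) ≡ lit 6 * (b * b) - b * b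
          e = Ring.solve-∀ ringQ

  re-⊝1 : ∀ z → re (z ⊝ 1K) ≡ re z - 1ℚ
  re-⊝1 (a ⸴ b) = refl
  im-⊝1 : ∀ z → im (z ⊝ 1K) ≡ im z
  im-⊝1 (a ⸴ b) = +-identityʳ b

  neg-sq : ∀ {t s} → 0ℚ ≤ s → t * t ≤ s * s → - s ≤ t
  neg-sq {t} {s} 0≤s h = diff⇒≤ (≤⇒diff (sq-cancel { - t} 0≤s (≤-trans (≤-≡ (e t)) h)) ≤≡ f s t)
    where e : ∀ t → - t * - t ≡ t * t
          e = Ring.solve-∀ ringQ
          f : ∀ s t → s - - t ≡ t - - s
          f = Ring.solve-∀ ringQ

  ι≡ : ∀ {a b} → a ≡ b → ι a ≡ ι b
  ι≡ = cong ι

  module _ (S : SmallStep) where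
    open SmallStep S
    open Walk S

    0≤η : 0ℚ ≤ η
    0≤η = nonneg h-1≼

    unit-Zh : ∀ {Z} i → Unit Z → Unit (Z ⊗ h ↑ i)
    unit-Zh {Z} i u = unit-⊗ {Z} u (unit-↑ {h} i unit-h)

    -- A step from below the axis to a point on or above it passes through 1, so Yh lies between 1
    -- and h on the circle. In coordinates, p = re(Yh · conj Y) = P′P + 6Q′Q ≤ P′P ≤ P′.
    cross : ∀ Y → Unit Y → im Y < 0ℚ → 0ℚ ≤ im (Y ⊗ h) → Y ⊗ h ⊝ 1K ≼ η
    cross Y u im<0 0≤im = bound 0≤η (≤-trans (≤-≡ (N-1 (Y ⊗ h) uh)) (≤-trans (diff⇒≤ (0≤* (0≤lit 2) (≤⇒diff p≤P′) ≤≡ e p P′)) (≤-trans (≤-≡ (sym (N-1 h unit-h))) (norm h-1≼))))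
      where
      uh = unit-⊗ {Y} u unit-h
      P = re Y
      Q = im Y
      P′ = re (Y ⊗ h)
      Q′ = im (Y ⊗ h)
      e : ∀ p P → lit 2 * (P - p) ≡ (lit 2 - lit 2 * p) - (lit 2 - lit 2 * P)
      e = Ring.solve-∀ ringQ
      p≡ : p ≡ P′ * P + lit 6 * (Q′ * Q)
      p≡ = trans (cong re (trans (l h) (trans (cong (h ⊗_) (sym (unit-inv {Y} u))) (l₂ h Y (conj Y))))) (trans (re-mul (Y ⊗ h) (conj Y)) (trans (cong₂ (λ s t → P′ * s - lit 6 * (Q′ * t)) (re-conj Y) (im-conj Y)) (f P′ P Q′ Q)))
        where l : ∀ h → h ≡ h ⊗ 1K
              l = Ring.solve-∀ ringK
              l₂ : ∀ h y y′ → h ⊗ (y ⊗ y′) ≡ (y ⊗ h) ⊗ y′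
              l₂ = Ring.solve-∀ ringK
              f : ∀ a b c d → a * b - lit 6 * (c * - d) ≡ a * b + lit 6 * (c * d)
              f = Ring.solve-∀ ringQ
      p≤PP : p ≤ P′ * P
      p≤PP = diff⇒≤ (0≤* (0≤lit 6) (0≤* 0≤im (<0⇒ im<0)) ≤≡ trans (f P′ P Q′ Q) (cong (λ t → P′ * P - t) (sym p≡)))
        where f : ∀ a b c d → lit 6 * (c * - d) ≡ a * b - (a * b + lit 6 * (c * d))
              f = Ring.solve-∀ ringQ
      0≤P : 0ℚ ≤ P
      0≤P = cancelʳ 0<q (≤-trans (≤-≡ (*-zeroˡ q)) (0≤+ 0≤im (0≤* (<0⇒ im<0) 0≤p) ≤≡ trans (cong (_+ - Q * p) (im-mul Y h)) (f (P * q) Q p)))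
        where f : ∀ x Q p → x + Q * p + - Q * p ≡ x
              f = Ring.solve-∀ ringQ
      0≤P′ : 0ℚ ≤ P′
      0≤P′ with 0ℚ ≤? P′
      ... | yes r = r
      ... | no ¬r = ⊥-elim (<⇒≱ 0<p (≤-trans p≤PP (diff⇒≤ (0≤* (neg≤ ¬r) 0≤P ≤≡ f P′ P))))
        where f : ∀ a b → - a * b ≡ 0ℚ - a * b
              f = Ring.solve-∀ ringQ
      p≤P′ : p ≤ P′
      p≤P′ = ≤-trans p≤PP (*-monoʳ 0≤P′ (re≤1 Y u) ≤≡ *-identityʳ P′)

    Up : K → Set
    Up Z = ∃ λ i → suc i ℕ.≤ 4 ℕ.* B × (∀ j → j ℕ.≤ i → im (Z ⊗ h ↑ j) < 0ℚ) × Z ⊗ h ↑ suc i ⊝ 1K ≼ η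

    shift : ∀ Z i → Z ⊗ h ↑ i ⊗ h ≡ Z ⊗ h ↑ suc i
    shift Z i = l Z (h ↑ i) h
      where l : ∀ z a h → z ⊗ a ⊗ h ≡ z ⊗ (h ⊗ a)
            l = Ring.solve-∀ ringK

    -- When -Z has been turned below the axis, Z has come above it; the first time this happens is a
    -- crossing at 1.
    up-crossing : ∀ Z → Unit Z → im Z < 0ℚ → Up Z
    up-crossing Z u im<0 = one (half-turn (⊖ Z) (trans (N-⊖ Z) u) (<0⇒ im<0 ≤≡ sym (im-⊖ Z)))
      where
      Pos : ℕ → Set
      Pos i = 0ℚ ≤ im (Z ⊗ h ↑ i)
      two : (∃ λ i → i ℕ.≤ 4 ℕ.* B × Pos i × (∀ j → j ℕ.< i → ¬ Pos j)) → (i : ℕ) → i ℕ.≤ 4 ℕ.* B → Up Z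
      two (zero , _ , pos , _) _ _ = ⊥-elim (<⇒≱ im<0 (pos ≤≡ cong im (l Z)))
        where l : ∀ z → z ⊗ 1K ≡ z
              l = Ring.solve-∀ ringK
      two (suc i , i≤ , pos , min) _ _ = i , i≤ , (λ j j≤ → ≰⇒> (min j (ℕ.s≤s j≤))) ,
        subst (λ t → t ⊝ 1K ≼ η) (shift Z i) (cross (Z ⊗ h ↑ i) (unit-Zh {Z} i u) (≰⇒> (min i ℕ.≤-refl)) (pos ≤≡ cong im (sym (shift Z i))))
      one : (∃ λ i → i ℕ.≤ 4 ℕ.* B × im (⊖ Z ⊗ h ↑ i) < 0ℚ) → Up Z
      one (i , i≤ , l) = two′ (least (λ i → 0ℚ ≤? im (Z ⊗ h ↑ i)) i (<0⇒ l ≤≡ trans (cong (λ t → - im t) (n Z (h ↑ i))) (trans (cong -_ (im-⊖ (Z ⊗ h ↑ i))) (nn (im (Z ⊗ h ↑ i))))))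
        where n : ∀ z g → ⊖ z ⊗ g ≡ ⊖ (z ⊗ g)
              n = Ring.solve-∀ ringK
              nn : ∀ x → - - x ≡ x
              nn = Ring.solve-∀ ringQ
              two′ : (∃ λ j → j ℕ.≤ i × Pos j × (∀ k → k ℕ.< j → ¬ Pos k)) → Up Z
              two′ (j , j≤ , r) = two (j , ℕ.≤-trans j≤ i≤ , r) i i≤

    -- One half-turn at most to get below the axis, and another to cross it upwards at 1.
    approach : ∀ Z → Unit Z → ∃ λ A → A ℕ.≤ 8 ℕ.* B × Z ⊗ h ↑ A ⊝ 1K ≼ η
    approach Z u = go (0ℚ ≤? im Z)
      where
      Goal = ∃ λ A → A ℕ.≤ 8 ℕ.* B × Z ⊗ h ↑ A ⊝ 1K ≼ η
      8B : 4 ℕ.* B ℕ.+ 4 ℕ.* B ≡ 8 ℕ.* B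
      8B = sym (ℕ.*-distribʳ-+ B 4 4)
      go : Dec (0ℚ ≤ im Z) → Goal
      go (no ¬0≤) = fin (up-crossing Z u (≰⇒> ¬0≤))
        where fin : Up Z → Goal
              fin (i , i≤ , _ , c) = suc i , ℕ.≤-trans i≤ (ℕ.*-monoˡ-≤ B (ℕ.m≤n+m 4 4)) , c
      go (yes 0≤) = one (half-turn Z u 0≤)
        where
        one : (∃ λ i → i ℕ.≤ 4 ℕ.* B × im (Z ⊗ h ↑ i) < 0ℚ) → Goal
        one (i , i≤ , l) = fin (up-crossing (Z ⊗ h ↑ i) (unit-Zh {Z} i u) l)
          where fin : Up (Z ⊗ h ↑ i) → Goal
                fin (j , j≤ , _ , c) = i ℕ.+ suc j , ℕ.≤-trans (ℕ.+-mono-≤ i≤ j≤) (ℕ.≤-reflexive 8B) ,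
                  ≼-≡ c (cong (_⊝ 1K) (trans (⊗-assoc Z (h ↑ i) (h ↑ suc j)) (cong (Z ⊗_) (sym (↑-+ h i (suc j))))))

    -- The powers of h stay above the axis up to `T₁`, then below it up to `T`, and then come back
    -- to 1. `1≤Tη` is a crude lower bound for the length of the circle.
    record Lap : Set where
      field
        T₁ T : ℕ
        T≤ : T ℕ.≤ 8 ℕ.* B
        1≤Tη : 1ℚ ≤ ι T * η
        upper : ∀ j → j ℕ.< T₁ → 0ℚ ≤ im (h ↑ j)
        lower : ∀ j → T₁ ℕ.≤ j → j ℕ.< T → im (h ↑ j) < 0ℚ
        closed : h ↑ T ⊝ 1K ≼ η

    h↑-1 : ∀ e → h ↑ e ⊝ 1K ≼ ι e * η
    h↑-1 e = ≼-≡ (unit-↑-close {h} {1K} e unit-h refl h-1≼) (cong (h ↑ e ⊝_) (1↑ e))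

    lap : Lap
    lap = one (half-turn 1K refl ≤-refl)
      where
      1⊗ : ∀ z → 1K ⊗ z ≡ z
      1⊗ = Ring.solve-∀ ringK
      Neg : ℕ → Set
      Neg i = im (h ↑ i) < 0ℚ
      one : (∃ λ i → i ℕ.≤ 4 ℕ.* B × im (1K ⊗ h ↑ i) < 0ℚ) → Lap
      one (i , i≤ , l) = two (least (λ i → im (h ↑ i) <? 0ℚ) i (subst (λ z → im z < 0ℚ) (1⊗ (h ↑ i)) l))
        where
        two : (∃ λ j → j ℕ.≤ i × Neg j × (∀ k → k ℕ.< j → ¬ Neg k)) → Lap
        two (zero , _ , neg , _) = ⊥-elim (<-irrefl refl neg)
        two (suc t , t≤ , neg , min) = three (up-crossing (h ↑ suc t) (unit-↑ {h} (suc t) unit-h) neg)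
          where
          three : Up (h ↑ suc t) → Lap
          three (k , k≤ , low , cl) = record
            { T₁ = suc t ; T = suc t ℕ.+ suc k
            ; T≤ = ℕ.≤-trans (ℕ.+-mono-≤ (ℕ.≤-trans t≤ i≤) k≤) (ℕ.≤-reflexive (sym (ℕ.*-distribʳ-+ B 4 4)))
            ; 1≤Tη = ≤-trans 1≤tη (*-monoˡ 0≤η (ι-mono (ℕ.≤-trans (ℕ.n≤1+n t) (ℕ.m≤m+n (suc t) (suc k)))))
            ; upper = λ j j< → ≮⇒≥ (min j j<)
            ; lower = λ j T₁≤j j<T → subst (λ z → im z < 0ℚ) (trans (sym (↑-+ h (suc t) (j ℕ.∸ suc t))) (cong (h ↑_) (ℕ.m+[n∸m]≡n T₁≤j)))
                 (low (j ℕ.∸ suc t) (ℕ.≤-trans (ℕ.∸-monoˡ-≤ (suc t) (ℕ.≤-pred (ℕ.≤-trans j<T (ℕ.≤-reflexive (ℕ.+-suc (suc t) k))))) (ℕ.≤-reflexive (ℕ.m+n∸m≡n (suc t) k))))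
            ; closed = ≼-≡ cl (cong (_⊝ 1K) (sym (↑-+ h (suc t) (suc k)))) }
            where
            -- From the first quadrant a step cannot go below the axis. So the last point above has
            -- negative real part, its distance to 1 exceeds 1, and t steps of size η cover that
            -- distance.
            re<0 : ¬ 0ℚ ≤ re (h ↑ t)
            re<0 0≤re = <⇒≱ (subst (λ z → im z < 0ℚ) (⊗-comm h (h ↑ t)) neg) (0≤+ (0≤* 0≤re 0≤q) (0≤* (≮⇒≥ (min t ℕ.≤-refl)) 0≤p) ≤≡ sym (im-mul (h ↑ t) h))
            1≤tη : 1ℚ ≤ ι t * η
            1≤tη = sq-cancel (0≤* (0≤ι t) 0≤η) (≤-trans (diff⇒≤ (0≤+ (0≤* (0≤lit 2) (neg≤ re<0)) 0≤1 ≤≡ trans (e (re (h ↑ t))) (cong (_- 1ℚ * 1ℚ) (sym (N-1 (h ↑ t) (unit-↑ {h} t unit-h)))))) (norm (h↑-1 t)))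
              where e : ∀ r → lit 2 * - r + 1ℚ ≡ (lit 2 - lit 2 * r) - 1ℚ * 1ℚ
                    e = Ring.solve-∀ ringQ

    -- If the real part is at least 1/2 after a step, it was so before the step, since Q and q are
    -- nonnegative. Each step then raises the imaginary part by Pq - Q(1 - p) ≥ q/2 - q/6 = q/3.
    mono : ∀ Y → Unit Y → ∀ i → (∀ j → j ℕ.≤ i → 0ℚ ≤ im (Y ⊗ h ↑ j)) → 1ℚ ≤ lit 2 * re (Y ⊗ h ↑ i) → ι i * q ≤ lit 3 * im (Y ⊗ h ↑ i)
    mono Y u zero pos _ = ≤-trans (≤-≡ (trans (cong (_* q) (ι-lit 0)) (*-zeroˡ q))) (0≤* (0≤lit 3) (pos 0 ℕ.z≤n))
    mono Y u (suc i) pos half = diff⇒≤ (0≤+ (0≤+ (≤⇒diff ih) (0≤* (≤⇒diff Q≤1) 0≤a)) (0≤+ (0≤* (≤⇒diff half-i) (0≤* mkhalf (0≤* (0≤lit 3) 0≤q))) (0≤* mkhalf (≤⇒diff 1-p≤))) ≤≡ trans (e (ι i) Q P p q) (cong₂ (λ s t → lit 3 * s - t * q) (trans (sym (im-mul Z h)) (cong im (shift Y i))) (sym (ι-suc i))))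
      where
      Z = Y ⊗ h ↑ i
      P = re Z
      Q = im Z
      uZ : Unit Z
      uZ = unit-Zh {Y} i u
      0≤Q : 0ℚ ≤ Q
      0≤Q = pos i (ℕ.n≤1+n i)
      mkhalf : 0ℚ ≤ ½
      mkhalf = toWitness {a? = 0ℚ ≤? ½} _
      Q≤1 : Q ≤ 1ℚ
      Q≤1 = im≤1 Z uZ
      half′ : 1ℚ ≤ lit 2 * (P * p)
      half′ = ≤-trans half (diff⇒≤ (0≤* (0≤lit 12) (0≤* 0≤Q 0≤q) ≤≡ trans (f P p Q q) (cong (λ t → lit 2 * (P * p) - lit 2 * t) (trans (sym (re-mul Z h)) (cong re (shift Y i))))))
        where f : ∀ P p Q q → lit 12 * (Q * q) ≡ lit 2 * (P * p) - lit 2 * (P * p - lit 6 * (Q * q))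
              f = Ring.solve-∀ ringQ
      0≤P : 0ℚ ≤ P
      0≤P with 0ℚ ≤? P
      ... | yes r = r
      ... | no ¬r = ⊥-elim (<⇒≱ (toWitness {a? = 0ℚ <? 1ℚ} _) (≤-trans half′ (diff⇒≤ (0≤* (0≤lit 2) (0≤* (neg≤ ¬r) 0≤p) ≤≡ f P p))))
        where f : ∀ a b → lit 2 * (- a * b) ≡ 0ℚ - lit 2 * (a * b)
              f = Ring.solve-∀ ringQ
      half-i : 1ℚ ≤ lit 2 * P
      half-i = ≤-trans half′ (*-monoʳ (0≤lit 2) (*-monoʳ 0≤P p≤1 ≤≡ *-identityʳ P))
      ih : ι i * q ≤ lit 3 * Q
      ih = mono Y u i (λ j j≤ → pos j (ℕ.m≤n⇒m≤1+n j≤)) half-i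
      0≤a : 0ℚ ≤ lit 3 * (1ℚ - p)
      0≤a = 0≤* (0≤lit 3) (≤⇒diff p≤1)
      e : ∀ i Q P p q → (lit 3 * Q - i * q) + (1ℚ - Q) * (lit 3 * (1ℚ - p)) + ((lit 2 * P - 1ℚ) * (½ * (lit 3 * q)) + ½ * (q - lit 6 * (1ℚ - p))) ≡ lit 3 * (P * q + Q * p) - (1ℚ + i) * q
      e = Ring.solve-∀ ringQ

    half-from-close : ∀ z τ → lit 2 * τ ≤ 1ℚ → z ⊝ 1K ≼ τ → 1ℚ ≤ lit 2 * re z
    half-from-close z τ 2τ≤1 (bound 0≤τ n) = diff⇒≤ (0≤+ (0≤* (0≤lit 2) (≤⇒diff lo)) (≤⇒diff 2τ≤1) ≤≡ e (re z) τ)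
      where lo : - τ ≤ re z - 1ℚ
            lo = neg-sq 0≤τ (≤-trans (≤-≡ (cong (λ t → t * t) (sym (re-⊝1 z)))) (≤-trans (re²≤N (z ⊝ 1K)) n))
            e : ∀ r τ → lit 2 * ((r - 1ℚ) - - τ) + (1ℚ - lit 2 * τ) ≡ lit 2 * r - 1ℚ
            e = Ring.solve-∀ ringQ

    -- a power of h within one lap that is close to 1 lies near one of the two ends of the lap
    near : (L : Lap) → ∀ ρ τ → ρ ℕ.< Lap.T L → h ↑ ρ ⊝ 1K ≼ τ → lit 2 * τ ≤ 1ℚ
      → ι ρ * q ≤ lit 3 * τ ⊎ ι (Lap.T L ℕ.∸ suc ρ) * q ≤ lit 3 * τ
    near L ρ τ ρ<T close 2τ≤1 = go (ρ ℕ.<? T₁)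
      where
      open Lap L
      1⊗ : ∀ z → z ≡ 1K ⊗ z
      1⊗ = Ring.solve-∀ ringK
      Goal = ι ρ * q ≤ lit 3 * τ ⊎ ι (T ℕ.∸ suc ρ) * q ≤ lit 3 * τ
      go : Dec (ρ ℕ.< T₁) → Goal
      go (yes ρ<T₁) = inj₁ (≤-trans (mono 1K refl ρ (λ j j≤ → subst (λ z → 0ℚ ≤ im z) (1⊗ (h ↑ j)) (upper j (ℕ.≤-<-trans j≤ ρ<T₁))) (subst (λ z → 1ℚ ≤ lit 2 * re z) (1⊗ (h ↑ ρ)) (half-from-close (h ↑ ρ) τ 2τ≤1 close)))
         (*-monoʳ (0≤lit 3) (subst (_≤ τ) (trans (im-⊝1 (h ↑ ρ)) (cong im (1⊗ (h ↑ ρ)))) (im≤bound close))))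
      go (no ρ≮T₁) = inj₂ (≤-trans (mono Y uY k above (subst (λ z → 1ℚ ≤ lit 2 * z) (trans (sym (re-conj (h ↑ ρ))) (cong re (sym (back k ρ kρ)))) (half-from-close (h ↑ ρ) τ 2τ≤1 close)))
         (*-monoʳ (0≤lit 3) (subst (_≤ τ) (trans (im-⊝1 (conj (h ↑ ρ))) (cong im (sym (back k ρ kρ)))) (im≤bound (≼-≡ (≼-conj close) (trans (conj-⊝ (h ↑ ρ) 1K) refl))))))
        where
        k = T ℕ.∸ suc ρ
        -- Conjugation reflects the lower arc, run backwards from the end of the lap, into the upper
        -- half-plane: Y h^j is the conjugate of h^(T-1-j).
        Y = conj (h ↑ (T ℕ.∸ 1))
        uY : Unit Y
        uY = unit-conj {h ↑ (T ℕ.∸ 1)} (unit-↑ {h} (T ℕ.∸ 1) unit-h)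
        kρ : k ℕ.+ ρ ≡ T ℕ.∸ 1
        kρ = trans (cong (ℕ._+ ρ) (trans (cong (T ℕ.∸_) (ℕ.+-comm 1 ρ)) (trans (sym (ℕ.∸-+-assoc T ρ 1)) (trans (ℕ.∸-+-assoc T ρ 1) (trans (cong (T ℕ.∸_) (ℕ.+-comm ρ 1)) (sym (ℕ.∸-+-assoc T 1 ρ))))))) (ℕ.m∸n+n≡m (ℕ.≤-pred (ℕ.≤-trans ρ<T (ℕ.≤-reflexive (sym (ℕ.m+[n∸m]≡n (ℕ.≤-trans (ℕ.s≤s ℕ.z≤n) ρ<T)))))))
        back : ∀ j i → j ℕ.+ i ≡ T ℕ.∸ 1 → Y ⊗ h ↑ j ≡ conj (h ↑ i)
        back j i e = trans (cong (λ m → conj (h ↑ m) ⊗ h ↑ j) (sym e)) (trans (cong (λ t → conj t ⊗ h ↑ j) (↑-+ h j i)) (trans (cong (_⊗ h ↑ j) (conj-⊗ (h ↑ j) (h ↑ i)))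
           (trans (l₁ (conj (h ↑ j)) (conj (h ↑ i)) (h ↑ j)) (trans (cong (_⊗ conj (h ↑ i)) (unit-inv {h ↑ j} (unit-↑ {h} j unit-h))) (sym (1⊗ (conj (h ↑ i))))))))
          where l₁ : ∀ a b c → (a ⊗ b) ⊗ c ≡ (c ⊗ a) ⊗ b
                l₁ = Ring.solve-∀ ringK
        above : ∀ j → j ℕ.≤ k → 0ℚ ≤ im (Y ⊗ h ↑ j)
        above j j≤k = <0⇒ (lower i T₁≤i i<T) ≤≡ trans (sym (im-conj (h ↑ i))) (cong im (sym (back j i ji)))
          where
          i = (k ℕ.∸ j) ℕ.+ ρ
          ji : j ℕ.+ i ≡ T ℕ.∸ 1
          ji = trans (sym (ℕ.+-assoc j (k ℕ.∸ j) ρ)) (trans (cong (ℕ._+ ρ) (ℕ.m+[n∸m]≡n j≤k)) kρ)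
          T₁≤i : T₁ ℕ.≤ i
          T₁≤i = ℕ.≤-trans (ℕ.≮⇒≥ ρ≮T₁) (ℕ.m≤n+m ρ (k ℕ.∸ j))
          i<T : i ℕ.< T
          i<T = ℕ.≤-trans (ℕ.s≤s (ℕ.≤-trans (ℕ.m≤n+m i j) (ℕ.≤-reflexive ji))) (ℕ.≤-reflexive (ℕ.m+[n∸m]≡n (ℕ.≤-trans (ℕ.s≤s ℕ.z≤n) ρ<T)))

    h↑-dist : ∀ a b e → a ≡ b ℕ.+ e → h ↑ a ⊝ h ↑ b ≼ ι e * η
    h↑-dist a b e refl = ≼-mono (≼-≡ (≼-⊗ (unit≼ {h ↑ b} (unit-↑ {h} b unit-h)) (h↑-1 e)) (trans (l (h ↑ b) (h ↑ e)) (cong (_⊝ h ↑ b) (sym (↑-+ h b e))))) (≤-≡ (*-identityˡ _))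
      where l : ∀ x y → x ⊗ (y ⊝ 1K) ≡ x ⊗ y ⊝ x
            l = Ring.solve-∀ ringK

    -- `g` takes the part of exp(2πi/n): nearly an n-th root of unity, with n|g - 1| bounded, and β
    -- is nearly one of its powers.
    record Arc (β : K) (n : ℕ) (δ : ℚ) : Set where
      field
        g : K
        k : ℕ
        k≤8n : k ℕ.≤ 8 ℕ.* n
        θ : ℚ
        unit-g : Unit g
        g-1≼ : g ⊝ 1K ≼ θ
        nθ≤7 : ι n * θ ≤ lit 7
        gⁿ≼ : g ↑ n ⊝ 1K ≼ ι n * η
        β≼ : β ⊝ g ↑ k ≼ lit 8 * δ + lit 74 * (ι n * η)

    module _ (β : K) (uβ : Unit β) (n : ℕ) .{{_ : ℕ.NonZero n}} (δ : ℚ) (βⁿ : β ↑ n ⊝ 1K ≼ δ) (small : lit 2 * (lit 8 * (ι n * η) + δ) ≤ 1ℚ)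
      (L : Lap) (A : ℕ) (A≤ : A ℕ.≤ 8 ℕ.* B) (close : conj β ⊗ h ↑ A ⊝ 1K ≼ η) where
      open Lap L

      private
        0≤nη : 0ℚ ≤ ι n * η
        0≤nη = 0≤* (0≤ι n) 0≤η

        T≢0 : ℕ.NonZero T
        T≢0 = ℕ.≢-nonZero λ e → <⇒≱ (toWitness {a? = 0ℚ <? 1ℚ} _) (≤-trans 1≤Tη (≤-≡ (trans (cong (λ t → ι t * η) e) (trans (cong (_* η) (ι-lit 0)) (*-zeroˡ η)))))

        instance
          nzT : ℕ.NonZero T
          nzT = T≢0

        -- One n-th of a lap, rounded down; `g` will be h^f.
        f = T ℕ./ n
        r₀ = T ℕ.% n
        r₀<n : r₀ ℕ.< n
        r₀<n = ℕ.m%n<n T n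
        T≡ : T ≡ f ℕ.* n ℕ.+ r₀
        T≡ = trans (ℕ.m≡m%n+[m/n]*n T n) (ℕ.+-comm r₀ _)

        hA≼β : h ↑ A ⊝ β ≼ η
        hA≼β = ≼-mono (≼-≡ (≼-⊗ (unit≼ {β} uβ) close) (trans (l β (conj β) (h ↑ A)) (trans (cong (λ t → t ⊗ h ↑ A ⊝ β) (unit-inv {β} uβ)) (l₂ (h ↑ A) β)))) (≤-≡ (*-identityˡ η))
          where l : ∀ b b′ x → b ⊗ (b′ ⊗ x ⊝ 1K) ≡ (b ⊗ b′) ⊗ x ⊝ b
                l = Ring.solve-∀ ringK
                l₂ : ∀ x b → 1K ⊗ x ⊝ b ≡ x ⊝ b
                l₂ = Ring.solve-∀ ringK

        -- h^(An) ≈ βⁿ ≈ 1 after q′ complete laps, so the remainder ρ lies near one of the ends of a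
        -- lap.
        q′ = (A ℕ.* n) ℕ./ T
        ρ = (A ℕ.* n) ℕ.% T
        ρ<T : ρ ℕ.< T
        ρ<T = ℕ.m%n<n (A ℕ.* n) T
        An≡ : A ℕ.* n ≡ ρ ℕ.+ q′ ℕ.* T
        An≡ = ℕ.m≡m%n+[m/n]*n (A ℕ.* n) T

        -- A lap has Tη ≥ 1, whereas Aη ≤ 8Bη ≤ 7.
        q′≤7n : ι q′ ≤ lit 7 * ι n
        q′≤7n = ≤-trans (diff⇒≤ (0≤* (0≤ι q′) (≤⇒diff 1≤Tη) ≤≡ e₀ (ι q′) (ι T * η))) (≤-trans (≤-≡ (trans (sym (*-assoc (ι q′) (ι T) η)) (cong (_* η) (sym (ι-* q′ T)))))
            (≤-trans (*-monoˡ 0≤η (ι-mono {q′ ℕ.* T} {A ℕ.* n} (ℕ.≤-trans (ℕ.m≤n+m _ ρ) (ℕ.≤-reflexive (sym An≡))))) (≤-trans (≤-≡ (trans (cong (_* η) (ι-* A n)) (e₁ (ι A) (ι n) η)))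
             (≤-trans (*-monoˡ (0≤ι n) (*-monoˡ 0≤η (ι-mono A≤))) (*-monoˡ (0≤ι n) lap≤7)))))
          where e₀ : ∀ a b → a * (b - 1ℚ) ≡ a * b - a
                e₀ = Ring.solve-∀ ringQ
                e₁ : ∀ a b c → a * b * c ≡ a * c * b
                e₁ = Ring.solve-∀ ringQ

        q′η : ι q′ * η ≤ lit 7 * (ι n * η)
        q′η = ≤-trans (*-monoˡ 0≤η q′≤7n) (≤-≡ (*-assoc (lit 7) (ι n) η))

        τ = lit 8 * (ι n * η) + δ

        hρ : h ↑ ρ ⊝ 1K ≼ τ
        hρ = ≼-mono (≼-trans {h ↑ ρ} {h ↑ (A ℕ.* n)} {1K} step₁ (≼-trans {h ↑ (A ℕ.* n)} {β ↑ n} {1K} step₂ βⁿ)) (≤-trans (+-monoˡ-≤ (ι n * η + δ) q′η) (≤-≡ (e (ι n * η) δ)))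
          where
          e : ∀ x d → lit 7 * x + (x + d) ≡ lit 8 * x + d
          e = Ring.solve-∀ ringQ
          step₁ : h ↑ ρ ⊝ h ↑ (A ℕ.* n) ≼ ι q′ * η
          step₁ = ≼-swap (≼-mono (≼-≡ (≼-⊗ (unit≼ {h ↑ ρ} (unit-↑ {h} ρ unit-h)) (unit-↑-close {h ↑ T} {1K} q′ (unit-↑ {h} T unit-h) refl closed))
              (trans (cong (λ t → h ↑ ρ ⊗ ((h ↑ T) ↑ q′ ⊝ t)) (1↑ q′)) (trans (l (h ↑ ρ) ((h ↑ T) ↑ q′)) (cong (_⊝ h ↑ ρ) (trans (cong (h ↑ ρ ⊗_) (trans (sym (↑-* h T q′)) (cong (h ↑_) (ℕ.*-comm T q′)))) (trans (sym (↑-+ h ρ (q′ ℕ.* T))) (cong (h ↑_) (sym An≡)))))))) (≤-≡ (*-identityˡ _)))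
            where l : ∀ x y → x ⊗ (y ⊝ 1K) ≡ x ⊗ y ⊝ x
                  l = Ring.solve-∀ ringK
          step₂ : h ↑ (A ℕ.* n) ⊝ β ↑ n ≼ ι n * η
          step₂ = ≼-≡ (unit-↑-close {h ↑ A} {β} n (unit-↑ {h} A unit-h) uβ hA≼β) (cong (_⊝ β ↑ n) (sym (↑-* h A n)))

        -- η is at most 5q/2, and 5/2 times 3τ is below 8τ.
        q→η : ∀ x → ι x * q ≤ lit 3 * τ → ι x * η ≤ lit 8 * τ
        q→η x h = cancelʳ {lit 2} (toWitness {a? = 0ℚ <? lit 2} _) (≤-trans (≤-≡ (e₀ (ι x) η)) (≤-trans (*-monoʳ (0≤ι x) η≤q) (≤-trans (≤-≡ (e₁ (ι x) q)) (≤-trans (*-monoʳ (0≤lit 5) h)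
            (diff⇒≤ (nonneg hρ ≤≡ e₂ τ))))))
          where e₀ : ∀ x y → x * y * lit 2 ≡ x * (lit 2 * y)
                e₀ = Ring.solve-∀ ringQ
                e₁ : ∀ x y → x * (lit 5 * y) ≡ lit 5 * (x * y)
                e₁ = Ring.solve-∀ ringQ
                e₂ : ∀ t → t ≡ lit 8 * t * lit 2 - lit 5 * (lit 3 * t)
                e₂ = Ring.solve-∀ ringQ

        -- the exponent κ with |A − fκ| ≤ κ + s, where s bounds the distance to the end of a lap
        finish : ∀ κ s e → κ ℕ.≤ suc q′ → ι s * η ≤ η + lit 8 * τ → e ℕ.≤ κ ℕ.+ s → A ≡ f ℕ.* κ ℕ.+ e ⊎ f ℕ.* κ ≡ A ℕ.+ e → Arc β n δ
        finish κ s e κ≤ sη e≤ rel = record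
          { g = h ↑ f ; k = κ ; k≤8n = ι-cancel-≤ (≤-trans (ι-mono κ≤) (≤-trans (≤-≡ (ι-suc q′)) (≤-trans (+-mono-≤ 1≤n q′≤7n) (≤-≡ (trans (e₄ (ι n)) (trans (cong (_* ι n) (sym (ι-lit 8))) (sym (ι-* 8 n)))))))) ; θ = ι f * η ; unit-g = unit-↑ {h} f unit-h ; g-1≼ = h↑-1 f
          ; nθ≤7 = ≤-trans (≤-≡ (trans (sym (*-assoc (ι n) (ι f) η)) (cong (_* η) (trans (*-comm (ι n) (ι f)) (sym (ι-* f n)))))) (≤-trans (*-monoˡ 0≤η (ι-mono (ℕ.≤-trans (ℕ.m≤m+n _ r₀) (ℕ.≤-trans (ℕ.≤-reflexive (sym T≡)) T≤)))) lap≤7)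
          ; gⁿ≼ = ≼-mono (≼-trans {(h ↑ f) ↑ n} {h ↑ T} {1K} (≼-≡ (≼-swap (h↑-dist T (f ℕ.* n) r₀ T≡)) (cong (_⊝ h ↑ T) (↑-* h f n))) closed)
               (≤-trans (≤-≡ (trans (e₁ (ι r₀) η) (cong (_* η) (sym (ι-suc r₀))))) (*-monoˡ 0≤η (ι-mono r₀<n)))
          ; β≼ = ≼-mono (≼-trans {β} {h ↑ A} {(h ↑ f) ↑ κ} (≼-swap hA≼β) (≼-≡ (dist rel) (cong (h ↑ A ⊝_) (↑-* h f κ)))) total }
          where
          e₁ : ∀ r x → r * x + x ≡ (1ℚ + r) * x
          e₁ = Ring.solve-∀ ringQ
          e₄ : ∀ n → n + lit 7 * n ≡ lit 8 * n
          e₄ = Ring.solve-∀ ringQ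
          1≤n : 1ℚ ≤ ι n
          1≤n = ≤-trans (≤-≡ (sym (ι-lit 1))) (ι-mono (ℕ.≤-trans (ℕ.s≤s ℕ.z≤n) r₀<n))
          dist : A ≡ f ℕ.* κ ℕ.+ e ⊎ f ℕ.* κ ≡ A ℕ.+ e → h ↑ A ⊝ h ↑ (f ℕ.* κ) ≼ ι e * η
          dist (inj₁ r) = h↑-dist A (f ℕ.* κ) e r
          dist (inj₂ r) = ≼-swap (h↑-dist (f ℕ.* κ) A e r)
          -- The parts are η for β ≈ h^A, η + 7nη for κ, and η + 8τ for s, where τ = 8nη + δ. As n ≥
          -- 1, the sum is at most (3 + 7 + 64)nη + 8δ.
          total : η + ι e * η ≤ lit 8 * δ + lit 74 * (ι n * η)
          total = ≤-trans (+-monoʳ-≤ η (≤-trans (*-monoˡ 0≤η (ι-mono e≤)) (≤-trans (≤-≡ (trans (cong (_* η) (ι-+ κ s)) (*-distribʳ-+ η (ι κ) (ι s))))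
             (+-mono-≤ (≤-trans (*-monoˡ 0≤η (ι-mono κ≤)) (≤-trans (≤-≡ (trans (cong (_* η) (ι-suc q′)) (e₂ (ι q′) η))) (+-monoʳ-≤ η q′η))) sη))))
             (diff⇒≤ (0≤* (0≤lit 3) (0≤* (≤⇒diff 1≤n) 0≤η) ≤≡ e₃ (ι n) η δ))
            where
            e₂ : ∀ a x → (1ℚ + a) * x ≡ x + a * x
            e₂ = Ring.solve-∀ ringQ
            e₃ : ∀ n x d → lit 3 * ((n - 1ℚ) * x) ≡ lit 8 * d + lit 74 * (n * x) - (x + ((x + lit 7 * (n * x)) + (x + lit 8 * (lit 8 * (n * x) + d))))
            e₃ = Ring.solve-∀ ringQ

        cancel-n : ∀ {a b} → a ℕ.* n ℕ.≤ b ℕ.* n → a ℕ.≤ b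
        cancel-n {a} {b} = ℕ.*-cancelʳ-≤ a b n

        -- ρ is near 0: take κ = q′, with n(A - fq′) = r₀q′ + ρ ≤ n(q′ + ρ).
        case₁ : ι ρ * q ≤ lit 3 * τ → Arc β n δ
        case₁ l = finish q′ ρ e (ℕ.n≤1+n q′) (≤-trans (q→η ρ l) (diff⇒≤ (0≤η ≤≡ e₀ η (lit 8 * τ)))) e≤ (inj₁ (sym (ℕ.m+[n∸m]≡n fκ≤A)))
          where
          e₀ : ∀ x y → x ≡ (x + y) - y
          e₀ = Ring.solve-∀ ringQ
          An′ : A ℕ.* n ≡ f ℕ.* q′ ℕ.* n ℕ.+ (r₀ ℕ.* q′ ℕ.+ ρ)
          An′ = trans An≡ (trans (cong (λ t → ρ ℕ.+ q′ ℕ.* t) T≡) (l′ ρ q′ f n r₀))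
            where l′ : ∀ ρ q f n r → ρ ℕ.+ q ℕ.* (f ℕ.* n ℕ.+ r) ≡ f ℕ.* q ℕ.* n ℕ.+ (r ℕ.* q ℕ.+ ρ)
                  l′ = solve-∀
          fκ≤A : f ℕ.* q′ ℕ.≤ A
          fκ≤A = cancel-n (ℕ.≤-trans (ℕ.m≤m+n _ _) (ℕ.≤-reflexive (sym An′)))
          e = A ℕ.∸ f ℕ.* q′
          en : e ℕ.* n ≡ r₀ ℕ.* q′ ℕ.+ ρ
          en = trans (ℕ.*-distribʳ-∸ n A (f ℕ.* q′)) (trans (cong (ℕ._∸ f ℕ.* q′ ℕ.* n) An′) (ℕ.m+n∸m≡n (f ℕ.* q′ ℕ.* n) _))
          e≤ : e ℕ.≤ q′ ℕ.+ ρ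
          e≤ = cancel-n (ℕ.≤-trans (ℕ.≤-reflexive en) (ℕ.≤-trans (ℕ.+-mono-≤ (ℕ.≤-trans (ℕ.≤-reflexive (ℕ.*-comm r₀ q′)) (ℕ.*-monoʳ-≤ q′ (ℕ.<⇒≤ r₀<n))) (ℕ.m≤m*n ρ n)) (ℕ.≤-reflexive (sym (ℕ.*-distribʳ-+ n q′ ρ)))))

        -- ρ is near T: the lap in progress counts as complete, κ = q′ + 1, and fκ may lie on either
        -- side of A.
        case₂ : ι (T ℕ.∸ suc ρ) * q ≤ lit 3 * τ → Arc β n δ
        case₂ l = go (ℕ.≤-total A (f ℕ.* k′))
          where
          k′ = suc q′
          s = T ℕ.∸ ρ
          s≡ : s ≡ suc (T ℕ.∸ suc ρ)
          s≡ = trans (cong (ℕ._∸ ρ) (sym (ℕ.m+[n∸m]≡n ρ<T))) (trans (cong (λ t → t ℕ.∸ ρ) (sym (ℕ.+-suc ρ (T ℕ.∸ suc ρ)))) (ℕ.m+n∸m≡n ρ _))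
          sη : ι s * η ≤ η + lit 8 * τ
          sη = ≤-trans (≤-≡ (trans (cong (λ t → ι t * η) s≡) (trans (cong (_* η) (ι-suc (T ℕ.∸ suc ρ))) (e₀ (ι (T ℕ.∸ suc ρ)) η)))) (+-monoʳ-≤ η (q→η (T ℕ.∸ suc ρ) l))
            where e₀ : ∀ a x → (1ℚ + a) * x ≡ x + a * x
                  e₀ = Ring.solve-∀ ringQ
          rel : A ℕ.* n ℕ.+ s ≡ f ℕ.* k′ ℕ.* n ℕ.+ r₀ ℕ.* k′
          rel = trans (cong (ℕ._+ s) An≡) (trans (l₁ ρ (q′ ℕ.* T) s) (trans (cong (ℕ._+ q′ ℕ.* T) (ℕ.m+[n∸m]≡n (ℕ.<⇒≤ ρ<T))) (trans (cong (k′ ℕ.*_) T≡) (l₂ k′ f n r₀))))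
            where l₁ : ∀ a b c → a ℕ.+ b ℕ.+ c ≡ a ℕ.+ c ℕ.+ b
                  l₁ = solve-∀
                  l₂ : ∀ k f n r → k ℕ.* (f ℕ.* n ℕ.+ r) ≡ f ℕ.* k ℕ.* n ℕ.+ r ℕ.* k
                  l₂ = solve-∀
          go : A ℕ.≤ f ℕ.* k′ ⊎ f ℕ.* k′ ℕ.≤ A → Arc β n δ
          go (inj₁ A≤fk′) = finish k′ s e ℕ.≤-refl sη (ℕ.≤-trans e≤s (ℕ.m≤n+m s k′)) (inj₂ (sym (ℕ.m+[n∸m]≡n A≤fk′)))
            where
            e = f ℕ.* k′ ℕ.∸ A
            e≤s : e ℕ.≤ s
            e≤s = ℕ.≤-trans (ℕ.m≤m*n e n) (ℕ.≤-trans (ℕ.≤-reflexive (ℕ.*-distribʳ-∸ n (f ℕ.* k′) A)) (ℕ.≤-trans (ℕ.∸-monoˡ-≤ (A ℕ.* n) (ℕ.≤-trans (ℕ.m≤m+n _ (r₀ ℕ.* k′)) (ℕ.≤-reflexive (sym rel)))) (ℕ.≤-reflexive (ℕ.m+n∸m≡n (A ℕ.* n) s))))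
          go (inj₂ fk′≤A) = finish k′ s e ℕ.≤-refl sη (ℕ.≤-trans e≤k′ (ℕ.m≤m+n k′ s)) (inj₁ (sym (ℕ.m+[n∸m]≡n fk′≤A)))
            where
            e = A ℕ.∸ f ℕ.* k′
            e≤k′ : e ℕ.≤ k′
            e≤k′ = cancel-n (ℕ.≤-trans (ℕ.≤-reflexive (ℕ.*-distribʳ-∸ n A (f ℕ.* k′))) (ℕ.≤-trans (ℕ.∸-monoˡ-≤ (f ℕ.* k′ ℕ.* n) (ℕ.≤-trans (ℕ.m≤m+n (A ℕ.* n) s) (ℕ.≤-reflexive rel))) (ℕ.≤-trans (ℕ.≤-reflexive (ℕ.m+n∸m≡n (f ℕ.* k′ ℕ.* n) _)) (ℕ.≤-trans (ℕ.≤-reflexive (ℕ.*-comm r₀ k′)) (ℕ.*-monoʳ-≤ k′ (ℕ.<⇒≤ r₀<n))))))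

      arc-from : Arc β n δ
      arc-from = go (near L ρ τ ρ<T hρ small)
        where go : ι ρ * q ≤ lit 3 * τ ⊎ ι (T ℕ.∸ suc ρ) * q ≤ lit 3 * τ → Arc β n δ
              go (inj₁ l) = case₁ l
              go (inj₂ l) = case₂ l

    arc : ∀ β → Unit β → ∀ n .{{_ : ℕ.NonZero n}} δ → β ↑ n ⊝ 1K ≼ δ → lit 2 * (lit 8 * (ι n * η) + δ) ≤ 1ℚ → Arc β n δ
    arc β uβ n δ βⁿ small = go (approach (conj β) (unit-conj {β} uβ))
      where go : (∃ λ A → A ℕ.≤ 8 ℕ.* B × conj β ⊗ h ↑ A ⊝ 1K ≼ η) → Arc β n δ
            go (A , A≤ , close) = arc-from β uβ n δ βⁿ small lap A A≤ close

-- Explicit small rotations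

module SmallSteps where
  open Rationals
  open QuadraticField
  open CircleWalk
  open LapCount
  open import Data.Rational
  open import Data.Rational.Properties
  import Data.Nat as ℕ
  import Data.Nat.Properties as ℕ

  -- The unit (m + √−6)² / (m² + 6) for m = 1000 T.
  module Step (T s i : ℚ) (1≤T : 1ℚ ≤ T) (0≤s : 0ℚ ≤ s) (0<i : 0ℚ < i) (Ts : lit 10000 * (T * s) ≡ 1ℚ)
    (Di : (lit 1000 * T * (lit 1000 * T) + lit 6) * i ≡ 1ℚ) (B : ℕ) (B≡ : ι B ≡ T * lit 177) where

    a D p q δs η : ℚ
    a = lit 1000 * T
    D = a * a + lit 6
    p = (a * a - lit 6) * i
    q = lit 2 * (a * i)
    -- Equal to 17q - 3(1 - p), as q = 2a/D and 1 - p = 12/D.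
    δs = (lit 34 * a - lit 36) * i
    -- s = 1/(10a), so η = 4.9/a, just above |h - 1| = 2√6/√(a² + 6).
    η = lit 49 * s

    private
      0≤i : 0ℚ ≤ i
      0≤i = <⇒≤ 0<i

      0≤T : 0ℚ ≤ T
      0≤T = ≤-trans 0≤1 1≤T

      a≥ : 0ℚ ≤ a - lit 1000
      a≥ = 0≤* (0≤lit 1000) (≤⇒diff 1≤T) ≤≡ e T
        where e : ∀ t → lit 1000 * (t - 1ℚ) ≡ lit 1000 * t - lit 1000
              e = Ring.solve-∀ ringQ

      0≤a : 0ℚ ≤ a
      0≤a = 0≤* (0≤lit 1000) 0≤T

      0<a : 0ℚ < a
      0<a = 0<* (toWitness {a? = 0ℚ <? lit 1000} _) (<-≤-trans (toWitness {a? = 0ℚ <? 1ℚ} _) 1≤T)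

      1-p : 1ℚ - p ≡ lit 12 * i
      1-p = trans (cong (_- p) (sym Di)) (e a i)
        where e : ∀ a i → (a * a + lit 6) * i - (a * a - lit 6) * i ≡ lit 12 * i
              e = Ring.solve-∀ ringQ

      10as : lit 10 * (a * s) ≡ 1ℚ
      10as = trans (e T s) Ts
        where e : ∀ t s → lit 10 * (lit 1000 * t * s) ≡ lit 10000 * (t * s)
              e = Ring.solve-∀ ringQ

      unit-h : Unit (p ⸴ q)
      unit-h = trans (e a i) (trans (cong₂ _*_ Di Di) refl)
        where e : ∀ a i → (a * a - lit 6) * i * ((a * a - lit 6) * i) + lit 6 * (lit 2 * (a * i) * (lit 2 * (a * i))) ≡ (a * a + lit 6) * i * ((a * a + lit 6) * i)
              e = Ring.solve-∀ ringQ

      9≤10p : lit 9 ≤ lit 10 * p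
      9≤10p = diff⇒≤ (0≤* (0≤+ (0≤* a≥ (0≤+ 0≤a (0≤lit 1000))) (0≤lit 999886)) 0≤i ≤≡ trans (e a i) (cong (λ t → lit 10 * p - lit 9 * t) Di))
        where e : ∀ a i → ((a - lit 1000) * (a + lit 1000) + lit 999886) * i ≡ lit 10 * ((a * a - lit 6) * i) - lit 9 * ((a * a + lit 6) * i)
              e = Ring.solve-∀ ringQ

      q≤ : lit 10 * q ≤ 1ℚ
      q≤ = diff⇒≤ (0≤* (0≤+ (0≤* a≥ (0≤+ 0≤a (0≤lit 980))) (0≤lit 980006)) 0≤i ≤≡ trans (e a i) (cong (_- lit 10 * q) Di))
        where e : ∀ a i → ((a - lit 1000) * (a + lit 980) + lit 980006) * i ≡ (a * a + lit 6) * i - lit 10 * (lit 2 * (a * i))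
              e = Ring.solve-∀ ringQ

      0≤δs : 0ℚ ≤ δs
      0≤δs = 0≤* (0≤+ (0≤* (0≤lit 34) a≥) (0≤lit 33964) ≤≡ e a) 0≤i
        where e : ∀ a → lit 34 * (a - lit 1000) + lit 33964 ≡ lit 34 * a - lit 36
              e = Ring.solve-∀ ringQ

      step≥ : δs ≤ lit 17 * q - lit 3 * (1ℚ - p)
      step≥ = ≤-≡ (trans (e a i) (cong (λ t → lit 17 * q - lit 3 * t) (sym 1-p)))
        where e : ∀ a i → (lit 34 * a - lit 36) * i ≡ lit 17 * (lit 2 * (a * i)) - lit 3 * (lit 12 * i)
              e = Ring.solve-∀ ringQ

      -- The leading term of Bδs is 177·34/1000 = 6.018.
      B-large : lit 6 < ι B * δs
      B-large = diff⇒< (0<* {(lit 18000 * T + lit 11628) * (T - 1ℚ) + lit 11592} (<-≤-trans (toWitness {a? = 0ℚ <? lit 11592} _) (diff⇒≤ (0≤* (0≤+ (0≤* (0≤lit 18000) 0≤T) (0≤lit 11628)) (≤⇒diff 1≤T) ≤≡ e₁ T))) 0<i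
            <≡ trans (e T i) (cong₂ (λ u v → u * δs - lit 6 * v) (sym B≡) Di))
        where e₁ : ∀ t → (lit 18000 * t + lit 11628) * (t - 1ℚ) ≡ ((lit 18000 * t + lit 11628) * (t - 1ℚ) + lit 11592) - lit 11592
              e₁ = Ring.solve-∀ ringQ
              e : ∀ t i → ((lit 18000 * t + lit 11628) * (t - 1ℚ) + lit 11592) * i ≡ t * lit 177 * ((lit 34 * (lit 1000 * t) - lit 36) * i) - lit 6 * ((lit 1000 * t * (lit 1000 * t) + lit 6) * i)
              e = Ring.solve-∀ ringQ

      1-p≤ : lit 6 * (1ℚ - p) ≤ q
      1-p≤ = diff⇒≤ (0≤* (0≤+ (0≤* (0≤lit 2) a≥) (0≤lit 1928)) 0≤i ≤≡ trans (e a i) (cong (λ t → q - lit 6 * t) (sym 1-p)))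
        where e : ∀ a i → (lit 2 * (a - lit 1000) + lit 1928) * i ≡ lit 2 * (a * i) - lit 6 * (lit 12 * i)
              e = Ring.solve-∀ ringQ

      h-1≼ : (p ⸴ q) ⊝ 1K ≼ η
      h-1≼ = bound (0≤* (0≤lit 49) 0≤s) (≤-trans (≤-≡ (N-1 (p ⸴ q) unit-h)) (diff⇒≤ (0≤* (0≤sq s) (0≤+ 0≤1 (0≤* (0≤lit 14400) 0≤i)) ≤≡ trans (e s i) (trans (cong (λ t → s * s * (1ℚ + lit 14400 * i) + lit 2400 * (s * s) * (1ℚ - t)) (sym Di))
            (trans (f a s i) (cong₂ (λ u v → η * η - u) (trans (cong (λ t → lit 24 * i * (t * t)) 10as) (trans (g i) (trans (cong (lit 2 *_) (sym 1-p)) (k p)))) Di))))))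
        where e : ∀ s i → s * s * (1ℚ + lit 14400 * i) ≡ s * s * (1ℚ + lit 14400 * i) + lit 2400 * (s * s) * (1ℚ - 1ℚ)
              e = Ring.solve-∀ ringQ
              f : ∀ a s i → s * s * (1ℚ + lit 14400 * i) + lit 2400 * (s * s) * (1ℚ - (a * a + lit 6) * i) ≡ lit 49 * s * (lit 49 * s) - lit 24 * i * (lit 10 * (a * s) * (lit 10 * (a * s)))
              f = Ring.solve-∀ ringQ
              g : ∀ i → lit 24 * i * (1ℚ * 1ℚ) ≡ lit 2 * (lit 12 * i)
              g = Ring.solve-∀ ringQ
              k : ∀ p → lit 2 * (1ℚ - p) ≡ lit 2 - lit 2 * p
              k = Ring.solve-∀ ringQ

      s≤ : 0ℚ ≤ 1ℚ - lit 10000 * s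
      s≤ = 0≤* (0≤* (0≤lit 10) a≥) 0≤s ≤≡ trans (e a s) (cong (_- lit 10000 * s) 10as)
        where e : ∀ a s → lit 10 * (a - lit 1000) * s ≡ lit 10 * (a * s) - lit 10000 * s
              e = Ring.solve-∀ ringQ

      η≤q : lit 2 * η ≤ lit 5 * q
      η≤q = cancelʳ {lit 5} (toWitness {a? = 0ℚ <? lit 5} _) (diff⇒≤ (0≤* core 0≤i ≤≡ trans (e₁ a s i) (trans (cong (λ w → (lit 50 * a - lit 49 * a * w - lit 2940 * s) * i) (sym 10as)) (trans (e a s i) (trans (cong (λ t → lit 5 * q * lit 5 - lit 490 * s * t) Di) (e₂ s q))))))
        where
        e₀ : ∀ a s → a - lit 1000 + (1ℚ - lit 10000 * s) + lit 7060 * s + lit 999 ≡ a - lit 2940 * s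
        e₀ = Ring.solve-∀ ringQ
        core : 0ℚ ≤ a - lit 2940 * s
        core = 0≤+ (0≤+ (0≤+ a≥ s≤) (0≤* (0≤lit 7060) 0≤s)) (0≤lit 999) ≤≡ e₀ a s
        e₁ : ∀ a s i → (a - lit 2940 * s) * i ≡ (lit 50 * a - lit 49 * a * 1ℚ - lit 2940 * s) * i
        e₁ = Ring.solve-∀ ringQ
        e : ∀ a s i → (lit 50 * a - lit 49 * a * (lit 10 * (a * s)) - lit 2940 * s) * i ≡ lit 5 * (lit 2 * (a * i)) * lit 5 - lit 490 * s * ((a * a + lit 6) * i)
        e = Ring.solve-∀ ringQ
        e₂ : ∀ s q → lit 5 * q * lit 5 - lit 490 * s * 1ℚ ≡ lit 5 * q * lit 5 - lit 2 * (lit 49 * s) * lit 5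
        e₂ = Ring.solve-∀ ringQ

      -- 8·177·49/10000 = 6.9384.
      lap≤7 : ι (8 ℕ.* B) * η ≤ lit 7
      lap≤7 = diff⇒≤ (0≤* (0≤lit 616) (0≤* 0≤T 0≤s) ≤≡ trans (e T s) (cong₂ (λ u v → lit 7 * u - v * η) Ts (trans (cong (lit 8 *_) (sym B≡)) (trans (cong (_* ι B) (sym (ι-lit 8))) (sym (ι-* 8 B))))))
        where e : ∀ t s → lit 616 * (t * s) ≡ lit 7 * (lit 10000 * (t * s)) - lit 8 * (t * lit 177) * (lit 49 * s)
              e = Ring.solve-∀ ringQ

    small-step : SmallStep
    small-step = record { p = p ; q = q ; δs = δs ; η = η ; B = B ; unit-h = unit-h ; 0<q = 0<* (toWitness {a? = 0ℚ <? lit 2} _) (0<* 0<a 0<i) ; 9≤10p = 9≤10p ; q≤ = q≤ ; 0≤δs = 0≤δs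
      ; step≥ = step≥ ; B-large = B-large ; 1-p≤ = 1-p≤ ; h-1≼ = h-1≼ ; η≤q = η≤q ; lap≤7 = lap≤7 }

  private
    inverse : ∀ x → ∃ λ i → 0ℚ < i × (ι x + lit 6) * i ≡ 1ℚ
    inverse x = 1/ι (5 ℕ.+ x) , 0<1/ι (5 ℕ.+ x) , trans (cong (_* 1/ι (5 ℕ.+ x)) (trans (+-comm (ι x) (lit 6)) (trans (cong (_+ ι x) (sym (ι-lit 6))) (sym (ι-+ 6 x))))) (1/ι-inverse (5 ℕ.+ x))

  -- η(t + 1) is exactly 49/10000, so steps can be taken as fine as desired.
  small-steps : ∀ t → ∃ λ S → lit 200 * (SmallStep.η S * ι (suc t)) ≤ 1ℚ
  small-steps t = go (inverse (1000 ℕ.* suc t ℕ.* (1000 ℕ.* suc t)))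
    where
    T = ι (suc t)
    s = 1/ι t * 1/ι 9999
    Ts : lit 10000 * (T * s) ≡ 1ℚ
    Ts = trans (e (lit 10000) T (1/ι t) (1/ι 9999)) (cong₂ _*_ (1/ι-inverse t) (trans (cong (_* 1/ι 9999) (sym (ι-lit 10000))) (1/ι-inverse 9999)))
      where e : ∀ l a b c → l * (a * (b * c)) ≡ a * b * (l * c)
            e = Ring.solve-∀ ringQ
    1≤T : 1ℚ ≤ T
    1≤T = ≤-trans (≤-≡ (sym (ι-lit 1))) (ι-mono (ℕ.s≤s ℕ.z≤n))
    0≤s = 0≤* (0≤1/ι t) (0≤1/ι 9999)
    D≡ : ι (1000 ℕ.* suc t ℕ.* (1000 ℕ.* suc t)) ≡ lit 1000 * T * (lit 1000 * T)
    D≡ = trans (ι-* (1000 ℕ.* suc t) (1000 ℕ.* suc t)) (cong₂ _*_ m m)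
      where m = trans (ι-* 1000 (suc t)) (cong (_* T) (ι-lit 1000))
    go : (∃ λ i → 0ℚ < i × (ι (1000 ℕ.* suc t ℕ.* (1000 ℕ.* suc t)) + lit 6) * i ≡ 1ℚ) → ∃ λ S → lit 200 * (SmallStep.η S * T) ≤ 1ℚ
    go (i , 0<i , Di) = St.small-step , diff⇒≤ (0≤* (0≤lit 200) (0≤* 0≤T 0≤s) ≤≡ trans (e T s) (cong (_- lit 200 * (lit 49 * s * T)) Ts))
      where
      0≤T = ≤-trans 0≤1 1≤T
      module St = Step T s i 1≤T 0≤s 0<i Ts (trans (cong (λ u → (u + lit 6) * i) (sym D≡)) Di) (suc t ℕ.* 177) (trans (ι-* (suc t) 177) (cong (T *_) (ι-lit 177)))
      e : ∀ t s → lit 200 * (t * s) ≡ lit 10000 * (t * s) - lit 200 * (lit 49 * s * t)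
      e = Ring.solve-∀ ringQ

-- Newton series of exponential polynomials

module NewtonSeries where
  open Rationals
  open QuadraticField
  open import Data.Rational
  open import Data.Rational.Properties
  import Data.Nat as ℕ
  import Data.Nat.Properties as ℕ
  open import Data.Nat.Tactic.RingSolver using (solve-∀)

  binom : ℕ → ℕ → ℕ
  binom n zero = 1
  binom zero (suc k) = 0
  binom (suc n) (suc k) = binom n k ℕ.+ binom n (suc k)

  binom-large : ∀ n k → n ℕ.< k → binom n k ≡ 0
  binom-large zero (suc k) _ = refl
  binom-large (suc n) (suc k) (ℕ.s≤s h) = cong₂ ℕ._+_ (binom-large n k h) (binom-large n (suc k) (ℕ.m≤n⇒m≤1+n h))

  binom-mono : ∀ {m n} k → m ℕ.≤ n → binom m k ℕ.≤ binom n k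
  binom-mono zero h = ℕ.≤-refl
  binom-mono {zero} (suc k) h = ℕ.z≤n
  binom-mono {suc m} {suc n} (suc k) (ℕ.s≤s h) = ℕ.+-mono-≤ (binom-mono k h) (binom-mono (suc k) h)

  binom-step : ∀ n k → suc k ℕ.* binom n (suc k) ℕ.+ k ℕ.* binom n k ≡ n ℕ.* binom n k
  binom-step zero zero = refl
  binom-step zero (suc k) = cong₂ ℕ._+_ (ℕ.*-zeroʳ (suc (suc k))) (ℕ.*-zeroʳ (suc k))
  binom-step (suc n) zero = trans (l₁ (binom n 1)) (trans (cong suc (trans (sym (l₂ (binom n 1))) (binom-step n zero))) (l₃ n))
    where l₁ : ∀ b → 1 ℕ.* (1 ℕ.+ b) ℕ.+ 0 ≡ suc b
          l₁ = solve-∀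
          l₂ : ∀ b → 1 ℕ.* b ℕ.+ 0 ≡ b
          l₂ = solve-∀
          l₃ : ∀ n → suc (n ℕ.* 1) ≡ suc n ℕ.* 1
          l₃ = solve-∀
  binom-step (suc n) (suc k) = trans (l₁ k (binom n k) (binom n (suc k)) (binom n (suc (suc k))))
    (trans (cong₂ (λ s t → s ℕ.+ t ℕ.+ (binom n k ℕ.+ binom n (suc k))) (binom-step n k) (binom-step n (suc k))) (l₂ n (binom n k) (binom n (suc k))))
    where l₁ : ∀ k a b c → suc (suc k) ℕ.* (b ℕ.+ c) ℕ.+ suc k ℕ.* (a ℕ.+ b) ≡ (suc k ℕ.* b ℕ.+ k ℕ.* a) ℕ.+ (suc (suc k) ℕ.* c ℕ.+ suc k ℕ.* b) ℕ.+ (a ℕ.+ b)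
          l₁ = solve-∀
          l₂ : ∀ n a b → n ℕ.* a ℕ.+ n ℕ.* b ℕ.+ (a ℕ.+ b) ≡ suc n ℕ.* (a ℕ.+ b)
          l₂ = solve-∀

  sum : ℕ → (ℕ → K) → K
  sum zero f = 0K
  sum (suc n) f = sum n f ⊕ f n

  sum-ext : ∀ n {f g} → (∀ i → i ℕ.< n → f i ≡ g i) → sum n f ≡ sum n g
  sum-ext zero h = refl
  sum-ext (suc n) h = cong₂ _⊕_ (sum-ext n (λ i l → h i (ℕ.m≤n⇒m≤1+n l))) (h n ℕ.≤-refl)

  sum-⊕ : ∀ n f g → sum n (λ i → f i ⊕ g i) ≡ sum n f ⊕ sum n g
  sum-⊕ zero f g = refl
  sum-⊕ (suc n) f g = trans (cong (_⊕ (f n ⊕ g n)) (sum-⊕ n f g)) (l _ _ _ _)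
    where l : ∀ a b c d → (a ⊕ b) ⊕ (c ⊕ d) ≡ (a ⊕ c) ⊕ (b ⊕ d)
          l = Ring.solve-∀ ringK

  sum-scale : ∀ n a f → sum n (λ i → a ⊗ f i) ≡ a ⊗ sum n f
  sum-scale zero a f = sym (⊗-zeroʳ a)
  sum-scale (suc n) a f = trans (cong (_⊕ a ⊗ f n) (sum-scale n a f)) (sym (⊗-distˡ a _ _))

  sum-scaleʳ : ∀ n a f → sum n (λ i → f i ⊗ a) ≡ sum n f ⊗ a
  sum-scaleʳ n a f = trans (sum-ext n (λ i _ → ⊗-comm (f i) a)) (trans (sum-scale n a f) (⊗-comm a _))

  sum-zero : ∀ n f → (∀ i → i ℕ.< n → f i ≡ 0K) → sum n f ≡ 0K
  sum-zero n f h = trans (sum-ext n h) (z n)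
    where z : ∀ n → sum n (λ _ → 0K) ≡ 0K
          z zero = refl
          z (suc n) = cong (_⊕ 0K) (z n)

  sum-swap : ∀ m n (f : ℕ → ℕ → K) → sum m (λ i → sum n (f i)) ≡ sum n (λ j → sum m (λ i → f i j))
  sum-swap zero n f = sym (sum-zero n _ (λ _ _ → refl))
  sum-swap (suc m) n f = trans (cong (_⊕ sum n (f m)) (sum-swap m n f)) (sym (sum-⊕ n _ _))

  sum-head : ∀ n f → sum (suc n) f ≡ f 0 ⊕ sum n (λ i → f (suc i))
  sum-head zero f = ⊕-comm 0K (f 0)
  sum-head (suc n) f = trans (cong (_⊕ f (suc n)) (sum-head n f)) (⊕-assoc _ _ _)

  sum-≼ : ∀ n {f b} → 0ℚ ≤ b → (∀ i → i ℕ.< n → f i ≼ b) → sum n f ≼ ι n * b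
  sum-≼ zero {b = b} 0≤b h = ≼-mono ≼-0 (≤-≡ (sym (trans (cong (_* b) (ι-lit 0)) (*-zeroˡ b))))
  sum-≼ (suc n) {b = b} 0≤b h = ≼-mono (≼-⊕ (sum-≼ n 0≤b (λ i l → h i (ℕ.m≤n⇒m≤1+n l))) (h n ℕ.≤-refl)) (≤-≡ (trans (e (ι n) b) (cong (_* b) (sym (ι-suc n)))))
    where e : ∀ n b → n * b + b ≡ (1ℚ + n) * b
          e = Ring.solve-∀ ringQ

  private
    -- For k > n the truncated subtraction spoils the exponent, but then the binomial coefficient is
    -- 0.
    absorb : ∀ z n k → κ (binom n k) ⊗ (z ⊗ z ↑ (n ℕ.∸ k)) ≡ κ (binom n k) ⊗ z ↑ (suc n ℕ.∸ k)
    absorb z n k with k ℕ.≤? n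
    ... | yes h = cong (κ (binom n k) ⊗_) (cong (z ↑_) (sym (ℕ.+-∸-assoc 1 h)))
    ... | no h = trans (cong (_⊗ (z ⊗ z ↑ (n ℕ.∸ k))) κ0) (trans (⊗-zeroˡ _) (sym (trans (cong (_⊗ z ↑ (suc n ℕ.∸ k)) κ0) (⊗-zeroˡ _))))
      where κ0 = trans (cong κ (binom-large n k (ℕ.≰⇒> h))) κ-0

    absorbQ : ∀ y n k → ι (binom n k) * (y * y ^ (n ℕ.∸ k)) ≡ ι (binom n k) * y ^ (suc n ℕ.∸ k)
    absorbQ y n k with k ℕ.≤? n
    ... | yes h = cong (ι (binom n k) *_) (cong (y ^_) (sym (ℕ.+-∸-assoc 1 h)))
    ... | no h = trans (cong (_* (y * y ^ (n ℕ.∸ k))) ι0) (trans (*-zeroˡ (y * y ^ (n ℕ.∸ k))) (sym (trans (cong (_* y ^ (suc n ℕ.∸ k)) ι0) (*-zeroˡ (y ^ (suc n ℕ.∸ k))))))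
      where ι0 : ι (binom n k) ≡ 0ℚ
            ι0 = trans (cong ι (binom-large n k (ℕ.≰⇒> h))) (ι-lit 0)

  module _ (e : K) where
    private
      z = 1K ⊕ e
      S : ℕ → ℕ → ℕ → K
      S J k m = sum J (λ j → κ (binom j k) ⊗ e ↑ (j ℕ.∸ k) ⊗ κ (binom m j))

      pascal : ∀ J k m → S (suc J) k (suc m) ≡ S (suc J) k m ⊕ sum J (λ j → κ (binom (suc j) k) ⊗ e ↑ (suc j ℕ.∸ k) ⊗ κ (binom m j))
      pascal J k m = trans (sum-head J _) (trans (cong (h₀ ⊕_) (trans (sum-ext J (λ j _ → trans (cong (κ (binom (suc j) k) ⊗ e ↑ (suc j ℕ.∸ k) ⊗_) (κ-+ (binom m j) (binom m (suc j)))) (⊗-distˡ _ _ _))) (sum-⊕ J _ _)))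
          (trans (l h₀ _ _) (cong (_⊕ sum J (λ j → κ (binom (suc j) k) ⊗ e ↑ (suc j ℕ.∸ k) ⊗ κ (binom m j))) (sym (sum-head J _)))))
        where h₀ = κ (binom 0 k) ⊗ e ↑ (0 ℕ.∸ k) ⊗ κ 1
              l : ∀ a b c → a ⊕ (b ⊕ c) ≡ (a ⊕ c) ⊕ b
              l = Ring.solve-∀ ringK

      up-shift : ∀ J k m → sum J (λ j → κ (binom j k) ⊗ e ↑ (suc j ℕ.∸ k) ⊗ κ (binom m j)) ≡ e ⊗ S J k m
      up-shift J k m = trans (sum-ext J (λ j _ → trans (cong (_⊗ κ (binom m j)) (sym (absorb e j k))) (l (κ (binom j k)) e (e ↑ (j ℕ.∸ k)) (κ (binom m j))))) (sum-scale J e _)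
        where l : ∀ a e p b → a ⊗ (e ⊗ p) ⊗ b ≡ e ⊗ (a ⊗ p ⊗ b)
              l = Ring.solve-∀ ringK

      -- In closed form: binom(j,k) binom(m,j) = binom(m,k) binom(m-k,j-k) reduces the sum to the
      -- binomial theorem for (1 + e)^(m-k). The induction uses Pascal's rule instead.
      closed : ∀ m J k → m ℕ.< J → S J k m ≡ κ (binom m k) ⊗ z ↑ (m ℕ.∸ k)
      closed zero (suc J) k _ = trans (sum-head J _) (trans (cong₂ _⊕_ (head k) (sum-zero J _ (λ j _ → trans (cong (κ (binom (suc j) k) ⊗ e ↑ (suc j ℕ.∸ k) ⊗_) κ-0) (⊗-zeroʳ _)))) (l _))
        where l : ∀ x → x ⊕ 0K ≡ x
              l = Ring.solve-∀ ringK
              l₁ : ∀ x → x ⊗ 1K ≡ x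
              l₁ = Ring.solve-∀ ringK
              head : ∀ k → κ (binom 0 k) ⊗ e ↑ (0 ℕ.∸ k) ⊗ κ 1 ≡ κ (binom 0 k) ⊗ z ↑ (0 ℕ.∸ k)
              head zero = trans (cong (κ 1 ⊗ 1K ⊗_) κ-1) (l₁ _)
              head (suc k) = trans (cong (κ 0 ⊗ 1K ⊗_) κ-1) (l₁ _)
      closed (suc m) (suc J) zero (ℕ.s≤s m<J) = trans (pascal J 0 m) (trans (cong₂ _⊕_ (closed m (suc J) 0 (ℕ.m≤n⇒m≤1+n m<J)) (trans (up-shift J 0 m) (cong (e ⊗_) (closed m J 0 m<J)))) (l e (κ 1) (z ↑ m)))
        where l : ∀ e a p → a ⊗ p ⊕ e ⊗ (a ⊗ p) ≡ a ⊗ ((1K ⊕ e) ⊗ p)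
              l = Ring.solve-∀ ringK
      closed (suc m) (suc J) (suc k) (ℕ.s≤s m<J) = trans (pascal J (suc k) m) (trans (cong₂ _⊕_ (closed m (suc J) (suc k) (ℕ.m≤n⇒m≤1+n m<J)) second)
          (trans (l e (κ (binom m (suc k))) (z ↑ (m ℕ.∸ suc k)) _) (trans (cong (_⊕ κ (binom m k) ⊗ z ↑ (m ℕ.∸ k)) (absorb z m (suc k))) (trans (l₂ _ _ _) (cong (_⊗ z ↑ (m ℕ.∸ k)) (sym (κ-+ (binom m k) (binom m (suc k)))))))))
        where
        l : ∀ e a p r → a ⊗ p ⊕ (r ⊕ e ⊗ (a ⊗ p)) ≡ a ⊗ ((1K ⊕ e) ⊗ p) ⊕ r
        l = Ring.solve-∀ ringK
        l₂ : ∀ a b p → a ⊗ p ⊕ b ⊗ p ≡ (b ⊕ a) ⊗ p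
        l₂ = Ring.solve-∀ ringK
        second : sum J (λ j → κ (binom j k ℕ.+ binom j (suc k)) ⊗ e ↑ (j ℕ.∸ k) ⊗ κ (binom m j)) ≡ κ (binom m k) ⊗ z ↑ (m ℕ.∸ k) ⊕ e ⊗ (κ (binom m (suc k)) ⊗ z ↑ (m ℕ.∸ suc k))
        second = trans (sum-ext J (λ j _ → trans (cong (λ t → t ⊗ e ↑ (j ℕ.∸ k) ⊗ κ (binom m j)) (κ-+ (binom j k) (binom j (suc k)))) (l₃ _ _ _ _)))
           (trans (sum-⊕ J _ _) (cong₂ _⊕_ (closed m J k m<J) (trans (up-shift J (suc k) m) (cong (e ⊗_) (closed m J (suc k) m<J)))))
          where l₃ : ∀ a b p c → (a ⊕ b) ⊗ p ⊗ c ≡ a ⊗ p ⊗ c ⊕ b ⊗ p ⊗ c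
                l₃ = Ring.solve-∀ ringK

    newton₁ : ∀ m J k → m ℕ.< J → κ (binom m k) ⊗ z ↑ m ≡ sum J (λ j → κ (binom j k) ⊗ (z ↑ k ⊗ e ↑ (j ℕ.∸ k)) ⊗ κ (binom m j))
    newton₁ m J k m<J = trans split (trans (cong (z ↑ k ⊗_) (sym (closed m J k m<J))) (trans (sym (sum-scale J (z ↑ k) _)) (sum-ext J (λ j _ → l (z ↑ k) _ _ _))))
      where
      l : ∀ p a b c → p ⊗ (a ⊗ b ⊗ c) ≡ a ⊗ (p ⊗ b) ⊗ c
      l = Ring.solve-∀ ringK
      split : κ (binom m k) ⊗ z ↑ m ≡ z ↑ k ⊗ (κ (binom m k) ⊗ z ↑ (m ℕ.∸ k))
      split with k ℕ.≤? m
      ... | yes h = trans (cong (λ t → κ (binom m k) ⊗ z ↑ t) (sym (ℕ.m+[n∸m]≡n h))) (trans (cong (κ (binom m k) ⊗_) (↑-+ z k (m ℕ.∸ k))) (l₂ _ _ _))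
        where l₂ : ∀ a b c → a ⊗ (b ⊗ c) ≡ b ⊗ (a ⊗ c)
              l₂ = Ring.solve-∀ ringK
      ... | no h = trans (cong (_⊗ z ↑ m) κ0) (trans (⊗-zeroˡ _) (sym (trans (cong (λ t → z ↑ k ⊗ (t ⊗ z ↑ (m ℕ.∸ k))) κ0) (trans (cong (z ↑ k ⊗_) (⊗-zeroˡ _)) (⊗-zeroʳ _)))))
        where κ0 : κ (binom m k) ≡ 0K
              κ0 = trans (cong κ (binom-large m k (ℕ.≰⇒> h))) κ-0

  -- Newton's expansion of the function binom(m,k) z^m of m. Its j-th coefficient contains (z -
  -- 1)^(j-k), which is small when z is near 1; any cutoff J > m will do, as binom(m,j) = 0 for j >
  -- m.
  newton : ∀ z m J k → m ℕ.< J → κ (binom m k) ⊗ z ↑ m ≡ sum J (λ j → κ (binom j k) ⊗ (z ↑ k ⊗ (z ⊝ 1K) ↑ (j ℕ.∸ k)) ⊗ κ (binom m j))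
  newton z m J k m<J = subst (λ t → κ (binom m k) ⊗ t ↑ m ≡ sum J (λ j → κ (binom j k) ⊗ (t ↑ k ⊗ (z ⊝ 1K) ↑ (j ℕ.∸ k)) ⊗ κ (binom m j))) (l z) (newton₁ (z ⊝ 1K) m J k m<J)
    where l : ∀ z → 1K ⊕ (z ⊝ 1K) ≡ z
          l = Ring.solve-∀ ringK

  -- The left side is a single term of the trinomial expansion of (1 + x + y)^M.
  trinomial : ∀ x y → 0ℚ ≤ x → 0ℚ ≤ y → ∀ M j k → ι (binom j k) * ι (binom M j) * (x ^ k * y ^ (j ℕ.∸ k)) ≤ (1ℚ + x + y) ^ M
  trinomial x y 0≤x 0≤y = go
    where
    s = 1ℚ + x + y
    0≤s : 0ℚ ≤ s
    0≤s = 0≤+ (0≤+ 0≤1 0≤x) 0≤y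
    t : ℕ → ℕ → ℕ → ℚ
    t M j k = ι (binom j k) * ι (binom M j) * (x ^ k * y ^ (j ℕ.∸ k))
    zeroᵐ : ∀ {a b c} → a ≡ 0ℚ → a * b * c ≡ 0ℚ
    zeroᵐ {b = b} {c} refl = trans (cong (_* c) (*-zeroˡ b)) (*-zeroˡ c)
    zeroᵐ′ : ∀ {a b c} → b ≡ 0ℚ → a * b * c ≡ 0ℚ
    zeroᵐ′ {a} {c = c} refl = trans (cong (_* c) (*-zeroʳ a)) (*-zeroˡ c)
    s^ : ∀ M → 0ℚ ≤ s ^ M
    s^ M = 0≤^ M 0≤s
    1≤s^ : ∀ M → 1ℚ ≤ s ^ M
    1≤s^ M = 1≤^ M (diff⇒≤ (0≤+ 0≤x 0≤y ≤≡ e x y))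
      where e : ∀ x y → x + y ≡ (1ℚ + x + y) - 1ℚ
            e = Ring.solve-∀ ringQ
    j0 : ∀ M k → ι (binom 0 k) * ι 1 * (x ^ k * 1ℚ) ≤ s ^ M
    j0 M zero = ≤-trans (≤-≡ (trans (cong (λ t → t * t * (1ℚ * 1ℚ)) (ι-lit 1)) refl)) (1≤s^ M)
    j0 M (suc k) = ≤-trans (≤-≡ (zeroᵐ {b = ι 1} {x ^ suc k * 1ℚ} (ι-lit 0))) (s^ M)
    go : ∀ M j k → t M j k ≤ s ^ M
    go M zero zero = j0 M zero
    go M zero (suc k) = j0 M (suc k)
    go zero (suc j) k = ≤-trans (≤-≡ (zeroᵐ′ {ι (binom (suc j) k)} {c = x ^ k * y ^ (suc j ℕ.∸ k)} (ι-lit 0))) 0≤1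
    go (suc M) (suc j) zero = ≤-trans (≤-≡ (trans (cong (λ b → ι 1 * b * (1ℚ * (y * y ^ j))) (ι-+ (binom M j) (binom M (suc j)))) (e (ι 1) (ι (binom M j)) (ι (binom M (suc j))) y (y ^ j))))
        (≤-trans (+-mono-≤ (*-monoʳ 0≤y (go M j zero)) (go M (suc j) zero)) (diff⇒≤ (0≤* 0≤x (s^ M) ≤≡ e₂ x y (s ^ M))))
      where e : ∀ o a b y p → o * (a + b) * (1ℚ * (y * p)) ≡ y * (o * a * (1ℚ * p)) + o * b * (1ℚ * (y * p))
            e = Ring.solve-∀ ringQ
            e₂ : ∀ x y p → x * p ≡ (1ℚ + x + y) * p - (y * p + p)
            e₂ = Ring.solve-∀ ringQ
    go (suc M) (suc j) (suc k) = ≤-trans (≤-≡ eq)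
        (≤-trans (+-mono-≤ (+-mono-≤ (*-monoʳ 0≤x (go M j k)) (*-monoʳ 0≤y (go M j (suc k)))) (go M (suc j) (suc k))) (≤-≡ (e₂ x y (s ^ M))))
      where
      a = ι (binom j k)
      b = ι (binom j (suc k))
      c = ι (binom M j)
      d = ι (binom M (suc j))
      X = x ^ k
      Y = y ^ (j ℕ.∸ k)
      Y′ = y ^ (j ℕ.∸ suc k)
      e₁ : ∀ a b c d x X Y yY → b * yY ≡ b * Y → (a + b) * (c + d) * (x * X * Y) ≡ x * (a * c * (X * Y)) + c * (x * X) * (b * yY) + (a + b) * d * (x * X * Y)
      e₁ a b c d x X Y yY h = trans (l a b c d x X Y) (cong (λ t → x * (a * c * (X * Y)) + c * (x * X) * t + (a + b) * d * (x * X * Y)) (sym h))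
        where l : ∀ a b c d x X Y → (a + b) * (c + d) * (x * X * Y) ≡ x * (a * c * (X * Y)) + c * (x * X) * (b * Y) + (a + b) * d * (x * X * Y)
              l = Ring.solve-∀ ringQ
      e₃ : ∀ c x X b y Y′ → c * (x * X) * (b * (y * Y′)) ≡ y * (b * c * (x * X * Y′))
      e₃ = Ring.solve-∀ ringQ
      eq : t (suc M) (suc j) (suc k) ≡ x * t M j k + y * t M j (suc k) + t M (suc j) (suc k)
      eq = trans (cong₂ (λ u v → u * v * (x * X * Y)) (ι-+ (binom j k) (binom j (suc k))) (ι-+ (binom M j) (binom M (suc j))))
         (trans (e₁ a b c d x X Y (y * Y′) (absorbQ y j (suc k))) (cong₂ (λ u v → x * t M j k + u + v * d * (x * X * Y)) (e₃ c x X b y Y′) (sym (ι-+ (binom j k) (binom j (suc k))))))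
      e₂ : ∀ x y p → x * p + y * p + p ≡ (1ℚ + x + y) * p
      e₂ = Ring.solve-∀ ringQ

  -- F c m = Σ c(k,l) binom(m,k) z(l)^m, an exponential polynomial, and its Newton coefficients
  module _ (κmax L : ℕ) (z : ℕ → K) where
    F : (ℕ → ℕ → K) → ℕ → K
    F c m = sum κmax (λ k → sum L (λ l → c k l ⊗ (κ (binom m k) ⊗ z l ↑ m)))

    coef : ℕ → (ℕ → ℕ → K) → K
    coef j c = sum κmax (λ k → sum L (λ l → c k l ⊗ (κ (binom j k) ⊗ (z l ↑ k ⊗ (z l ⊝ 1K) ↑ (j ℕ.∸ k)))))

    F-expand : ∀ c m J → m ℕ.< J → F c m ≡ sum J (λ j → coef j c ⊗ κ (binom m j))
    F-expand c m J m<J = trans (sum-ext κmax (λ k _ → trans (sum-ext L (λ l _ → trans (cong (c k l ⊗_) (newton (z l) m J k m<J)) (trans (sym (sum-scale J (c k l) _)) (sum-ext J (λ j _ → assoc _ _ _ _)))))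
          (sum-swap L J _))) (trans (sum-swap κmax J _) (sum-ext J (λ j _ → trans (sum-ext κmax (λ k _ → sum-scaleʳ L (κ (binom m j)) _)) (sum-scaleʳ κmax (κ (binom m j)) _))))
      where assoc : ∀ c a p b → c ⊗ (a ⊗ p ⊗ b) ≡ c ⊗ (a ⊗ p) ⊗ b
            assoc = Ring.solve-∀ ringK

    coef-⊝ : ∀ j c c′ → coef j (λ k l → c k l ⊝ c′ k l) ≡ coef j c ⊝ coef j c′
    coef-⊝ j c c′ = trans (sum-ext κmax (λ k _ → trans (sum-ext L (λ l _ → d (c k l) (c′ k l) _)) (trans (sum-⊕ L _ _) (cong (sum L _ ⊕_) (sum-scale L (⊖ 1K) _)))))
        (trans (sum-⊕ κmax _ _) (trans (cong (coef j c ⊕_) (sum-scale κmax (⊖ 1K) _)) (n (coef j c) (coef j c′))))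
      where d : ∀ a b w → (a ⊝ b) ⊗ w ≡ a ⊗ w ⊕ ⊖ 1K ⊗ (b ⊗ w)
            d = Ring.solve-∀ ringK
            n : ∀ a b → a ⊕ ⊖ 1K ⊗ b ≡ a ⊝ b
            n = Ring.solve-∀ ringK

    -- Writing θ = σ·ρθ extracts σ^(j-k) ≤ σ^(j-κmax), and `trinomial` bounds what is left. A larger
    -- ρ buys faster decay in j at the price of a larger (1 + x + ρθ)^M.
    coef-bound : ∀ {c γ x θ ρ σ} M j → 0ℚ ≤ γ → 0ℚ ≤ x → 0ℚ ≤ θ → 0ℚ ≤ ρ → 0ℚ ≤ σ → σ ≤ 1ℚ → ρ * σ ≡ 1ℚ
      → (∀ k l → k ℕ.< κmax → c k l ≼ γ * x ^ k) → (∀ l → l ℕ.< L → Unit (z l)) → (∀ l → l ℕ.< L → z l ⊝ 1K ≼ θ)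
      → coef j c ⊗ κ (binom M j) ≼ ι (κmax ℕ.* L) * (γ * (σ ^ (j ℕ.∸ κmax) * (1ℚ + x + ρ * θ) ^ M))
    coef-bound {c} {γ} {x} {θ} {ρ} {σ} M j 0≤γ 0≤x 0≤θ 0≤ρ 0≤σ σ≤1 ρσ hc hu hz =
      ≼-mono (≼-≡ (sum-≼ κmax (0≤* (0≤ι L) 0≤b) (λ k k< → sum-≼ L 0≤b (λ l l< → term k l k< l<))) (trans (sum-ext κmax (λ k _ → sum-scaleʳ L (κ (binom M j)) _)) (sum-scaleʳ κmax (κ (binom M j)) _)))
        (≤-≡ (trans (sym (*-assoc (ι κmax) (ι L) b)) (cong (_* b) (sym (ι-* κmax L)))))
      where
      P = (1ℚ + x + ρ * θ) ^ M
      0≤ρθ = 0≤* 0≤ρ 0≤θ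
      0≤P : 0ℚ ≤ P
      0≤P = 0≤^ M (0≤+ (0≤+ 0≤1 0≤x) 0≤ρθ)
      b = γ * (σ ^ (j ℕ.∸ κmax) * P)
      0≤b : 0ℚ ≤ b
      0≤b = 0≤* 0≤γ (0≤* (0≤^ (j ℕ.∸ κmax) 0≤σ) 0≤P)
      term : ∀ k l → k ℕ.< κmax → l ℕ.< L → c k l ⊗ (κ (binom j k) ⊗ (z l ↑ k ⊗ (z l ⊝ 1K) ↑ (j ℕ.∸ k))) ⊗ κ (binom M j) ≼ b
      term k l k< l< = ≼-mono (≼-⊗ (≼-⊗ (hc k l k<) (≼-⊗ (≼-κ (binom j k)) (≼-⊗ (unit≼ {z l ↑ k} (unit-↑ {z l} k (hu l l<))) (↑-≼ (j ℕ.∸ k) (hz l l<))))) (≼-κ (binom M j)))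
         (≤-trans (≤-≡ eq) (*-monoʳ 0≤γ (*-mono (0≤^ i 0≤σ) (σ-mono) (0≤* (0≤* (0≤ι (binom j k)) (0≤ι (binom M j))) (0≤* (0≤^ k 0≤x) (0≤^ i 0≤ρθ))) (trinomial x (ρ * θ) 0≤x 0≤ρθ M j k))))
        where
        i = j ℕ.∸ k
        σ-mono : σ ^ i ≤ σ ^ (j ℕ.∸ κmax)
        σ-mono = subst (λ e → σ ^ e ≤ σ ^ (j ℕ.∸ κmax)) (ℕ.m+[n∸m]≡n (ℕ.∸-monoʳ-≤ j (ℕ.<⇒≤ k<)))
          (≤-trans (≤-≡ (^-+ σ (j ℕ.∸ κmax) (i ℕ.∸ (j ℕ.∸ κmax)))) (≤-trans (*-monoʳ (0≤^ (j ℕ.∸ κmax) 0≤σ) (≤-trans (^-mono (i ℕ.∸ (j ℕ.∸ κmax)) 0≤σ σ≤1) (≤-≡ (1^ (i ℕ.∸ (j ℕ.∸ κmax)))))) (≤-≡ (*-identityʳ (σ ^ (j ℕ.∸ κmax))))))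
        eq : γ * x ^ k * (ι (binom j k) * (1ℚ * θ ^ i)) * ι (binom M j) ≡ γ * (σ ^ i * (ι (binom j k) * ι (binom M j) * (x ^ k * (ρ * θ) ^ i)))
        eq = trans (l₁ γ (x ^ k) (ι (binom j k)) (θ ^ i) (ι (binom M j))) (trans (cong (λ t → γ * (t * (ι (binom j k) * ι (binom M j) * (x ^ k * θ ^ i)))) (sym (inv-^ i ρσ)))
            (trans (l₂ γ (ρ ^ i) (σ ^ i) (ι (binom j k)) (ι (binom M j)) (x ^ k) (θ ^ i)) (cong (λ t → γ * (σ ^ i * (ι (binom j k) * ι (binom M j) * (x ^ k * t)))) (sym (^-*-base ρ θ i)))))
          where l₁ : ∀ g X a t b → g * X * (a * (1ℚ * t)) * b ≡ g * (1ℚ * (a * b * (X * t)))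
                l₁ = Ring.solve-∀ ringQ
                l₂ : ∀ g r s a b X t → g * (r * s * (a * b * (X * t))) ≡ g * (s * (a * b * (X * (r * t))))
                l₂ = Ring.solve-∀ ringQ

-- The box principle

module SiegelLemma where
  open Rationals
  open ParameterChoice using (prod)
  open QuadraticField
  open LapCount using (neg-sq; im≤bound)
  open import Data.Rational
  open import Data.Rational.Properties
  import Data.Nat as ℕ
  import Data.Nat.Properties as ℕ
  import Data.Integer as ℤ
  import Data.Integer.Properties as ℤ
  import Data.Integer.Tactic.RingSolver as ℤR
  open import Data.Integer using (ℤ; +_)
  open import Data.Fin as Fin using (Fin; toℕ; fromℕ<; remQuot; combine)
  import Data.Fin.Properties as Fin

  encode : ∀ n (f : ℕ → ℕ) → ((i : ℕ) → Fin (f i)) → Fin (prod n f)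
  encode zero f g = Fin.zero
  encode (suc n) f g = combine (g n) (encode n f g)

  encode-inj : ∀ n (f : ℕ → ℕ) (g g′ : (i : ℕ) → Fin (f i)) → encode n f g ≡ encode n f g′ → ∀ i → i ℕ.< n → g i ≡ g′ i
  encode-inj (suc n) f g g′ e i i<n with i ℕ.≟ n
  ... | yes refl = Fin.combine-injectiveˡ (g n) (encode n f g) (g′ n) (encode n f g′) e
  ... | no i≢n = encode-inj n f g g′ (Fin.combine-injectiveʳ (g n) (encode n f g) (g′ n) (encode n f g′) e) i (ℕ.≤∧≢⇒< (ℕ.≤-pred i<n) i≢n)

  digit : ∀ n f → Fin (prod n f) → ∀ i → i ℕ.< n → Fin (f i)
  digit (suc n) f x i i<n with i ℕ.≟ n
  ... | yes refl = proj₁ (remQuot {f n} (prod n f) x)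
  ... | no i≢n = digit n f (proj₂ (remQuot {f n} (prod n f) x)) i (ℕ.≤∧≢⇒< (ℕ.≤-pred i<n) i≢n)

  digit-inj : ∀ n f x y → (∀ i (i<n : i ℕ.< n) → digit n f x i i<n ≡ digit n f y i i<n) → x ≡ y
  digit-inj zero f Fin.zero Fin.zero h = refl
  digit-inj (suc n) f x y h = trans (sym (Fin.combine-remQuot {f n} (prod n f) x)) (trans (cong₂ combine top (digit-inj n f _ _ rest)) (Fin.combine-remQuot {f n} (prod n f) y))
    where
    top : proj₁ (remQuot {f n} (prod n f) x) ≡ proj₁ (remQuot {f n} (prod n f) y)
    top with h n ℕ.≤-refl
    ... | e with n ℕ.≟ n
    ...   | yes refl = e
    ...   | no n≢n = ⊥-elim (n≢n refl)
    rest : ∀ i (i<n : i ℕ.< n) → digit n f (proj₂ (remQuot {f n} (prod n f) x)) i i<n ≡ digit n f (proj₂ (remQuot {f n} (prod n f) y)) i i<n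
    rest i i<n with h i (ℕ.m≤n⇒m≤1+n i<n)
    ... | e with i ℕ.≟ n
    ...   | yes refl = ⊥-elim (ℕ.<-irrefl refl i<n)
    ...   | no i≢n = trans (cong (digit n f _ i) (ℕ.<-irrelevant i<n _)) (trans e (cong (digit n f _ i) (ℕ.<-irrelevant _ i<n)))

  clamp : ∀ T → ℕ → Fin (suc T)
  clamp T n with n ℕ.<? suc T
  ... | yes p = fromℕ< p
  ... | no _ = Fin.zero

  clamp-inj : ∀ T m n → m ℕ.≤ T → n ℕ.≤ T → clamp T m ≡ clamp T n → m ≡ n
  clamp-inj T m n m≤ n≤ e with m ℕ.<? suc T | n ℕ.<? suc T
  ... | yes p | yes q = Fin.fromℕ<-injective m n p q e
  ... | no p | _ = ⊥-elim (p (ℕ.s≤s m≤))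
  ... | yes _ | no q = ⊥-elim (q (ℕ.s≤s n≤))

  -- The floor of p shifted by T; for |p| ≤ T the fallback value of `clamp` is not reached.
  box : (T : ℕ) → ℚ → Fin (suc (T ℕ.+ T))
  box T p = clamp (T ℕ.+ T) ℤ.∣ proj₁ (floor-exists p) ℤ.+ + T ∣

  box-range : ∀ T p → - ι T ≤ p → p ≤ ι T → + 0 ℤ.≤ proj₁ (floor-exists p) ℤ.+ + T × proj₁ (floor-exists p) ℤ.+ + T ℤ.≤ + (T ℕ.+ T)
  box-range T p lo hi with floor-exists p
  ... | z , z≤p , p<z+1 = ℤ.≤-trans (ℤ.≤-reflexive (e₁ (+ T))) (ℤ.+-monoˡ-≤ (+ T) -T≤z) , ℤ.+-monoˡ-≤ (+ T) z≤T
    where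
    e₁ : ∀ t → + 0 ≡ ℤ.- t ℤ.+ t
    e₁ = ℤR.solve-∀
    e₂ : ∀ z → ℤ.- + 1 ℤ.+ (z ℤ.+ + 1) ≡ z
    e₂ = ℤR.solve-∀
    e₃ : ∀ t → t ≡ ℤ.- + 1 ℤ.+ (+ 1 ℤ.+ t)
    e₃ = ℤR.solve-∀
    z≤T : z ℤ.≤ + T
    z≤T = ζ-cancel-≤ (≤-trans z≤p hi)
    -T≤z : ℤ.- + T ℤ.≤ z
    -T≤z = ℤ.≤-trans (ℤ.≤-reflexive (e₃ (ℤ.- + T))) (ℤ.≤-trans (ℤ.+-monoʳ-≤ (ℤ.- + 1) (ℤ.i<j⇒suc[i]≤j (ζ-cancel-< (≤-<-trans (ζ-neg (+ T) ≡≤ lo) p<z+1)))) (ℤ.≤-reflexive (e₂ z)))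

  ∣∣-inj : ∀ {a b} → + 0 ℤ.≤ a → + 0 ℤ.≤ b → ℤ.∣ a ∣ ≡ ℤ.∣ b ∣ → a ≡ b
  ∣∣-inj {+ m} {+ n} _ _ e = cong +_ e

  box-inj : ∀ T p p′ → - ι T ≤ p → p ≤ ι T → - ι T ≤ p′ → p′ ≤ ι T → box T p ≡ box T p′ → p - p′ ≤ 1ℚ
  box-inj T p p′ lo hi lo′ hi′ e with box-range T p lo hi | box-range T p′ lo′ hi′
  ... | n≥ , n≤ | n≥′ , n≤′ = same (proj₂ (proj₂ (floor-exists p))) (proj₁ (proj₂ (floor-exists p′))) z≡
    where
    z = proj₁ (floor-exists p)
    z′ = proj₁ (floor-exists p′)
    abs≤ : ∀ {a} → + 0 ℤ.≤ a → a ℤ.≤ + (T ℕ.+ T) → ℤ.∣ a ∣ ℕ.≤ T ℕ.+ T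
    abs≤ {+ n} _ (ℤ.+≤+ h) = h
    add-cancel : z ℤ.+ + T ≡ z′ ℤ.+ + T → z ≡ z′
    add-cancel e = trans (r z (+ T)) (trans (cong (ℤ._- + T) e) (sym (r z′ (+ T))))
      where r : ∀ z t → z ≡ z ℤ.+ t ℤ.- t
            r = ℤR.solve-∀
    z≡ : z ≡ z′
    z≡ = add-cancel (∣∣-inj n≥ n≥′ (clamp-inj (T ℕ.+ T) _ _ (abs≤ n≥ n≤) (abs≤ n≥′ n≤′) e))
    same : ∀ {z z′} → p < ζ (z ℤ.+ + 1) → ζ z′ ≤ p′ → z ≡ z′ → p - p′ ≤ 1ℚ
    same {z} u l refl = diff⇒≤ (0≤+ (≤⇒diff l) (≤⇒diff (≤-trans (<⇒≤ u) (≤-≡ (trans (ζ-+ z (+ 1)) (cong (λ t → ζ z + t) (ζ-lit 1)))))) ≤≡ e₀ p p′ (ζ z))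
      where e₀ : ∀ p p′ z → (p′ - z) + ((z + 1ℚ) - p) ≡ 1ℚ - (p - p′)
            e₀ = Ring.solve-∀ ringQ

  abs≤1⇒sq : ∀ {p} → p ≤ 1ℚ → - p ≤ 1ℚ → p * p ≤ 1ℚ
  abs≤1⇒sq {p} h k = diff⇒≤ (0≤* (≤⇒diff h) (≤⇒diff k) ≤≡ e p)
    where e : ∀ p → (1ℚ - p) * (1ℚ - - p) ≡ 1ℚ - p * p
          e = Ring.solve-∀ ringQ

  re≤bound : ∀ {z t} → z ≼ t → re z ≤ t
  re≤bound {z} (bound h n) = sq-cancel h (≤-trans (re²≤N z) n)

  re≥bound : ∀ {z t} → z ≼ t → - t ≤ re z
  re≥bound {z} (bound h n) = neg-sq h (≤-trans (re²≤N z) n)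

  im≥bound : ∀ {z t} → z ≼ t → - t ≤ im z
  im≥bound {z} (bound h n) = neg-sq h (≤-trans (diff⇒≤ (0≤* (0≤lit 5) (0≤sq (im z)) ≤≡ e (im z))) (≤-trans (im²≤N z) n))
    where e : ∀ b → lit 5 * (b * b) ≡ lit 6 * (b * b) - b * b
          e = Ring.solve-∀ ringQ

  -- The norm of the difference is at most 1 + 6 = 7, below 3².
  small-coords : ∀ z w → re z - re w ≤ 1ℚ → re w - re z ≤ 1ℚ → im z - im w ≤ 1ℚ → im w - im z ≤ 1ℚ → z ⊝ w ≼ lit 3
  small-coords (a ⸴ b) (c ⸴ d) h₁ h₂ h₃ h₄ = bound (0≤lit 3) (≤-trans (+-mono-≤ (abs≤1⇒sq h₁ (≤-trans (≤-≡ (e a c)) h₂)) (*-monoʳ (0≤lit 6) (abs≤1⇒sq h₃ (≤-trans (≤-≡ (e b d)) h₄)))) (toWitness {a? = 1ℚ + lit 6 * 1ℚ ≤? lit 3 * lit 3} _))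
    where e : ∀ a c → - (a - c) ≡ c - a
          e = Ring.solve-∀ ringQ

  ι-coords : ∀ C m n m′ n′ → m ℕ.< C → n ℕ.< C → m′ ℕ.< C → n′ ℕ.< C → (ι m ⸴ ι n) ⊝ (ι m′ ⸴ ι n′) ≼ lit 3 * ι C
  ι-coords C m n m′ n′ m< n< m′< n′< = bound (0≤* (0≤lit 3) (0≤ι C)) (≤-trans (+-mono-≤ (sq m m′ m< m′<) (*-monoʳ (0≤lit 6) (sq n n′ n< n′<))) (diff⇒≤ (0≤* (0≤lit 2) (0≤sq (ι C)) ≤≡ e (ι C))))
    where
    e : ∀ c → lit 2 * (c * c) ≡ lit 3 * c * (lit 3 * c) - (c * c + lit 6 * (c * c))
    e = Ring.solve-∀ ringQ
    sq : ∀ m m′ → m ℕ.< C → m′ ℕ.< C → (ι m - ι m′) * (ι m - ι m′) ≤ ι C * ι C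
    sq m m′ l l′ = diff⇒≤ (0≤* (0≤+ (≤⇒diff (ι-mono (ℕ.<⇒≤ l))) (0≤ι m′)) (0≤+ (≤⇒diff (ι-mono (ℕ.<⇒≤ l′))) (0≤ι m)) ≤≡ f (ι C) (ι m) (ι m′))
      where f : ∀ c a b → ((c - a) + b) * ((c - b) + a) ≡ c * c - (a - b) * (a - b)
            f = Ring.solve-∀ ringQ

  -- Siegel's lemma in approximate form: some nonzero integral c of bounded size makes all the linear forms A j small.
  module _ (κmax L J : ℕ) (C T : ℕ → ℕ) (D : ℚ) (A : ℕ → (ℕ → ℕ → K) → K)
    (A-⊝ : ∀ j c c′ → A j (λ k l → c k l ⊝ c′ k l) ≡ A j c ⊝ A j c′)
    (A-bound : ∀ j c → j ℕ.< J → (∀ k l → c k l ≼ lit 3 * ι (C k)) → ⌜ D ⌝ ⊗ A j c ≼ ι (T j))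
    (C>0 : ∀ k → 0 ℕ.< C k)
    (count : prod J (λ j → suc (T j ℕ.+ T j)) ℕ.< prod κmax (λ k → prod L (λ _ → C k))) where

    private
      P Q : ℕ
      P = prod κmax (λ k → prod L (λ _ → C k))
      Q = prod J (λ j → suc (T j ℕ.+ T j))

      sz : ℕ → ℕ
      sz j = suc (T j ℕ.+ T j)

      -- The digits of x in a mixed radix; the default 0 outside the range keeps `coordinate<` valid
      -- everywhere.
      coordinate : Fin P → ℕ → ℕ → ℕ
      coordinate x k l with k ℕ.<? κmax | l ℕ.<? L
      ... | yes p | yes q = toℕ (digit L (λ _ → C k) (digit κmax (λ k → prod L (λ _ → C k)) x k p) l q)
      ... | _ | _ = 0

      coordinate< : ∀ x k l → coordinate x k l ℕ.< C k
      coordinate< x k l with k ℕ.<? κmax | l ℕ.<? L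
      ... | yes p | yes q = Fin.toℕ<n _
      ... | yes p | no _ = C>0 k
      ... | no _ | _ = C>0 k

      coordinate-inj : ∀ x y → (∀ k l → k ℕ.< κmax → l ℕ.< L → coordinate x k l ≡ coordinate y k l) → x ≡ y
      coordinate-inj x y h = digit-inj κmax _ x y λ k p → digit-inj L _ _ _ λ l q → Fin.toℕ-injective (trans (sym (at x k l p q)) (trans (h k l p q) (at y k l p q)))
        where at : ∀ x k l (p : k ℕ.< κmax) (q : l ℕ.< L) → coordinate x k l ≡ toℕ (digit L (λ _ → C k) (digit κmax (λ k → prod L (λ _ → C k)) x k p) l q)
              at x k l p q with k ℕ.<? κmax | l ℕ.<? L
              ... | yes p′ | yes q′ = cong₂ (λ p q → toℕ (digit L (λ _ → C k) (digit κmax (λ k → prod L (λ _ → C k)) x k p) l q)) (ℕ.<-irrelevant p′ p) (ℕ.<-irrelevant q′ q)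
              ... | no ¬p | _ = ⊥-elim (¬p p)
              ... | yes _ | no ¬q = ⊥-elim (¬q q)

      vec : Fin P × Fin P → ℕ → ℕ → K
      vec (x , x′) k l = ι (coordinate x k l) ⸴ ι (coordinate x′ k l)

      form : Fin P × Fin P → ℕ → K
      form v j = ⌜ D ⌝ ⊗ A j (vec v)

      form≼ : ∀ v j → j ℕ.< J → form v j ≼ ι (T j)
      form≼ (x , x′) j j<J = A-bound j (vec (x , x′)) j<J λ k l → ≼-≡ (ι-coords (C k) _ _ 0 0 (coordinate< x k l) (coordinate< x′ k l) (C>0 k) (C>0 k)) (z (ι (coordinate x k l)) (ι (coordinate x′ k l)))
        where z : ∀ a b → (a ⸴ b) ⊝ (ι 0 ⸴ ι 0) ≡ (a ⸴ b)
              z a b = trans (cong (λ t → (a ⸴ b) ⊝ (t ⸴ t)) (ι-lit 0)) (l (a ⸴ b))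
                where l : ∀ z → z ⊝ 0K ≡ z
                      l = Ring.solve-∀ ringK

      boxes : Fin P × Fin P → Fin Q × Fin Q
      boxes v = encode J sz (λ j → box (T j) (re (form v j))) , encode J sz (λ j → box (T j) (im (form v j)))

      f : Fin (P ℕ.* P) → Fin (Q ℕ.* Q)
      f i = combine (proj₁ (boxes (remQuot {P} P i))) (proj₂ (boxes (remQuot {P} P i)))

    record Small : Set where
      field
        c : ℕ → ℕ → K
        c-bound : ∀ k l → c k l ≼ lit 3 * ι (C k)
        c-nonzero : ¬ (∀ k l → k ℕ.< κmax → l ℕ.< L → c k l ≡ 0K)
        c-integral : ∀ k l → Integral (c k l)
        small : ∀ j → j ℕ.< J → ⌜ D ⌝ ⊗ A j c ≼ lit 3

    siegel : Small
    -- Vectors have real and imaginary coordinates, P choices for each, and the values of the forms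
    -- likewise fall into Q · Q boxes. Two vectors sharing a box are subtracted.
    siegel = go (Fin.pigeonhole (ℕ.*-mono-< count count) f)
      where
      go : (∃₂ λ i j → i Fin.< j × f i ≡ f j) → Small
      go (i , j , i<j , e) = record
        { c = λ k l → vec v k l ⊝ vec w k l
        ; c-bound = λ k l → ι-coords (C k) _ _ _ _ (coordinate< (proj₁ v) k l) (coordinate< (proj₂ v) k l) (coordinate< (proj₁ w) k l) (coordinate< (proj₂ w) k l)
        ; c-nonzero = λ z → Fin.<⇒≢ i<j (trans (sym (Fin.combine-remQuot {P} P i)) (trans (cong₂ combine
            (coordinate-inj (proj₁ v) (proj₁ w) (λ k l p q → ιeq (cong re (eqK {vec v k l} {vec w k l} (z k l p q)))))
            (coordinate-inj (proj₂ v) (proj₂ w) (λ k l p q → ιeq (cong im (eqK {vec v k l} {vec w k l} (z k l p q)))))) (Fin.combine-remQuot {P} P j)))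
        ; c-integral = λ k l → integral-⊕ (_ , _ , refl) (integral-⊖ (_ , _ , refl))
        ; small = λ j j<J → ≼-≡ (small-coords (form v j) (form w j)
            (le re j j<J (λ u → re≥bound (form≼ u j j<J)) (λ u → re≤bound (form≼ u j j<J)) v w e-re)
            (le re j j<J (λ u → re≥bound (form≼ u j j<J)) (λ u → re≤bound (form≼ u j j<J)) w v (sym e-re))
            (le im j j<J (λ u → im≥bound (form≼ u j j<J)) (λ u → im≤bound (form≼ u j j<J)) v w e-im)
            (le im j j<J (λ u → im≥bound (form≼ u j j<J)) (λ u → im≤bound (form≼ u j j<J)) w v (sym e-im)))
            (trans (d ⌜ D ⌝ (A j (vec v)) (A j (vec w))) (cong (⌜ D ⌝ ⊗_) (sym (A-⊝ j (vec v) (vec w))))) }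
        where
        v = remQuot {P} P i
        w = remQuot {P} P j
        e-re : proj₁ (boxes v) ≡ proj₁ (boxes w)
        e-re = Fin.combine-injectiveˡ (proj₁ (boxes v)) (proj₂ (boxes v)) (proj₁ (boxes w)) (proj₂ (boxes w)) e
        e-im : proj₂ (boxes v) ≡ proj₂ (boxes w)
        e-im = Fin.combine-injectiveʳ (proj₁ (boxes v)) (proj₂ (boxes v)) (proj₁ (boxes w)) (proj₂ (boxes w)) e
        le : ∀ (r : K → ℚ) j → j ℕ.< J → (∀ u → - ι (T j) ≤ r (form u j)) → (∀ u → r (form u j) ≤ ι (T j))
          → ∀ u u′ → encode J sz (λ j → box (T j) (r (form u j))) ≡ encode J sz (λ j → box (T j) (r (form u′ j))) → r (form u j) - r (form u′ j) ≤ 1ℚ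
        le r j j<J lo hi u u′ e = box-inj (T j) (r (form u j)) (r (form u′ j)) (lo u) (hi u) (lo u′) (hi u′)
          (encode-inj J sz (λ j → box (T j) (r (form u j))) (λ j → box (T j) (r (form u′ j))) e j j<J)
        eqK : ∀ {z w} → z ⊝ w ≡ 0K → z ≡ w
        eqK {z} {w} e = trans (l z w) (trans (cong (_⊕ w) e) (⊕-idˡ w))
          where l : ∀ z w → z ≡ (z ⊝ w) ⊕ w
                l = Ring.solve-∀ ringK
        ιeq : ∀ {m n} → ι m ≡ ι n → m ≡ n
        ιeq e = ℤ.+-injective (ζ-inj e)
        d : ∀ x a b → x ⊗ a ⊝ x ⊗ b ≡ x ⊗ (a ⊝ b)
        d = Ring.solve-∀ ringK

-- The zero estimate

module ZeroEstimate where
  open Rationals using (ι; 1/ι; 1/ι-inverse; ι-+; ι-*)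
  open QuadraticField
  open Determinants
  open NewtonSeries using (binom; binom-step; sum; sum-ext; sum-zero)
  open import Data.Nat using (ℕ; zero; suc; _+_; _*_; _∸_; _≤_; _<_; z≤n; s≤s)
  open import Data.Nat.Properties
  open import Data.List using (List; []; _∷_; _++_; map; length)
  open import Data.List.Properties using (map-∘; length-map)
  open import Data.List.Relation.Unary.All as All using (All; []; _∷_)
  import Data.List.Relation.Unary.All.Properties as All
  open import Data.List.Relation.Unary.AllPairs as AllPairs using (AllPairs; []; _∷_)

  nonzero-⊗ : ∀ {a b} → ¬ a ≡ 0K → ¬ b ≡ 0K → ¬ a ⊗ b ≡ 0K
  nonzero-⊗ {a} {b} na nb e = nb (noZeroDiv a b e na)

  ⌜1/⌝-inverse : ∀ k → κ (suc k) ⊗ ⌜ 1/ι k ⌝ ≡ 1K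
  ⌜1/⌝-inverse k = trans (sym (⌜⌝-* (ι (suc k)) (1/ι k))) (cong ⌜_⌝ (1/ι-inverse k))

  binom-stepK : ∀ n k → κ (binom n (suc k)) ≡ ⌜ 1/ι k ⌝ ⊗ ((κ n ⊝ κ k) ⊗ κ (binom n k))
  binom-stepK n k = trans (l₁ _) (trans (cong (_⊗ κ (binom n (suc k))) (sym (⌜1/⌝-inverse k))) (trans (l₂ (κ (suc k)) ⌜ 1/ι k ⌝ _ (κ k) (κ (binom n k)))
    (cong (λ t → ⌜ 1/ι k ⌝ ⊗ t) (trans (cong (_⊝ κ k ⊗ κ (binom n k)) step) (l₃ (κ n) (κ k) (κ (binom n k)))))))
    where
    step : κ (suc k) ⊗ κ (binom n (suc k)) ⊕ κ k ⊗ κ (binom n k) ≡ κ n ⊗ κ (binom n k)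
    step = trans (cong₂ _⊕_ (sym (κ-* (suc k) (binom n (suc k)))) (sym (κ-* k (binom n k)))) (trans (sym (κ-+ _ _)) (trans (cong κ (binom-step n k)) (κ-* n (binom n k))))
    l₁ : ∀ x → x ≡ 1K ⊗ x
    l₁ = Ring.solve-∀ ringK
    l₂ : ∀ s i x k b → (s ⊗ i) ⊗ x ≡ i ⊗ ((s ⊗ x ⊕ k ⊗ b) ⊝ k ⊗ b)
    l₂ = Ring.solve-∀ ringK
    l₃ : ∀ n k b → n ⊗ b ⊝ k ⊗ b ≡ (n ⊝ k) ⊗ b
    l₃ = Ring.solve-∀ ringK

  -- This is 1/k!, the top coefficient of binom(X, k); the factor `1K` matches the shape that
  -- `poly-⊗` produces.
  lead : ℕ → K
  lead zero = 1K
  lead (suc k) = ⌜ 1/ι k ⌝ ⊗ (1K ⊗ lead k)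

  1≢0 : ¬ 1K ≡ 0K
  1≢0 ()

  lead≢0 : ∀ k → ¬ lead k ≡ 0K
  lead≢0 zero = 1≢0
  lead≢0 (suc k) = nonzero-⊗ inv≢0 (nonzero-⊗ {1K} 1≢0 (lead≢0 k))
    where inv≢0 : ¬ ⌜ 1/ι k ⌝ ≡ 0K
          inv≢0 e = 1≢0 (trans (sym (⌜1/⌝-inverse k)) (trans (cong (κ (suc k) ⊗_) e) (⊗-zeroʳ (κ (suc k)))))

  binom-poly : ∀ s k → Poly κ k (lead k) (λ X → κ (binom (s + X) k))
  binom-poly s zero = con (λ _ → κ-1)
  binom-poly s (suc k) = poly-ext (poly-scale ⌜ 1/ι k ⌝ (poly-⊗ linear (binom-poly s k)))
      (λ X → trans (binom-stepK (s + X) k) (cong (λ t → ⌜ 1/ι k ⌝ ⊗ (t ⊗ κ (binom (s + X) k))) (trans (cong (_⊝ κ k) (κ-+ s X)) (l (κ s) (κ X) (κ k)))))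
    where
    linear : Poly κ 1 1K (λ X → (κ s ⊝ κ k) ⊕ κ X ⊗ 1K)
    linear = hor (κ s ⊝ κ k) (con (λ _ → refl)) (λ _ → refl)
    l : ∀ s x k → (s ⊕ x) ⊝ k ≡ (s ⊝ k) ⊕ x ⊗ 1K
    l = Ring.solve-∀ ringK

  combination-poly : ∀ s (c : ℕ → K) d → Poly κ d (c d ⊗ lead d) (λ X → sum (suc d) (λ k → c k ⊗ κ (binom (s + X) k)))
  combination-poly s c d = poly-lead (⊕-idˡ _) (poly-⊕ (lower d ≤-refl) (poly-scale (c d) (binom-poly s d)))
    where
    lower : ∀ n → n ≤ d → Poly κ d 0K (λ X → sum n (λ k → c k ⊗ κ (binom (s + X) k)))
    lower zero _ = poly-zero d
    lower (suc n) n<d = poly-lead (⊕-idˡ 0K) (poly-⊕ (lower n (<⇒≤ n<d)) (poly-deg (m∸n+n≡m′ n<d) (poly-raise (d ∸ suc n) (poly-scale (c n) (binom-poly s n)))))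
      where m∸n+n≡m′ : suc n ≤ d → suc (d ∸ suc n) + n ≡ d
            m∸n+n≡m′ h = trans (sym (+-suc (d ∸ suc n) n)) (m∸n+n≡m h)

  D-zero-col : ∀ t P Q → D t 0 (P ++ (λ _ → 0K) ∷ Q) ≡ 0K
  D-zero-col t P Q = trans (D-lin {t} {c = λ _ → 0K} {d = λ _ → 0K} (⊖ 1K) (λ _ _ → refl) t 0 ≤-refl P Q) (l _)
    where l : ∀ x → ⊖ 1K ⊗ x ⊕ x ≡ 0K
          l = Ring.solve-∀ ringK

  -- The scalars are taken out one column at a time; `P` holds the columns already dealt with.
  scaled≢0 : ∀ {A : Set} (s : A → K) (col : A → ℕ → K) t P as → All (λ a → ¬ s a ≡ 0K) as → ¬ D t 0 (P ++ map col as) ≡ 0K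
    → ¬ D t 0 (P ++ map (λ a r → s a ⊗ col a r) as) ≡ 0K
  scaled≢0 s col t P [] [] n = n
  scaled≢0 s col t P (a ∷ as) (na ∷ nas) n e = step (λ e′ → nonzero-⊗ na n (trans (sym (⊕0 _)) (trans (sym (lin (map col as))) e′)))
    where
    ⊕0 : ∀ x → x ⊕ 0K ≡ x
    ⊕0 = Ring.solve-∀ ringK
    e′ = λ r → s a ⊗ col a r
    lin : ∀ Q → D t 0 (P ++ e′ ∷ Q) ≡ s a ⊗ D t 0 (P ++ col a ∷ Q) ⊕ 0K
    lin Q = trans (D-lin {t} {d = λ _ → 0K} (s a) (λ r _ → sym (⊕0 _)) t 0 ≤-refl P Q) (cong (s a ⊗ D t 0 (P ++ col a ∷ Q) ⊕_) (D-zero-col t P Q))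
    mv : ∀ Q → (P ++ e′ ∷ []) ++ Q ≡ P ++ e′ ∷ Q
    mv Q = Data.List.Properties.++-assoc P (e′ ∷ []) Q
      where import Data.List.Properties
    step : ¬ D t 0 (P ++ e′ ∷ map col as) ≡ 0K → ⊥
    step n′ = scaled≢0 s col t (P ++ e′ ∷ []) as nas (λ x → n′ (trans (cong (D t 0) (sym (mv _))) x)) (trans (cong (D t 0) (mv _)) e)

  -- An exponential polynomial Σ_l P_l(m) b_l^r v_l cannot vanish at too many points of a grid (r, m).
  module _ (κmax L : ℕ) (c : ℕ → ℕ → K) (b : ℕ → K) (b-inj : ∀ l l′ → l < L → l′ < l → ¬ b l ≡ b l′)
    (s : ℕ → ℕ) (X : ℕ → ℕ) (X-inj : ∀ i j → i ≤ L * κmax → j ≤ L * κmax → X i ≡ X j → i ≡ j)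
    (v : ℕ → ℕ → K) (unit-v : ∀ i l → Unit (v i l))
    (vanish : ∀ r i → r < L → i ≤ L * κmax → sum κmax (λ k → sum L (λ l → c k l ⊗ (κ (binom (s r + X i) k) ⊗ (b l ↑ r ⊗ v i l)))) ≡ 0K)
    (nonzero : ¬ (∀ k l → k < κmax → l < L → c k l ≡ 0K)) where

    private
      Inactive : ℕ → Set
      Inactive l = ∀ k → k < κmax → c k l ≡ 0K

      -- d is the degree of P_l, the last index with a nonzero coefficient.
      Active : ℕ → Set
      Active l = ∃ λ d → d < κmax × ¬ c d l ≡ 0K × (∀ k → d < k → k < κmax → c k l ≡ 0K)

      classify : ∀ n l → n ≤ κmax → (∀ k → n ≤ k → k < κmax → c k l ≡ 0K) → Inactive l ⊎ Active l
      classify zero l _ h = inj₁ (λ k → h k z≤n)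
      classify (suc n) l n<κ h with c n l ≟K 0K
      ... | no nz = inj₂ (n , n<κ , nz , h)
      ... | yes e = classify n l (<⇒≤ n<κ) λ k n≤k k< → case k n≤k k< (k ≟ n)
        where case : ∀ k → n ≤ k → k < κmax → Dec (k ≡ n) → c k l ≡ 0K
              case k n≤k k< (yes refl) = e
              case k n≤k k< (no k≢n) = h k (≤∧≢⇒< n≤k (λ e → k≢n (sym e))) k<

      Act : Set
      Act = Σ ℕ Active

      dec : ∀ l → Inactive l ⊎ Active l
      dec l = classify κmax l ≤-refl (λ k h h′ → ⊥-elim (<⇒≱ h′ h))

      push : ∀ l → Inactive l ⊎ Active l → List Act → List Act
      push l (inj₁ _) as = as
      push l (inj₂ a) as = (l , a) ∷ as

      acts : ℕ → List Act
      acts zero = []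
      acts (suc n) = push n (dec n) (acts n)

      acts-< : ∀ n → All (λ a → proj₁ a < n) (acts n)
      acts-< zero = []
      acts-< (suc n) with dec n
      ... | inj₁ _ = All.map (λ h → m≤n⇒m≤1+n h) (acts-< n)
      ... | inj₂ a = ≤-refl ∷ All.map (λ h → m≤n⇒m≤1+n h) (acts-< n)

      acts-length : ∀ n → length (acts n) ≤ n
      acts-length zero = z≤n
      acts-length (suc n) with dec n
      ... | inj₁ _ = m≤n⇒m≤1+n (acts-length n)
      ... | inj₂ a = s≤s (acts-length n)

      acts-distinct : ∀ n → n ≤ L → AllPairs _≢_ (map (λ a → b (proj₁ a)) (acts n))
      acts-distinct zero _ = []
      acts-distinct (suc n) n<L with dec n
      ... | inj₁ _ = acts-distinct n (<⇒≤ n<L)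
      ... | inj₂ a = All.map⁺ (All.map (λ {a′} h → b-inj n (proj₁ a′) n<L h) (acts-< n)) ∷ acts-distinct n (<⇒≤ n<L)

      degree : Act → ℕ
      degree (l , d , _) = d

      sumdeg≤ : ∀ as → sumdeg {p = κ} degree as ≤ length as * κmax
      sumdeg≤ [] = z≤n
      sumdeg≤ ((l , d , d< , _) ∷ as) = +-mono-≤ (<⇒≤ d<) (sumdeg≤ as)

      -- The entry at row r is P_l(s r + x) b_l^r, a polynomial of degree d in x whatever r is.
      column : Act → ℕ → ℕ → K
      column (l , d , _) r x = sum (suc d) (λ k → c k l ⊗ κ (binom (s r + x) k)) ⊗ b l ↑ r

      scaleOf : Act → K
      scaleOf (l , d , _) = c d l ⊗ lead d

      column-poly : ∀ a r → Poly κ (degree a) (scaleOf a ⊗ b (proj₁ a) ↑ r) (column a r)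
      column-poly (l , d , _) r = poly-ext (poly-lead (⊗-comm _ _) (poly-scale (b l ↑ r) (combination-poly (s r) (λ k → c k l) d))) (λ x → ⊗-comm _ _)

      truncate : ∀ l d n → suc d ≤ n → (∀ k → d < k → k < n → c k l ≡ 0K) → ∀ (w : ℕ → K) → sum n (λ k → c k l ⊗ w k) ≡ sum (suc d) (λ k → c k l ⊗ w k)
      truncate l d (suc n) (s≤s d≤n) h w with d ≟ n
      ... | yes refl = refl
      ... | no d≢n = trans (cong₂ _⊕_ (truncate l d n (≤∧≢⇒< d≤n d≢n) (λ k h₁ h₂ → h k h₁ (m≤n⇒m≤1+n h₂)) w) (trans (cong (_⊗ w n) (h n (≤∧≢⇒< d≤n d≢n) ≤-refl)) (⊗-zeroˡ _))) (⊕0 _)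
        where ⊕0 : ∀ x → x ⊕ 0K ≡ x
              ⊕0 = Ring.solve-∀ ringK

      regroup : ∀ n (w : ℕ → K) (e : ℕ → K) → sum n (λ l → e l ⊗ sum κmax (λ k → c k l ⊗ w k))
        ≡ comb (λ a (_ : ℕ) → sum (suc (degree a)) (λ k → c k (proj₁ a) ⊗ w k)) (λ a → e (proj₁ a)) (acts n) 0
      regroup zero w e = refl
      regroup (suc n) w e with dec n
      ... | inj₁ z = trans (cong₂ _⊕_ (regroup n w e) (trans (cong (e n ⊗_) (sum-zero κmax _ (λ k k< → trans (cong (_⊗ w k) (z k k<)) (⊗-zeroˡ _)))) (⊗-zeroʳ _))) (⊕0 _)
        where ⊕0 : ∀ x → x ⊕ 0K ≡ x
              ⊕0 = Ring.solve-∀ ringK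
      ... | inj₂ (d , d< , nz , h) = trans (⊕-comm _ _) (cong₂ _⊕_ (cong (e n ⊗_) (truncate n d κmax d< h w)) (regroup n w e))

      comb-cong : ∀ {A : Set} (f g : A → ℕ → K) (u u′ : A → K) r r′ as → (∀ a → u a ⊗ f a r ≡ u′ a ⊗ g a r′) → comb f u as r ≡ comb g u′ as r′
      comb-cong f g u u′ r r′ [] h = refl
      comb-cong f g u u′ r r′ (a ∷ as) h = cong₂ _⊕_ (h a) (comb-cong f g u u′ r r′ as h)

      open NewtonSeries using (sum-swap; sum-scale)

      -- For fixed i the vanishing says that the vector of the `v i l` is killed by every row; its
      -- entries are invertible, so the matrix at x = X i is singular.
      kernel : ∀ r i → r < L → i ≤ L * κmax → comb (λ a r → column a r (X i)) (λ a → v i (proj₁ a)) (acts L) r ≡ 0K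
      kernel r i r<L i≤ = trans (comb-cong _ _ _ (λ a → b (proj₁ a) ↑ r ⊗ v i (proj₁ a)) r 0 (acts L) (λ { (l , d , _) → l₁ (v i l) _ (b l ↑ r) }))
        (trans (sym (regroup L (λ k → κ (binom (s r + X i) k)) (λ l → b l ↑ r ⊗ v i l)))
        (trans (sum-ext L (λ l _ → trans (sym (sum-scale κmax (b l ↑ r ⊗ v i l) _)) (sum-ext κmax (λ k _ → l₂ _ _ _)))) (trans (sym (sum-swap κmax L _)) (vanish r i r<L i≤))))
        where l₁ : ∀ v s p → v ⊗ (s ⊗ p) ≡ (p ⊗ v) ⊗ s
              l₁ = Ring.solve-∀ ringK
              l₂ : ∀ e c w → e ⊗ (c ⊗ w) ≡ c ⊗ (w ⊗ e)
              l₂ = Ring.solve-∀ ringK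

      t = length (acts L)
      t≤L : t ≤ L
      t≤L = acts-length L
      deg≤ : sumdeg {p = κ} degree (acts L) ≤ L * κmax
      deg≤ = ≤-trans (sumdeg≤ (acts L)) (*-monoˡ-≤ κmax t≤L)

      singular : ∀ as → acts L ≡ as → 0 < length as → ∀ i → i ≤ L * κmax → D t 0 (map (λ a r → column a r (X i)) as) ≡ 0K
      singular (a ∷ as) e _ i i≤ = D-singular (λ a r → column a r (X i)) (λ a → v i (proj₁ a)) (conj (v i (proj₁ a))) a as t (trans (⊗-comm _ _) (unit-inv {v i (proj₁ a)} (unit-v i (proj₁ a))))
        (λ r r<t → subst (λ as → comb (λ a r → column a r (X i)) (λ a → v i (proj₁ a)) as r ≡ 0K) e (kernel r i (≤-trans r<t t≤L) i≤))

      nonempty : 0 < t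
      nonempty with t in e
      ... | suc _ = s≤s z≤n
      ... | zero = ⊥-elim (nonzero (λ k l k< l< → all-inactive L e l l< k k<))
        where
        all-inactive : ∀ n → length (acts n) ≡ 0 → ∀ l → l < n → Inactive l
        all-inactive (suc n) e l (s≤s l≤n) with dec n
        ... | inj₁ z = case (l ≟ n)
          where case : Dec (l ≡ n) → Inactive l
                case (yes refl) = z
                case (no l≢n) = all-inactive n e l (≤∧≢⇒< l≤n l≢n)

      lead-zero : D t 0 (map (λ a r → scaleOf a ⊗ b (proj₁ a) ↑ r) (acts L)) ≡ 0K
      lead-zero = poly-roots (D-poly degree column (λ a r → scaleOf a ⊗ b (proj₁ a) ↑ r) column-poly t 0 (acts L)) X
        (λ i j i≤ j≤ e → X-inj i j (≤-trans i≤ deg≤) (≤-trans j≤ deg≤) (κ-inj e))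
        (λ i i≤ → singular (acts L) refl nonempty i (≤-trans i≤ deg≤))

    -- The determinant is a polynomial in x of degree at most L·κmax with L·κmax + 1 zeros `X i`, so
    -- its top coefficient vanishes. Up to nonzero column factors that coefficient is the
    -- Vandermonde determinant of the distinct `b l`.
    zero-estimate : ⊥
    zero-estimate = scaled≢0 scaleOf (λ a → pw (b (proj₁ a))) t [] (acts L) (All.universal (λ { (l , d , _ , nz , _) → nonzero-⊗ nz (lead≢0 d) }) (acts L))
      (λ e → vandermonde (map (λ a → b (proj₁ a)) (acts L)) (acts-distinct L ≤-refl)
        (trans (cong₂ (λ n cs → D n 0 cs) (length-map _ (acts L)) (sym (map-∘ (acts L)))) e))
      lead-zero

-- Construction of the auxiliary function

module AuxiliaryFunction where
  open Rationals
  open ParameterChoice using (prod)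
  open QuadraticField
  open NewtonSeries
  open SiegelLemma
  open import Data.Rational
  open import Data.Rational.Properties
  import Data.Nat as ℕ
  import Data.Nat.Properties as ℕ

  2ℚ : ℚ
  2ℚ = lit 2

  ι2^ : ∀ n → ι (2 ℕ.^ n) ≡ 2ℚ ^ n
  ι2^ n = trans (ι-^ 2 n) (cong (_^ n) (ι-lit 2))

  1≤2 : 1ℚ ≤ 2ℚ
  1≤2 = toWitness {a? = 1ℚ ≤? lit 2} _

  0≤½ : 0ℚ ≤ ½
  0≤½ = toWitness {a? = 0ℚ ≤? ½} _

  ½≤1 : ½ ≤ 1ℚ
  ½≤1 = toWitness {a? = ½ ≤? 1ℚ} _

  ½^-cancel : ∀ a i → 2ℚ ^ (i ℕ.+ a) * ½ ^ i ≡ 2ℚ ^ a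
  ½^-cancel a i = trans (cong (_* ½ ^ i) (^-+ 2ℚ i a)) (trans (l (2ℚ ^ i) (2ℚ ^ a) (½ ^ i)) (trans (cong (_* 2ℚ ^ a) (inv-^ i refl)) (*-identityˡ _)))
    where l : ∀ x y z → x * y * z ≡ x * z * y
          l = Ring.solve-∀ ringQ

  ½^-∸ : ∀ a i → 2ℚ ^ a * ½ ^ i ≤ 2ℚ ^ (a ℕ.∸ i)
  ½^-∸ a i = go (i ℕ.≤? a)
    where
    go : Dec (i ℕ.≤ a) → 2ℚ ^ a * ½ ^ i ≤ 2ℚ ^ (a ℕ.∸ i)
    go (yes h) = ≤-≡ (trans (cong (λ t → 2ℚ ^ t * ½ ^ i) (sym (ℕ.m+[n∸m]≡n h))) (½^-cancel (a ℕ.∸ i) i))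
    go (no h) = ≤-trans (≤-trans (*-monoˡ (0≤^ i 0≤½) (^-mono-exp {m = a} {i} 1≤2 (ℕ.<⇒≤ (ℕ.≰⇒> h)))) (≤-≡ (inv-^ i refl)))
       (1≤^ (a ℕ.∸ i) 1≤2)

  ½^-≡ : ∀ b m → m ℕ.≤ b → 2ℚ ^ (b ℕ.∸ m) ≡ 2ℚ ^ b * ½ ^ m
  ½^-≡ b m h = sym (trans (cong (λ t → 2ℚ ^ t * ½ ^ m) (sym (ℕ.m+[n∸m]≡n h))) (½^-cancel (b ℕ.∸ m) m))

  ≼-κ-mono : ∀ {a u v q} → u ℕ.≤ v → a ⊗ κ v ≼ q → a ⊗ κ u ≼ q
  ≼-κ-mono {a} {u} {v} {q} u≤v (bound 0≤q n) = bound 0≤q (≤-trans (≤-≡ (N-⊗ a (κ u))) (≤-trans (*-monoʳ (0≤N a) (≤-trans (≤-≡ (N-⌜⌝ (ι u))) (≤-trans (*-mono (0≤ι u) (ι-mono u≤v) (0≤ι u) (ι-mono u≤v)) (≤-≡ (sym (N-⌜⌝ (ι v))))))) (≤-trans (≤-≡ (sym (N-⊗ a (κ v)))) n)))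

  module _ (κmax L J M : ℕ) (z : ℕ → K) (θ : ℚ) (μ b δ pad p₂ p₃ : ℕ) (0≤θ : 0ℚ ≤ θ)
    (unit-z : ∀ l → l ℕ.< L → Unit (z l)) (z-1≼ : ∀ l → l ℕ.< L → z l ⊝ 1K ≼ θ)
    (P₂ : (1ℚ + ½ ^ μ + lit 4 * θ) ^ M ≤ 2ℚ ^ p₂) (P₃ : (1ℚ + ½ ^ μ + lit 8 * θ) ^ M ≤ 2ℚ ^ p₃)
    (μk≤b : ∀ k → k ℕ.< κmax → μ ℕ.* k ℕ.≤ b) (hpad : 3 ℕ.* (κmax ℕ.* L) ℕ.≤ 2 ℕ.^ pad) where

    a₂ a₃ : ℕ
    a₂ = δ ℕ.+ (pad ℕ.+ (b ℕ.+ p₂))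
    a₃ = δ ℕ.+ (pad ℕ.+ (b ℕ.+ p₃))

    -- The lower of two lines, from ρ = 4 (two bits gained per step beyond κmax) and ρ = 8 (three
    -- bits per step). With the chosen parameters the first starts lower and the second reaches 0
    -- sooner.
    bits : ℕ → ℕ
    bits j = (a₂ ℕ.∸ 2 ℕ.* (j ℕ.∸ κmax)) ℕ.⊓ (a₃ ℕ.∸ 3 ℕ.* (j ℕ.∸ κmax))

    -- The weight 2^(-μk) offsets the growth of binom(m, k): their product stays below (1 +
    -- 2^(-μ))^M for m ≤ M.
    Cₖ : ℕ → ℕ
    Cₖ k = 2 ℕ.^ (b ℕ.∸ μ ℕ.* k)

    Dδ : ℚ
    Dδ = 2ℚ ^ δ

    -- The weight binom(M, j) dominates binom(m, j) for all m ≤ M, so that one bound serves the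
    -- Newton series at all these m.
    form : ℕ → (ℕ → ℕ → K) → K
    form j c = coef κmax L z j c ⊗ κ (binom M j)

    Bounded : (ℕ → ℕ → K) → Set
    Bounded c = ∀ k l → c k l ≼ lit 3 * ι (Cₖ k)

    bounded⇒ : ∀ {c} → Bounded c → ∀ k l → k ℕ.< κmax → c k l ≼ lit 3 * 2ℚ ^ b * (½ ^ μ) ^ k
    bounded⇒ h k l k< = ≼-mono (h k l) (≤-≡ (trans (cong (lit 3 *_) (trans (ι2^ (b ℕ.∸ μ ℕ.* k)) (trans (½^-≡ b (μ ℕ.* k) (μk≤b k k<)) (cong (2ℚ ^ b *_) (^-* ½ μ k))))) (sym (*-assoc (lit 3) (2ℚ ^ b) ((½ ^ μ) ^ k)))))

    private
      -- `coef-bound` with ρ = 2^s: every step beyond κmax gains s bits.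
      line : ∀ c j s ρ p → Bounded c → 0ℚ ≤ ρ → ρ * ½ ^ s ≡ 1ℚ → (1ℚ + ½ ^ μ + ρ * θ) ^ M ≤ 2ℚ ^ p
        → ⌜ Dδ ⌝ ⊗ form j c ≼ 2ℚ ^ (δ ℕ.+ (pad ℕ.+ (b ℕ.+ p)) ℕ.∸ s ℕ.* (j ℕ.∸ κmax))
      line c j s ρ p hc 0≤ρ ρσ hP = ≼-mono (≼-⊗ (≼-⌜⌝ (0≤^ δ (0≤lit 2))) (coef-bound κmax L z {c} {lit 3 * 2ℚ ^ b} {½ ^ μ} {θ} {ρ} {½ ^ s} M j (0≤* (0≤lit 3) (0≤^ b (0≤lit 2))) (0≤^ μ 0≤½) 0≤θ 0≤ρ (0≤^ s 0≤½)
            (≤-trans (^-mono s 0≤½ ½≤1) (≤-≡ (1^ s))) ρσ (bounded⇒ hc) unit-z z-1≼))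
          (≤-trans (≤-≡ (l Dδ (ι (κmax ℕ.* L)) (2ℚ ^ b) ((½ ^ s) ^ i) ((1ℚ + ½ ^ μ + ρ * θ) ^ M)))
            (≤-trans (*-monoˡ (0≤^ i (0≤^ s 0≤½)) (*-monoʳ (0≤^ δ (0≤lit 2)) (*-mono (0≤* (0≤lit 3) (0≤ι _)) pad≤ (0≤* (0≤^ b (0≤lit 2)) (0≤^ M (0≤+ (0≤+ 0≤1 (0≤^ μ 0≤½)) (0≤* 0≤ρ 0≤θ)))) (*-monoʳ (0≤^ b (0≤lit 2)) hP))))
            (≤-trans (≤-≡ (cong₂ _*_ (sym (trans (^-+ 2ℚ δ _) (cong (2ℚ ^ δ *_) (trans (^-+ 2ℚ pad _) (cong (2ℚ ^ pad *_) (^-+ 2ℚ b p)))))) (sym (^-* ½ s i)))) (½^-∸ (δ ℕ.+ (pad ℕ.+ (b ℕ.+ p))) (s ℕ.* i)))))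
        where
        i = j ℕ.∸ κmax
        l : ∀ d k b s P → d * (k * (lit 3 * b * (s * P))) ≡ d * (lit 3 * k * (b * P)) * s
        l = Ring.solve-∀ ringQ
        pad≤ : lit 3 * ι (κmax ℕ.* L) ≤ 2ℚ ^ pad
        pad≤ = ≤-trans (≤-≡ (trans (cong (_* ι (κmax ℕ.* L)) (sym (ι-lit 3))) (sym (ι-* 3 (κmax ℕ.* L))))) (≤-trans (ι-mono hpad) (≤-≡ (ι2^ pad)))

    form-bound : ∀ c j → Bounded c → ⌜ Dδ ⌝ ⊗ form j c ≼ 2ℚ ^ bits j
    form-bound c j hc = bound (0≤^ (bits j) (0≤lit 2)) (both (line c j 2 (lit 4) p₂ hc (0≤lit 4) refl P₂) (line c j 3 (lit 8) p₃ hc (0≤lit 8) refl P₃))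
      where
      both : ⌜ Dδ ⌝ ⊗ form j c ≼ 2ℚ ^ (a₂ ℕ.∸ 2 ℕ.* (j ℕ.∸ κmax)) → ⌜ Dδ ⌝ ⊗ form j c ≼ 2ℚ ^ (a₃ ℕ.∸ 3 ℕ.* (j ℕ.∸ κmax)) → N (⌜ Dδ ⌝ ⊗ form j c) ≤ 2ℚ ^ bits j * 2ℚ ^ bits j
      both (bound _ h₂) (bound _ h₃) with ℕ.⊓-sel (a₂ ℕ.∸ 2 ℕ.* (j ℕ.∸ κmax)) (a₃ ℕ.∸ 3 ℕ.* (j ℕ.∸ κmax))
      ... | inj₁ e = subst (λ m → N (⌜ Dδ ⌝ ⊗ form j c) ≤ 2ℚ ^ m * 2ℚ ^ m) (sym e) h₂
      ... | inj₂ e = subst (λ m → N (⌜ Dδ ⌝ ⊗ form j c) ≤ 2ℚ ^ m * 2ℚ ^ m) (sym e) h₃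

    record Auxiliary : Set where
      field
        c : ℕ → ℕ → K
        c-bound : ∀ k l → k ℕ.< κmax → c k l ≼ lit 3 * 2ℚ ^ b * (½ ^ μ) ^ k
        c-nonzero : ¬ (∀ k l → k ℕ.< κmax → l ℕ.< L → c k l ≡ 0K)
        c-integral : ∀ k l → Integral (c k l)
        F-small : ∀ m → m ℕ.< M → ⌜ Dδ ⌝ ⊗ F κmax L z c m ≼ ι M * lit 3

    -- At m < M the Newton series has at most M terms. Those with j < J are made small by the choice
    -- of c, the later ones are small for any admissible c.
    auxiliary : a₃ ℕ.≤ 3 ℕ.* (J ℕ.∸ κmax)
      → prod J (λ j → suc (2 ℕ.^ bits j ℕ.+ 2 ℕ.^ bits j)) ℕ.< prod κmax (λ k → prod L (λ _ → Cₖ k)) → Auxiliary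
    auxiliary tail count = go (siegel κmax L J Cₖ (λ j → 2 ℕ.^ bits j) Dδ form form-⊝ (λ j c _ h → ≼-mono (form-bound c j h) (≤-≡ (sym (ι2^ (bits j))))) (λ k → ℕ.m^n>0 2 (b ℕ.∸ μ ℕ.* k)) count)
      where
      form-⊝ : ∀ j c c′ → form j (λ k l → c k l ⊝ c′ k l) ≡ form j c ⊝ form j c′
      form-⊝ j c c′ = trans (cong (_⊗ κ (binom M j)) (coef-⊝ κmax L z j c c′)) (l _ _ _)
        where l : ∀ a b x → (a ⊝ b) ⊗ x ≡ a ⊗ x ⊝ b ⊗ x
              l = Ring.solve-∀ ringK
      go : Small κmax L J Cₖ (λ j → 2 ℕ.^ bits j) Dδ form form-⊝ (λ j c _ h → ≼-mono (form-bound c j h) (≤-≡ (sym (ι2^ (bits j))))) (λ k → ℕ.m^n>0 2 (b ℕ.∸ μ ℕ.* k)) count → Auxiliary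
      go s = record
        { c = c ; c-bound = bounded⇒ c-bound ; c-nonzero = c-nonzero ; c-integral = c-integral
        ; F-small = λ m m<M → ≼-≡ (sum-≼ M (0≤lit 3) (λ j _ → ≼-≡ (≼-κ-mono {⌜ Dδ ⌝ ⊗ coef κmax L z j c} (binom-mono j (ℕ.<⇒≤ m<M)) (≼-≡ (each j) (sym (⊗-assoc ⌜ Dδ ⌝ _ _)))) (⊗-assoc ⌜ Dδ ⌝ _ _)))
             (trans (sum-scale M ⌜ Dδ ⌝ _) (cong (⌜ Dδ ⌝ ⊗_) (sym (F-expand κmax L z c m M m<M)))) }
        where
        open Small s
        each : ∀ j → ⌜ Dδ ⌝ ⊗ form j c ≼ lit 3
        each j = pick (j ℕ.<? J)
          where
          pick : Dec (j ℕ.< J) → ⌜ Dδ ⌝ ⊗ form j c ≼ lit 3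
          pick (yes j<J) = small j j<J
          -- By `tail` the exponent `bits j` is 0 here, so the bound is 2^0 = 1.
          pick (no j≮J) = ≼-mono (form-bound c j c-bound) (≤-trans (≤-≡ (cong (2ℚ ^_) bits≡0)) (toWitness {a? = 1ℚ ≤? lit 3} _))
            where
            bits≡0 : bits j ≡ 0
            bits≡0 = ℕ.n≤0⇒n≡0 (ℕ.≤-trans (ℕ.m⊓n≤n (a₂ ℕ.∸ 2 ℕ.* (j ℕ.∸ κmax)) _) (ℕ.≤-reflexive (ℕ.m≤n⇒m∸n≡0 (ℕ.≤-trans tail (ℕ.*-monoʳ-≤ 3 (ℕ.∸-monoˡ-≤ κmax (ℕ.≮⇒≥ j≮J)))))))

-- Extrapolation: small values at sample points vanish

module Extrapolation where
  open Rationals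
  open QuadraticField
  open NewtonSeries
  open ZeroEstimate using (zero-estimate)
  open import Data.Rational
  open import Data.Rational.Properties
  import Data.Nat as ℕ
  import Data.Nat.Properties as ℕ
  import Data.Nat.DivMod as ℕ
  open import Data.Nat.Tactic.RingSolver using (solve-∀)
  open import Relation.Binary.Definitions using (tri<; tri≈; tri>)

  integral-vanish : ∀ {z q} → Integral z → z ≼ q → q < 1ℚ → z ≡ 0K
  integral-vanish iz (bound 0≤q n) q<1 = integral-small iz (≤-<-trans n (≤-<-trans (*-monoʳ 0≤q (<⇒≤ q<1)) (subst (_< 1ℚ) (sym (*-identityʳ _)) q<1)))

  integral-sum : ∀ n {f} → (∀ i → i ℕ.< n → Integral (f i)) → Integral (sum n f)
  integral-sum zero h = subst Integral κ-0 (integral-κ 0)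
  integral-sum (suc n) h = integral-⊕ (integral-sum n (λ i l → h i (ℕ.m≤n⇒m≤1+n l))) (h n ℕ.≤-refl)

  -- signed powers: sp H w l is w ^ (l − H) for a unit w
  module Signed (H : ℕ) where
    sp : K → ℕ → K
    sp w l = w ↑ (l ℕ.∸ H) ⊗ conj w ↑ (H ℕ.∸ l)

    -- One of the two truncated differences is 0, and l ≤ 2H bounds the other.
    exps : ∀ l → l ℕ.< suc (H ℕ.+ H) → (l ℕ.∸ H) ℕ.+ (H ℕ.∸ l) ℕ.≤ H
    exps l (ℕ.s≤s l≤) with ℕ.≤-total l H
    ... | inj₁ h = subst (λ t → t ℕ.+ (H ℕ.∸ l) ℕ.≤ H) (sym (ℕ.m≤n⇒m∸n≡0 h)) (ℕ.m∸n≤m H l)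
    ... | inj₂ h = subst (λ t → (l ℕ.∸ H) ℕ.+ t ℕ.≤ H) (sym (ℕ.m≤n⇒m∸n≡0 h)) (ℕ.≤-trans (ℕ.≤-reflexive (ℕ.+-identityʳ _)) (ℕ.≤-trans (ℕ.∸-monoˡ-≤ H l≤) (ℕ.≤-reflexive (ℕ.m+n∸n≡m H H))))

    sp-unit : ∀ {w} l → Unit w → Unit (sp w l)
    sp-unit {w} l u = unit-⊗ {w ↑ (l ℕ.∸ H)} (unit-↑ {w} (l ℕ.∸ H) u) (unit-↑ {conj w} (H ℕ.∸ l) (unit-conj {w} u))

    sp-close : ∀ {a b τ} l → l ℕ.< suc (H ℕ.+ H) → Unit a → Unit b → a ⊝ b ≼ τ → sp a l ⊝ sp b l ≼ ι H * τ
    sp-close {a} {b} {τ} l l< ua ub h = ≼-mono (⊗-close {a ↑ (l ℕ.∸ H)} {b ↑ (l ℕ.∸ H)} (unit-↑ {a} (l ℕ.∸ H) ua) (unit-↑ {conj b} (H ℕ.∸ l) (unit-conj {b} ub))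
         (unit-↑-close {a} {b} (l ℕ.∸ H) ua ub h) (unit-↑-close {conj a} {conj b} (H ℕ.∸ l) (unit-conj {a} ua) (unit-conj {b} ub) (≼-≡ (≼-conj h) (conj-⊝ a b))))
       (≤-trans (≤-≡ (trans (sym (*-distribʳ-+ τ (ι (l ℕ.∸ H)) (ι (H ℕ.∸ l)))) (cong (_* τ) (sym (ι-+ (l ℕ.∸ H) (H ℕ.∸ l)))))) (*-monoˡ (nonneg h) (ι-mono (exps l l<))))

    sp-1 : ∀ l → sp 1K l ≡ 1K
    sp-1 l = trans (cong₂ _⊗_ (1↑ (l ℕ.∸ H)) (1↑ (H ℕ.∸ l))) refl

    sp-⊗ : ∀ a b l → sp (a ⊗ b) l ≡ sp a l ⊗ sp b l
    sp-⊗ a b l = trans (cong₂ _⊗_ (↑-⊗ a b (l ℕ.∸ H)) (trans (cong (_↑ (H ℕ.∸ l)) (conj-⊗ a b)) (↑-⊗ (conj a) (conj b) (H ℕ.∸ l)))) (e _ _ _ _)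
      where e : ∀ p q r s → (p ⊗ q) ⊗ (r ⊗ s) ≡ (p ⊗ r) ⊗ (q ⊗ s)
            e = Ring.solve-∀ ringK

    sp-↑ : ∀ a l m → sp (a ↑ m) l ≡ sp a l ↑ m
    sp-↑ a l zero = sp-1 l
    sp-↑ a l (suc m) = trans (sp-⊗ a (a ↑ m) l) (cong (sp a l ⊗_) (sp-↑ a l m))

    sp-unsigned : ∀ {w} l → Unit w → w ↑ H ⊗ sp w l ≡ w ↑ l
    sp-unsigned {w} l u with ℕ.≤-total l H
    ... | inj₂ h = trans (cong (λ t → w ↑ H ⊗ (w ↑ (l ℕ.∸ H) ⊗ conj w ↑ t)) (ℕ.m≤n⇒m∸n≡0 h)) (trans (e _ _) (trans (sym (↑-+ w H (l ℕ.∸ H))) (cong (w ↑_) (ℕ.m+[n∸m]≡n h))))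
      where e : ∀ a b → a ⊗ (b ⊗ 1K) ≡ a ⊗ b
            e = Ring.solve-∀ ringK
    ... | inj₁ h = trans (cong₂ (λ s t → s ⊗ (w ↑ t ⊗ conj w ↑ (H ℕ.∸ l))) (trans (cong (w ↑_) (sym (ℕ.m+[n∸m]≡n h))) (↑-+ w l (H ℕ.∸ l))) (ℕ.m≤n⇒m∸n≡0 h))
         (trans (e _ _ _) (trans (cong (w ↑ l ⊗_) (trans (sym (↑-⊗ w (conj w) (H ℕ.∸ l))) (trans (cong (_↑ (H ℕ.∸ l)) (unit-inv {w} u)) (1↑ (H ℕ.∸ l))))) (e₂ _)))
      where e : ∀ a b c → (a ⊗ b) ⊗ (1K ⊗ c) ≡ a ⊗ (b ⊗ c)
            e = Ring.solve-∀ ringK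
            e₂ : ∀ a → a ⊗ 1K ≡ a
            e₂ = Ring.solve-∀ ringK

    integral-sp : ∀ {q B} l → l ℕ.< suc (H ℕ.+ H) → Integral q → Integral (q ⊗ B) → Integral (q ⊗ conj B) → Integral (q ↑ H ⊗ sp B l)
    integral-sp {q} {B} l l< iq iB iB̄ = subst Integral (sym eq) (integral-⊗ (integral-↑ r iq) (integral-⊗ (integral-↑ a iB) (integral-↑ c iB̄)))
      where
      a = l ℕ.∸ H
      c = H ℕ.∸ l
      r = H ℕ.∸ (a ℕ.+ c)
      eq : q ↑ H ⊗ sp B l ≡ q ↑ r ⊗ ((q ⊗ B) ↑ a ⊗ (q ⊗ conj B) ↑ c)
      eq = trans (cong (λ t → q ↑ t ⊗ sp B l) (sym (ℕ.m∸n+n≡m (exps l l<)))) (trans (cong (_⊗ sp B l) (trans (↑-+ q r (a ℕ.+ c)) (cong (q ↑ r ⊗_) (↑-+ q a c))))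
         (trans (e _ _ _ _ _) (cong (q ↑ r ⊗_) (cong₂ _⊗_ (sym (↑-⊗ q B a)) (sym (↑-⊗ q (conj B) c))))))
        where e : ∀ r a c x y → (r ⊗ (a ⊗ c)) ⊗ (x ⊗ y) ≡ r ⊗ ((a ⊗ x) ⊗ (c ⊗ y))
              e = Ring.solve-∀ ringK

  binom-diag : ∀ k → binom k k ≡ 1
  binom-diag zero = refl
  binom-diag (suc k) = trans (cong₂ ℕ._+_ (binom-diag k) (binom-large k (suc k) ℕ.≤-refl)) refl

  -- The case j = k, y = 0 of `trinomial`.
  binom-weight : ∀ x → 0ℚ ≤ x → ∀ M k → x ^ k * ι (binom M k) ≤ (1ℚ + x) ^ M
  binom-weight x 0≤x M k = ≤-trans (≤-≡ (sym (trans (cong₂ (λ s t → s * ι (binom M k) * (x ^ k * 0ℚ ^ t)) (trans (cong ι (binom-diag k)) (ι-lit 1)) (ℕ.n∸n≡0 k)) (e (ι (binom M k)) (x ^ k)))))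
      (≤-trans (trinomial x 0ℚ 0≤x ≤-refl M k k) (≤-≡ (cong (_^ M) (+-identityʳ (1ℚ + x)))))
    where e : ∀ b p → 1ℚ * b * (p * 1ℚ) ≡ p * b
          e = Ring.solve-∀ ringQ

  k/n : ∀ n .{{_ : ℕ.NonZero n}} a b → a ℕ.≤ n ℕ.* b → a ℕ./ n ℕ.≤ b
  k/n n a b h = ℕ.*-cancelʳ-≤ (a ℕ./ n) b n (ℕ.≤-trans (ℕ.m/n*n≤m a n) (ℕ.≤-trans h (ℕ.≤-reflexive (ℕ.*-comm n b))))

  -- Every multiple of n removed from the exponent costs one ε, and there are at most b of them.
  reduce-exponent : ∀ n .{{_ : ℕ.NonZero n}} {g ε} → Unit g → g ↑ n ⊝ 1K ≼ ε → ∀ a b → a ℕ.≤ n ℕ.* b → g ↑ (a ℕ.% n) ⊝ g ↑ a ≼ ι b * ε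
  reduce-exponent n {g} {ε} ug gⁿ a b h = ≼-swap (≼-mono (≼-≡ (≼-⊗ (unit≼ {g ↑ (a ℕ.% n)} (unit-↑ {g} (a ℕ.% n) ug)) (unit-↑-close {g ↑ n} {1K} (a ℕ./ n) (unit-↑ {g} n ug) refl gⁿ))
     (trans (cong (λ t → g ↑ (a ℕ.% n) ⊗ ((g ↑ n) ↑ (a ℕ./ n) ⊝ t)) (1↑ (a ℕ./ n))) (trans (e _ _) (cong (_⊝ g ↑ (a ℕ.% n)) (trans (cong (g ↑ (a ℕ.% n) ⊗_) (trans (sym (↑-* g n (a ℕ./ n))) (cong (g ↑_) (ℕ.*-comm n (a ℕ./ n)))))
        (trans (sym (↑-+ g (a ℕ.% n) _)) (cong (g ↑_) (sym (ℕ.m≡m%n+[m/n]*n a n)))))))))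
     (≤-trans (≤-≡ (*-identityˡ _)) (*-monoˡ (nonneg gⁿ) (ι-mono (k/n n a b h)))))
    where e : ∀ a b → a ⊗ (b ⊝ 1K) ≡ a ⊗ b ⊝ a
          e = Ring.solve-∀ ringK

  module _ (n y H κmax S R₂ R′ : ℕ) .{{_ : ℕ.NonZero n}} .{{_ : ℕ.NonZero S}} (β : K) (uβ : Unit β)
    (iβ : Integral (κ y ⊗ β)) (iβ̄ : Integral (κ y ⊗ conj β)) (not-root : ∀ r → ¬ β ↑ suc r ≡ 1K)
    (g : K) (k : ℕ) (ε : ℚ) (ug : Unit g) (gⁿ : g ↑ n ⊝ 1K ≼ ε) (βg : β ⊝ g ↑ k ≼ ε) (k<n : k ℕ.< n)
    (T₀ : ℕ) (c : ℕ → ℕ → K) (x γ Dinv P₀ : ℚ) (0≤x : 0ℚ ≤ x) (1≤y : 1 ℕ.≤ y) where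

    open Signed H
    L M : ℕ
    L = suc (H ℕ.+ H)
    M = suc S ℕ.* n

    module _ (T₀≥ : 2 ℕ.* (L ℕ.+ R₂) ℕ.+ S ℕ.+ 2 ℕ.* (n ℕ.* R′) ℕ.≤ T₀) (R′≥ : L ℕ.+ R₂ ℕ.≤ R′ ℕ.+ R′) (points : L ℕ.* κmax ℕ.< R₂ ℕ.* S)
      (c-bound : ∀ k l → k ℕ.< κmax → c k l ≼ γ * x ^ k) (c-nonzero : ¬ (∀ k l → k ℕ.< κmax → l ℕ.< L → c k l ≡ 0K)) (c-integral : ∀ k l → Integral (c k l))
      (F-small : ∀ m → m ℕ.< M → F κmax L (sp g) c m ≼ Dinv) (hP₀ : (1ℚ + x) ^ M ≤ P₀)
      (E₁ : lit 4 * (ι y ^ (R′ ℕ.* H) * Dinv) ≤ 1ℚ)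
      (E₂ : lit 4 * (ι y ^ (R′ ℕ.* H) * (ι (κmax ℕ.* L) * (γ * P₀ * (ι H * (ι T₀ * ε))))) ≤ 1ℚ)
      (E₃ : lit 4 * (ι y ^ R₂ * (ι T₀ * ε)) ≤ 1ℚ) where

      private
        0≤ε : 0ℚ ≤ ε
        0≤ε = nonneg gⁿ

        τ : ℚ
        τ = ι T₀ * ε
        0≤τ : 0ℚ ≤ τ
        0≤τ = 0≤* (0≤ι T₀) 0≤ε

        quarters : ∀ p q → lit 4 * p ≤ 1ℚ → lit 4 * q ≤ 1ℚ → p + q < 1ℚ
        quarters p q h₁ h₂ = *-cancelˡ-<-nonNeg (lit 4) {{nonNegative (0≤lit 4)}} (≤-<-trans (≤-trans (≤-≡ (*-distribˡ-+ (lit 4) p q)) (+-mono-≤ h₁ h₂)) (toWitness {a? = 1ℚ + 1ℚ <? lit 4 * 1ℚ} _))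

        -- F(m) is tiny (`E₁`) and replacing g^m by B changes it little (`E₂`). Multiplied by the
        -- denominator y^(R′H), the value at B is an integral element of absolute value at most 1/4
        -- + 1/4.
        vanishing : ∀ B m → Unit B → Integral (κ y ↑ R′ ⊗ B) → Integral (κ y ↑ R′ ⊗ conj B) → g ↑ m ⊝ B ≼ τ → m ℕ.< M
          → sum κmax (λ k → sum L (λ l → c k l ⊗ (κ (binom m k) ⊗ sp B l))) ≡ 0K
        vanishing B m uB iB iB̄ close m<M = noZeroDiv q G (integral-vanish integral-qG qG≼ <1) q≢0
          where
          q = (κ y ↑ R′) ↑ H
          G = sum κmax (λ k → sum L (λ l → c k l ⊗ (κ (binom m k) ⊗ sp B l)))
          q≢0 : ¬ q ≡ 0K
          q≢0 e = y^≢0 H (y^≢0 R′ (λ e′ → ℕ.<⇒≢ 1≤y (sym (κ-inj (trans e′ (sym κ-0)))))) e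
            where y^≢0 : ∀ {a} j → ¬ a ≡ 0K → ¬ a ↑ j ≡ 0K
                  y^≢0 zero _ ()
                  y^≢0 {a} (suc j) na e = y^≢0 j na (noZeroDiv a (a ↑ j) e na)
          integral-qG : Integral (q ⊗ G)
          integral-qG = subst Integral (trans (sum-ext κmax (λ k _ → sum-scale L q _)) (sum-scale κmax q _))
            (integral-sum κmax (λ k _ → integral-sum L (λ l l< → subst Integral (e (c k l) (κ (binom m k)) q (sp B l))
              (integral-⊗ (c-integral k l) (integral-⊗ (integral-κ (binom m k)) (integral-sp {κ y ↑ R′} {B} l l< (integral-↑ R′ (integral-κ y)) iB iB̄))))))
            where e : ∀ c b q s → c ⊗ (b ⊗ (q ⊗ s)) ≡ q ⊗ (c ⊗ (b ⊗ s))
                  e = Ring.solve-∀ ringK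
          diff : F κmax L (sp g) c m ⊝ G ≼ ι (κmax ℕ.* L) * (γ * P₀ * (ι H * τ))
          diff = ≼-mono (≼-≡ (sum-≼ κmax (0≤* (0≤ι L) 0≤b) (λ k k< → sum-≼ L 0≤b (λ l l< → term k l k< l<))) difference)
              (≤-≡ (trans (sym (*-assoc (ι κmax) (ι L) b)) (cong (_* b) (sym (ι-* κmax L)))))
            where
            b = γ * P₀ * (ι H * τ)
            0≤P₀ : 0ℚ ≤ P₀
            0≤P₀ = ≤-trans (0≤^ M (0≤+ 0≤1 0≤x)) hP₀
            0≤γ : 0 ℕ.< κmax → 0ℚ ≤ γ
            0≤γ h = nonneg (c-bound 0 0 h) ≤≡ *-identityʳ γ
            κ>0 : 0 ℕ.< κmax
            κ>0 with κmax ℕ.≟ 0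
            ... | no nz = ℕ.n≢0⇒n>0 nz
            ... | yes z = ⊥-elim (c-nonzero (λ k l k< _ → ⊥-elim (ℕ.n≮0 (subst (k ℕ.<_) z k<))))
            0≤b : 0ℚ ≤ b
            0≤b = 0≤* (0≤* (0≤γ κ>0) 0≤P₀) (0≤* (0≤ι H) 0≤τ)
            term : ∀ k l → k ℕ.< κmax → l ℕ.< L → c k l ⊗ (κ (binom m k) ⊗ (sp g l ↑ m ⊝ sp B l)) ≼ b
            term k l k< l< = ≼-mono (≼-⊗ (c-bound k l k<) (≼-⊗ (≼-κ (binom m k)) (≼-≡ (sp-close {g ↑ m} {B} l l< (unit-↑ {g} m ug) uB close) (cong (_⊝ sp B l) (sp-↑ g l m)))))
              (≤-trans (≤-≡ (e γ (x ^ k) (ι (binom m k)) (ι H * τ))) (*-monoˡ (0≤* (0≤ι H) 0≤τ) (*-monoʳ (0≤γ κ>0) (≤-trans (*-monoʳ (0≤^ k 0≤x) (ι-mono (binom-mono k (ℕ.<⇒≤ m<M)))) (≤-trans (binom-weight x 0≤x M k) hP₀)))))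
              where e : ∀ g X a t → g * X * (a * t) ≡ g * (X * a) * t
                    e = Ring.solve-∀ ringQ
            difference : sum κmax (λ k → sum L (λ l → c k l ⊗ (κ (binom m k) ⊗ (sp g l ↑ m ⊝ sp B l)))) ≡ F κmax L (sp g) c m ⊝ G
            difference = trans (sum-ext κmax (λ k _ → trans (sum-ext L (λ l _ → e₁ (c k l) (κ (binom m k)) (sp g l ↑ m) (sp B l))) (trans (sum-⊕ L _ _) (cong (sum L _ ⊕_) (sum-scale L (⊖ 1K) _)))))
               (trans (sum-⊕ κmax _ _) (trans (cong (F κmax L (sp g) c m ⊕_) (sum-scale κmax (⊖ 1K) _)) (e₂ _ _)))
              where e₁ : ∀ c b p q → c ⊗ (b ⊗ (p ⊝ q)) ≡ c ⊗ (b ⊗ p) ⊕ ⊖ 1K ⊗ (c ⊗ (b ⊗ q))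
                    e₁ = Ring.solve-∀ ringK
                    e₂ : ∀ p q → p ⊕ ⊖ 1K ⊗ q ≡ p ⊝ q
                    e₂ = Ring.solve-∀ ringK
          G≼ : G ≼ Dinv + ι (κmax ℕ.* L) * (γ * P₀ * (ι H * τ))
          G≼ = ≼-≡ (≼-⊝ (F-small m m<M) diff) (e (F κmax L (sp g) c m) G)
            where e : ∀ f g → f ⊝ (f ⊝ g) ≡ g
                  e = Ring.solve-∀ ringK
          q≼ : q ≼ ι y ^ (R′ ℕ.* H)
          q≼ = ≼-≡ (↑-≼ (R′ ℕ.* H) (≼-κ y)) (↑-* (κ y) R′ H)
          bd : ℚ
          bd = ι y ^ (R′ ℕ.* H) * (Dinv + ι (κmax ℕ.* L) * (γ * P₀ * (ι H * τ)))
          qG≼ : q ⊗ G ≼ bd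
          qG≼ = ≼-⊗ q≼ G≼
          <1 : bd < 1ℚ
          <1 = subst (_< 1ℚ) (sym (*-distribˡ-+ (ι y ^ (R′ ℕ.* H)) Dinv _)) (quarters (ι y ^ (R′ ℕ.* H) * Dinv) (ι y ^ (R′ ℕ.* H) * (ι (κmax ℕ.* L) * (γ * P₀ * (ι H * τ)))) E₁ E₂)

        reduce : ∀ a b → a ℕ.≤ n ℕ.* b → g ↑ (a ℕ.% n) ⊝ g ↑ a ≼ ι b * ε
        reduce = reduce-exponent n {g} ug gⁿ

        gk-close : ∀ r → g ↑ (k ℕ.* r) ⊝ β ↑ r ≼ ι r * ε
        gk-close r = ≼-≡ (≼-swap (unit-↑-close {β} {g ↑ k} r uβ (unit-↑ {g} k ug) βg)) (cong (_⊝ β ↑ r) (sym (↑-* g k r)))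

        -- k(n - 1) ≡ -k modulo n, so the natural exponent n - 1 stands for inversion.
        gk̄-close : g ↑ (k ℕ.* (n ℕ.∸ 1)) ⊝ conj β ≼ ι n * ε
        gk̄-close = ≼-mono (≼-trans {g ↑ (k ℕ.* (n ℕ.∸ 1))} {conj (g ↑ k)} {conj β} first (≼-≡ (≼-conj (≼-swap βg)) (conj-⊝ (g ↑ k) β)))
            (≤-trans (≤-≡ (trans (e₁ (ι k) ε) (cong (_* ε) (sym (ι-suc k))))) (*-monoˡ 0≤ε (ι-mono k<n)))
          where
          e₁ : ∀ k e → k * e + e ≡ (1ℚ + k) * e
          e₁ = Ring.solve-∀ ringQ
          nn : k ℕ.* (n ℕ.∸ 1) ℕ.+ k ≡ n ℕ.* k
          nn = trans (ℕ.+-comm _ k) (trans (sym (ℕ.*-suc k (n ℕ.∸ 1))) (trans (cong (k ℕ.*_) (ℕ.m+[n∸m]≡n (ℕ.≤-trans (ℕ.s≤s ℕ.z≤n) k<n))) (ℕ.*-comm k n)))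
          first : g ↑ (k ℕ.* (n ℕ.∸ 1)) ⊝ conj (g ↑ k) ≼ ι k * ε
          first = ≼-mono (≼-≡ (≼-⊗ (unit≼ {conj (g ↑ k)} (unit-conj {g ↑ k} (unit-↑ {g} k ug))) (≼-≡ (unit-↑-close {g ↑ n} {1K} k (unit-↑ {g} n ug) refl gⁿ) (cong₂ _⊝_ (sym (↑-* g n k)) (1↑ k))))
              (trans (cong (λ t → conj (g ↑ k) ⊗ (g ↑ t ⊝ 1K)) (sym nn)) (trans (cong (λ t → conj (g ↑ k) ⊗ (t ⊝ 1K)) (↑-+ g (k ℕ.* (n ℕ.∸ 1)) k)) (trans (e (conj (g ↑ k)) (g ↑ (k ℕ.* (n ℕ.∸ 1))) (g ↑ k)) (trans (cong (λ t → g ↑ (k ℕ.* (n ℕ.∸ 1)) ⊗ t ⊝ conj (g ↑ k)) (unit-inv {g ↑ k} (unit-↑ {g} k ug))) (e₂ _ _))))))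
              (≤-≡ (*-identityˡ _))
            where e : ∀ c a b → c ⊗ (a ⊗ b ⊝ 1K) ≡ a ⊗ (b ⊗ c) ⊝ c
                  e = Ring.solve-∀ ringK
                  e₂ : ∀ a c → a ⊗ 1K ⊝ c ≡ a ⊝ c
                  e₂ = Ring.solve-∀ ringK

        -- This is β^(i-R′). As r + i ≤ 2R′, the exponents in β^r · `A₀ i` lie between -R′ and R′,
        -- which halves the power of y needed as denominator.
        A₀ : ℕ → K
        A₀ i = β ↑ i ⊗ conj β ↑ R′

        uA₀ : ∀ i → Unit (A₀ i)
        uA₀ i = unit-⊗ {β ↑ i} (unit-↑ {β} i uβ) (unit-↑ {conj β} R′ (unit-conj {β} uβ))

        expo : ℕ → ℕ
        expo i = k ℕ.* i ℕ.+ k ℕ.* (n ℕ.∸ 1) ℕ.* R′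

        s₁ x₁ : ℕ → ℕ
        s₁ r = (k ℕ.* r) ℕ.% n
        x₁ i = expo i ℕ.% n

        s₁-close : ∀ r → g ↑ s₁ r ⊝ β ↑ r ≼ ι (r ℕ.+ r) * ε
        s₁-close r = ≼-mono (≼-trans {g ↑ s₁ r} {g ↑ (k ℕ.* r)} {β ↑ r} (reduce (k ℕ.* r) r (ℕ.*-monoˡ-≤ r (ℕ.<⇒≤ k<n))) (gk-close r)) (≤-≡ (trans (sym (*-distribʳ-+ ε (ι r) (ι r))) (cong (_* ε) (sym (ι-+ r r)))))

        x₁-close : ∀ i → g ↑ x₁ i ⊝ A₀ i ≼ ι ((i ℕ.+ n ℕ.* R′) ℕ.+ (i ℕ.+ n ℕ.* R′)) * ε
        x₁-close i = ≼-mono (≼-trans {g ↑ x₁ i} {g ↑ expo i} {A₀ i} (reduce (expo i) (i ℕ.+ n ℕ.* R′) expo≤) second) (≤-≡ (trans (sym (*-distribʳ-+ ε (ι q) (ι q))) (cong (_* ε) (sym (ι-+ q q)))))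
          where
          q = i ℕ.+ n ℕ.* R′
          expo≤ : expo i ℕ.≤ n ℕ.* q
          expo≤ = ℕ.≤-trans (ℕ.+-mono-≤ (ℕ.*-monoˡ-≤ i (ℕ.<⇒≤ k<n)) (ℕ.*-monoˡ-≤ R′ (ℕ.*-mono-≤ (ℕ.<⇒≤ k<n) (ℕ.m∸n≤m n 1)))) (ℕ.≤-reflexive (e n i R′))
            where e : ∀ n i r → n ℕ.* i ℕ.+ n ℕ.* n ℕ.* r ≡ n ℕ.* (i ℕ.+ n ℕ.* r)
                  e = solve-∀
          second : g ↑ expo i ⊝ A₀ i ≼ ι q * ε
          second = ≼-mono (≼-≡ (⊗-close {g ↑ (k ℕ.* i)} {β ↑ i} (unit-↑ {g} (k ℕ.* i) ug) (unit-↑ {conj β} R′ (unit-conj {β} uβ)) (gk-close i)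
               (unit-↑-close {g ↑ (k ℕ.* (n ℕ.∸ 1))} {conj β} R′ (unit-↑ {g} (k ℕ.* (n ℕ.∸ 1)) ug) (unit-conj {β} uβ) gk̄-close))
               (cong (_⊝ A₀ i) (trans (cong (g ↑ (k ℕ.* i) ⊗_) (sym (↑-* g (k ℕ.* (n ℕ.∸ 1)) R′))) (sym (↑-+ g (k ℕ.* i) _)))))
             (≤-≡ (trans (e (ι i) (ι n) (ι R′) ε) (cong (_* ε) (sym (trans (ι-+ i (n ℕ.* R′)) (cong (λ t → ι i + t) (ι-* n R′)))))))
            where e : ∀ i n r e → i * e + r * (n * e) ≡ (i + n * r) * e
                  e = Ring.solve-∀ ringQ

        -- Division by S enumerates pairs (i, s): i selects a power of β and s a translate by n,
        -- which hardly moves g^m because gⁿ ≈ 1 but yields a new point m for the polynomials.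
        X : ℕ → ℕ
        X idx = x₁ (idx ℕ./ S) ℕ.+ (idx ℕ.% S) ℕ.* n

        -- The cost in units of ε is 2r for `s₁ r`, 2(i + nR′) for `x₁ i` and s for the translate;
        -- `T₀` covers the sum.
        grid-close : ∀ r i s → r ℕ.< L → i ℕ.< R₂ → s ℕ.< S → g ↑ (s₁ r ℕ.+ (x₁ i ℕ.+ s ℕ.* n)) ⊝ β ↑ r ⊗ A₀ i ≼ τ
        grid-close r i s r< i< s< = ≼-mono (≼-≡ (⊗-close {g ↑ s₁ r} {β ↑ r} (unit-↑ {g} (s₁ r) ug) (uA₀ i) (s₁-close r) (≼-≡ (⊗-close {g ↑ x₁ i} {A₀ i} {(g ↑ n) ↑ s} {1K} (unit-↑ {g} (x₁ i) ug) refl (x₁-close i)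
              (≼-≡ (unit-↑-close {g ↑ n} {1K} s (unit-↑ {g} n ug) refl gⁿ) (cong ((g ↑ n) ↑ s ⊝_) (1↑ s))))
              (cong₂ _⊝_ (trans (cong (g ↑ x₁ i ⊗_) (trans (sym (↑-* g n s)) (cong (g ↑_) (ℕ.*-comm n s)))) (sym (↑-+ g (x₁ i) _))) (e₁ (A₀ i)))))
              (cong (_⊝ β ↑ r ⊗ A₀ i) (sym (↑-+ g (s₁ r) _))))
            (≤-trans (≤-≡ (trans (cong (λ t → ι (r ℕ.+ r) * ε + t) (sym (*-distribʳ-+ ε (ι ((i ℕ.+ n ℕ.* R′) ℕ.+ (i ℕ.+ n ℕ.* R′))) (ι s)))) (trans (sym (*-distribʳ-+ ε (ι (r ℕ.+ r)) _)) (cong (_* ε) (sym (trans (ι-+ (r ℕ.+ r) _) (cong (λ t → ι (r ℕ.+ r) + t) (ι-+ ((i ℕ.+ n ℕ.* R′) ℕ.+ (i ℕ.+ n ℕ.* R′)) s))))))))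
               (*-monoˡ 0≤ε (ι-mono (ℕ.≤-trans (ℕ.≤-trans (ℕ.≤-reflexive (e₂ r i s (n ℕ.* R′))) (ℕ.+-monoˡ-≤ (2 ℕ.* (n ℕ.* R′)) (ℕ.+-mono-≤ (ℕ.*-monoʳ-≤ 2 (ℕ.+-mono-≤ (ℕ.<⇒≤ r<) (ℕ.<⇒≤ i<))) (ℕ.<⇒≤ s<)))) T₀≥))))
          where e₁ : ∀ a → a ⊗ 1K ≡ a
                e₁ = Ring.solve-∀ ringK
                e₂ : ∀ r i s m → (r ℕ.+ r) ℕ.+ ((i ℕ.+ m) ℕ.+ (i ℕ.+ m) ℕ.+ s) ≡ 2 ℕ.* (r ℕ.+ i) ℕ.+ s ℕ.+ 2 ℕ.* m
                e₂ = solve-∀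

        integral-pow : ∀ w d → d ℕ.≤ R′ → Integral (κ y ⊗ w) → Integral (κ y ↑ R′ ⊗ w ↑ d)
        integral-pow w d d≤ iw = subst Integral (trans (cong (κ y ↑ (R′ ℕ.∸ d) ⊗_) (↑-⊗ (κ y) w d)) (trans (sym (⊗-assoc _ _ _)) (cong (_⊗ w ↑ d) (trans (sym (↑-+ (κ y) (R′ ℕ.∸ d) d)) (cong (κ y ↑_) (ℕ.m∸n+n≡m d≤))))))
           (integral-⊗ (integral-↑ (R′ ℕ.∸ d) (integral-κ y)) (integral-↑ d iw))

        cancel-powers : ∀ w w̄ a b → w ⊗ w̄ ≡ 1K → w ↑ (a ℕ.+ b) ⊗ w̄ ↑ b ≡ w ↑ a
        cancel-powers w w̄ a b e = trans (cong (_⊗ w̄ ↑ b) (↑-+ w a b)) (trans (⊗-assoc _ _ _) (trans (cong (w ↑ a ⊗_) (trans (sym (↑-⊗ w w̄ b)) (trans (cong (_↑ b) e) (1↑ b)))) (e₁ _)))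
          where e₁ : ∀ a → a ⊗ 1K ≡ a
                e₁ = Ring.solve-∀ ringK

        integral-quotient : ∀ w w̄ m → w ⊗ w̄ ≡ 1K → m ℕ.≤ R′ ℕ.+ R′ → Integral (κ y ⊗ w) → Integral (κ y ⊗ w̄) → Integral (κ y ↑ R′ ⊗ (w ↑ m ⊗ w̄ ↑ R′))
        integral-quotient w w̄ m e m≤ iw iw̄ with ℕ.≤-total m R′
        ... | inj₁ h = subst (λ t → Integral (κ y ↑ R′ ⊗ t)) (sym (trans (⊗-comm _ _) (trans (cong (λ t → w̄ ↑ t ⊗ w ↑ m) (sym (ℕ.m∸n+n≡m h))) (cancel-powers w̄ w (R′ ℕ.∸ m) m (trans (⊗-comm w̄ w) e)))))
             (integral-pow w̄ (R′ ℕ.∸ m) (ℕ.m∸n≤m R′ m) iw̄)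
        ... | inj₂ h = subst (λ t → Integral (κ y ↑ R′ ⊗ t)) (sym (trans (cong (λ t → w ↑ t ⊗ w̄ ↑ R′) (sym (ℕ.m∸n+n≡m h))) (cancel-powers w w̄ (m ℕ.∸ R′) R′ e)))
             (integral-pow w (m ℕ.∸ R′) (ℕ.≤-trans (ℕ.∸-monoˡ-≤ R′ m≤) (ℕ.≤-reflexive (ℕ.m+n∸n≡m R′ R′))) iw)

        grid-form : ∀ r i → β ↑ r ⊗ A₀ i ≡ β ↑ (r ℕ.+ i) ⊗ conj β ↑ R′
        grid-form r i = trans (sym (⊗-assoc _ _ _)) (cong (_⊗ conj β ↑ R′) (sym (↑-+ β r i)))

        conj-grid : ∀ m → conj (β ↑ m ⊗ conj β ↑ R′) ≡ conj β ↑ m ⊗ β ↑ R′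
        conj-grid m = trans (conj-⊗ (β ↑ m) (conj β ↑ R′)) (cong₂ _⊗_ (conj-↑ β m) (trans (conj-↑ (conj β) R′) (cong (_↑ R′) (conj-conj β))))
          where conj-conj : ∀ z → conj (conj z) ≡ z
                conj-conj (a ⸴ b) = cong (a ⸴_) (neg-neg b)
                  where neg-neg : ∀ b → - - b ≡ b
                        neg-neg = Ring.solve-∀ ringQ

        idx<R₂ : ∀ idx → idx ℕ.≤ L ℕ.* κmax → idx ℕ./ S ℕ.< R₂
        idx<R₂ idx h = ℕ.*-cancelʳ-< S (idx ℕ./ S) R₂ (ℕ.≤-<-trans (ℕ.m/n*n≤m idx S) (ℕ.≤-<-trans h points))

        vanish : ∀ r idx → r ℕ.< L → idx ℕ.≤ L ℕ.* κmax → sum κmax (λ k → sum L (λ l → c k l ⊗ (κ (binom (s₁ r ℕ.+ X idx) k) ⊗ (sp β l ↑ r ⊗ sp (A₀ (idx ℕ./ S)) l)))) ≡ 0K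
        vanish r idx r< idx≤ = trans (sum-ext κmax (λ k _ → sum-ext L (λ l _ → cong (λ t → c k l ⊗ (κ (binom (s₁ r ℕ.+ X idx) k) ⊗ t)) (sym (trans (sp-⊗ (β ↑ r) (A₀ i) l) (cong (_⊗ sp (A₀ i) l) (sp-↑ β l r)))))))
            (vanishing (β ↑ r ⊗ A₀ i) (s₁ r ℕ.+ X idx) (unit-⊗ {β ↑ r} (unit-↑ {β} r uβ) (uA₀ i))
              (subst (λ t → Integral (κ y ↑ R′ ⊗ t)) (sym (grid-form r i)) (integral-quotient β (conj β) (r ℕ.+ i) (unit-inv {β} uβ) ri≤ iβ iβ̄))
              (subst (λ t → Integral (κ y ↑ R′ ⊗ t)) (sym (trans (cong conj (grid-form r i)) (conj-grid (r ℕ.+ i)))) (integral-quotient (conj β) β (r ℕ.+ i) (trans (⊗-comm _ _) (unit-inv {β} uβ)) ri≤ iβ̄ iβ))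
              (grid-close r i s r< i< s<) m<M)
          where
          i = idx ℕ./ S
          s = idx ℕ.% S
          i< : i ℕ.< R₂
          i< = idx<R₂ idx idx≤
          s< : s ℕ.< S
          s< = ℕ.m%n<n idx S
          ri≤ : r ℕ.+ i ℕ.≤ R′ ℕ.+ R′
          ri≤ = ℕ.≤-trans (ℕ.+-mono-≤ (ℕ.<⇒≤ r<) (ℕ.<⇒≤ i<)) R′≥
          m<M : s₁ r ℕ.+ X idx ℕ.< M
          m<M = ℕ.+-mono-<-≤ (ℕ.m%n<n (k ℕ.* r) n) (ℕ.≤-trans (ℕ.+-monoˡ-≤ (s ℕ.* n) (ℕ.<⇒≤ (ℕ.m%n<n (expo i) n))) (ℕ.*-monoˡ-≤ n s<))

        -- Equal residues would bring β^(d+1) within 2τ of 1. Since y^(d+1) clears the denominator,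
        -- `E₃` forces β^(d+1) = 1, but β is not a root of unity.
        no-collision : ∀ i d → i ℕ.+ suc d ℕ.< R₂ → ¬ x₁ (i ℕ.+ suc d) ≡ x₁ i
        no-collision i d i< e = not-root d (eqK (noZeroDiv (κ y ↑ suc d) (β ↑ suc d ⊝ 1K) (integral-vanish int small <1) y≢0))
          where
          j = i ℕ.+ suc d
          eqK : ∀ {z w} → z ⊝ w ≡ 0K → z ≡ w
          eqK {z} {w} e = trans (l z w) (trans (cong (_⊕ w) e) (⊕-idˡ w))
            where l : ∀ z w → z ≡ (z ⊝ w) ⊕ w
                  l = Ring.solve-∀ ringK
          y≢0 : ¬ κ y ↑ suc d ≡ 0K
          y≢0 = go (suc d)
            where go : ∀ j → ¬ κ y ↑ j ≡ 0K
                  go zero ()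
                  go (suc j) e = go j (noZeroDiv (κ y) (κ y ↑ j) e (λ e′ → ℕ.<⇒≢ 1≤y (sym (κ-inj (trans e′ (sym κ-0))))))
          τ′ : ∀ i → i ℕ.< R₂ → g ↑ x₁ i ⊝ A₀ i ≼ τ
          τ′ i i< = ≼-mono (x₁-close i) (*-monoˡ 0≤ε (ι-mono (ℕ.≤-trans (ℕ.≤-trans (ℕ.≤-reflexive (e₂ i (n ℕ.* R′))) (ℕ.+-monoˡ-≤ (2 ℕ.* (n ℕ.* R′)) (ℕ.≤-trans (ℕ.*-monoʳ-≤ 2 (ℕ.≤-trans (ℕ.<⇒≤ i<) (ℕ.m≤n+m R₂ L))) (ℕ.m≤m+n _ S)))) T₀≥)))
            where e₂ : ∀ i m → (i ℕ.+ m) ℕ.+ (i ℕ.+ m) ≡ 2 ℕ.* i ℕ.+ 2 ℕ.* m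
                  e₂ = solve-∀
          AA : A₀ j ⊝ A₀ i ≼ τ + τ
          AA = ≼-trans {A₀ j} {g ↑ x₁ j} {A₀ i} (≼-swap (τ′ j i<)) (subst (λ t → g ↑ t ⊝ A₀ i ≼ τ) (sym e) (τ′ i (ℕ.≤-trans (ℕ.s≤s (ℕ.m≤m+n i (suc d))) i<)))
          β1 : β ↑ suc d ⊝ 1K ≼ τ + τ
          β1 = ≼-mono (≼-≡ (≼-⊗ (unit≼ {conj (A₀ i)} (unit-conj {A₀ i} (uA₀ i))) AA) (trans (cong (λ t → conj (A₀ i) ⊗ (t ⊝ A₀ i)) (trans (cong (_⊗ conj β ↑ R′) (↑-+ β i (suc d))) (l₁ _ _ _))) (trans (l₂ (conj (A₀ i)) (A₀ i) (β ↑ suc d)) (trans (cong (λ t → t ⊗ (β ↑ suc d ⊝ 1K)) (unit-inv {A₀ i} (uA₀ i))) (⊗-idˡ _)))))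
               (≤-≡ (*-identityˡ _))
            where l₁ : ∀ a b c → (a ⊗ b) ⊗ c ≡ (a ⊗ c) ⊗ b
                  l₁ = Ring.solve-∀ ringK
                  l₂ : ∀ c a b → c ⊗ (a ⊗ b ⊝ a) ≡ (a ⊗ c) ⊗ (b ⊝ 1K)
                  l₂ = Ring.solve-∀ ringK
          int : Integral (κ y ↑ suc d ⊗ (β ↑ suc d ⊝ 1K))
          int = subst Integral (trans (cong (_⊝ κ y ↑ suc d) (↑-⊗ (κ y) β (suc d))) (l _ _)) (integral-⊕ (integral-↑ (suc d) iβ) (integral-⊖ (integral-↑ (suc d) (integral-κ y))))
            where l : ∀ a b → a ⊗ b ⊝ a ≡ a ⊗ (b ⊝ 1K)
                  l = Ring.solve-∀ ringK
          small : κ y ↑ suc d ⊗ (β ↑ suc d ⊝ 1K) ≼ ι y ^ suc d * (τ + τ)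
          small = ≼-⊗ (↑-≼ (suc d) (≼-κ y)) β1
          <1 : ι y ^ suc d * (τ + τ) < 1ℚ
          <1 = ≤-<-trans (≤-trans (*-monoˡ (0≤+ 0≤τ 0≤τ) (^-mono-exp {m = suc d} {R₂} (≤-trans (≤-≡ (sym (ι-lit 1))) (ι-mono 1≤y)) (ℕ.≤-trans (ℕ.m≤n+m (suc d) i) (ℕ.<⇒≤ i<))))
              (≤-≡ (*-distribˡ-+ (ι y ^ R₂) τ τ))) (quarters (ι y ^ R₂ * τ) (ι y ^ R₂ * τ) E₃ E₃)

        x₁-inj : ∀ i j → i ℕ.< R₂ → j ℕ.< R₂ → x₁ i ≡ x₁ j → i ≡ j
        x₁-inj i j i< j< e with ℕ.<-cmp i j
        ... | tri≈ _ i≡j _ = i≡j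
        ... | tri< i<j _ _ = ⊥-elim (no-collision i (j ℕ.∸ suc i) (subst (ℕ._< R₂) (sym eq) j<) (trans (cong x₁ eq) (sym e)))
          where eq : i ℕ.+ suc (j ℕ.∸ suc i) ≡ j
                eq = trans (ℕ.+-suc i _) (ℕ.m+[n∸m]≡n i<j)
        ... | tri> _ _ j<i = ⊥-elim (no-collision j (i ℕ.∸ suc j) (subst (ℕ._< R₂) (sym eq) i<) (trans (cong x₁ eq) e))
          where eq : j ℕ.+ suc (i ℕ.∸ suc j) ≡ i
                eq = trans (ℕ.+-suc j _) (ℕ.m+[n∸m]≡n j<i)

        X-inj : ∀ i j → i ℕ.≤ L ℕ.* κmax → j ℕ.≤ L ℕ.* κmax → X i ≡ X j → i ≡ j
        X-inj i j i≤ j≤ e = trans (ℕ.m≡m%n+[m/n]*n i S) (trans (cong₂ (λ a b → a ℕ.+ b ℕ.* S) s≡ q≡) (sym (ℕ.m≡m%n+[m/n]*n j S)))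
          where
          q≡ : i ℕ./ S ≡ j ℕ./ S
          q≡ = x₁-inj _ _ (idx<R₂ i i≤) (idx<R₂ j j≤) (trans (sym (mod i)) (trans (cong (ℕ._% n) e) (mod j)))
            where mod : ∀ i → X i ℕ.% n ≡ x₁ (i ℕ./ S)
                  mod i = trans (ℕ.[m+kn]%n≡m%n (x₁ (i ℕ./ S)) (i ℕ.% S) n) (ℕ.m%n%n≡m%n (expo (i ℕ./ S)) n)
          s≡ : i ℕ.% S ≡ j ℕ.% S
          s≡ = ℕ.*-cancelʳ-≡ _ _ n (ℕ.+-cancelˡ-≡ (x₁ (i ℕ./ S)) _ _ (trans e (cong (λ t → x₁ t ℕ.+ (j ℕ.% S) ℕ.* n) (sym q≡))))

        b-inj : ∀ l l′ → l ℕ.< L → l′ ℕ.< l → ¬ sp β l ≡ sp β l′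
        b-inj l l′ _ l′<l e = not-root (l ℕ.∸ suc l′) (trans (sym (⊗-idˡ _)) (trans (cong (_⊗ β ↑ suc d) (sym (trans (⊗-comm _ _) inv))) (trans (⊗-assoc _ _ _) (trans (cong (conj (β ↑ l′) ⊗_) (trans (sym (↑-+ β l′ (suc d))) (trans (cong (β ↑_) (trans (ℕ.+-suc l′ d) (ℕ.m+[n∸m]≡n l′<l))) pw≡))) (trans (⊗-comm _ _) inv)))))
          where
          d = l ℕ.∸ suc l′
          inv : β ↑ l′ ⊗ conj (β ↑ l′) ≡ 1K
          inv = unit-inv {β ↑ l′} (unit-↑ {β} l′ uβ)
          pw≡ : β ↑ l ≡ β ↑ l′
          pw≡ = trans (sym (sp-unsigned {β} l uβ)) (trans (cong (β ↑ H ⊗_) e) (sp-unsigned {β} l′ uβ))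

      contradiction′ : ⊥
      contradiction′ = zero-estimate κmax L c (sp β) b-inj s₁ X X-inj (λ idx l → sp (A₀ (idx ℕ./ S)) l) (λ idx l → sp-unit {A₀ (idx ℕ./ S)} l (uA₀ (idx ℕ./ S))) vanish c-nonzero

-- Powers of 1 + x bounded by powers of 2

module PowerBounds where
  open Rationals
  open AuxiliaryFunction
  open import Data.Rational
  open import Data.Rational.Properties
  import Data.Nat as ℕ
  import Data.Nat.Properties as ℕ
  open import Data.Nat.Tactic.RingSolver using (solve-∀)

  ^-cancel-≤ : ∀ {a b} n → 0ℚ ≤ a → 0ℚ ≤ b → a ^ suc n ≤ b ^ suc n → a ≤ b
  ^-cancel-≤ {a} {b} n 0≤a 0≤b h = go (a ≤? b)
    where
    strict : b < a → ∀ n → b ^ suc n < a ^ suc n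
    strict l zero = subst₂ _<_ (sym (*-identityʳ b)) (sym (*-identityʳ a)) l
    strict l (suc n) = ≤-<-trans (*-monoʳ 0≤b (<⇒≤ (strict l n))) (*-monoˡ-<-pos (a ^ suc n) {{positive (≤-<-trans (0≤^ (suc n) 0≤b) (strict l n))}} l)
    go : Dec (a ≤ b) → a ≤ b
    go (yes p) = p
    go (no ¬p) with () ← <⇒≱ (strict (≰⇒> ¬p) n) h

  -- (1 + x)^m ≤ 1 + w + ⅔ w² for w = m x ≤ ½.
  small-power : ∀ {x} p → 0ℚ ≤ x → lit 2 * (ι p * x) ≤ 1ℚ → lit 3 * (1ℚ + x) ^ p ≤ lit 5
  small-power {x} p 0≤x h = ≤-trans (go p h) (cancelʳ {lit 2} (toWitness {a? = 0ℚ <? lit 2} _) (diff⇒≤ (0≤* (≤⇒diff h) (0≤+ (0≤lit 4) (0≤* (0≤lit 2) (0≤* (0≤ι p) 0≤x))) ≤≡ e (ι p * x))))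
    where
    e : ∀ w → (1ℚ - lit 2 * w) * (lit 4 + lit 2 * w) ≡ lit 5 * lit 2 - (lit 3 + lit 3 * w + lit 2 * (w * w)) * lit 2
    e = Ring.solve-∀ ringQ
    go : ∀ m → lit 2 * (ι m * x) ≤ 1ℚ → lit 3 * (1ℚ + x) ^ m ≤ lit 3 + lit 3 * (ι m * x) + lit 2 * (ι m * x * (ι m * x))
    go zero _ = ≤-≡ (trans (z x) (cong (λ t → lit 3 + lit 3 * (t * x) + lit 2 * (t * x * (t * x))) (sym (ι-lit 0))))
      where z : ∀ x → lit 3 * 1ℚ ≡ lit 3 + lit 3 * (0ℚ * x) + lit 2 * (0ℚ * x * (0ℚ * x))
            z = Ring.solve-∀ ringQ
    go (suc m) h = ≤-trans (≤-≡ (l (1ℚ + x) ((1ℚ + x) ^ m))) (≤-trans (*-monoʳ (0≤+ 0≤1 0≤x) (go m h′)) (diff⇒≤ (0≤+ (0≤* (0≤* (0≤* (0≤ι m) 0≤x) 0≤x) (≤⇒diff h′)) (0≤* (0≤lit 2) (0≤sq x)) ≤≡ trans (f (ι m) x) (cong (λ t → lit 3 + lit 3 * (t * x) + lit 2 * (t * x * (t * x)) - (1ℚ + x) * (lit 3 + lit 3 * (ι m * x) + lit 2 * (ι m * x * (ι m * x)))) (sym (ι-suc m))))))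
      where
      l : ∀ a b → lit 3 * (a * b) ≡ a * (lit 3 * b)
      l = Ring.solve-∀ ringQ
      h′ : lit 2 * (ι m * x) ≤ 1ℚ
      h′ = ≤-trans (*-monoʳ (0≤lit 2) (*-monoˡ 0≤x (ι-mono (ℕ.n≤1+n m)))) h
      f : ∀ m x → m * x * x * (1ℚ - lit 2 * (m * x)) + lit 2 * (x * x)
          ≡ lit 3 + lit 3 * ((1ℚ + m) * x) + lit 2 * ((1ℚ + m) * x * ((1ℚ + m) * x)) - (1ℚ + x) * (lit 3 + lit 3 * (m * x) + lit 2 * (m * x * (m * x)))
      f = Ring.solve-∀ ringQ

  -- (5/3)⁴ < 8.
  small-power⁴ : ∀ {x} p → 0ℚ ≤ x → lit 2 * (ι p * x) ≤ 1ℚ → (1ℚ + x) ^ (p ℕ.* 4) ≤ 2ℚ ^ 3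
  small-power⁴ {x} p 0≤x h = *-cancelˡ-≤-pos (lit 3 ^ 4) {{positive (toWitness {a? = 0ℚ <? lit 3 ^ 4} _)}}
    (≤-trans (≤-≡ (trans (cong (lit 3 ^ 4 *_) (^-* (1ℚ + x) p 4)) (sym (^-*-base (lit 3) ((1ℚ + x) ^ p) 4))))
    (≤-trans (^-mono 4 (0≤* (0≤lit 3) (0≤^ p (0≤+ 0≤1 0≤x))) (small-power p 0≤x h)) (toWitness {a? = lit 5 ^ 4 ≤? lit 3 ^ 4 * 2ℚ ^ 3} _)))

  -- The inequality is proved for (r + 1)-th powers, which allows exponents with denominator r + 1
  -- and so less rounding.
  small-power-scaled : ∀ {x} p M r q → 0ℚ ≤ x → lit 2 * (ι p * x) ≤ 1ℚ → M ℕ.* suc r ℕ.≤ p ℕ.* 4 ℕ.* q → ∀ s → 3 ℕ.* q ℕ.≤ s ℕ.* suc r → (1ℚ + x) ^ M ≤ 2ℚ ^ s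
  small-power-scaled {x} p M r q 0≤x h le s le₂ = ^-cancel-≤ r (0≤^ M 0≤1+x) (0≤^ s (0≤lit 2))
    (≤-trans (≤-≡ (sym (^-* (1ℚ + x) M (suc r)))) (≤-trans (^-mono-exp 1≤1+x le) (≤-trans (≤-≡ (^-* (1ℚ + x) (p ℕ.* 4) q)) (≤-trans (^-mono q (0≤^ (p ℕ.* 4) 0≤1+x) (small-power⁴ p 0≤x h))
     (≤-trans (≤-≡ (sym (^-* 2ℚ 3 q))) (≤-trans (^-mono-exp 1≤2 le₂) (≤-≡ (^-* 2ℚ s (suc r)))))))))
    where
    0≤1+x : 0ℚ ≤ 1ℚ + x
    0≤1+x = 0≤+ 0≤1 0≤x
    1≤1+x : 1ℚ ≤ 1ℚ + x
    1≤1+x = diff⇒≤ (0≤x ≤≡ e x)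
      where e : ∀ x → x ≡ 1ℚ + x - 1ℚ
            e = Ring.solve-∀ ringQ

  +-^-≤ : ∀ {x y} M → 0ℚ ≤ x → 0ℚ ≤ y → (1ℚ + x + y) ^ M ≤ (1ℚ + x) ^ M * (1ℚ + y) ^ M
  +-^-≤ {x} {y} M 0≤x 0≤y = ≤-trans (^-mono M (0≤+ (0≤+ 0≤1 0≤x) 0≤y) (diff⇒≤ (0≤* 0≤x 0≤y ≤≡ e x y))) (≤-≡ (^-*-base (1ℚ + x) (1ℚ + y) M))
    where e : ∀ x y → x * y ≡ (1ℚ + x) * (1ℚ + y) - (1ℚ + x + y)
          e = Ring.solve-∀ ringQ

-- From the representation of y to a near root of unity

module NearRoots where
  open Rationals
  open QuadraticField
  open CircleWalk using (N-1)
  open PowerBounds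
  open RootExtraction using (κ-↑)
  open import Data.Rational
  open import Data.Rational.Properties
  import Data.Nat as ℕ
  import Data.Nat.Properties as ℕ

  -- All that the Diophantine part has to know of the equation.
  record NearRoot (n y : ℕ) (w : ℚ) : Set where
    field
      β : K
      unit-β : Unit β
      integral-β : Integral (κ y ⊗ β)
      integral-β̄ : Integral (κ y ⊗ conj β)
      not-root : ∀ r → ¬ β ↑ suc r ≡ 1K
      near : β ↑ n ⊝ 1K ≼ lit 2 * w

  -- β = M/y. The real part of βⁿ is (3x² - 2d²)/yⁿ, so |βⁿ - 1|² = 8d²/yⁿ, and the assumed size of
  -- yⁿ turns this into a power of y.
  near-root : ∀ {y′ n d M} e X Q → let y = suc y′ ; Δ = ι d in Integral M → N M ≡ ι y * ι y
    → M ↑ n ≡ (lit 3 * (X * X) - lit 2 * (Δ * Δ)) ⸴ Q → lit 3 * (X * X) + lit 2 * (Δ * Δ) ≡ ι (y ℕ.^ n) → (∀ r → ¬ M ↑ suc r ≡ κ y ↑ suc r)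
    → 8 ℕ.* d ℕ.^ 6 ℕ.≤ y ℕ.^ n ℕ.* y ℕ.^ n → e ℕ.* 6 ℕ.≤ n → NearRoot n y (1/ι y′ ^ e)
  near-root {y′} {n} {d} {M} e X Q integral-M N-M M↑n form not-root d≤ 6e≤n = record
    { β = β ; unit-β = unit-β ; integral-β = subst Integral (sym κβ) integral-M ; integral-β̄ = subst Integral (sym κβ̄) (integral-conj integral-M)
    ; not-root = λ r h → not-root r (trans (cong (_↑ suc r) (sym κβ)) (trans (↑-⊗ (κ y) β (suc r)) (trans (cong (κ y ↑ suc r ⊗_) h) (l₁ (κ y ↑ suc r)))))
    ; near = bound 0≤2w (≤-trans (≤-≡ N-near) (^-cancel-≤ 2 0≤A (0≤* 0≤2w 0≤2w) A³≤)) }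
    where
    y = suc y′
    Δ = ι d
    v = 1/ι y′
    w = v ^ e
    F = ι y ^ n
    P = lit 3 * (X * X) - lit 2 * (Δ * Δ)
    β = ⌜ v ⌝ ⊗ M
    Yv : ι y * v ≡ 1ℚ
    Yv = 1/ι-inverse y′
    0≤v : 0ℚ ≤ v
    0≤v = 0≤1/ι y′
    l₁ : ∀ z → z ⊗ 1K ≡ z
    l₁ = Ring.solve-∀ ringK
    l₂ : ∀ z → 1K ⊗ z ≡ z
    l₂ = Ring.solve-∀ ringK
    κv : ∀ z → κ y ⊗ (⌜ v ⌝ ⊗ z) ≡ z
    κv z = trans (sym (⊗-assoc (κ y) ⌜ v ⌝ z)) (trans (cong (_⊗ z) (trans (sym (⌜⌝-* (ι y) v)) (cong ⌜_⌝ Yv))) (l₂ z))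
    κβ : κ y ⊗ β ≡ M
    κβ = κv M
    κβ̄ : κ y ⊗ conj β ≡ conj M
    κβ̄ = trans (cong (κ y ⊗_) (conj-⊗ ⌜ v ⌝ M)) (κv (conj M))
    unit-β : Unit β
    unit-β = trans (N-⊗ ⌜ v ⌝ M) (trans (cong₂ _*_ (N-⌜⌝ v) N-M) (trans (l v (ι y)) (cong₂ _*_ Yv Yv)))
      where l : ∀ v y → v * v * (y * y) ≡ y * v * (y * v)
            l = Ring.solve-∀ ringQ
    vF : v ^ n * F ≡ 1ℚ
    vF = trans (*-comm (v ^ n) F) (inv-^ n Yv)
    β↑n : β ↑ n ≡ v ^ n * P ⸴ v ^ n * Q
    β↑n = trans (↑-⊗ ⌜ v ⌝ M n) (trans (cong₂ _⊗_ (sym (⌜⌝-↑ v n)) M↑n) (scale (v ^ n) P Q))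
    A : ℚ
    A = lit 8 * (v ^ n * (Δ * Δ))
    0≤vn : 0ℚ ≤ v ^ n
    0≤vn = 0≤^ n 0≤v
    0≤A : 0ℚ ≤ A
    0≤A = 0≤* (0≤lit 8) (0≤* 0≤vn (0≤sq Δ))
    0≤w : 0ℚ ≤ w
    0≤w = 0≤^ e 0≤v
    0≤2w : 0ℚ ≤ lit 2 * w
    0≤2w = 0≤* (0≤lit 2) 0≤w
    N-near : N (β ↑ n ⊝ 1K) ≡ A
    N-near = trans (N-1 (β ↑ n) (unit-↑ {β} n unit-β)) (trans (cong (λ z → lit 2 - lit 2 * re z) β↑n) (trans (cong (λ t → t - lit 2 * (v ^ n * P)) (sym (trans (cong (lit 2 *_) (trans (cong (v ^ n *_) (trans form (ι-^ y n))) vF)) refl))) (l (v ^ n) (X * X) (Δ * Δ))))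
      where l : ∀ v x d → lit 2 * (v * (lit 3 * x + lit 2 * d)) - lit 2 * (v * (lit 3 * x - lit 2 * d)) ≡ lit 8 * (v * d)
            l = Ring.solve-∀ ringQ
    d≤ℚ : lit 8 * Δ ^ 6 ≤ F * F
    d≤ℚ = ≤-trans (≤-≡ (sym (trans (ι-* 8 (d ℕ.^ 6)) (cong₂ _*_ (ι-lit 8) (ι-^ d 6))))) (≤-trans (ι-mono d≤) (≤-≡ (trans (ι-* (y ℕ.^ n) (y ℕ.^ n)) (cong₂ _*_ (ι-^ y n) (ι-^ y n)))))
    -- (8d²vⁿ)³ = 64v³ⁿ · 8d⁶ ≤ 64v³ⁿF² = 64vⁿ ≤ (2w)⁶, where F = yⁿ; cubing avoids fractional
    -- powers of F.
    A³≤ : A ^ 3 ≤ (lit 2 * w * (lit 2 * w)) ^ 3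
    A³≤ = ≤-trans (≤-≡ (l (v ^ n) Δ)) (≤-trans (*-monoʳ (0≤* (0≤lit 64) (0≤* 0≤vn (0≤* 0≤vn 0≤vn))) d≤ℚ) (≤-trans (≤-≡ (trans (l₃ (v ^ n) F) (trans (cong (λ t → lit 64 * (v ^ n * (t * t))) vF) (l₄ (v ^ n)))))
       (≤-trans (*-monoʳ (0≤lit 64) vn≤) (≤-≡ (l₅ w)))))
      where
      l : ∀ v d → (lit 8 * (v * (d * d))) * ((lit 8 * (v * (d * d))) * ((lit 8 * (v * (d * d))) * 1ℚ)) ≡ lit 64 * (v * (v * v)) * (lit 8 * (d * (d * (d * (d * (d * (d * 1ℚ)))))))
      l = Ring.solve-∀ ringQ
      l₃ : ∀ v f → lit 64 * (v * (v * v)) * (f * f) ≡ lit 64 * (v * (v * f * (v * f)))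
      l₃ = Ring.solve-∀ ringQ
      l₄ : ∀ v → lit 64 * (v * (1ℚ * 1ℚ)) ≡ lit 64 * v
      l₄ = Ring.solve-∀ ringQ
      l₅ : ∀ w → lit 64 * (w * (w * (w * (w * (w * (w * 1ℚ)))))) ≡ lit 2 * w * (lit 2 * w) * (lit 2 * w * (lit 2 * w) * (lit 2 * w * (lit 2 * w) * 1ℚ))
      l₅ = Ring.solve-∀ ringQ
      v≤1 : v ≤ 1ℚ
      v≤1 = diff⇒≤ (0≤* (≤⇒diff (≤-trans (≤-≡ (sym (ι-lit 1))) (ι-mono {1} {y} (ℕ.s≤s ℕ.z≤n)))) 0≤v ≤≡ trans (k (ι y) v) (cong (_- v) Yv))
        where k : ∀ y v → (y - 1ℚ) * v ≡ y * v - v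
              k = Ring.solve-∀ ringQ
      vn≤ : v ^ n ≤ w ^ 6
      vn≤ = ≤-trans (≤-≡ (trans (cong (v ^_) (sym (ℕ.m+[n∸m]≡n 6e≤n))) (^-+ v (e ℕ.* 6) (n ℕ.∸ e ℕ.* 6)))) (≤-trans (*-monoʳ (0≤^ (e ℕ.* 6) 0≤v) (≤-trans (^-mono (n ℕ.∸ e ℕ.* 6) 0≤v v≤1) (≤-≡ (1^ (n ℕ.∸ e ℕ.* 6)))))
         (≤-≡ (trans (*-identityʳ _) (^-* v e 6))))

-- Assembly of the contradiction

module Assembly where
  open Rationals
  open QuadraticField hiding (K)
  open CircleWalk using (SmallStep)
  open LapCount using (Arc; arc)
  open SmallSteps using (small-steps)
  open AuxiliaryFunction
  open PowerBounds
  open Extrapolation using (module Signed; reduce-exponent; contradiction′)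
  open NearRoots using (NearRoot; near-root)
  open NewtonSeries using (F)
  open ParameterChoice using (find-H; find-u; module Parameters)
  open ParameterEstimates using (module Estimates)
  open import Data.Rational
  open import Data.Rational.Properties
  import Data.Nat as ℕ
  import Data.Nat.Properties as ℕ
  import Data.Nat.DivMod as ℕ
  open import Data.Nat.Tactic.RingSolver using (solve-∀)

  -- j is the integral part of n/(112H). Since j ≥ 224, rounding costs at most a factor 900/896.
  find-j : ∀ n H → 1 ℕ.≤ H → H ℕ.* 25088 ℕ.≤ n → ∃ λ j → j ℕ.* (H ℕ.* 112) ℕ.≤ n × n ℕ.* 8 ℕ.≤ j ℕ.* H ℕ.* 900
  find-j n H 1≤H h = j , ℕ.m/n*n≤m n D {{nz}} , ℕ.≤-trans (ℕ.*-monoˡ-≤ 8 n≤) (ℕ.≤-trans (ℕ.≤-reflexive (e j H)) (ℕ.≤-trans (ℕ.+-monoʳ-≤ (j ℕ.* H ℕ.* 896) (ℕ.*-monoˡ-≤ (H ℕ.* 4) 224≤j)) (ℕ.≤-reflexive (e₂ j H))))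
    where
    D = H ℕ.* 112
    nz : ℕ.NonZero D
    nz = ℕ.>-nonZero (ℕ.*-mono-≤ {1} {H} {1} {112} 1≤H (ℕ.s≤s ℕ.z≤n))
    j = ℕ._/_ n D {{nz}}
    n≤ : n ℕ.≤ j ℕ.* D ℕ.+ D
    n≤ = ℕ.≤-trans (ℕ.≤-reflexive (ℕ.m≡m%n+[m/n]*n n D {{nz}})) (ℕ.≤-trans (ℕ.+-monoˡ-≤ (j ℕ.* D) (ℕ.<⇒≤ (ℕ.m%n<n n D {{nz}}))) (ℕ.≤-reflexive (ℕ.+-comm D (j ℕ.* D))))
    224≤j : 224 ℕ.≤ j
    224≤j = ℕ.≤-trans (ℕ.≤-reflexive (sym (ℕ.m*n/n≡m 224 D {{nz}}))) (ℕ./-monoˡ-≤ D {{nz}} (ℕ.≤-trans (ℕ.≤-reflexive (e₃ H)) h))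
      where e₃ : ∀ H → 224 ℕ.* (H ℕ.* 112) ≡ H ℕ.* 25088
            e₃ = solve-∀
    e : ∀ j H → (j ℕ.* (H ℕ.* 112) ℕ.+ H ℕ.* 112) ℕ.* 8 ≡ j ℕ.* H ℕ.* 896 ℕ.+ 224 ℕ.* (H ℕ.* 4)
    e = solve-∀
    e₂ : ∀ j H → j ℕ.* H ℕ.* 896 ℕ.+ j ℕ.* (H ℕ.* 4) ≡ j ℕ.* H ℕ.* 900
    e₂ = solve-∀

  module Contradiction (n y′ h u : ℕ) (1≤n : 1 ℕ.≤ n) (5≤y : 5 ℕ.≤ suc y′) (n≤ : n ℕ.≤ 4 ℕ.^ (h ℕ.+ 9)) (n≥ : (h ℕ.+ 9) ℕ.* 25088 ℕ.≤ n)
    (e≥ : (h ℕ.* 188 ℕ.+ 1601) ℕ.* (h ℕ.+ 9) ℕ.* 7 ℕ.≤ (n ℕ./ 6) ℕ.* 3) (5≤u : 5 ℕ.≤ u) (y²≤ : suc y′ ℕ.* suc y′ ℕ.≤ 2 ℕ.^ u) (y¹⁴≥ : 2 ℕ.^ (u ℕ.* 6) ℕ.≤ suc y′ ℕ.^ 14)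
    (pt : NearRoot n (suc y′) (1/ι y′ ^ (n ℕ./ 6))) where

    y e : ℕ
    y = suc y′
    e = n ℕ./ 6

    1≤y : 1 ℕ.≤ y
    1≤y = ℕ.s≤s ℕ.z≤n

    open Parameters h u 5≤u
    open Estimates n y h u e 5≤u 1≤n 1≤y n≤ e≥ y²≤ y¹⁴≥
    open NearRoot pt
    open Signed H

    instance
      nz-n : ℕ.NonZero n
      nz-n = ℕ.>-nonZero 1≤n
      nz-S : ℕ.NonZero S
      nz-S = ℕ.>-nonZero (ℕ.≤-trans (toWitness {a? = 1 ℕ.≤? 44} _) (ℕ.∸-monoˡ-≤ 1 45≤U))

    M : ℕ
    M = suc S ℕ.* n

    M≡ : M ≡ U ℕ.* n
    M≡ = cong (ℕ._* n) S+1≡U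

    w x ε : ℚ
    w = 1/ι y′ ^ e
    x = ½ ^ μ
    -- In `βg` the error is 16w + 82nη, and 200nη ≤ w.
    ε = lit 17 * w

    0≤w : 0ℚ ≤ w
    0≤w = 0≤^ e (0≤1/ι y′)

    0≤x : 0ℚ ≤ x
    0≤x = 0≤^ μ 0≤½

    Yw : ι (y ℕ.^ e) * w ≡ 1ℚ
    Yw = trans (cong (_* w) (ι-^ y e)) (inv-^ e (1/ι-inverse y′))

    w-small : ∀ {X} → X ℕ.≤ y ℕ.^ e → ι X * w ≤ 1ℚ
    w-small h = ≤-trans (*-monoˡ 0≤w (ι-mono h)) (≤-≡ Yw)

    5w≤1 : lit 5 * w ≤ 1ℚ
    5w≤1 = ≤-trans (≤-≡ (cong (_* w) (sym (ι-lit 5)))) (w-small (ℕ.≤-trans 5≤y (ℕ.≤-trans (ℕ.≤-reflexive (sym (ℕ.*-identityʳ y))) (ℕ.^-monoʳ-≤ y 1≤e))))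
      where
      1≤e : 1 ℕ.≤ e
      1≤e = ℕ.*-cancelʳ-< 3 0 e (ℕ.<-≤-trans (ℕ.*-mono-≤ {1} {_} {1} {7} (ℕ.*-mono-≤ {1} {_} {1} (ℕ.≤-trans (ℕ.s≤s ℕ.z≤n) (ℕ.m≤n+m 1601 (h ℕ.* 188))) (ℕ.≤-trans (ℕ.s≤s ℕ.z≤n) (ℕ.m≤n+m 9 h))) (ℕ.s≤s ℕ.z≤n)) e≥)

    -- With a = μ - 1 one has 2·2^a·x = 1 and n ≤ 64·2^a, so Mx ≤ 32U, and e^(32U) is below 2^(48U).
    hP₀ : (1ℚ + x) ^ M ≤ 2ℚ ^ (U ℕ.* 48)
    hP₀ = small-power-scaled {x} (2 ℕ.^ a) M 0 (U ℕ.* 16) 0≤x (≤-≡ half) M≤ (U ℕ.* 48) (ℕ.≤-reflexive (d U))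
      where
      a = h ℕ.* 2 ℕ.+ 12
      d : ∀ U → 3 ℕ.* (U ℕ.* 16) ≡ U ℕ.* 48 ℕ.* 1
      d = solve-∀
      half : lit 2 * (ι (2 ℕ.^ a) * x) ≡ 1ℚ
      half = trans (cong (λ t → lit 2 * (t * x)) (ι2^ a)) (trans (sym (*-assoc (lit 2) (2ℚ ^ a) x)) (trans (cong (λ m → 2ℚ ^ suc a * ½ ^ m) (ℕ.+-suc (h ℕ.* 2) 12)) (inv-^ (suc a) refl)))
      pow : 4 ℕ.^ (h ℕ.+ 9) ≡ 2 ℕ.^ a ℕ.* 64
      pow = trans (ℕ.^-*-assoc 2 2 (h ℕ.+ 9)) (trans (cong (2 ℕ.^_) (d₂ h)) (ℕ.^-distribˡ-+-* 2 a 6))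
        where d₂ : ∀ h → 2 ℕ.* (h ℕ.+ 9) ≡ h ℕ.* 2 ℕ.+ 12 ℕ.+ 6
              d₂ = solve-∀
      M≤ : M ℕ.* 1 ℕ.≤ 2 ℕ.^ a ℕ.* 4 ℕ.* (U ℕ.* 16)
      M≤ = ℕ.≤-trans (ℕ.≤-reflexive (trans (ℕ.*-identityʳ M) M≡)) (ℕ.≤-trans (ℕ.*-monoʳ-≤ U (ℕ.≤-trans n≤ (ℕ.≤-reflexive pow))) (ℕ.≤-reflexive (d₃ U (2 ℕ.^ a))))
        where d₃ : ∀ u p → u ℕ.* (p ℕ.* 64) ≡ p ℕ.* 4 ℕ.* (u ℕ.* 16)
              d₃ = solve-∀

    module WithStep (S₀ : SmallStep) (hs : lit 200 * (SmallStep.η S₀ * ι (n ℕ.* y ℕ.^ e)) ≤ 1ℚ) where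
      η = SmallStep.η S₀

      0≤η : 0ℚ ≤ η
      0≤η = nonneg (SmallStep.h-1≼ S₀)

      0≤nη : 0ℚ ≤ ι n * η
      0≤nη = 0≤* (0≤ι n) 0≤η

      nη≤ : 0ℚ ≤ w - lit 200 * (ι n * η)
      nη≤ = ≤⇒diff (≤-trans (≤-≡ (trans (sym (trans (cong (lit 200 * (ι n * η) *_) Yw) (*-identityʳ (lit 200 * (ι n * η))))) (trans (d η (ι n) (ι (y ℕ.^ e)) w) (cong (λ t → lit 200 * (η * t) * w) (sym (ι-* n (y ℕ.^ e))))))) (≤-trans (*-monoˡ 0≤w hs) (≤-≡ (*-identityˡ w))))
        where d : ∀ η n Y w → lit 200 * (n * η) * (Y * w) ≡ lit 200 * (η * (n * Y)) * w
              d = Ring.solve-∀ ringQ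

      small : lit 2 * (lit 8 * (ι n * η) + lit 2 * w) ≤ 1ℚ
      small = diff⇒≤ (0≤+ (0≤+ (0≤+ (≤⇒diff 5w≤1) nη≤) (0≤* (0≤lit 184) 0≤nη)) ≤-refl ≤≡ d w (ι n * η))
        where d : ∀ w t → 1ℚ - lit 5 * w + (w - lit 200 * t) + lit 184 * t + 0ℚ ≡ 1ℚ - lit 2 * (lit 8 * t + lit 2 * w)
              d = Ring.solve-∀ ringQ

      module WithArc (A : Arc S₀ β n (lit 2 * w)) (j : ℕ) (j≤ : j ℕ.* (H ℕ.* 112) ℕ.≤ n) (j≥ : n ℕ.* 8 ℕ.≤ j ℕ.* H ℕ.* 900) where
        open Arc A

        gⁿ : g ↑ n ⊝ 1K ≼ ε
        gⁿ = ≼-mono gⁿ≼ (diff⇒≤ (0≤+ (0≤+ nη≤ (0≤* (0≤lit 16) 0≤w)) (0≤* (0≤lit 199) 0≤nη) ≤≡ d w (ι n * η)))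
          where d : ∀ w t → w - lit 200 * t + lit 16 * w + lit 199 * t ≡ lit 17 * w - t
                d = Ring.solve-∀ ringQ

        βg : β ⊝ g ↑ (k ℕ.% n) ≼ ε
        βg = ≼-mono (≼-trans {β} {g ↑ k} {g ↑ (k ℕ.% n)} β≼ (≼-swap (reduce-exponent n {g} unit-g gⁿ≼ k 8 (ℕ.≤-trans k≤8n (ℕ.≤-reflexive (ℕ.*-comm 8 n))))))
          (≤-trans (≤-≡ (cong (λ t → lit 8 * (lit 2 * w) + lit 74 * (ι n * η) + t * (ι n * η)) (ι-lit 8))) (diff⇒≤ (0≤+ nη≤ (0≤* (0≤lit 118) 0≤nη) ≤≡ d w (ι n * η))))
          where d : ∀ w t → w - lit 200 * t + lit 118 * t ≡ lit 17 * w - (lit 8 * (lit 2 * w) + lit 74 * t + lit 8 * t)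
                d = Ring.solve-∀ ringQ

        θ′ : ℚ
        θ′ = ι H * θ

        0≤θ′ : 0ℚ ≤ θ′
        0≤θ′ = 0≤* (0≤ι H) (nonneg g-1≼)

        -- 112 = 16·7: j·112H ≤ n and nθ ≤ 7.
        16jθ′≤1 : lit 16 * (ι j * θ′) ≤ 1ℚ
        16jθ′≤1 = cancelʳ {lit 7} (toWitness {a? = 0ℚ <? lit 7} _) (≤-trans (≤-≡ (trans (d (ι j) (ι H) θ) (cong (_* θ) (sym (trans (ι-* j (H ℕ.* 112)) (cong (ι j *_) (trans (ι-* H 112) (cong (ι H *_) (ι-lit 112))))))))) (≤-trans (*-monoˡ (nonneg g-1≼) (ι-mono j≤)) (≤-trans nθ≤7 (≤-≡ (sym (*-identityˡ (lit 7)))))))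
          where d : ∀ j H θ → lit 16 * (j * (H * θ)) * lit 7 ≡ j * (H * lit 112) * θ
                d = Ring.solve-∀ ringQ

        M*8≤ : M ℕ.* 8 ℕ.≤ j ℕ.* 4 ℕ.* (V ℕ.* 225)
        M*8≤ = ℕ.≤-trans (ℕ.≤-reflexive (trans (cong (ℕ._* 8) M≡) (ℕ.*-assoc U n 8))) (ℕ.≤-trans (ℕ.*-monoʳ-≤ U j≥) (ℕ.≤-reflexive (d U j H)))
          where d : ∀ U j H → U ℕ.* (j ℕ.* H ℕ.* 900) ≡ j ℕ.* 4 ℕ.* (H ℕ.* U ℕ.* 225)
                d = solve-∀

        -- The multiple of V is 3·225/16 < 43; in `P₈` it is 3·225/8 < 85.
        P₄ : (1ℚ + lit 4 * θ′) ^ M ≤ 2ℚ ^ (V ℕ.* 43)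
        P₄ = small-power-scaled {lit 4 * θ′} (j ℕ.* 2) M 15 (V ℕ.* 225) (0≤* (0≤lit 4) 0≤θ′) (≤-trans (≤-≡ (trans (cong (λ t → lit 2 * (t * (lit 4 * θ′))) (trans (ι-* j 2) (cong (ι j *_) (ι-lit 2)))) (d (ι j) θ′))) 16jθ′≤1)
            (ℕ.≤-trans (ℕ.≤-reflexive (d₁ M)) (ℕ.≤-trans (ℕ.*-monoˡ-≤ 2 M*8≤) (ℕ.≤-reflexive (d₂ j (V ℕ.* 225))))) (V ℕ.* 43) (ℕ.≤-trans (ℕ.m≤m+n (3 ℕ.* (V ℕ.* 225)) (V ℕ.* 13)) (ℕ.≤-reflexive (d₃ V)))
          where d : ∀ j θ → lit 2 * (j * lit 2 * (lit 4 * θ)) ≡ lit 16 * (j * θ)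
                d = Ring.solve-∀ ringQ
                d₁ : ∀ M → M ℕ.* 16 ≡ M ℕ.* 8 ℕ.* 2
                d₁ = solve-∀
                d₂ : ∀ j v → j ℕ.* 4 ℕ.* v ℕ.* 2 ≡ j ℕ.* 2 ℕ.* 4 ℕ.* v
                d₂ = solve-∀
                d₃ : ∀ V → 3 ℕ.* (V ℕ.* 225) ℕ.+ V ℕ.* 13 ≡ V ℕ.* 43 ℕ.* 16
                d₃ = solve-∀

        P₈ : (1ℚ + lit 8 * θ′) ^ M ≤ 2ℚ ^ (V ℕ.* 85)
        P₈ = small-power-scaled {lit 8 * θ′} j M 7 (V ℕ.* 225) (0≤* (0≤lit 8) 0≤θ′) (≤-trans (≤-≡ (d (ι j) θ′)) 16jθ′≤1) M*8≤ (V ℕ.* 85) (ℕ.≤-trans (ℕ.m≤m+n (3 ℕ.* (V ℕ.* 225)) (V ℕ.* 5)) (ℕ.≤-reflexive (d₃ V)))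
          where d : ∀ j θ → lit 2 * (j * (lit 8 * θ)) ≡ lit 16 * (j * θ)
                d = Ring.solve-∀ ringQ
                d₃ : ∀ V → 3 ℕ.* (V ℕ.* 225) ℕ.+ V ℕ.* 5 ≡ V ℕ.* 85 ℕ.* 8
                d₃ = solve-∀

        P-bound : ∀ ρ s → 0ℚ ≤ ρ * θ′ → (1ℚ + ρ * θ′) ^ M ≤ 2ℚ ^ s → (1ℚ + x + ρ * θ′) ^ M ≤ 2ℚ ^ (U ℕ.* 48 ℕ.+ s)
        P-bound ρ s 0≤ hs = ≤-trans (+-^-≤ M 0≤x 0≤) (≤-trans (*-mono (0≤^ M (0≤+ 0≤1 0≤x)) hP₀ (0≤^ M (0≤+ 0≤1 0≤)) hs) (≤-≡ (sym (^-+ 2ℚ (U ℕ.* 48) s))))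

        z-1≼ : ∀ l → l ℕ.< L → sp g l ⊝ 1K ≼ θ′
        z-1≼ l l< = ≼-≡ (sp-close {g} {1K} l l< unit-g refl g-1≼) (cong (sp g l ⊝_) (sp-1 l))

        unit-z : ∀ l → l ℕ.< L → Unit (sp g l)
        unit-z l _ = sp-unit {g} l unit-g

        P₂ : (1ℚ + x + lit 4 * θ′) ^ M ≤ 2ℚ ^ p₂
        P₂ = P-bound (lit 4) (V ℕ.* 43) (0≤* (0≤lit 4) 0≤θ′) P₄

        P₃ : (1ℚ + x + lit 8 * θ′) ^ M ≤ 2ℚ ^ p₃
        P₃ = P-bound (lit 8) (V ℕ.* 85) (0≤* (0≤lit 8) 0≤θ′) P₈

        aux : Auxiliary K L Jmax M (sp g) θ′ μ b δ U p₂ p₃ 0≤θ′ unit-z z-1≼ P₂ P₃ μk≤b pad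
        aux = auxiliary K L Jmax M (sp g) θ′ μ b δ U p₂ p₃ 0≤θ′ unit-z z-1≼ P₂ P₃ μk≤b pad tail
          (count (bits K L Jmax M (sp g) θ′ μ b δ U p₂ p₃ 0≤θ′ unit-z z-1≼ P₂ P₃ μk≤b pad) (λ j → ℕ.m⊓n≤m (δ ℕ.+ (U ℕ.+ (b ℕ.+ p₂)) ℕ.∸ 2 ℕ.* (j ℕ.∸ K)) _) (λ j → ℕ.m⊓n≤n (δ ℕ.+ (U ℕ.+ (b ℕ.+ p₂)) ℕ.∸ 2 ℕ.* (j ℕ.∸ K)) _))

        γ Dinv : ℚ
        γ = lit 3 * 2ℚ ^ b
        Dinv = ½ ^ δ * (ι M * lit 3)

        E₁ : lit 4 * (ι y ^ (R′ ℕ.* H) * Dinv) ≤ 1ℚ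
        E₁ = ≤-trans (≤-≡ (trans (d (ι y ^ (R′ ℕ.* H)) (½ ^ δ) (ι M)) (cong (_* ½ ^ δ) (sym (trans (ι-* (y ℕ.^ (R′ ℕ.* H)) (U ℕ.* n ℕ.* 12)) (cong₂ _*_ (ι-^ y (R′ ℕ.* H)) (trans (ι-* (U ℕ.* n) 12) (cong₂ _*_ (cong ι (sym M≡)) (ι-lit 12)))))))))
           (≤-trans (*-monoˡ (0≤^ δ 0≤½) (≤-trans (ι-mono bound₁) (≤-≡ (ι2^ δ)))) (≤-≡ (inv-^ δ refl)))
          where d : ∀ Y h m → lit 4 * (Y * (h * (m * lit 3))) ≡ Y * (m * lit 12) * h
                d = Ring.solve-∀ ringQ

        E₂ : lit 4 * (ι y ^ (R′ ℕ.* H) * (ι (K ℕ.* L) * (γ * 2ℚ ^ (U ℕ.* 48) * (ι H * (ι T₀ * ε))))) ≤ 1ℚ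
        E₂ = ≤-trans (≤-≡ (trans (d (ι y ^ (R′ ℕ.* H)) (ι (K ℕ.* L)) (2ℚ ^ b) (2ℚ ^ (U ℕ.* 48)) (ι H) (ι T₀) w) (cong (_* w) (sym ι≡)))) (w-small bound₂)
          where
          d : ∀ Y k b p H T w → lit 4 * (Y * (k * (lit 3 * b * p * (H * (T * (lit 17 * w)))))) ≡ Y * (k * (b * p * (H * T))) * lit 204 * w
          d = Ring.solve-∀ ringQ
          ι≡ : ι (y ℕ.^ (R′ ℕ.* H) ℕ.* (K ℕ.* L ℕ.* (2 ℕ.^ b ℕ.* 2 ℕ.^ (U ℕ.* 48) ℕ.* (H ℕ.* T₀))) ℕ.* 204) ≡ ι y ^ (R′ ℕ.* H) * (ι (K ℕ.* L) * (2ℚ ^ b * 2ℚ ^ (U ℕ.* 48) * (ι H * ι T₀))) * lit 204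
          ι≡ = trans (ι-* (y ℕ.^ (R′ ℕ.* H) ℕ.* (K ℕ.* L ℕ.* (2 ℕ.^ b ℕ.* 2 ℕ.^ (U ℕ.* 48) ℕ.* (H ℕ.* T₀)))) 204) (cong₂ _*_ (trans (ι-* (y ℕ.^ (R′ ℕ.* H)) (K ℕ.* L ℕ.* (2 ℕ.^ b ℕ.* 2 ℕ.^ (U ℕ.* 48) ℕ.* (H ℕ.* T₀)))) (cong₂ _*_ (ι-^ y (R′ ℕ.* H))
             (trans (ι-* (K ℕ.* L) (2 ℕ.^ b ℕ.* 2 ℕ.^ (U ℕ.* 48) ℕ.* (H ℕ.* T₀))) (cong (ι (K ℕ.* L) *_) (trans (ι-* (2 ℕ.^ b ℕ.* 2 ℕ.^ (U ℕ.* 48)) (H ℕ.* T₀)) (cong₂ _*_ (trans (ι-* (2 ℕ.^ b) (2 ℕ.^ (U ℕ.* 48))) (cong₂ _*_ (ι2^ b) (ι2^ (U ℕ.* 48)))) (ι-* H T₀))))))) (ι-lit 204))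

        E₃ : lit 4 * (ι y ^ R₂ * (ι T₀ * ε)) ≤ 1ℚ
        E₃ = ≤-trans (≤-≡ (trans (d (ι y ^ R₂) (ι T₀) w) (cong (_* w) (sym (trans (ι-* (y ℕ.^ R₂ ℕ.* T₀) 68) (cong₂ _*_ (trans (ι-* (y ℕ.^ R₂) T₀) (cong (_* ι T₀) (ι-^ y R₂))) (ι-lit 68))))))) (w-small bound₃)
          where d : ∀ Y T w → lit 4 * (Y * (T * (lit 17 * w))) ≡ Y * T * lit 68 * w
                d = Ring.solve-∀ ringQ

        module WithAux (aux : Auxiliary K L Jmax M (sp g) θ′ μ b δ U p₂ p₃ 0≤θ′ unit-z z-1≼ P₂ P₃ μk≤b pad) where
          open Auxiliary aux

          F≼ : ∀ m → m ℕ.< M → F K L (sp g) c m ≼ Dinv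
          F≼ m m< = ≼-≡ (≼-⊗ (≼-⌜⌝ (0≤^ δ 0≤½)) (F-small m m<)) (trans (sym (⊗-assoc ⌜ ½ ^ δ ⌝ ⌜ 2ℚ ^ δ ⌝ (F K L (sp g) c m))) (trans (cong (_⊗ F K L (sp g) c m) (trans (sym (⌜⌝-* (½ ^ δ) (2ℚ ^ δ))) (cong ⌜_⌝ (inv-^ δ refl)))) (d (F K L (sp g) c m))))
            where d : ∀ z → 1K ⊗ z ≡ z
                  d = Ring.solve-∀ ringK

          absurd : ⊥
          absurd = contradiction′ n y H K S R₂ R′ β unit-β integral-β integral-β̄ not-root g (k ℕ.% n) ε unit-g gⁿ βg (ℕ.m%n<n k n) T₀ c x γ Dinv (2ℚ ^ (U ℕ.* 48)) 0≤x 1≤y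
            T₀≥ R′≥ points c-bound c-nonzero c-integral F≼ hP₀ E₁ E₂ E₃

    absurd : ⊥
    -- The step is chosen for n·y^e, which gives 200nη ≤ y^(-e) = w.
    absurd = go (small-steps (n ℕ.* y ℕ.^ e ℕ.∸ 1)) (find-j n H (ℕ.≤-trans (ℕ.s≤s ℕ.z≤n) (ℕ.m≤n+m 9 h)) n≥)
      where
      suc-pred : suc (n ℕ.* y ℕ.^ e ℕ.∸ 1) ≡ n ℕ.* y ℕ.^ e
      suc-pred = ℕ.m+[n∸m]≡n (ℕ.*-mono-≤ {1} {n} {1} 1≤n (ℕ.m^n>0 y e))
      go : (∃ λ S₀ → lit 200 * (SmallStep.η S₀ * ι (suc (n ℕ.* y ℕ.^ e ℕ.∸ 1))) ≤ 1ℚ) → (∃ λ j → j ℕ.* (H ℕ.* 112) ℕ.≤ n × n ℕ.* 8 ℕ.≤ j ℕ.* H ℕ.* 900) → ⊥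
      go (S₀ , hs) (j , j≤ , j≥) = WithArc.WithAux.absurd A j j≤ j≥ (WithArc.aux A j j≤ j≥)
        where
        open WithStep S₀ (subst (λ t → lit 200 * (SmallStep.η S₀ * ι t) ≤ 1ℚ) suc-pred hs)
        A : Arc S₀ β n (lit 2 * w)
        A = arc S₀ β unit-β n (lit 2 * w) near small

  no-near-root : ∀ n y′ → 228000 ℕ.< n → 5 ℕ.≤ suc y′ → ¬ NearRoot n (suc y′) (1/ι y′ ^ (n ℕ./ 6))
  no-near-root n y′ n> 5≤y pt = go (find-H n n>) (find-u (suc y′) 5≤y)
    where
    go : (∃ λ h → n ℕ.≤ 4 ℕ.^ (h ℕ.+ 9) × (h ℕ.+ 9) ℕ.* 25088 ℕ.≤ n × (h ℕ.* 188 ℕ.+ 1601) ℕ.* (h ℕ.+ 9) ℕ.* 7 ℕ.≤ (n ℕ./ 6) ℕ.* 3)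
       → (∃ λ u → 5 ℕ.≤ u × suc y′ ℕ.* suc y′ ℕ.≤ 2 ℕ.^ u × 2 ℕ.^ (u ℕ.* 6) ℕ.≤ suc y′ ℕ.^ 14) → ⊥
    go (h , n≤ , n≥ , e≥) (u , 5≤u , y²≤ , y¹⁴≥) = Contradiction.absurd n y′ h u (ℕ.≤-trans (ℕ.s≤s ℕ.z≤n) n>) 5≤y n≤ n≥ e≥ 5≤u y²≤ y¹⁴≥ pt

-- Reduction of the equation to the near root

module Reduction where
  open Rationals using (ι; ι-+; ι-*; ι-lit; lit)
  open ThueLemma using (module Form; pos-form)
  open RootExtraction using (module RootOf)
  open QuadraticField using (_↑_)
  open NearRoots using (near-root)
  open Assembly using (no-near-root)
  import Data.Rational as ℚ
  open import Data.Nat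
  open import Data.Nat.Properties
  open import Data.Nat.DivMod using (_/_; m/n*n≤m)
  open import Data.Nat.Coprimality using (Coprime)
  open import Data.Integer as ℤ using (ℤ) renaming (+_ to pos)
  import Data.Integer.Properties as ℤ
  import Data.Integer.Tactic.RingSolver as ℤR

  quadratic-form : ∀ n d x y → (pos x ℤ.- pos d) ℤ.* (pos x ℤ.- pos d) ℤ.+ pos x ℤ.* pos x ℤ.+ (pos x ℤ.+ pos d) ℤ.* (pos x ℤ.+ pos d) ≡ pos (y ^ n)
    → 3 * (x * x) + 2 * (d * d) ≡ y ^ n
  quadratic-form n d x y E = ℤ.+-injective (trans (pos-form (x * x) (d * d)) (trans (cong₂ (λ s t → pos 3 ℤ.* s ℤ.+ pos 2 ℤ.* t) (ℤ.pos-* x x) (ℤ.pos-* d d)) (trans (sym (e (pos x) (pos d))) E)))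
    where e : ∀ x d → (x ℤ.- d) ℤ.* (x ℤ.- d) ℤ.+ x ℤ.* x ℤ.+ (x ℤ.+ d) ℤ.* (x ℤ.+ d) ≡ pos 3 ℤ.* (x ℤ.* x) ℤ.+ pos 2 ℤ.* (d ℤ.* d)
          e = ℤR.solve-∀

  not-large : ∀ n d x y → 228000 < n → 0 < y → Coprime x y → 3 * (x * x) + 2 * (d * d) ≡ y ^ n → ¬ 8 * d ^ 6 ≤ y ^ n * y ^ n
  not-large n d x (suc y′) n> y>0 cop E d≤ = go n-odd rep
    where
    y = suc y′
    2≤n : 2 ≤ n
    2≤n = ≤-trans (s≤s (s≤s z≤n)) n>
    open Form {n} {d} {x} {y} 2≤n y>0 cop E
    y≢1 : ¬ y ≡ 1
    y≢1 e = <⇒≢ (≤-trans (s≤s (s≤s z≤n)) 5≤y) (sym e)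
    y≢0 : ¬ y ≡ 0
    y≢0 ()
    form : lit 3 ℚ.* (ι x ℚ.* ι x) ℚ.+ lit 2 ℚ.* (ι d ℚ.* ι d) ≡ ι (y ^ n)
    form = trans (cong₂ ℚ._+_ (sym (trans (ι-* 3 (x * x)) (cong₂ ℚ._*_ (ι-lit 3) (ι-* x x)))) (sym (trans (ι-* 2 (d * d)) (cong₂ ℚ._*_ (ι-lit 2) (ι-* d d))))) (trans (sym (ι-+ (3 * (x * x)) (2 * (d * d)))) (cong ι E))
    go : (∃ λ h → n ≡ suc (h + h)) → ¬ Rep
    go (h , n≡) (a , b , c , lin , r) = no-near-root n y′ n> 5≤y
        (near-root {y′} {n} {d} {M} (n / 6) (ι x) (ℚ.- (lit 2 ℚ.* (ι x ℚ.* ι d))) integral-M N-M (trans (cong (M ↑_) n≡) M↑n) form (M-not-root y≢1 coprime-y2 coprime-yd) d≤ (m/n*n≤m n 6))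
      where
      open RootOf {x} {d} {y} {h} {a} {b} {c} y≢0 coprime-yx (trans E (cong (y ^_) n≡)) lin r

-- The inequality in squared form

open import Defs
open import Data.Nat using (_<_; _^_; _*_)
open import Data.Nat.GCD using (gcd)
open import Data.Nat.Coprimality using (gcd≡1⇒coprime)
open import Data.Nat.Properties using (≰⇒>)
open import Data.Integer using (ℤ; +_) renaming (_+_ to _+ℤ_; _-_ to _-ℤ_; _*_ to _*ℤ_)

theorem1p4 : (n d x y : ℕ) → 228000 < n → 0 < d → 128 < d * d → 0 < x → 0 < y
    → gcd x y ≡ 1
    → ((+ x -ℤ + d) *ℤ (+ x -ℤ + d)) +ℤ ((+ x) *ℤ (+ x)) +ℤ ((+ x +ℤ + d) *ℤ (+ x +ℤ + d)) ≡ + (y ^ n)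
    → (y ^ n) * (y ^ n) < 8 * (d ^ 6)
theorem1p4 n d x y n> _ _ _ y>0 coprime E = ≰⇒> (Reduction.not-large n d x y n> y>0 (gcd≡1⇒coprime coprime) (Reduction.quadratic-form n d x y E))
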